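{- Let $M$ be the graphic matroid $M(G)$ or the cographic matroid $M(G)^*$ of a simple connected graph $G$. Then the following are equivalent: (a) $\mu(M)\le2$; (b) $M$ has no g-series minor isomorphic to $M(K_4)$; (c) $M$ has no minor isomorphic to $M(K_4)$ obtained by a sequence of deletions, series contractions or coloop contractions; (a$'$) $M$ has no minor isomorphic to $M(K_4)$.
   Context: Throughout, matroids are finite and non-free (they have at least one circuit). $\mathbb{K}$ is a field. $M(G)$ is the cycle matroid of $G$ and $M(G)^*$ its dual; $K_4$ is the complete graph on $4$ vertices. A cycle of $M$ is a disjoint union of (possibly zero) circuits; the cycle ideal $I_{\mathrm{Cyc}(M)}$ is the kernel of $\mathbb{K}[x_C:C\text{ cycle}]\to\mathbb{K}[y_e,z:e\in E(M)]$, $x_C\mapsto\prod_{e\in C}y_e\cdot z$; $\mu(M)$ is the highest degree of an element of a minimal homogeneous generating set of $I_{\mathrm{Cyc}(M)}$ (with $\deg0=-\infty$). Series contraction: $M/e$ with $e$ in a $2$-element cocircuit; coloop contraction: $M/e$ with $e$ a coloop. Binary matroidal retract: for binary $M$ and disjoint $E=\{e_1,\dots,e_s\}$, $E'=\{e'_1,\dots,e'_s\}\subseteq E(M)$, $s\ge1$, such that $E'$ is a circuit of $M$ and for every circuit $C$, every $p\in\{0,\dots,s-1\}$ and indices $i_1,\dots,i_p$: $C\cap E'=\{e'_{i_1},\dots,e'_{i_p}\}$ iff $C\cap E$ equals $\{e_{i_1},\dots,e_{i_p}\}$ or $E-\{e_{i_1},\dots,e_{i_p}\}$; then $M/E'$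 is a binary matroidal retract. A g-series minor is obtained by a sequence of deletions, series contractions, coloop contractions and binary matroidal retracts. -}

module Defs where

open import Level using (Level; _⊔_) renaming (suc to lsuc; zero to lzero)
open import Data.Bool using (Bool; true; false; if_then_else_; _∧_; _∨_; _xor_)
open import Data.Nat as ℕ using (ℕ; zero; suc; _≤_)
open import Data.Fin as Fin using (Fin; zero; suc)
open import Data.Fin.Subset using (Subset; _∈_; _∉_; _⊆_; _─_; ∣_∣; Nonempty; ⁅_⁆; _∪_; _∩_; ∁) renaming (⊥ to ∅ˢ; ⊤ to fullˢ)
open import Data.Vec as Vec using (Vec; []; _∷_; tabulate; lookup; replicate; zipWith)
import Data.Vec.Properties as VecP
open import Data.List as List using (List; []; _∷_; _++_; concatMap; length; removeAt; foldr)
open import Data.List.Relation.Unary.All using (All)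
open import Data.Product using (Σ; ∃; ∃-syntax; _×_; _,_; proj₁; proj₂)
open import Data.Product.Properties using (≡-dec)
open import Data.Sum using (_⊎_)
open import Data.Empty using (⊥)
open import Relation.Nullary using (¬_; Dec; yes; no)
open import Relation.Nullary.Decidable using (⌊_⌋)
open import Relation.Binary.PropositionalEquality using (_≡_; _≢_)
open import Relation.Binary.Construct.Closure.ReflexiveTransitive using (Star)
open import Algebra.Bundles using (CommutativeRing)

_⇔_ : ∀ {a b} → Set a → Set b → Set (a ⊔ b)
A ⇔ B = (A → B) × (B → A)

anyFin : ∀ {s} → (Fin s → Bool) → Bool
anyFin {zero} f = false
anyFin {suc s} f = f zero ∨ anyFin (λ i → f (suc i))

img : ∀ {s n} → (Fin s → Fin n) → Subset s → Subset n
img f P = tabulate (λ x → anyFin (λ i → lookup P i ∧ ⌊ f i Fin.≟ x ⌋))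

-- Matroids, given by ground set (a subset of Fin n) and circuit predicate.
-- Element labels are kept fixed as Fin n throughout (minors shrink the ground set).

record Mat (n : ℕ) : Set₁ where
  field
    ground : Subset n
    circ   : Subset n → Set
open Mat public

module _ {n : ℕ} (M : Mat n) where
  Independent : Subset n → Set
  Independent I = I ⊆ ground M × (∀ C → circ M C → ¬ (C ⊆ I))

  Basis : Subset n → Set
  Basis B = Independent B × (∀ J → Independent J → B ⊆ J → J ≡ B)

  MeetsAllBases : Subset n → Set
  MeetsAllBases D = ∀ B → Basis B → ∃[ e ] (e ∈ D × e ∈ B)

  Cocircuit : Subset n → Set
  Cocircuit D = D ⊆ ground M × Nonempty D × MeetsAllBases D
    × (∀ D' → Nonempty D' → D' ⊆ D → MeetsAllBases D' → D' ≡ D)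

  Coloop : Fin n → Set
  Coloop e = e ∈ ground M × (∀ B → Basis B → e ∈ B)

  InSeriesPair : Fin n → Set
  InSeriesPair e = ∃[ f ] (f ≢ e × Cocircuit (⁅ e ⁆ ∪ ⁅ f ⁆))

  data IsCycle : Subset n → Set where
    cyc-∅ : IsCycle ∅ˢ
    cyc-∪ : ∀ {C X} → circ M C → IsCycle X → C ∩ X ≡ ∅ˢ → IsCycle (C ∪ X)

dual : ∀ {n} → Mat n → Mat n
dual M = record { ground = ground M ; circ = Cocircuit M }

delete : ∀ {n} → Mat n → Fin n → Mat n
delete M e = record { ground = ground M Data.Fin.Subset.- e ; circ = λ C → circ M C × e ∉ C }
  where import Data.Fin.Subset

contractSet : ∀ {n} → Mat n → Subset n → Mat n
contractSet {n} M T = record { ground = ground M ─ T ; circ = Cand× }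
  where
  Cand : Subset n → Set
  Cand D = Nonempty D × ∃[ C ] (circ M C × D ≡ C ─ T)
  Cand× : Subset n → Set
  Cand× D = Cand D × (∀ D' → Cand D' → D' ⊆ D → D' ≡ D)

contract : ∀ {n} → Mat n → Fin n → Mat n
contract M e = contractSet M ⁅ e ⁆

xorV : ∀ {r} → Vec Bool r → Vec Bool r → Vec Bool r
xorV = zipWith _xor_

sumCols : ∀ {n r} → (Fin n → Vec Bool r) → Subset n → Vec Bool r
sumCols {zero} v [] = replicate _ false
sumCols {suc n} v (b ∷ X) =
  xorV (if b then v zero else replicate _ false) (sumCols (λ i → v (suc i)) X)

Binary : ∀ {n} → Mat n → Set
Binary {n} M = ∃[ r ] Σ (Fin n → Vec Bool r) λ v →
  ∀ X → circ M X ⇔ (X ⊆ ground M × Nonempty X × sumCols v X ≡ replicate r false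
                    × (∀ Y → Nonempty Y → Y ⊆ X → sumCols v Y ≡ replicate r false → Y ≡ X))

-- binary matroidal retract data: E = {e 0..e (s-1)}, E' = {e' 0..e' (s-1)}
record RetractData {n : ℕ} (M : Mat n) : Set where
  field
    s      : ℕ
    s≥1    : 1 ≤ s
    e e'   : Fin s → Fin n
    e-inj  : ∀ i j → e i ≡ e j → i ≡ j
    e'-inj : ∀ i j → e' i ≡ e' j → i ≡ j
    e-gr   : ∀ i → e i ∈ ground M
    e'-gr  : ∀ i → e' i ∈ ground M
    disj   : ∀ i j → e i ≢ e' j
    binary : Binary M
    E'circ : circ M (img e' fullˢ)
    cond   : ∀ C → circ M C → ∀ (P : Subset s) → ∣ P ∣ ℕ.< s →
               (C ∩ img e' fullˢ ≡ img e' P)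
                 ⇔ (C ∩ img e fullˢ ≡ img e P ⊎ C ∩ img e fullˢ ≡ img e (∁ P))

data MinorStep {n} (M : Mat n) : Mat n → Set₁ where
  del : ∀ x → x ∈ ground M → MinorStep M (delete M x)
  con : ∀ x → x ∈ ground M → MinorStep M (contract M x)

data SeriesStep {n} (M : Mat n) : Mat n → Set₁ where
  del    : ∀ x → x ∈ ground M → SeriesStep M (delete M x)
  series : ∀ x → x ∈ ground M → InSeriesPair M x → SeriesStep M (contract M x)
  coloop : ∀ x → Coloop M x → SeriesStep M (contract M x)

data GSeriesStep {n} (M : Mat n) : Mat n → Set₁ where
  del    : ∀ x → x ∈ ground M → GSeriesStep M (delete M x)
  series : ∀ x → x ∈ ground M → InSeriesPair M x → GSeriesStep M (contract M x)
  coloop : ∀ x → Coloop M x → GSeriesStep M (contract M x)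
  retract : (R : RetractData M) → GSeriesStep M (contractSet M (img (RetractData.e' R) fullˢ))

Minor : ∀ {n} → Mat n → Mat n → Set₁
Minor M N = Star MinorStep M N

SeriesMinor : ∀ {n} → Mat n → Mat n → Set₁
SeriesMinor M N = Star SeriesStep M N

GSeriesMinor : ∀ {n} → Mat n → Mat n → Set₁
GSeriesMinor M N = Star GSeriesStep M N

-- isomorphism of N (on its ground set) with a matroid K on all of Fin k
Iso : ∀ {n k} → Mat n → Mat k → Set
Iso {n} {k} N K = Σ (Fin k → Fin n) λ f →
    (∀ i j → f i ≡ f j → i ≡ j)
  × (∀ i → f i ∈ ground N)
  × (∀ x → x ∈ ground N → ∃[ i ] (f i ≡ x))
  × (∀ X → circ K X ⇔ circ N (img f X))
  × (∀ C → circ N C → ∃[ X ] (C ≡ img f X))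

record Graph (v m : ℕ) : Set where
  field ends : Fin m → Fin v × Fin v
open Graph public

module _ {v m : ℕ} (G : Graph v m) where
  Incident : Fin v → Fin m → Set
  Incident a i = a ≡ proj₁ (ends G i) ⊎ a ≡ proj₂ (ends G i)

  SameEnds : Fin m → Fin m → Set
  SameEnds i j = ends G i ≡ ends G j ⊎ (proj₁ (ends G i) ≡ proj₂ (ends G j) × proj₂ (ends G i) ≡ proj₁ (ends G j))

  Simple : Set
  Simple = (∀ i → proj₁ (ends G i) ≢ proj₂ (ends G i)) × (∀ i j → SameEnds i j → i ≡ j)

  data Reach (S : Subset m) : Fin v → Fin v → Set where
    here : ∀ {a} → Reach S a a
    step : ∀ {a c b} i → i ∈ S → Incident a i → Incident c i → Reach S c b → Reach S a b

  Connected : Set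
  Connected = ∀ a b → Reach fullˢ a b

  incB : Fin v → Fin m → Bool
  incB a i = ⌊ a Fin.≟ proj₁ (ends G i) ⌋ ∨ ⌊ a Fin.≟ proj₂ (ends G i) ⌋

  degIn : Subset m → Fin v → ℕ
  degIn C a = ∣ tabulate (λ i → lookup C i ∧ incB a i) ∣

  IsGraphCycle : Subset m → Set
  IsGraphCycle C = Nonempty C × (∀ a → degIn C a ≡ 0 ⊎ degIn C a ≡ 2)
    × (∀ a b i j → i ∈ C → j ∈ C → Incident a i → Incident b j → Reach C a b)

  cycM : Mat m
  cycM = record { ground = fullˢ ; circ = IsGraphCycle }

K4 : Graph 4 6
K4 = record { ends = E }
  where
  E : Fin 6 → Fin 4 × Fin 4
  E zero = (Fin.# 0 , Fin.# 1)
  E (suc zero) = (Fin.# 0 , Fin.# 2)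
  E (suc (suc zero)) = (Fin.# 0 , Fin.# 3)
  E (suc (suc (suc zero))) = (Fin.# 1 , Fin.# 2)
  E (suc (suc (suc (suc zero)))) = (Fin.# 1 , Fin.# 3)
  E (suc (suc (suc (suc (suc zero))))) = (Fin.# 2 , Fin.# 3)

MK4 : Mat 6
MK4 = cycM K4

record Field (c ℓ : Level) : Set (lsuc (c ⊔ ℓ)) where
  field commRing : CommutativeRing c ℓ
  open CommutativeRing commRing public
  field
    1≉0 : ¬ (1# ≈ 0#)
    inverse : ∀ x → ¬ (x ≈ 0#) → ∃[ y ] (x * y ≈ 1#)

-- Monomials in variables x_X, X : Subset n  (a table of exponents)

Tbl : ℕ → Set
Tbl zero = ℕ
Tbl (suc n) = Tbl n × Tbl n

expT : ∀ {n} → Tbl n → Subset n → ℕ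
expT {zero} t [] = t
expT {suc n} (l , r) (false ∷ X) = expT l X
expT {suc n} (l , r) (true ∷ X) = expT r X

_≟T_ : ∀ {n} (s t : Tbl n) → Dec (s ≡ t)
_≟T_ {zero} = ℕ._≟_
_≟T_ {suc n} = ≡-dec _≟T_ _≟T_

mulT : ∀ {n} → Tbl n → Tbl n → Tbl n
mulT {zero} a b = a ℕ.+ b
mulT {suc n} (a , b) (c , d) = mulT a c , mulT b d

degT : ∀ {n} → Tbl n → ℕ
degT {zero} t = t
degT {suc n} (l , r) = degT l ℕ.+ degT r

-- exponent of y_e in the image of the monomial: Σ_X α(X)·[e ∈ X]
yexp : ∀ {n} → Tbl n → Fin n → ℕ
yexp {suc n} (l , r) zero = degT r
yexp {suc n} (l , r) (suc e) = yexp l e ℕ.+ yexp r e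

-- image monomial in K[z, y_e]: exponent vector (z-exponent ∷ y-exponents)
φmono : ∀ {n} → Tbl n → Vec ℕ (suc n)
φmono α = degT α ∷ tabulate (yexp α)

-- Polynomials as finite lists of terms; compared coefficientwise

module Polys {c ℓ} (K : Field c ℓ) where
  open Field K

  Pol : Set → Set c
  Pol Mono = List (Carrier × Mono)

  coeff : ∀ {Mono : Set} → ((a b : Mono) → Dec (a ≡ b)) → Pol Mono → Mono → Carrier
  coeff dec [] α = 0#
  coeff dec ((a , β) ∷ p) α with dec β α
  ... | yes _ = a + coeff dec p α
  ... | no _  = coeff dec p α

  module Cyc {n : ℕ} (M : Mat n) where
    PolX : Set c
    PolX = Pol (Tbl n)

    coeffX : PolX → Tbl n → Carrier
    coeffX = coeff _≟T_

    _≈X_ : PolX → PolX → Set ℓ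
    p ≈X q = ∀ α → coeffX p α ≈ coeffX q α

    _+X_ : PolX → PolX → PolX
    _+X_ = _++_

    _*X_ : PolX → PolX → PolX
    p *X q = concatMap (λ t → List.map (λ u → (proj₁ t * proj₁ u , mulT (proj₂ t) (proj₂ u))) q) p

    InRing : PolX → Set c
    InRing p = All (λ t → ∀ X → ¬ IsCycle M X → expT (proj₂ t) X ≡ 0) p

    -- the K-algebra map x_C ↦ (∏_{e∈C} y_e)·z
    φ : PolX → Pol (Vec ℕ (suc n))
    φ = List.map (λ t → (proj₁ t , φmono (proj₂ t)))

    InI : PolX → Set (c ⊔ ℓ)
    InI p = InRing p × (∀ β → coeff (VecP.≡-dec ℕ._≟_) (φ p) β ≈ 0#)

    Homogeneous : ℕ → PolX → Set ℓ
    Homogeneous d p = ∀ α → degT α ≢ d → coeffX p α ≈ 0#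

    combo : List PolX → List PolX → PolX
    combo hs gs = foldr _+X_ [] (List.zipWith _*X_ hs gs)

    Generates : List PolX → Set (c ⊔ ℓ)
    Generates gs = ∀ f → InI f → ∃[ hs ] (All InRing hs × f ≈X combo hs gs)

    MinHomGenSet : List PolX → Set (c ⊔ ℓ)
    MinHomGenSet gs = All InI gs × All (λ g → ∃[ d ] Homogeneous d g) gs
      × Generates gs × (∀ i → ¬ Generates (removeAt gs i))

    μ≤2 : Set (c ⊔ ℓ)
    μ≤2 = ∃[ gs ] (MinHomGenSet gs × All (λ g → ∃[ d ] (d ≤ 2 × Homogeneous d g)) gs)

-- The cycles of M form a space Z over GF(2): the even edge sets of G, or its cuts. A fibre of the toric map
-- consists of the matrices with rows in Z and prescribed column sums, and the ideal is generated by quadrics as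
-- soon as any two such matrices are joined by moves adding to two rows a cycle contained in their sum.
--
-- Suppressing vertices with at most two neighbours either exhibits G as a series-parallel network or leads to a
-- contraction of G onto K4. In the second case M(K4) is a series minor of both M(G) and its dual, and the relation
-- between the four triangles of K4 on one side and the empty cycle with the three quadrilaterals on the other
-- lifts to a quartic in whose fibre no quadric applies. In the first case minors of M stay series-parallel, so
-- they have a loop, a coloop, a series pair or a parallel pair, unlike M(K4). The moves connect the fibres by
-- induction on the network: the number of rows through the root edge of a two-terminal network can be changed in
-- steps of two rows, each by a single move, so that the moves in the two halves of a composition can be synchronised.
module Submission where

open import Defs
open import Data.Bool using (Bool; true; false; if_then_else_; _∧_; _∨_; _xor_; not)
import Data.Bool.Properties as 𝔹
open import Data.Nat as ℕ using (ℕ; zero; suc; _≤_; _<_; z≤n; s≤s; _+_)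
import Data.Nat.Properties as ℕP
open import Data.Fin as Fin using (Fin; zero; suc; punchIn; punchOut)
import Data.Fin.Properties as FinP
open import Data.Fin.Subset using (Subset; _∈_; _∉_; _⊆_; _─_; ∣_∣; ⁅_⁆; _∪_; _∩_; ∁) renaming (⊥ to ∅ˢ; ⊤ to fullˢ)
import Data.Fin.Subset.Properties as SubP
open import Data.Vec as Vec using (Vec; []; _∷_; tabulate; lookup; zipWith)
import Data.Vec.Properties as VecP
open import Data.Product using (∃; ∃-syntax; _×_; _,_; proj₁; proj₂)
open import Data.Sum using (_⊎_; inj₁; inj₂; [_,_]′) renaming (map to ⊎-map; swap to ⊎-swap)
open import Data.Product.Properties using () renaming (≡-dec to ×-≡-dec)
open import Data.Empty using (⊥; ⊥-elim)
open import Relation.Nullary using (¬_; Dec; yes; no)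
open import Relation.Nullary.Decidable using (⌊_⌋; ¬?; _×-dec_; _→-dec_; _⊎-dec_; map′; decidable-stable)
open import Relation.Binary.PropositionalEquality
open import Function using (_∘_; id; case_of_)
open import Data.Unit using (⊤; tt)
open import Level using (Level)

-- Matroids are handed over as circuit predicates, so each one that occurs is paired with a
-- decidable subspace of GF(2)^n whose minimal nonzero vectors are its circuits (`Rep`). Dual,
-- deletion and contraction then become linear algebra, and existence questions are settled by
-- searching all subsets. Two obstacles shape the rest. Matching matrices network by network does
-- not survive a parallel composition, where the currents of the two halves are tied only through
-- their sum. Hence the induction hypothesis `Good`, which besides matching for a given root column
-- contains `SlowRoot`, and the notion `Flippable`, which prepares a change of root values without
-- carrying it out. On the other side, a contraction of G onto K4 uses arbitrary edges, whereas only
-- coloops and elements of series pairs may be contracted. For the dual these trees are deleted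
-- instead.

-- Linear algebra over GF(2) on subsets.

module BinaryVectors where

  import Algebra.Properties.CommutativeMonoid.Sum as CMSum
  open import Algebra.Bundles using (CommutativeRing)

  private variable
    n : ℕ

  infixl 9 _!_
  _!_ : Subset n → Fin n → Bool
  X ! i = lookup X i

  infixl 6 _⊕_
  _⊕_ : Subset n → Subset n → Subset n
  _⊕_ = zipWith _xor_

  infix 4 _≼_
  record _≼_ (X Y : Subset n) : Set where
    constructor incl
    field at : ∀ i → X ! i ≡ true → Y ! i ≡ true
  open _≼_ public

  ≼-refl : {X : Subset n} → X ≼ X
  ≼-refl = incl (λ _ p → p)

  ≼-trans : {X Y Z : Subset n} → X ≼ Y → Y ≼ Z → X ≼ Z
  ≼-trans f g = incl (λ i p → at g i (at f i p))

  ≢true⇒false : ∀ {b} → b ≢ true → b ≡ false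
  ≢true⇒false {false} _ = refl
  ≢true⇒false {true} h = ⊥-elim (h refl)

  ≢false⇒true : ∀ {b} → b ≢ false → b ≡ true
  ≢false⇒true {true} _ = refl
  ≢false⇒true {false} h = ⊥-elim (h refl)

  t≢f : ∀ {b} → b ≡ true → b ≡ false → ⊥
  t≢f refl ()

  b-ext : ∀ {a b : Bool} → (a ≡ true → b ≡ true) → (b ≡ true → a ≡ true) → a ≡ b
  b-ext {false} {false} f g = refl
  b-ext {false} {true} f g = g refl
  b-ext {true} {b} f g = sym (f refl)

  ∧-true : ∀ {a b} → a ∧ b ≡ true → a ≡ true × b ≡ true
  ∧-true {true} {true} _ = refl , refl

  ∨-true : ∀ {a b} → a ∨ b ≡ true → a ≡ true ⊎ b ≡ true
  ∨-true {true} _ = inj₁ refl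
  ∨-true {false} h = inj₂ h

  xor≡f⇒≡ : ∀ {a b} → a xor b ≡ false → a ≡ b
  xor≡f⇒≡ {false} {false} _ = refl
  xor≡f⇒≡ {true} {true} _ = refl

  xor-cancelˡ : ∀ s t → s xor (s xor t) ≡ t
  xor-cancelˡ s t = trans (sym (𝔹.xor-assoc s s t)) (cong (_xor t) (𝔹.xor-same s))

  ∧-rotate : ∀ a b c → a ∧ (b ∧ c) ≡ b ∧ (a ∧ c)
  ∧-rotate true b c = refl
  ∧-rotate false b c = sym (𝔹.∧-zeroʳ b)

  xor-cancel : ∀ a b → (a xor b) xor b ≡ a
  xor-cancel a b = trans (𝔹.xor-assoc a b b) (trans (cong (a xor_) (𝔹.xor-same b)) (𝔹.xor-identityʳ a))

  ⊆⇒≼ : {X Y : Subset n} → X ⊆ Y → X ≼ Y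
  ⊆⇒≼ {X = X} h = incl (λ i p → VecP.[]=⇒lookup (h (VecP.lookup⇒[]= i X p)))

  ≼⇒⊆ : {X Y : Subset n} → X ≼ Y → X ⊆ Y
  ≼⇒⊆ {X = X} {Y} h {i} p = VecP.lookup⇒[]= i Y (at h i (VecP.[]=⇒lookup p))

  ∈⇒! : {X : Subset n} {i : Fin n} → i ∈ X → X ! i ≡ true
  ∈⇒! = VecP.[]=⇒lookup

  !⇒∈ : {X : Subset n} {i : Fin n} → X ! i ≡ true → i ∈ X
  !⇒∈ {X = X} {i} = VecP.lookup⇒[]= i X

  ∉⇒! : {X : Subset n} {i : Fin n} → i ∉ X → X ! i ≡ false
  ∉⇒! h = ≢true⇒false (h ∘ !⇒∈)

  !⇒∉ : {X : Subset n} {i : Fin n} → X ! i ≡ false → i ∉ X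
  !⇒∉ h p = t≢f (∈⇒! p) h

  ext : {X Y : Subset n} → (∀ i → X ! i ≡ Y ! i) → X ≡ Y
  ext {X = X} {Y} h = trans (sym (VecP.tabulate∘lookup X)) (trans (VecP.tabulate-cong h) (VecP.tabulate∘lookup Y))

  ≼-antisym : {X Y : Subset n} → X ≼ Y → Y ≼ X → X ≡ Y
  ≼-antisym f g = ext (λ i → b-ext (at f i) (at g i))

  !-⊕ : (X Y : Subset n) (i : Fin n) → (X ⊕ Y) ! i ≡ X ! i xor Y ! i
  !-⊕ X Y i = VecP.lookup-zipWith _xor_ i X Y

  !-∪ : (X Y : Subset n) (i : Fin n) → (X ∪ Y) ! i ≡ X ! i ∨ Y ! i
  !-∪ X Y i = VecP.lookup-zipWith _∨_ i X Y

  !-∩ : (X Y : Subset n) (i : Fin n) → (X ∩ Y) ! i ≡ X ! i ∧ Y ! i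
  !-∩ X Y i = VecP.lookup-zipWith _∧_ i X Y

  !-─ : (X Y : Subset n) (i : Fin n) → (X ─ Y) ! i ≡ X ! i ∧ not (Y ! i)
  !-─ (true ∷ X) (true ∷ Y) zero = refl
  !-─ (true ∷ X) (false ∷ Y) zero = refl
  !-─ (false ∷ X) (true ∷ Y) zero = refl
  !-─ (false ∷ X) (false ∷ Y) zero = refl
  !-─ (_ ∷ X) (_ ∷ Y) (suc i) = !-─ X Y i

  !-∅ : (i : Fin n) → ∅ˢ ! i ≡ false
  !-∅ i = VecP.lookup-replicate i false

  !-full : (i : Fin n) → fullˢ ! i ≡ true
  !-full i = VecP.lookup-replicate i true

  !-⁅⁆-same : (i : Fin n) → ⁅ i ⁆ ! i ≡ true
  !-⁅⁆-same i = ∈⇒! (SubP.x∈⁅x⁆ i)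

  !-⁅⁆⇒≡ : (i j : Fin n) → ⁅ i ⁆ ! j ≡ true → j ≡ i
  !-⁅⁆⇒≡ i j h = SubP.x∈⁅y⁆⇒x≡y i (!⇒∈ h)

  !-⁅⁆-diff : {i j : Fin n} → j ≢ i → ⁅ i ⁆ ! j ≡ false
  !-⁅⁆-diff {i = i} {j} h = ≢true⇒false (h ∘ !-⁅⁆⇒≡ i j)

  !-tab : (f : Fin n → Bool) (i : Fin n) → tabulate f ! i ≡ f i
  !-tab = VecP.lookup∘tabulate

  Inhabited : Subset n → Set
  Inhabited X = ∃ λ i → X ! i ≡ true

  inhabited? : (X : Subset n) → Dec (Inhabited X)
  inhabited? X = FinP.any? (λ i → X ! i 𝔹.≟ true)

  ¬inhabited⇒∅ : {X : Subset n} → ¬ Inhabited X → X ≡ ∅ˢ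
  ¬inhabited⇒∅ h = ext (λ i → trans (≢true⇒false (λ p → h (i , p))) (sym (!-∅ i)))

  ⊕-cancel : (X Y : Subset n) → (X ⊕ Y) ⊕ Y ≡ X
  ⊕-cancel X Y = ext (λ i → trans (!-⊕ (X ⊕ Y) Y i) (trans (cong (_xor Y ! i) (!-⊕ X Y i)) (xor-cancel (X ! i) (Y ! i))))

  ⊕-comm : (X Y : Subset n) → X ⊕ Y ≡ Y ⊕ X
  ⊕-comm X Y = ext (λ i → trans (!-⊕ X Y i) (trans (𝔹.xor-comm (X ! i) _) (sym (!-⊕ Y X i))))

  ⊕-∅ : (X : Subset n) → X ⊕ ∅ˢ ≡ X
  ⊕-∅ X = ext (λ i → trans (!-⊕ X ∅ˢ i) (trans (cong (X ! i xor_) (!-∅ i)) (𝔹.xor-identityʳ _)))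

  ∅-⊕ : (X : Subset n) → ∅ˢ ⊕ X ≡ X
  ∅-⊕ X = trans (⊕-comm ∅ˢ X) (⊕-∅ X)

  ⊕≡∅⇒≡ : {X Y : Subset n} → X ⊕ Y ≡ ∅ˢ → X ≡ Y
  ⊕≡∅⇒≡ {X = X} {Y} h = trans (sym (⊕-cancel X Y)) (trans (cong (_⊕ Y) h) (∅-⊕ Y))

  ⊕-≼ : {X Y Z : Subset n} → X ≼ Z → Y ≼ Z → X ⊕ Y ≼ Z
  ⊕-≼ {X = X} {Y} {Z} f g = incl go
    where
    go : ∀ i → (X ⊕ Y) ! i ≡ true → Z ! i ≡ true
    go i p with X ! i in eq | Y ! i in eq' | trans (sym (!-⊕ X Y i)) p
    ... | true | _ | _ = at f i eq
    ... | false | true | _ = at g i eq'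

  module ⨁ = CMSum (CommutativeRing.+-commutativeMonoid 𝔹.xor-∧-commutativeRing)

  ⨁ : (Fin n → Bool) → Bool
  ⨁ = ⨁.sum

  ⨁-false : (f : Fin n → Bool) → (∀ i → f i ≡ false) → ⨁ f ≡ false
  ⨁-false {n} f h = trans (⨁.sum-cong-≗ h) (⨁.sum-replicate-zero n)

  ⨁-∧ : (c : Bool) (f : Fin n → Bool) → ⨁ (λ i → c ∧ f i) ≡ c ∧ ⨁ f
  ⨁-∧ true f = refl
  ⨁-∧ {n} false f = ⨁-false {n} (λ i → false) (λ _ → refl)

  ⨁-single : (f : Fin n → Bool) (i : Fin n) → (∀ j → j ≢ i → f j ≡ false) → ⨁ f ≡ f i
  ⨁-single {suc n} f i h = trans (⨁.sum-remove {i = i} f)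
    (trans (cong (f i xor_) (⨁-false _ (λ j → h (punchIn i j) (FinP.punchInᵢ≢i i j)))) (𝔹.xor-identityʳ (f i)))

  ⨁-two : (f : Fin n → Bool) (i j : Fin n) → i ≢ j → (∀ k → k ≢ i → k ≢ j → f k ≡ false) → ⨁ f ≡ f i xor f j
  ⨁-two {suc n} f i j i≢j h = trans (⨁.sum-remove {i = i} f) (cong (f i xor_)
    (trans (⨁-single _ (punchOut i≢j) (λ k k≢ → h (punchIn i k) (FinP.punchInᵢ≢i i k)
        (λ e → k≢ (FinP.punchIn-injective i _ _ (trans e (sym (FinP.punchIn-punchOut i≢j)))))))
      (cong f (FinP.punchIn-punchOut i≢j))))

  dot : Subset n → Subset n → Bool
  dot X Y = ⨁ (λ i → X ! i ∧ Y ! i)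

  dot-⊕ʳ : (X Y Z : Subset n) → dot X (Y ⊕ Z) ≡ dot X Y xor dot X Z
  dot-⊕ʳ X Y Z = trans
    (⨁.sum-cong-≗ (λ i → trans (cong (X ! i ∧_) (!-⊕ Y Z i)) (𝔹.∧-distribˡ-xor (X ! i) (Y ! i) (Z ! i))))
    (⨁.∑-distrib-+ (λ i → X ! i ∧ Y ! i) (λ i → X ! i ∧ Z ! i))

  dot-comm : (X Y : Subset n) → dot X Y ≡ dot Y X
  dot-comm X Y = ⨁.sum-cong-≗ (λ i → 𝔹.∧-comm (X ! i) (Y ! i))

  dot-⊕ˡ : (X Y Z : Subset n) → dot (X ⊕ Y) Z ≡ dot X Z xor dot Y Z
  dot-⊕ˡ X Y Z = trans (dot-comm (X ⊕ Y) Z) (trans (dot-⊕ʳ Z X Y) (cong₂ _xor_ (dot-comm Z X) (dot-comm Z Y)))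

  dot-∅ʳ : (X : Subset n) → dot X ∅ˢ ≡ false
  dot-∅ʳ X = ⨁-false _ (λ i → trans (cong (X ! i ∧_) (!-∅ i)) (𝔹.∧-zeroʳ _))

  dot-∅ˡ : (X : Subset n) → dot ∅ˢ X ≡ false
  dot-∅ˡ X = trans (dot-comm ∅ˢ X) (dot-∅ʳ X)

  dot-⁅⁆ : (X : Subset n) (e : Fin n) → dot X ⁅ e ⁆ ≡ X ! e
  dot-⁅⁆ X e = trans
    (⨁-single _ e (λ j j≢e → trans (cong (X ! j ∧_) (!-⁅⁆-diff j≢e)) (𝔹.∧-zeroʳ _)))
    (trans (cong (X ! e ∧_) (!-⁅⁆-same e)) (𝔹.∧-identityʳ _))

  -- Decidable membership lets questions about the existence of members be answered by running
  -- through all subsets, in place of excluded middle.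
  record Space (n : ℕ) : Set₁ where
    field
      mem   : Subset n → Set
      mem?  : ∀ z → Dec (mem z)
      mem-∅ : mem ∅ˢ
      mem-⊕ : ∀ {y z} → mem y → mem z → mem (y ⊕ z)
  open Space public

  allSubset? : {P : Subset n → Set} → (∀ X → Dec (P X)) → Dec (∀ X → P X)
  allSubset? P? with SubP.anySubset? (λ X → ¬? (P? X))
  ... | yes (X , ¬p) = no (λ h → ¬p (h X))
  ... | no ¬e = yes (λ X → decidable-stable (P? X) (λ ¬p → ¬e (X , ¬p)))

  ≼? : (X Y : Subset n) → Dec (X ≼ Y)
  ≼? X Y = map′ incl at (FinP.all? (λ i → (X ! i 𝔹.≟ true) →-dec (Y ! i 𝔹.≟ true)))

  Orth : Space n → Subset n → Set
  Orth Z y = ∀ z → mem Z z → dot y z ≡ false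

  -- Gaussian elimination on the first coordinate.
  fredholm : (Z : Space n) (D : Subset n) → mem Z D ⊎ (∃ λ y → Orth Z y × dot y D ≡ true)
  fredholm {zero} Z [] = inj₁ (mem-∅ Z)
  fredholm {suc n} Z (d ∷ D) with SubP.anySubset? (λ p → mem? Z (true ∷ p))
  -- No member uses the first coordinate, so the unit vector there is orthogonal to all members and
  -- separates `D` as soon as `d` is `true`.
  ... | no none with d
  ...   | true = inj₂ ((true ∷ ∅ˢ) , (λ where
            (true ∷ z) m → ⊥-elim (none (z , m))
            (false ∷ z) m → dot-∅ˡ z) , cong not (dot-∅ˡ D))
  ...   | false with fredholm Z₀ D
    where
    Z₀ : Space n
    Z₀ = record { mem = λ z → mem Z (false ∷ z) ; mem? = λ z → mem? Z (false ∷ z) ; mem-∅ = mem-∅ Z ; mem-⊕ = mem-⊕ Z }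
  ...     | inj₁ m = inj₁ m
  ...     | inj₂ (y , orth , y·D) = inj₂ ((false ∷ y) , (λ where
            (true ∷ z) m → ⊥-elim (none (z , m))
            (false ∷ z) m → orth z m) , y·D)
  -- The pivot `true ∷ p` clears the first coordinate of the target.
  fredholm {suc n} Z (d ∷ D) | yes (p , pm) with fredholm Z₀ (if d then D ⊕ p else D)
    where
    Z₀ : Space n
    Z₀ = record { mem = λ z → mem Z (false ∷ z) ; mem? = λ z → mem? Z (false ∷ z) ; mem-∅ = mem-∅ Z ; mem-⊕ = mem-⊕ Z }
  ... | inj₁ m = inj₁ (back d m)
    where
    back : ∀ d → mem Z (false ∷ (if d then D ⊕ p else D)) → mem Z (d ∷ D)
    back false m = m
    back true m = subst (λ w → mem Z (true ∷ w)) (⊕-cancel D p) (mem-⊕ Z m pm)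
  -- The first entry is forced: it is the one that makes the vector orthogonal to the pivot.
  ... | inj₂ (y , orth , y·D) = inj₂ ((dot y p ∷ y) , orth' , last d y·D)
    where
    orth' : Orth Z (dot y p ∷ y)
    orth' (false ∷ z) m = trans (cong (_xor dot y z) (𝔹.∧-zeroʳ (dot y p))) (orth z m)
    orth' (true ∷ z) m = trans (cong (_xor dot y z) (𝔹.∧-identityʳ (dot y p)))
      (trans (𝔹.xor-comm (dot y p) _) (trans (sym (dot-⊕ʳ y z p)) (orth (z ⊕ p) (mem-⊕ Z m pm))))
    last : ∀ d → dot y (if d then D ⊕ p else D) ≡ true → ((dot y p ∧ d) xor dot y D) ≡ true
    last false h = trans (cong (_xor dot y D) (𝔹.∧-zeroʳ (dot y p))) h
    last true h = trans (cong (_xor dot y D) (𝔹.∧-identityʳ (dot y p)))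
      (trans (𝔹.xor-comm (dot y p) _) (trans (sym (dot-⊕ʳ y D p)) h))

open BinaryVectors

-- Circuits, cycles and closure in a binary space.

module CycleSpaces where

  private variable
    n : ℕ

  _≟ˢ_ : (X Y : Subset n) → Dec (X ≡ Y)
  _≟ˢ_ = VecP.≡-dec 𝔹._≟_

  ≼∧≢⇒∣∣< : {X Y : Subset n} → X ≼ Y → X ≢ Y → ∣ X ∣ < ∣ Y ∣
  ≼∧≢⇒∣∣< {X = X} {Y} h ne with FinP.any? (λ i → (Y ! i 𝔹.≟ true) ×-dec (X ! i 𝔹.≟ false))
  ... | yes (i , y , x) = SubP.p⊂q⇒∣p∣<∣q∣ {p = X} {q = Y} (≼⇒⊆ h , i , !⇒∈ y , !⇒∉ x)
  ... | no none = ⊥-elim (ne (≼-antisym h (incl (λ i y → ≢false⇒true (λ x → none (i , y , x))))))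

  ⁅⁆-inh : (e : Fin n) → Inhabited ⁅ e ⁆
  ⁅⁆-inh e = e , !-⁅⁆-same e

  Min : Space n → Subset n → Set
  Min Z C = mem Z C × Inhabited C × (∀ D → mem Z D → Inhabited D → D ≼ C → D ≡ C)

  -- If a nonzero proper subcycle `D` of `z` misses `e`, then `z ⊕ D` still contains it. So as long
  -- as `z` is not minimal there is a smaller cycle through `e`.
  circuit-through : (Z : Space n) (z : Subset n) (e : Fin n) → mem Z z → z ! e ≡ true →
    ∃ λ C → Min Z C × C ≼ z × C ! e ≡ true
  circuit-through {n} Z z₀ e = go ∣ z₀ ∣ z₀ ℕP.≤-refl
    where
    go : ∀ k z → ∣ z ∣ ≤ k → mem Z z → z ! e ≡ true → ∃ λ C → Min Z C × C ≼ z × C ! e ≡ true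
    go k z le m ze with SubP.anySubset? (λ D → mem? Z D ×-dec inhabited? D ×-dec ≼? D z ×-dec ¬? (D ≟ˢ z))
    ... | no none = z , (m , (e , ze) , λ D Dm Di D≼z → decidable-stable (D ≟ˢ z) (λ D≢ → none (D , Dm , Di , D≼z , D≢)))
                      , ≼-refl , ze
    go zero z le m ze | yes (D , Dm , Di , D≼z , D≢) =
      ⊥-elim (ℕP.n≮0 (ℕP.<-≤-trans (≼∧≢⇒∣∣< D≼z D≢) le))
    go (suc k) z le m ze | yes (D , Dm , (i , Di) , D≼z , D≢) with D ! e in eq
    ... | true = let C , mC , C≼ , Ce = go k D (ℕP.≤-pred (ℕP.<-≤-trans (≼∧≢⇒∣∣< D≼z D≢) le)) Dm eq
                 in C , mC , ≼-trans C≼ D≼z , Ce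
    ... | false =
      let w≼z = ⊕-≼ {X = z} ≼-refl D≼z
          w≢z = λ h → t≢f (at D≼z i Di) (trans (cong (_! i) (sym h)) (trans (!-⊕ z D i) (cong₂ _xor_ (at D≼z i Di) Di)))
          C , mC , C≼ , Ce = go k (z ⊕ D) (ℕP.≤-pred (ℕP.<-≤-trans (≼∧≢⇒∣∣< w≼z w≢z) le)) (mem-⊕ Z m Dm)
                               (trans (!-⊕ z D e) (cong₂ _xor_ ze eq))
      in C , mC , ≼-trans C≼ w≼z , Ce

  -- Every cycle is a disjoint union of circuits.
  mem-induction : (Z : Space n) (P : Subset n → Set) → P ∅ˢ →
    (∀ C X → Min Z C → (C ∩ X ≡ ∅ˢ) → P X → P (C ⊕ X)) → ∀ z → mem Z z → P z
  mem-induction {n} Z P P∅ add z₀ = go ∣ z₀ ∣ z₀ ℕP.≤-refl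
    where
    go : ∀ k z → ∣ z ∣ ≤ k → mem Z z → P z
    go k z le m with inhabited? z
    ... | no none = subst P (sym (¬inhabited⇒∅ none)) P∅
    go zero z le m | yes (i , zi) = ⊥-elim (ℕP.n≮0 (ℕP.<-≤-trans (SubP.x∈p⇒∣p-x∣<∣p∣ {x = i} {p = z} (!⇒∈ {X = z} zi)) le))
    go (suc k) z le m | yes (i , zi) with circuit-through Z z i m zi
    ... | C , (mC , minC) , C≼z , Ci =
      subst P (trans (⊕-comm C (z ⊕ C)) (⊕-cancel z C))
        (add C (z ⊕ C) (mC , minC) disj
          (go k (z ⊕ C) (ℕP.≤-pred (ℕP.<-≤-trans (≼∧≢⇒∣∣< (⊕-≼ ≼-refl C≼z) w≢z) le)) (mem-⊕ Z m mC)))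
      where
      w≢z : z ⊕ C ≢ z
      w≢z h = t≢f zi (trans (cong (_! i) (sym h)) (trans (!-⊕ z C i) (cong₂ _xor_ zi Ci)))
      disj : C ∩ (z ⊕ C) ≡ ∅ˢ
      disj = ext λ j → trans (!-∩ C (z ⊕ C) j) (trans (lem j) (sym (!-∅ j)))
        where
        lem : ∀ j → C ! j ∧ (z ⊕ C) ! j ≡ false
        lem j with C ! j in eq
        ... | false = refl
        ... | true = trans (!-⊕ z C j) (cong₂ _xor_ (at C≼z j eq) eq)

  disjoint-∪≡⊕ : (C X : Subset n) → C ∩ X ≡ ∅ˢ → C ∪ X ≡ C ⊕ X
  disjoint-∪≡⊕ C X h = ext λ i → trans (!-∪ C X i) (trans
    (lem (C ! i) (X ! i) (trans (sym (!-∩ C X i)) (trans (cong (_! i) h) (!-∅ i)))) (sym (!-⊕ C X i)))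
    where
    lem : ∀ a b → a ∧ b ≡ false → a ∨ b ≡ a xor b
    lem false b _ = refl
    lem true false _ = refl

  -- A `Mat` comes without any circuit axioms; this record is the interface that replaces them. All
  -- matroid arguments below go through a space whose minimal nonzero vectors are the circuits.
  record Rep {n : ℕ} (M : Mat n) (Z : Space n) : Set where
    field
      supp  : ∀ z → mem Z z → z ≼ ground M
      circ⇒ : ∀ {C} → circ M C → Min Z C
      circ⇐ : ∀ {C} → Min Z C → circ M C
  open Rep public

  module _ {M : Mat n} {Z : Space n} (R : Rep M Z) where

    isCycle⇒mem : ∀ {X} → IsCycle M X → mem Z X
    isCycle⇒mem cyc-∅ = mem-∅ Z
    isCycle⇒mem (cyc-∪ {C} {X} c x d) =
      subst (mem Z) (sym (disjoint-∪≡⊕ C X d)) (mem-⊕ Z (proj₁ (circ⇒ R c)) (isCycle⇒mem x))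

    mem⇒isCycle : ∀ {X} → mem Z X → IsCycle M X
    mem⇒isCycle {X} = mem-induction Z (IsCycle M) cyc-∅
      (λ C Y mC d cY → subst (IsCycle M) (disjoint-∪≡⊕ C Y d) (cyc-∪ (circ⇐ R mC) cY d)) X

  Free : Space n → Subset n → Set
  Free Z I = ∀ z → mem Z z → Inhabited z → ¬ (z ≼ I)

  -- Membership of `x` in the closure of `B`, witnessed by a cycle that plays the role of the
  -- fundamental circuit.
  Span : Space n → Subset n → Fin n → Set
  Span Z B x = ∃ λ z → mem Z z × z ! x ≡ true × (∀ i → z ! i ≡ true → i ≡ x ⊎ B ! i ≡ true)

  span? : (Z : Space n) (B : Subset n) (x : Fin n) → Dec (Span Z B x)
  span? Z B x = SubP.anySubset? (λ z → mem? Z z ×-dec (z ! x 𝔹.≟ true) ×-dec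
    FinP.all? (λ i → (z ! i 𝔹.≟ true) →-dec ((i Fin.≟ x) ⊎-dec (B ! i 𝔹.≟ true))))

  insert-≼ : {X Y : Subset n} {x : Fin n} → X ≼ Y → Y ! x ≡ true → X ∪ ⁅ x ⁆ ≼ Y
  insert-≼ {X = X} {Y} {x} h yx = incl λ i p → case ∨-true (trans (sym (!-∪ X ⁅ x ⁆ i)) p) of λ where
    (inj₁ q) → at h i q
    (inj₂ q) → subst (λ j → Y ! j ≡ true) (sym (!-⁅⁆⇒≡ x i q)) yx

  ≼-insert : (X : Subset n) (x : Fin n) → X ≼ X ∪ ⁅ x ⁆
  ≼-insert X x = incl (λ i p → trans (!-∪ X ⁅ x ⁆ i) (cong (_∨ ⁅ x ⁆ ! i) p))

  insert-new : (X : Subset n) (x : Fin n) → (X ∪ ⁅ x ⁆) ! x ≡ true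
  insert-new X x = trans (!-∪ X ⁅ x ⁆ x) (trans (cong (X ! x ∨_) (!-⁅⁆-same x)) (𝔹.∨-zeroʳ _))

  insert-free : (Z : Space n) (I : Subset n) (x : Fin n) → Free Z I → ¬ Span Z I x → Free Z (I ∪ ⁅ x ⁆)
  insert-free Z I x fr ns z mz iz z≼ with z ! x in eq
  ... | true = ns (z , mz , eq , λ i p → case ∨-true (trans (sym (!-∪ I ⁅ x ⁆ i)) (at z≼ i p)) of λ where
          (inj₁ q) → inj₂ q
          (inj₂ q) → inj₁ (!-⁅⁆⇒≡ x i q))
  ... | false = fr z mz iz (incl λ i p → case ∨-true (trans (sym (!-∪ I ⁅ x ⁆ i)) (at z≼ i p)) of λ where
          (inj₁ q) → q
          (inj₂ q) → ⊥-elim (t≢f p (subst (λ j → z ! j ≡ false) (sym (!-⁅⁆⇒≡ x i q)) eq)))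

  -- Greedy extension; `k` bounds the number of elements of `A` that can still be added. The result
  -- is a basis of `A`.
  maximal-free : (Z : Space n) (A I : Subset n) → I ≼ A → Free Z I →
    ∃ λ B → B ≼ A × Free Z B × (∀ x → A ! x ≡ true → B ! x ≡ false → Span Z B x)
  maximal-free {n} Z A I₀ = go ∣ A ∣ I₀ (ℕP.m≤n+m _ _)
    where
    go : ∀ k I → ∣ A ∣ ≤ ∣ I ∣ + k → I ≼ A → Free Z I →
      ∃ λ B → B ≼ A × Free Z B × (∀ x → A ! x ≡ true → B ! x ≡ false → Span Z B x)
    go k I le I≼A fr with FinP.any? (λ x → (A ! x 𝔹.≟ true) ×-dec (I ! x 𝔹.≟ false) ×-dec ¬? (span? Z I x))
    ... | no none = I , I≼A , fr , λ x a b → decidable-stable (span? Z I x) (λ ns → none (x , a , b , ns))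
    ... | yes (x , a , b , ns) = next k le
      where
      bigger : ∣ I ∣ < ∣ I ∪ ⁅ x ⁆ ∣
      bigger = ≼∧≢⇒∣∣< (≼-insert I x) (λ h → t≢f (insert-new I x) (trans (cong (_! x) (sym h)) b))
      I'≼ : I ∪ ⁅ x ⁆ ≼ A
      I'≼ = insert-≼ I≼A a
      next : ∀ k → ∣ A ∣ ≤ ∣ I ∣ + k →
        ∃ λ B → B ≼ A × Free Z B × (∀ x → A ! x ≡ true → B ! x ≡ false → Span Z B x)
      next zero le = ⊥-elim (ℕP.<⇒≱ bigger (ℕP.≤-trans (SubP.p⊆q⇒∣p∣≤∣q∣ {p = I ∪ ⁅ x ⁆} {q = A} (≼⇒⊆ I'≼)) (subst (∣ A ∣ ≤_) (ℕP.+-identityʳ _) le)))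
      next (suc k) le = go k (I ∪ ⁅ x ⁆)
        (ℕP.≤-trans (subst (∣ A ∣ ≤_) (ℕP.+-suc ∣ I ∣ k) le) (ℕP.+-monoˡ-≤ k bigger)) I'≼ (insert-free Z I x fr ns)

  -- Elements of the witness outside `B`, other than `x`, are removed one at a time by adding their
  -- own witnesses. As `B` misses `x`, these do not touch `x`, and the part outside `B` shrinks.
  span-trans : (Z : Space n) (A B : Subset n) (x : Fin n) → B ! x ≡ false →
    (∀ i → A ! i ≡ true → B ! i ≡ false → Span Z B i) → Span Z A x → Span Z B x
  span-trans {n} Z A B x Bx sp (z₀ , m₀ , zx₀ , h₀) = go ∣ z₀ ─ B ∣ z₀ ℕP.≤-refl m₀ zx₀ h₀'
    where
    h₀' : ∀ i → z₀ ! i ≡ true → i ≡ x ⊎ (A ! i ≡ true ⊎ B ! i ≡ true)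
    h₀' i p = [ inj₁ , (λ q → inj₂ (inj₁ q)) ]′ (h₀ i p)
    go : ∀ k z → ∣ z ─ B ∣ ≤ k → mem Z z → z ! x ≡ true →
      (∀ i → z ! i ≡ true → i ≡ x ⊎ (A ! i ≡ true ⊎ B ! i ≡ true)) → Span Z B x
    go k z le m zx h with FinP.any? (λ i → (z ! i 𝔹.≟ true) ×-dec ¬? (i Fin.≟ x) ×-dec (B ! i 𝔹.≟ false))
    ... | no none = z , m , zx , λ i p → case i Fin.≟ x of λ where
            (yes e) → inj₁ e
            (no ne) → inj₂ (≢false⇒true (λ b → none (i , p , ne , b)))
    ... | yes (i , zi , i≢x , Bi) with h i zi
    ...   | inj₁ e = ⊥-elim (i≢x e)
    ...   | inj₂ (inj₂ b) = ⊥-elim (t≢f b Bi)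
    ...   | inj₂ (inj₁ a) with sp i a Bi
    ...     | c , mc , ci , hc = next k le
      where
      cx : c ! x ≡ false
      cx = ≢true⇒false λ p → [ (λ e → i≢x (sym e)) , (λ b → t≢f b Bx) ]′ (hc x p)
      sub' : ∀ j → ((z ⊕ c) ─ B) ! j ≡ true → (z ─ B) ! j ≡ true
      sub' j p with ∧-true (trans (sym (!-─ (z ⊕ c) B j)) p)
      ... | q , nb with c ! j in cj
      ...   | false = trans (!-─ z B j) (cong₂ _∧_ (trans (sym (𝔹.xor-identityʳ _)) (trans (cong (z ! j xor_) (sym cj)) (trans (sym (!-⊕ z c j)) q))) nb)
      ...   | true with hc j cj
      ...     | inj₁ refl = trans (!-─ z B j) (cong₂ _∧_ zi nb)
      ...     | inj₂ b = ⊥-elim (t≢f nb (cong not b))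
      sub : ((z ⊕ c) ─ B) ≼ (z ─ B)
      sub = incl sub'
      ne : (z ⊕ c) ─ B ≢ z ─ B
      ne e = t≢f (trans (!-─ z B i) (cong₂ _∧_ zi (cong not Bi)))
        (trans (cong (_! i) (sym e)) (trans (!-─ (z ⊕ c) B i) (cong (_∧ not (B ! i)) (trans (!-⊕ z c i) (cong₂ _xor_ zi ci)))))
      smaller : ∣ (z ⊕ c) ─ B ∣ < ∣ z ─ B ∣
      smaller = ≼∧≢⇒∣∣< sub ne
      h' : ∀ j → (z ⊕ c) ! j ≡ true → j ≡ x ⊎ (A ! j ≡ true ⊎ B ! j ≡ true)
      h' j p with z ! j in zj
      ... | true = h j zj
      ... | false with hc j (trans (cong (_xor c ! j) (sym zj)) (trans (sym (!-⊕ z c j)) p))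
      ...   | inj₁ refl = inj₂ (inj₁ a)
      ...   | inj₂ b = inj₂ (inj₂ b)
      next : ∀ k → ∣ z ─ B ∣ ≤ k → Span Z B x
      next zero le = ⊥-elim (ℕP.n≮0 (ℕP.<-≤-trans smaller le))
      next (suc k) le = go k (z ⊕ c) (ℕP.≤-pred (ℕP.<-≤-trans smaller le)) (mem-⊕ Z m mc)
        (trans (!-⊕ z c x) (cong₂ _xor_ zx cx)) h'

open CycleSpaces

-- Bases and cocircuits; the spaces of the dual, of deletions and of contractions.

module Duality where

  private variable
    n k : ℕ

  ⁅⁆-≼ : {X : Subset n} {e : Fin n} → X ! e ≡ true → ⁅ e ⁆ ≼ X
  ⁅⁆-≼ {X = X} {e} h = incl (λ i p → subst (λ j → X ! j ≡ true) (sym (!-⁅⁆⇒≡ e i p)) h)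

  ≼-⁅⁆ : {X : Subset n} {e : Fin n} → X ≼ ⁅ e ⁆ → Inhabited X → X ≡ ⁅ e ⁆
  ≼-⁅⁆ {X = X} {e} h (i , p) = ≼-antisym h (⁅⁆-≼ (subst (λ j → X ! j ≡ true) (!-⁅⁆⇒≡ e i (at h i p)) p))

  ≼-─ : {X Y : Subset n} → X ─ Y ≼ X
  ≼-─ {X = X} {Y} = incl (λ i p → proj₁ (∧-true (trans (sym (!-─ X Y i)) p)))

  ∩-⊕ : (X Y D : Subset n) → (X ⊕ Y) ∩ D ≡ (X ∩ D) ⊕ (Y ∩ D)
  ∩-⊕ X Y D = ext λ i → trans (!-∩ (X ⊕ Y) D i) (trans (cong (_∧ D ! i) (!-⊕ X Y i))
    (trans (𝔹.∧-distribʳ-xor (D ! i) (X ! i) (Y ! i))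
      (sym (trans (!-⊕ (X ∩ D) (Y ∩ D) i) (cong₂ _xor_ (!-∩ X D i) (!-∩ Y D i))))))

  ─≡∩∁ : (X T : Subset n) → X ─ T ≡ X ∩ ∁ T
  ─≡∩∁ X T = ext λ i → trans (!-─ X T i) (sym (trans (!-∩ X (∁ T) i) (cong (X ! i ∧_) (VecP.lookup-map i not T))))

  ∩-space : Space n → Subset n → Space n
  ∩-space Z D = record
    { mem = λ w → ∃ λ z → mem Z z × w ≡ z ∩ D
    ; mem? = λ w → SubP.anySubset? (λ z → mem? Z z ×-dec (w ≟ˢ (z ∩ D)))
    ; mem-∅ = ∅ˢ , mem-∅ Z , ext (λ i → trans (!-∅ i) (sym (trans (!-∩ ∅ˢ D i) (cong (_∧ D ! i) (!-∅ i)))))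
    ; mem-⊕ = λ (y , ym , ye) (z , zm , ze) → y ⊕ z , mem-⊕ Z ym zm , trans (cong₂ _⊕_ ye ze) (sym (∩-⊕ y z D))
    }

  dot-∩ : (X Y D : Subset n) → dot (X ∩ D) Y ≡ dot X (Y ∩ D)
  dot-∩ X Y D = ⨁.sum-cong-≗ λ i → trans (cong (_∧ Y ! i) (!-∩ X D i))
    (trans (𝔹.∧-assoc (X ! i) (D ! i) (Y ! i)) (cong (X ! i ∧_) (trans (𝔹.∧-comm (D ! i) (Y ! i)) (sym (!-∩ Y D i)))))

  orth? : (Z : Space n) (y : Subset n) → Dec (Orth Z y)
  orth? Z y = allSubset? (λ z → mem? Z z →-dec (dot y z 𝔹.≟ false))

  perp : Space n → Subset n → Space n
  perp Z S = record
    { mem = λ y → y ≼ S × Orth Z y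
    ; mem? = λ y → ≼? y S ×-dec orth? Z y
    ; mem-∅ = incl (λ i p → ⊥-elim (t≢f p (!-∅ i))) , (λ z _ → dot-∅ˡ z)
    ; mem-⊕ = λ {x} {y} (xS , xo) (yS , yo) → ⊕-≼ xS yS , λ z m → trans (dot-⊕ˡ x y z) (cong₂ _xor_ (xo z m) (yo z m))
    }

  pair-! : ∀ {e f : Fin n} i → (⁅ e ⁆ ∪ ⁅ f ⁆) ! i ≡ true → i ≡ e ⊎ i ≡ f
  pair-! {e = e} {f} i p = ⊎-map (!-⁅⁆⇒≡ e i) (!-⁅⁆⇒≡ f i) (∨-true (trans (sym (!-∪ ⁅ e ⁆ ⁅ f ⁆ i)) p))

  pair-l : (e f : Fin n) → (⁅ e ⁆ ∪ ⁅ f ⁆) ! e ≡ true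
  pair-l e f = trans (!-∪ ⁅ e ⁆ ⁅ f ⁆ e) (cong (_∨ ⁅ f ⁆ ! e) (!-⁅⁆-same e))

  pair-r : (e f : Fin n) → (⁅ e ⁆ ∪ ⁅ f ⁆) ! f ≡ true
  pair-r e f = insert-new ⁅ e ⁆ f

  dot-pair : ∀ {e f : Fin n} {D : Subset n} → f ≢ e → D ≼ ⁅ e ⁆ ∪ ⁅ f ⁆ → ∀ z → dot D z ≡ (D ! e ∧ z ! e) xor (D ! f ∧ z ! f)
  dot-pair {e = e} {f} {D} f≢e D≼ z = ⨁-two _ e f (f≢e ∘ sym) λ j j≢e j≢f →
    cong (_∧ z ! j) (≢true⇒false (λ p → [ j≢e , j≢f ]′ (pair-! j (at D≼ j p))))

  module _ {M : Mat n} {Z : Space n} (R : Rep M Z) where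

    free⇒independent : ∀ {I} → I ≼ ground M → Free Z I → Independent M I
    free⇒independent I≼ fr = ≼⇒⊆ I≼ , λ C c C⊆I →
      let m , i , _ = circ⇒ R c in fr C m i (⊆⇒≼ C⊆I)

    independent⇒free : ∀ {I} → Independent M I → Free Z I
    independent⇒free (_ , ind) z m (e , ze) z≼I =
      let C , mC , C≼ , _ = circuit-through Z z e m ze in ind C (circ⇐ R mC) (≼⇒⊆ (≼-trans C≼ z≼I))

    -- Suppose a basis `B` missed `y`, and take `e` in `y`. Either `e` can be added to `B`, against
    -- maximality, or its fundamental cycle meets `y` in `e` alone, against orthogonality.
    cocycle-meets : ∀ {y D} → y ≼ D → D ≼ ground M → Orth Z y → Inhabited y → MeetsAllBases M D
    cocycle-meets {y} {D} y≼D D≼ orth (e , ye) B ((B⊆ , indB) , maxB)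
      with FinP.any? (λ i → (y ! i 𝔹.≟ true) ×-dec (B ! i 𝔹.≟ true))
    ... | yes (i , yi , Bi) = i , !⇒∈ (at y≼D i yi) , !⇒∈ Bi
    ... | no none with span? Z B e
    ...   | no ns = ⊥-elim (none (e , ye , trans (cong (_! e) (sym eq)) (insert-new B e)))
      where
      eq : B ∪ ⁅ e ⁆ ≡ B
      eq = maxB (B ∪ ⁅ e ⁆)
        (free⇒independent (insert-≼ (⊆⇒≼ B⊆) (at D≼ e (at y≼D e ye))) (insert-free Z B e (independent⇒free (B⊆ , indB)) ns))
        (≼⇒⊆ (≼-insert B e))
    ...   | yes (z , mz , ze , h) = ⊥-elim (t≢f (trans (⨁-single _ e single) (cong₂ _∧_ ye ze)) (orth z mz))
      where
      single : ∀ j → j ≢ e → y ! j ∧ z ! j ≡ false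
      single j j≢e = ≢true⇒false λ p → let yj , zj = ∧-true p in
        [ j≢e , (λ b → none (j , yj , b)) ]′ (h j zj)

    -- If `D` contained no nonzero cocycle, every element of `D` would be isolated by a cycle
    -- meeting `D` only there. A basis of the complement of `D` would then span everything and be a
    -- basis of `M` missing `D`.
    meets⇒cocycle : ∀ {D} → D ≼ ground M → MeetsAllBases M D → ∃ λ y → y ≼ D × Orth Z y × Inhabited y
    meets⇒cocycle {D} D≼ meets with SubP.anySubset? (λ y → ≼? y D ×-dec orth? Z y ×-dec inhabited? y)
    ... | yes p = p
    ... | no none = ⊥-elim (avoid (maximal-free Z A ∅ˢ ∅≼ (λ z _ (i , zi) z≼ → t≢f (at z≼ i zi) (!-∅ i))))
      where
      A : Subset n
      A = ground M ─ D
      ∅≼ : ∅ˢ ≼ A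
      ∅≼ = incl (λ i p → ⊥-elim (t≢f p (!-∅ i)))
      isolate : ∀ e → D ! e ≡ true → ∃ λ z → mem Z z × ⁅ e ⁆ ≡ z ∩ D
      -- The alternative is a vector orthogonal to all traces of cycles on `D`; its restriction to
      -- `D` would be the excluded cocycle.
      isolate e De with fredholm (∩-space Z D) ⁅ e ⁆
      ... | inj₁ m = m
      ... | inj₂ (y , orth , ye) = ⊥-elim (none (y ∩ D
          , incl (λ i p → proj₂ (∧-true (trans (sym (!-∩ y D i)) p)))
          , (λ z m → trans (dot-∩ y z D) (orth (z ∩ D) (z , m , refl)))
          , e , trans (!-∩ y D e) (cong₂ _∧_ (trans (sym (dot-⁅⁆ y e)) ye) De)))
      avoid : ¬ (∃ λ B → B ≼ A × Free Z B × (∀ x → A ! x ≡ true → B ! x ≡ false → Span Z B x))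
      avoid (B , B≼A , fr , sp) = contr (meets B basis)
        where
        B≼G : B ≼ ground M
        B≼G = ≼-trans B≼A ≼-─
        spanAll : ∀ x → ground M ! x ≡ true → B ! x ≡ false → Span Z B x
        spanAll x gx Bx with D ! x in Dx
        ... | false = sp x (trans (!-─ (ground M) D x) (cong₂ _∧_ gx (cong not Dx))) Bx
        -- The isolating cycle puts `x` into the closure of the complement `A`, which is spanned by
        -- `B`.
        ... | true = let z , m , eq = isolate x Dx in span-trans Z A B x Bx sp
            (z , m , proj₁ (∧-true (trans (sym (!-∩ z D x)) (trans (cong (_! x) (sym eq)) (!-⁅⁆-same x)))) , λ i zi →
              case D ! i 𝔹.≟ true of λ where
                (yes Di) → inj₁ (!-⁅⁆⇒≡ x i (trans (cong (_! i) eq) (trans (!-∩ z D i) (cong₂ _∧_ zi Di))))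
                (no nD) → inj₂ (trans (!-─ (ground M) D i) (cong₂ _∧_ (at (supp R z m) i zi) (cong not (≢true⇒false nD)))))
        basis : Basis M B
        basis = free⇒independent B≼G fr , λ J indJ B⊆J → ≼-antisym (incl (λ x Jx → ≢false⇒true (λ Bx →
            let z , m , zx , h = spanAll x (at (⊆⇒≼ (proj₁ indJ)) x Jx) Bx
            in independent⇒free indJ z m (x , zx) (incl (λ i zi → [ (λ e → trans (cong (J !_) e) Jx) , at (⊆⇒≼ B⊆J) i ]′ (h i zi))))))
          (⊆⇒≼ B⊆J)
        contr : ¬ (∃ λ e → e ∈ D × e ∈ B)
        contr (e , eD , eB) = t≢f (proj₂ (∧-true (trans (sym (!-─ (ground M) D e)) (at B≼A e (∈⇒! eB))))) (cong not (∈⇒! eD))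

    -- Every nonzero cocycle meets all bases, and every set meeting all bases contains a nonzero
    -- cocycle; so the minimal sets of the two kinds coincide.
    dual-rep : Rep (dual M) (perp Z (ground M))
    dual-rep = record
      { supp = λ z m → proj₁ m
      ; circ⇒ = λ {D} (D⊆ , (e , eD) , meets , mini) →
          let y , y≼D , orth , inh = meets⇒cocycle (⊆⇒≼ D⊆) meets
              y≡D = mini y (proj₁ inh , !⇒∈ (proj₂ inh)) (≼⇒⊆ y≼D) (cocycle-meets ≼-refl (≼-trans y≼D (⊆⇒≼ D⊆)) orth inh)
          in (⊆⇒≼ D⊆ , subst (Orth Z) y≡D orth) , (e , ∈⇒! eD) , λ D' (D'≼ , orth') inh' D'≼D →
               mini D' (proj₁ inh' , !⇒∈ (proj₂ inh')) (≼⇒⊆ D'≼D) (cocycle-meets ≼-refl D'≼ orth' inh')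
      ; circ⇐ = λ {D} ((D≼ , orth) , (e , De) , mini) →
          ≼⇒⊆ D≼ , (e , !⇒∈ De) , cocycle-meets ≼-refl D≼ orth (e , De) , λ D' _ D'⊆D meets →
            let y , y≼D' , orth' , inh = meets⇒cocycle (≼-trans (⊆⇒≼ D'⊆D) D≼) meets
                y≡D = mini y (≼-trans (≼-trans y≼D' (⊆⇒≼ D'⊆D)) D≼ , orth') inh (≼-trans y≼D' (⊆⇒≼ D'⊆D))
            in ≼-antisym (⊆⇒≼ D'⊆D) (subst (_≼ D') y≡D y≼D')
      }

    coloop⇒ : ∀ {e} → Coloop M e → ∀ z → mem Z z → z ! e ≡ false
    coloop⇒ {e} (eG , inAll) z m =
      let y , y≼ , orth , inh = meets⇒cocycle (⁅⁆-≼ (∈⇒! eG)) (λ B b → e , SubP.x∈⁅x⁆ e , inAll B b)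
      in trans (sym (dot-⁅⁆ z e)) (trans (dot-comm z ⁅ e ⁆) (trans (cong (λ w → dot w z) (sym (≼-⁅⁆ y≼ inh))) (orth z m)))

    coloop⇐ : ∀ {e} → ground M ! e ≡ true → (∀ z → mem Z z → z ! e ≡ false) → Coloop M e
    coloop⇐ {e} eG h = !⇒∈ eG , λ B b →
      let f , fe , fB = cocycle-meets {⁅ e ⁆} ≼-refl (⁅⁆-≼ eG) (λ z m → trans (dot-comm ⁅ e ⁆ z) (trans (dot-⁅⁆ z e) (h z m))) (⁅⁆-inh e) B b
      in subst (_∈ B) (SubP.x∈⁅y⁆⇒x≡y e fe) fB

    series⇒ : ∀ {e} → InSeriesPair M e → ∃ λ f → f ≢ e × ground M ! f ≡ true × (∀ z → mem Z z → z ! e ≡ z ! f)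
    series⇒ {e} (f , f≢e , coc) =
      let (D≼ , orth) , _ = circ⇒ dual-rep coc
      in f , f≢e , at D≼ f (pair-r e f) , λ z m → xor≡f⇒≡ (trans
           (sym (trans (dot-pair f≢e ≼-refl z) (cong₂ (λ a b → (a ∧ z ! e) xor (b ∧ z ! f)) (pair-l e f) (pair-r e f)))) (orth z m))

    -- The cycle through `e` is needed for minimality: it rules out that `e` alone, or `f` alone, is
    -- a cocycle, which would make the pair too large to be a cocircuit.
    series⇐ : ∀ {e f} → f ≢ e → ground M ! e ≡ true → ground M ! f ≡ true →
      (∀ z → mem Z z → z ! e ≡ z ! f) → (∃ λ z → mem Z z × z ! e ≡ true) → InSeriesPair M e
    series⇐ {e} {f} f≢e eG fG h (z , m , ze) = f , f≢e , circ⇐ dual-rep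
      ( (incl (λ i p → [ (λ q → trans (cong (ground M !_) q) eG) , (λ q → trans (cong (ground M !_) q) fG) ]′ (pair-! i p))
        , λ w mw → trans (dot-pair f≢e ≼-refl w) (trans (cong₂ (λ a b → (a ∧ w ! e) xor (b ∧ w ! f)) (pair-l e f) (pair-r e f))
            (trans (cong (_xor w ! f) (h w mw)) (𝔹.xor-same (w ! f)))))
      , (e , pair-l e f)
      , λ D (_ , orth) (i , Di) D≼ →
          let same : D ! e ≡ D ! f
              same = xor≡f⇒≡ (trans (sym (cong₂ _xor_ (trans (cong (D ! e ∧_) ze) (𝔹.∧-identityʳ _))
                       (trans (cong (D ! f ∧_) (trans (sym (h z m)) ze)) (𝔹.∧-identityʳ _))))
                       (trans (sym (dot-pair f≢e D≼ z)) (orth z m)))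
              De : D ! e ≡ true
              De = [ (λ q → trans (cong (D !_) (sym q)) Di) , (λ q → trans same (trans (cong (D !_) (sym q)) Di)) ]′ (pair-! i (at D≼ i Di))
          in ≼-antisym D≼ (incl (λ j p → [ (λ q → trans (cong (D !_) q) De) , (λ q → trans (cong (D !_) q) (trans (sym same) De)) ]′ (pair-! j p))))

  deletion : Space n → Fin n → Space n
  deletion Z x = record
    { mem = λ z → mem Z z × z ! x ≡ false
    ; mem? = λ z → mem? Z z ×-dec (z ! x 𝔹.≟ false)
    ; mem-∅ = mem-∅ Z , !-∅ x
    ; mem-⊕ = λ {y} {z} (ym , yx) (zm , zx) → mem-⊕ Z ym zm , trans (!-⊕ y z x) (cong₂ _xor_ yx zx)
    }

  contraction : Space n → Subset n → Space n
  contraction Z T = ∩-space Z (∁ T)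

  !-minus : (S : Subset n) (x i : Fin n) → S ! i ≡ true → i ≢ x → (S ─ ⁅ x ⁆) ! i ≡ true
  !-minus S x i Si i≢x = trans (!-─ S ⁅ x ⁆ i) (cong₂ _∧_ Si (cong not (!-⁅⁆-diff i≢x)))

  delete-rep : {M : Mat n} {Z : Space n} → Rep M Z → ∀ x → Rep (delete M x) (deletion Z x)
  delete-rep {M = M} {Z} R x = record
    { supp = λ z (m , zx) → incl λ i p → !-minus (ground M) x i (at (supp R z m) i p) (λ e → t≢f p (trans (cong (z !_) e) zx))
    ; circ⇒ = λ (c , x∉) → let m , i , mini = circ⇒ R c in (m , ∉⇒! x∉) , i , λ D (Dm , _) → mini D Dm
    ; circ⇐ = λ {C} ((m , Cx) , i , mini) → circ⇐ R (m , i , λ D Dm Di D≼C → mini D (Dm , ≢true⇒false (λ p → t≢f (at D≼C x p) Cx)) Di D≼C) , !⇒∉ Cx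
    }

  -- `contractSet` minimises over traces of circuits, the space contains traces of all cycles. Below
  -- every nonzero trace of a cycle lies the nonzero trace of one circuit, by `circuit-through`, so
  -- the minimal members agree.
  contract-rep : {M : Mat n} {Z : Space n} → Rep M Z → ∀ T → Rep (contractSet M T) (contraction Z T)
  contract-rep {M = M} {Z} R T = record
    { supp = λ { w (z , m , refl) → incl λ i p → trans (!-─ (ground M) T i)
        (let zi , nT = ∧-true (trans (sym (!-∩ z (∁ T) i)) p) in cong₂ _∧_ (at (supp R z m) i zi) (trans (sym (VecP.lookup-map i not T)) nT)) }
    ; circ⇒ = λ { {D} (((e , eD) , C , c , D≡) , mini) →
        (C , proj₁ (circ⇒ R c) , trans D≡ (─≡∩∁ C T)) , (e , ∈⇒! eD) , λ { D' (z , m , refl) (i , Di) D'≼ →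
          let zi , Ti = ∧-true (trans (sym (!-∩ z (∁ T) i)) Di)
              C' , mC' , C'≼ , C'i = circuit-through Z z i m zi
              C'T≼ : C' ─ T ≼ z ∩ ∁ T
              C'T≼ = incl λ j p → let cj , tj = ∧-true (trans (sym (!-─ C' T j)) p) in
                       trans (!-∩ z (∁ T) j) (cong₂ _∧_ (at C'≼ j cj) (trans (VecP.lookup-map j not T) tj))
              eq = mini (C' ─ T) ((i , !⇒∈ (trans (!-─ C' T i) (cong₂ _∧_ C'i (trans (sym (VecP.lookup-map i not T)) Ti)))) , C' , circ⇐ R mC' , refl) (≼⇒⊆ (≼-trans C'T≼ D'≼))
          in ≼-antisym D'≼ (subst (_≼ _) eq C'T≼) } }
    ; circ⇐ = λ { ((z , m , refl) , (i , Di) , mini) →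
        let zi , Ti = ∧-true (trans (sym (!-∩ z (∁ T) i)) Di)
            C' , mC' , C'≼ , C'i = circuit-through Z z i m zi
            C'T≼ : C' ∩ ∁ T ≼ z ∩ ∁ T
            C'T≼ = incl λ j p → let cj , tj = ∧-true (trans (sym (!-∩ C' (∁ T) j)) p) in
                     trans (!-∩ z (∁ T) j) (cong₂ _∧_ (at C'≼ j cj) tj)
            eq = mini (C' ∩ ∁ T) (C' , proj₁ mC' , refl) (i , trans (!-∩ C' (∁ T) i) (cong₂ _∧_ C'i Ti)) C'T≼
        in ((i , !⇒∈ Di) , C' , circ⇐ R mC' , trans (sym eq) (sym (─≡∩∁ C' T)))
           , λ { D' ((j , jD') , C'' , c'' , refl) D'⊆ → mini (C'' ─ T) (C'' , proj₁ (circ⇒ R c'') , ─≡∩∁ C'' T) (j , ∈⇒! jD') (⊆⇒≼ D'⊆) } }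
    }

open Duality

-- Isomorphisms and series minors in terms of spaces.

module SeriesMinors where

  open import Relation.Binary.Construct.Closure.ReflexiveTransitive using (Star; ε; _◅_)

  private variable
    n k : ℕ

  anyFin-elim : ∀ {s} (f : Fin s → Bool) → anyFin f ≡ true → ∃ λ i → f i ≡ true
  anyFin-elim {suc s} f p with f zero in eq
  ... | true = zero , eq
  ... | false = let i , q = anyFin-elim (f ∘ suc) p in suc i , q

  anyFin-intro : ∀ {s} (f : Fin s → Bool) i → f i ≡ true → anyFin f ≡ true
  anyFin-intro f zero p = cong (_∨ anyFin (f ∘ suc)) p
  anyFin-intro f (suc i) p = trans (cong (f zero ∨_) (anyFin-intro (f ∘ suc) i p)) (𝔹.∨-zeroʳ (f zero))

  ⌊⌋-true : ∀ {A : Set} (d : Dec A) → ⌊ d ⌋ ≡ true → A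
  ⌊⌋-true (yes a) _ = a

  ⌊⌋-yes : ∀ {A : Set} (d : Dec A) → A → ⌊ d ⌋ ≡ true
  ⌊⌋-yes (yes _) _ = refl
  ⌊⌋-yes (no h) a = ⊥-elim (h a)

  ⌊⌋-no : ∀ {A : Set} (d : Dec A) → ¬ A → ⌊ d ⌋ ≡ false
  ⌊⌋-no (yes a) h = ⊥-elim (h a)
  ⌊⌋-no (no _) _ = refl

  img-elim : ∀ {s} (f : Fin s → Fin n) X x → img f X ! x ≡ true → ∃ λ i → f i ≡ x × X ! i ≡ true
  img-elim f X x p =
    let i , q = anyFin-elim _ (trans (sym (!-tab _ x)) p)
        a , b = ∧-true q
    in i , ⌊⌋-true (f i Fin.≟ x) b , a

  img-intro : ∀ {s} (f : Fin s → Fin n) X i → X ! i ≡ true → img f X ! f i ≡ true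
  img-intro f X i p = trans (!-tab _ (f i)) (anyFin-intro _ i (cong₂ _∧_ p (⌊⌋-yes (f i Fin.≟ f i) refl)))

  Inj : ∀ {s} → (Fin s → Fin n) → Set
  Inj f = ∀ i j → f i ≡ f j → i ≡ j

  img-! : ∀ {s} (f : Fin s → Fin n) → Inj f → ∀ X i → img f X ! f i ≡ X ! i
  img-! f inj X i = b-ext
    (λ p → let j , fj , Xj = img-elim f X (f i) p in trans (cong (X !_) (sym (inj j i fj))) Xj)
    (img-intro f X i)

  pre : ∀ {s} → (Fin s → Fin n) → Subset n → Subset s
  pre f z = tabulate (λ i → z ! f i)

  pre-! : ∀ {s} (f : Fin s → Fin n) z i → pre f z ! i ≡ z ! f i
  pre-! f z i = !-tab _ i

  pre-img : ∀ {s} (f : Fin s → Fin n) → Inj f → ∀ X → pre f (img f X) ≡ X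
  pre-img f inj X = ext (λ i → trans (pre-! f (img f X) i) (img-! f inj X i))

  img-pre : ∀ {s} (f : Fin s → Fin n) → Inj f → ∀ z → (∀ x → z ! x ≡ true → ∃ λ i → f i ≡ x) → img f (pre f z) ≡ z
  img-pre f inj z onto = ext λ x → b-ext
    (λ p → let i , fi , q = img-elim f (pre f z) x p in trans (cong (z !_) (sym fi)) (trans (sym (pre-! f z i)) q))
    (λ p → let i , fi = onto x p in subst (λ y → img f (pre f z) ! y ≡ true) fi (img-intro f (pre f z) i (trans (pre-! f z i) (trans (cong (z !_) fi) p))))

  img-∅ : ∀ {s} (f : Fin s → Fin n) → img f ∅ˢ ≡ ∅ˢ
  img-∅ f = ¬inhabited⇒∅ (λ (x , p) → let i , _ , q = img-elim f ∅ˢ x p in t≢f q (!-∅ i))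

  img-⊕ : ∀ {s} (f : Fin s → Fin n) → Inj f → ∀ X Y → img f (X ⊕ Y) ≡ img f X ⊕ img f Y
  img-⊕ f inj X Y = ext λ x → case FinP.any? (λ i → f i Fin.≟ x) of λ where
    (yes (i , refl)) → trans (img-! f inj (X ⊕ Y) i) (trans (!-⊕ X Y i)
      (sym (trans (!-⊕ (img f X) (img f Y) (f i)) (cong₂ _xor_ (img-! f inj X i) (img-! f inj Y i)))))
    (no none) → let off : ∀ Z → img f Z ! x ≡ false
                    off Z = ≢true⇒false (λ p → let i , fi , _ = img-elim f Z x p in none (i , fi))
                in trans (off (X ⊕ Y)) (sym (trans (!-⊕ (img f X) (img f Y) x) (cong₂ _xor_ (off X) (off Y))))

  ─-! : (X Y : Subset n) → ∀ i → (X ─ Y) ! i ≡ true → X ! i ≡ true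
  ─-! X Y = at (≼-─ {X = X} {Y})

  -- Isomorphism read on all cycles rather than on circuits. Circuits are recovered as minimal
  -- nonzero members, cycles as disjoint sums of circuits.
  record SpaceIso {n k} (S : Subset n) (Z : Space n) (W : Space k) : Set where
    field
      f    : Fin k → Fin n
      inj  : Inj f
      inS  : ∀ i → S ! f i ≡ true
      onto : ∀ x → S ! x ≡ true → ∃ λ i → f i ≡ x
      to   : ∀ X → mem W X → mem Z (img f X)
      from : ∀ z → mem Z z → mem W (pre f z)

  module _ {N : Mat n} {K : Mat k} {Z : Space n} {W : Space k} (RN : Rep N Z) (RK : Rep K W) where

    iso⇒spaceIso : Iso N K → SpaceIso (ground N) Z W
    iso⇒spaceIso (f , inj , inG , onto , circs , onCirc) = record
      { f = f ; inj = inj ; inS = λ i → ∈⇒! (inG i) ; onto = λ x p → onto x (!⇒∈ p)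
      ; to = mem-induction W (λ X → mem Z (img f X)) (subst (mem Z) (sym (img-∅ f)) (mem-∅ Z))
          (λ C X mC _ m → subst (mem Z) (sym (img-⊕ f inj C X)) (mem-⊕ Z (proj₁ (circ⇒ RN (proj₁ (circs C) (circ⇐ RK mC)))) m))
      ; from = λ z m → let X , mX , z≡ = back z m in subst (mem W) (trans (sym (pre-img f inj X)) (cong (pre f) (sym z≡))) mX
      }
      where
      back : ∀ z → mem Z z → ∃ λ X → mem W X × z ≡ img f X
      back = mem-induction Z _ (∅ˢ , mem-∅ W , sym (img-∅ f))
        (λ C z mC _ (X , mX , z≡) →
          let D , C≡ = onCirc C (circ⇐ RN mC)
              mD = proj₁ (circ⇒ RK (proj₂ (circs D) (subst (circ N) C≡ (circ⇐ RN mC))))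
          in D ⊕ X , mem-⊕ W mD mX , trans (cong₂ _⊕_ C≡ z≡) (sym (img-⊕ f inj D X)))

    spaceIso⇒iso : SpaceIso (ground N) Z W → Iso N K
    spaceIso⇒iso I = f , inj , (λ i → !⇒∈ (inS i)) , (λ x p → onto x (∈⇒! p)) ,
      (λ X → (λ c → circ⇐ RN (min→ X (circ⇒ RK c))) , (λ c → circ⇐ RK (min← X (circ⇒ RN c)))) ,
      (λ C c → pre f C , sym (img-pre f inj C (inRange C (proj₁ (circ⇒ RN c)))))
      where
      open SpaceIso I
      inRange : ∀ z → mem Z z → ∀ x → z ! x ≡ true → ∃ λ i → f i ≡ x
      inRange z m x p = onto x (at (supp RN z m) x p)
      min→ : ∀ X → Min W X → Min Z (img f X)
      min→ X (m , (i , Xi) , mini) = to X m , (f i , img-intro f X i Xi) , λ D Dm (x , Dx) D≼ →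
        let j , fj = inRange D Dm x Dx
            eq = mini (pre f D) (from D Dm) (j , trans (pre-! f D j) (trans (cong (D !_) fj) Dx))
                   (incl λ l p → trans (sym (img-! f inj X l)) (at D≼ (f l) (trans (sym (pre-! f D l)) p)))
        in trans (sym (img-pre f inj D (inRange D Dm))) (cong (img f) eq)
      min← : ∀ X → Min Z (img f X) → Min W X
      min← X (m , (x , Xx) , mini) =
        subst (mem W) (pre-img f inj X) (from _ m) , (let i , _ , q = img-elim f X x Xx in i , q) ,
        λ D Dm (i , Di) D≼ → trans (sym (pre-img f inj D)) (trans (cong (pre f)
          (mini (img f D) (to D Dm) (f i , img-intro f D i Di)
            (incl λ y p → let j , fj , q = img-elim f D y p in subst (λ y → img f X ! y ≡ true) fj (img-intro f X j (at D≼ j q)))))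
          (pre-img f inj X))

  Avoids : Subset n → Subset n → Set
  Avoids D z = ∀ x → D ! x ≡ true → z ! x ≡ false

  -- `D` is deleted and all other elements outside `K` are contracted by permitted steps; the last
  -- two fields say that the cycles of `N` are exactly the traces on `K` of the cycles avoiding `D`.
  record SeriesMinorOn {n} (M : Mat n) (Z : Space n) (K D : Subset n) : Set₁ where
    field
      N       : Mat n
      steps   : SeriesMinor M N
      space   : Space n
      rep     : Rep N space
      ground≡ : ground N ≡ K
      trace   : ∀ z → mem Z z → Avoids D z → mem space (z ∩ K)
      extend  : ∀ w → mem space w → ∃ λ z → mem Z z × Avoids D z × w ≡ z ∩ K

  remove-smaller : (X Y : Subset n) (x : Fin n) → Y ! x ≡ false → X ! x ≡ true → ∣ (X ─ ⁅ x ⁆) ─ Y ∣ < ∣ X ─ Y ∣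
  remove-smaller X Y x Yx Xx = ≼∧≢⇒∣∣< {X = (X ─ ⁅ x ⁆) ─ Y} {Y = X ─ Y}
    (incl λ i p → let a , b = ∧-true (trans (sym (!-─ (X ─ ⁅ x ⁆) Y i)) p) in trans (!-─ X Y i) (cong₂ _∧_ (─-! X ⁅ x ⁆ i a) b))
    (λ e → t≢f (trans (!-─ X Y x) (cong₂ _∧_ Xx (cong not Yx))) (trans (cong (_! x) (sym e))
      (trans (!-─ (X ─ ⁅ x ⁆) Y x) (cong (_∧ not (Y ! x)) (trans (!-─ X ⁅ x ⁆ x) (trans (cong (λ b → X ! x ∧ not b) (!-⁅⁆-same x)) (𝔹.∧-zeroʳ _)))))))

  ∩-of-≼ : {X Y : Subset n} → X ≼ Y → X ∩ Y ≡ X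
  ∩-of-≼ {X = X} {Y} h = ext λ i → trans (!-∩ X Y i) (b-ext (proj₁ ∘ ∧-true) (λ p → cong₂ _∧_ p (at h i p)))

  ≼-minus : {X S : Subset n} {x : Fin n} → X ≼ S → X ! x ≡ false → X ≼ S ─ ⁅ x ⁆
  ≼-minus {X = X} {S} {x} h Xx = incl λ i p → !-minus S x i (at h i p) (λ e → t≢f p (trans (cong (X !_) e) Xx))

  not-in-minus : (X : Subset n) (x : Fin n) → (X ─ ⁅ x ⁆) ! x ≡ false
  not-in-minus X x = trans (!-─ X ⁅ x ⁆ x) (trans (cong (λ b → X ! x ∧ not b) (!-⁅⁆-same x)) (𝔹.∧-zeroʳ _))

  !-∩∁⁅⁆ : (z : Subset n) (x i : Fin n) → i ≢ x → (z ∩ ∁ ⁅ x ⁆) ! i ≡ z ! i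
  !-∩∁⁅⁆ z x i h = trans (!-∩ z (∁ ⁅ x ⁆) i) (trans (cong (z ! i ∧_) (trans (VecP.lookup-map i not ⁅ x ⁆) (cong not (!-⁅⁆-diff h)))) (𝔹.∧-identityʳ _))

  module _ {n} (K : Subset n) where

    -- An element of this kind is a coloop or in series with an element of `K`. The reference
    -- element is taken in `K` because that one is never contracted, so the property survives the
    -- contraction of other elements.
    Determined : Space n → Fin n → Set
    Determined Z x = (∀ z → mem Z z → z ! x ≡ false) ⊎ (∃ λ f → K ! f ≡ true × (∀ z → mem Z z → z ! x ≡ z ! f))

    private
      DeterminedOff : Space n → Subset n → Fin n → Set
      DeterminedOff Z D x = (∀ z → mem Z z → Avoids D z → z ! x ≡ false)
        ⊎ (∃ λ f → K ! f ≡ true × (∀ z → mem Z z → Avoids D z → z ! x ≡ z ! f))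

    contract-all : ∀ {M Z} → Rep M Z → K ≼ ground M →
      (∀ x → ground M ! x ≡ true → K ! x ≡ false → Determined Z x) → SeriesMinorOn M Z K ∅ˢ
    contract-all {M₀} {Z₀} R₀ K≼₀ = go ∣ ground M₀ ─ K ∣ R₀ K≼₀ ℕP.≤-refl
      where
      go : ∀ k {M Z} → Rep M Z → K ≼ ground M → ∣ ground M ─ K ∣ ≤ k →
        (∀ x → ground M ! x ≡ true → K ! x ≡ false → Determined Z x) → SeriesMinorOn M Z K ∅ˢ
      go k {M} {Z} R K≼ le det with FinP.any? (λ x → (ground M ! x 𝔹.≟ true) ×-dec (K ! x 𝔹.≟ false))
      ... | no none = record
        { N = M ; steps = ε ; space = Z ; rep = R
        ; ground≡ = eq
        ; trace = λ z m _ → subst (mem Z) (sym (tr z m)) m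
        ; extend = λ w m → w , m , (λ x p → ⊥-elim (t≢f p (!-∅ x))) , sym (tr w m) }
        where
        eq : ground M ≡ K
        eq = ≼-antisym (incl (λ x p → ≢false⇒true (λ q → none (x , p , q)))) K≼
        tr : ∀ z → mem Z z → z ∩ K ≡ z
        tr z m = ∩-of-≼ (subst (z ≼_) eq (supp R z m))
      ... | yes (x , xG , xK) = next k le
        where
        seriesStep : SeriesStep M (contract M x)
        -- An element that copies one of `K` may still lie in no cycle at all; it is then a coloop
        -- and in no series pair, so this is tested before `Determined` is consulted.
        seriesStep with SubP.anySubset? (λ z → mem? Z z ×-dec (z ! x 𝔹.≟ true))
        ... | no none = coloop x (coloop⇐ R xG (λ z m → ≢true⇒false (λ p → none (z , m , p))))
        ... | yes (z , m , zx) with det x xG xK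
        ...   | inj₁ h = ⊥-elim (t≢f zx (h z m))
        ...   | inj₂ (f , fK , h) = series x (!⇒∈ xG) (series⇐ R (λ e → t≢f fK (trans (cong (K !_) e) xK)) xG (at K≼ f fK) h (z , m , zx))
        det' : ∀ y → ground (contract M x) ! y ≡ true → K ! y ≡ false → Determined (contraction Z ⁅ x ⁆) y
        det' y yG yK with y Fin.≟ x
        ... | yes refl = ⊥-elim (t≢f yG (not-in-minus (ground M) x))
        ... | no y≢x with det y (─-! (ground M) ⁅ x ⁆ y yG) yK
        ...   | inj₁ h = inj₁ λ { w (z , m , refl) → trans (!-∩∁⁅⁆ z x y y≢x) (h z m) }
        ...   | inj₂ (f , fK , h) = inj₂ (f , fK , λ { w (z , m , refl) → trans (!-∩∁⁅⁆ z x y y≢x) (trans (h z m)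
                  (sym (!-∩∁⁅⁆ z x f (λ e → t≢f fK (trans (cong (K !_) e) xK))))) })
        tr : ∀ z → (z ∩ ∁ ⁅ x ⁆) ∩ K ≡ z ∩ K
        tr z = ext λ i → trans (!-∩ (z ∩ ∁ ⁅ x ⁆) K i) (trans (lem i) (sym (!-∩ z K i)))
          where
          lem : ∀ i → (z ∩ ∁ ⁅ x ⁆) ! i ∧ K ! i ≡ z ! i ∧ K ! i
          lem i with i Fin.≟ x
          ... | yes refl = trans (cong ((z ∩ ∁ ⁅ x ⁆) ! x ∧_) xK) (trans (𝔹.∧-zeroʳ _) (sym (trans (cong (z ! x ∧_) xK) (𝔹.∧-zeroʳ _))))
          ... | no ne = cong (_∧ K ! i) (!-∩∁⁅⁆ z x i ne)
        next : ∀ k → ∣ ground M ─ K ∣ ≤ k → SeriesMinorOn M Z K ∅ˢ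
        next zero le = ⊥-elim (ℕP.n≮0 (ℕP.<-≤-trans (remove-smaller (ground M) K x xK xG) le))
        next (suc k) le =
          let open SeriesMinorOn (go k (contract-rep R ⁅ x ⁆) (≼-minus K≼ xK)
                (ℕP.≤-pred (ℕP.<-≤-trans (remove-smaller (ground M) K x xK xG) le)) det')
          in record
            { N = N ; steps = seriesStep ◅ steps ; space = space ; rep = rep ; ground≡ = ground≡
            ; trace = λ z m _ → subst (mem space) (tr z) (trace _ (z , m , refl) (λ y p → ⊥-elim (t≢f p (!-∅ y))))
            ; extend = λ w m → case extend w m of λ { (w' , (z , zm , refl) , _ , w≡) →
                z , zm , (λ y p → ⊥-elim (t≢f p (!-∅ y))) , trans w≡ (tr z) } }

    -- All deletions come before all contractions: elements need to be determined only on the cycles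
    -- avoiding `D`, and after the deletions these are all the cycles.
    series-minor : ∀ {M Z} → Rep M Z → K ≼ ground M → (D : Subset n) → (∀ x → D ! x ≡ true → K ! x ≡ false) →
      (∀ x → ground M ! x ≡ true → K ! x ≡ false → D ! x ≡ false → DeterminedOff Z D x) → SeriesMinorOn M Z K D
    series-minor {M₀} R₀ K≼₀ D disj = go ∣ ground M₀ ─ ∁ D ∣ R₀ K≼₀ ℕP.≤-refl
      where
      go : ∀ k {M Z} → Rep M Z → K ≼ ground M → ∣ ground M ─ ∁ D ∣ ≤ k →
        (∀ x → ground M ! x ≡ true → K ! x ≡ false → D ! x ≡ false → DeterminedOff Z D x) → SeriesMinorOn M Z K D
      go k {M} {Z} R K≼ le det with FinP.any? (λ x → (ground M ! x 𝔹.≟ true) ×-dec (D ! x 𝔹.≟ true))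
      ... | no none = record
        { N = N ; steps = steps ; space = space ; rep = rep ; ground≡ = ground≡
        ; trace = λ z m _ → trace z m (λ x p → ⊥-elim (t≢f p (!-∅ x)))
        ; extend = λ w m → let z , zm , _ , e = extend w m in z , zm , avoid z zm , e }
        where
        avoid : ∀ z → mem Z z → Avoids D z
        avoid z m x Dx = ≢true⇒false (λ zx → none (x , at (supp R z m) x zx , Dx))
        det' : ∀ x → ground M ! x ≡ true → K ! x ≡ false → Determined Z x
        det' x xG xK = case det x xG xK (≢true⇒false (λ Dx → none (x , xG , Dx))) of λ where
          (inj₁ h) → inj₁ (λ z m → h z m (avoid z m))
          (inj₂ (f , fK , h)) → inj₂ (f , fK , λ z m → h z m (avoid z m))
        open SeriesMinorOn (contract-all R K≼ det')
      ... | yes (x , xG , xD) = next k le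
        where
        c : (∁ D) ! x ≡ false
        c = trans (VecP.lookup-map x not D) (cong not xD)
        det' : ∀ y → ground (delete M x) ! y ≡ true → K ! y ≡ false → D ! y ≡ false → DeterminedOff (deletion Z x) D y
        det' y yG yK yD = case det y (─-! (ground M) ⁅ x ⁆ y yG) yK yD of λ where
          (inj₁ h) → inj₁ (λ z m → h z (proj₁ m))
          (inj₂ (f , fK , h)) → inj₂ (f , fK , λ z m → h z (proj₁ m))
        next : ∀ k → ∣ ground M ─ ∁ D ∣ ≤ k → SeriesMinorOn M Z K D
        next zero le = ⊥-elim (ℕP.n≮0 (ℕP.<-≤-trans (remove-smaller (ground M) (∁ D) x c xG) le))
        next (suc k) le =
          let open SeriesMinorOn (go k (delete-rep R x) (≼-minus K≼ (disj x xD))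
                (ℕP.≤-pred (ℕP.<-≤-trans (remove-smaller (ground M) (∁ D) x c xG) le)) det')
          in record
            { N = N ; steps = del x (!⇒∈ xG) ◅ steps ; space = space ; rep = rep ; ground≡ = ground≡
            ; trace = λ z m av → trace z (m , av x xD) av
            ; extend = λ w m → let z , (zm , _) , av , e = extend w m in z , zm , av , e }

  -- What distinguishes series minors from arbitrary minors: a permitted contraction forgets a
  -- coordinate that is zero or a copy of another one. By `traced`, a cycle of `M` avoiding `D` can
  -- be recovered from its values on `N`, so fibres can be compared in `M` and in `N`.
  record Faithful {n} (M : Mat n) (Z : Space n) (N : Mat n) : Set₁ where
    field
      D        : Subset n
      D≼       : D ≼ ground M
      space    : Space n
      rep      : Rep N space
      lift     : ∀ w → mem space w → ∃ λ z → mem Z z × Avoids D z × (∀ x → ground N ! x ≡ true → z ! x ≡ w ! x)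
      restrict : ∀ z → mem Z z → Avoids D z → ∃ λ w → mem space w × (∀ x → ground N ! x ≡ true → z ! x ≡ w ! x)
      traced   : ∀ x → (∀ z → mem Z z → Avoids D z → z ! x ≡ false)
                     ⊎ (∃ λ g → ground N ! g ≡ true × (∀ z → mem Z z → Avoids D z → z ! x ≡ z ! g))

  series-shrinks : ∀ {n} {M N : Mat n} → SeriesMinor M N → ground N ≼ ground M
  series-shrinks ε = ≼-refl
  series-shrinks (del x _ ◅ s) = ≼-trans (series-shrinks s) ≼-─
  series-shrinks (series x _ _ ◅ s) = ≼-trans (series-shrinks s) ≼-─
  series-shrinks (coloop x _ ◅ s) = ≼-trans (series-shrinks s) ≼-─

  faithful-contract : ∀ {n} {M N : Mat n} {Z : Space n} → Rep M Z → ∀ x →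
    (∀ z → mem Z z → z ! x ≡ false) ⊎ (∃ λ f → f ≢ x × (∀ z → mem Z z → z ! x ≡ z ! f)) → ground N ≼ ground (contract M x) →
    Faithful (contract M x) (contraction Z ⁅ x ⁆) N → Faithful M Z N
  faithful-contract {n} {M} {N} {Z} R x at-x N≼ F = record
    { D = F.D ; D≼ = ≼-trans F.D≼ ≼-─ ; space = F.space ; rep = F.rep
    ; lift = λ w m → case F.lift w m of λ { (_ , (z , zm , refl) , av , h) →
        z , zm , (λ y p → trans (sym (!-∩∁⁅⁆ z x y (D≢ y p))) (av y p)) , (λ y p → trans (sym (!-∩∁⁅⁆ z x y (N≢ y p))) (h y p)) }
    ; restrict = λ z m av → let w , wm , h = F.restrict _ (z , m , refl) (av' z av)
        in w , wm , λ y p → trans (sym (!-∩∁⁅⁆ z x y (N≢ y p))) (h y p)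
    ; traced = λ y → case y Fin.≟ x of λ where
        (yes refl) → case at-x of λ where
          (inj₁ h) → inj₁ (λ z m _ → h z m)
          -- The series partner `f` of `x` may itself be contracted later, so the trace of `f` has
          -- to be followed further.
          (inj₂ (f , f≢x , h)) → transfer x f f≢x h (F.traced f)
        (no y≢x) → transfer y y y≢x (λ z m → refl) (F.traced y) }
    where
    module F = Faithful F
    D≢ : ∀ y → F.D ! y ≡ true → y ≢ x
    D≢ y p refl = t≢f (at F.D≼ x p) (not-in-minus (ground M) x)
    N≢ : ∀ y → ground N ! y ≡ true → y ≢ x
    N≢ y p refl = t≢f (at N≼ x p) (not-in-minus (ground M) x)
    av' : ∀ z → Avoids F.D z → Avoids F.D (z ∩ ∁ ⁅ x ⁆)
    av' z av y p = trans (!-∩∁⁅⁆ z x y (D≢ y p)) (av y p)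
    Traced : Space n → Fin n → Set
    Traced Y y = (∀ z → mem Y z → Avoids F.D z → z ! y ≡ false)
      ⊎ (∃ λ g → ground N ! g ≡ true × (∀ z → mem Y z → Avoids F.D z → z ! y ≡ z ! g))
    transfer : ∀ y f → f ≢ x → (∀ z → mem Z z → z ! y ≡ z ! f) → Traced (contraction Z ⁅ x ⁆) f → Traced Z y
    transfer y f f≢x h (inj₁ g) = inj₁ λ z m av → trans (h z m) (trans (sym (!-∩∁⁅⁆ z x f f≢x)) (g _ (z , m , refl) (av' z av)))
    transfer y f f≢x h (inj₂ (g , gN , e)) = inj₂ (g , gN , λ z m av →
      trans (h z m) (trans (sym (!-∩∁⁅⁆ z x f f≢x)) (trans (e _ (z , m , refl) (av' z av)) (!-∩∁⁅⁆ z x g (N≢ g gN)))))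

  faithful : ∀ {n} {M N : Mat n} {Z} → Rep M Z → SeriesMinor M N → Faithful M Z N
  faithful {M = M} {Z = Z} R ε = record
    { D = ∅ˢ ; D≼ = incl (λ i p → ⊥-elim (t≢f p (!-∅ i))) ; space = Z ; rep = R
    ; lift = λ w m → w , m , (λ x p → ⊥-elim (t≢f p (!-∅ x))) , λ _ _ → refl
    ; restrict = λ z m _ → z , m , λ _ _ → refl
    ; traced = λ x → case ground M ! x 𝔹.≟ true of λ where
        (yes p) → inj₂ (x , p , λ _ _ _ → refl)
        (no np) → inj₁ (λ z m _ → ≢true⇒false (λ zx → np (at (supp R z m) x zx))) }
  faithful {M = M} {N} {Z} R (del x xG ◅ steps) =
    let open Faithful (faithful (delete-rep R x) steps) in record
    { D = D ∪ ⁅ x ⁆ ; D≼ = insert-≼ (≼-trans D≼ ≼-─) (∈⇒! xG) ; space = space ; rep = rep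
    ; lift = λ w m → let z , (zm , zx) , av , h = lift w m in z , zm
        , (λ y p → [ av y , (λ q → trans (cong (z !_) (!-⁅⁆⇒≡ x y q)) zx) ]′ (∨-true (trans (sym (!-∪ D ⁅ x ⁆ y)) p))) , h
    ; restrict = λ z m av → restrict z (m , av x (insert-new D x)) (λ y p → av y (at (≼-insert D x) y p))
    ; traced = λ y → case traced y of λ where
        (inj₁ h) → inj₁ (λ z m av → h z (m , av x (insert-new D x)) (λ y p → av y (at (≼-insert D x) y p)))
        (inj₂ (g , gN , h)) → inj₂ (g , gN , λ z m av → h z (m , av x (insert-new D x)) (λ y p → av y (at (≼-insert D x) y p))) }
  faithful R (series x xG s ◅ steps) =
    let f , f≢x , _ , h = series⇒ R s in
    faithful-contract R x (inj₂ (f , f≢x , h)) (series-shrinks steps) (faithful (contract-rep R ⁅ x ⁆) steps)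
  faithful R (coloop x c ◅ steps) =
    faithful-contract R x (inj₁ (coloop⇒ R c)) (series-shrinks steps) (faithful (contract-rep R ⁅ x ⁆) steps)

open SeriesMinors

-- Even edge sets and cuts of a graph.

module GraphSpaces where

  private variable
    n m v : ℕ

  Ends : ℕ → ℕ → Set
  Ends v m = Fin m → Fin v × Fin v

  eqB : Fin n → Fin n → Bool
  eqB a b = ⌊ a Fin.≟ b ⌋

  eqB-refl : (a : Fin n) → eqB a a ≡ true
  eqB-refl a = ⌊⌋-yes (a Fin.≟ a) refl

  -- Loops contribute nothing.
  inc : Ends v m → Fin v → Fin m → Bool
  inc E a i = eqB a (proj₁ (E i)) xor eqB a (proj₂ (E i))

  boundary : Ends v m → Subset m → Fin v → Bool
  boundary E z a = ⨁ (λ i → z ! i ∧ inc E a i)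

  cut : Ends v m → Subset v → Subset m
  cut E f = tabulate (λ i → f ! proj₁ (E i) xor f ! proj₂ (E i))

  cut-! : (E : Ends v m) (f : Subset v) (i : Fin m) → cut E f ! i ≡ f ! proj₁ (E i) xor f ! proj₂ (E i)
  cut-! E f i = !-tab _ i

  xor-swap : ∀ a b c d → (a xor b) xor (c xor d) ≡ (a xor c) xor (b xor d)
  xor-swap false b c d = trans (sym (𝔹.xor-assoc b c d)) (trans (cong (_xor d) (𝔹.xor-comm b c)) (𝔹.xor-assoc c b d))
  xor-swap true b c d = trans (sym (𝔹.not-distribˡ-xor b (c xor d)))
    (trans (cong not (xor-swap false b c d)) (𝔹.not-distribˡ-xor c (b xor d)))

  cut-∅ : (E : Ends v m) → cut E ∅ˢ ≡ ∅ˢ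
  cut-∅ E = ext λ i → trans (cut-! E ∅ˢ i) (trans (cong₂ _xor_ (!-∅ (proj₁ (E i))) (!-∅ (proj₂ (E i)))) (sym (!-∅ i)))

  cut-⊕ : (E : Ends v m) (f g : Subset v) → cut E (f ⊕ g) ≡ cut E f ⊕ cut E g
  cut-⊕ E f g = ext λ i → trans (cut-! E (f ⊕ g) i) (trans (cong₂ _xor_ (!-⊕ f g _) (!-⊕ f g _))
    (trans (xor-swap (f ! proj₁ (E i)) (g ! proj₁ (E i)) (f ! proj₂ (E i)) (g ! proj₂ (E i)))
      (sym (trans (!-⊕ (cut E f) (cut E g) i) (cong₂ _xor_ (cut-! E f i) (cut-! E g i))))))

  cutSpace : Ends v m → Space m
  cutSpace E = record
    { mem = λ y → ∃ λ f → y ≡ cut E f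
    ; mem? = λ y → SubP.anySubset? (λ f → y ≟ˢ cut E f)
    ; mem-∅ = ∅ˢ , sym (cut-∅ E)
    ; mem-⊕ = λ (f , p) (g , q) → f ⊕ g , trans (cong₂ _⊕_ p q) (sym (cut-⊕ E f g)) }

  boundary-⊕ : (E : Ends v m) (y z : Subset m) (a : Fin v) → boundary E (y ⊕ z) a ≡ boundary E y a xor boundary E z a
  boundary-⊕ E y z a = trans
    (⨁.sum-cong-≗ (λ i → trans (cong (_∧ inc E a i) (!-⊕ y z i)) (𝔹.∧-distribʳ-xor (inc E a i) (y ! i) (z ! i))))
    (⨁.∑-distrib-+ (λ i → y ! i ∧ inc E a i) (λ i → z ! i ∧ inc E a i))

  evenSpace : Ends v m → Space m
  evenSpace E = record
    { mem = λ z → ∀ a → boundary E z a ≡ false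
    ; mem? = λ z → FinP.all? (λ a → boundary E z a 𝔹.≟ false)
    ; mem-∅ = λ a → ⨁-false _ (λ i → cong (_∧ inc E a i) (!-∅ i))
    ; mem-⊕ = λ {y} {z} ym zm a → trans (boundary-⊕ E y z a) (cong₂ _xor_ (ym a) (zm a)) }

  ⨁-pick : (f : Fin n → Bool) (p : Fin n) → ⨁ (λ a → f a ∧ eqB a p) ≡ f p
  ⨁-pick f p = trans (⨁-single _ p (λ j j≢ → trans (cong (f j ∧_) (⌊⌋-no (j Fin.≟ p) j≢)) (𝔹.∧-zeroʳ _)))
    (trans (cong (f p ∧_) (eqB-refl p)) (𝔹.∧-identityʳ _))

  ⨁-inc : (E : Ends v m) (f : Fin v → Bool) (i : Fin m) → ⨁ (λ a → f a ∧ inc E a i) ≡ f (proj₁ (E i)) xor f (proj₂ (E i))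
  ⨁-inc E f i = trans (⨁.sum-cong-≗ (λ a → 𝔹.∧-distribˡ-xor (f a) (eqB a (proj₁ (E i))) (eqB a (proj₂ (E i)))))
    (trans (⨁.∑-distrib-+ (λ a → f a ∧ eqB a (proj₁ (E i))) (λ a → f a ∧ eqB a (proj₂ (E i))))
      (cong₂ _xor_ (⨁-pick f _) (⨁-pick f _)))

  -- Taking cuts is the transpose of taking boundaries: both sides sum over incident pairs of a
  -- vertex and an edge, in different orders.
  cut-adjoint : (E : Ends v m) (f : Subset v) (z : Subset m) → dot z (cut E f) ≡ ⨁ (λ a → f ! a ∧ boundary E z a)
  cut-adjoint E f z = trans
    (⨁.sum-cong-≗ (λ i → trans (cong (z ! i ∧_) (trans (cut-! E f i) (sym (⨁-inc E (f !_) i))))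
      (sym (⨁-∧ (z ! i) (λ a → f ! a ∧ inc E a i)))))
    (trans (⨁.∑-comm (λ i a → z ! i ∧ (f ! a ∧ inc E a i)))
      (⨁.sum-cong-≗ (λ a → trans (⨁.sum-cong-≗ (λ i → ∧-rotate (z ! i) (f ! a) (inc E a i))) (⨁-∧ (f ! a) (λ i → z ! i ∧ inc E a i)))))

  orth-cuts⇒even : (E : Ends v m) (z : Subset m) → (∀ f → dot z (cut E f) ≡ false) → mem (evenSpace E) z
  orth-cuts⇒even E z h a = trans (sym (trans
    (⨁-single (λ b → ⁅ a ⁆ ! b ∧ boundary E z b) a (λ b b≢ → cong (_∧ boundary E z b) (!-⁅⁆-diff b≢)))
    (cong (_∧ boundary E z a) (!-⁅⁆-same a))))
    (trans (sym (cut-adjoint E ⁅ a ⁆ z)) (h ⁅ a ⁆))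

  even-orth-cut : (E : Ends v m) (f : Subset v) (z : Subset m) → mem (evenSpace E) z → dot z (cut E f) ≡ false
  even-orth-cut E f z mz = trans (cut-adjoint E f z) (⨁-false _ (λ a → trans (cong (f ! a ∧_) (mz a)) (𝔹.∧-zeroʳ _)))

  -- By `fredholm` a vector that is no cut is separated from all cuts by some `w`. Being orthogonal
  -- to the cuts, `w` is even, and this contradicts the hypothesis.
  orth-even⇒cut : (E : Ends v m) (y : Subset m) → Orth (evenSpace E) y → mem (cutSpace E) y
  orth-even⇒cut E y orth with fredholm (cutSpace E) y
  ... | inj₁ c = c
  ... | inj₂ (w , w⊥ , wy) = ⊥-elim (t≢f wy (trans (dot-comm w y)
      (orth w (orth-cuts⇒even E w (λ f → w⊥ (cut E f) (f , refl))))))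

  cut⇒orth-even : (E : Ends v m) (y : Subset m) → mem (cutSpace E) y → Orth (evenSpace E) y
  cut⇒orth-even E _ (f , refl) z mz = trans (dot-comm (cut E f) z) (even-orth-cut E f z mz)

  odd : ℕ → Bool
  odd zero = false
  odd (suc k) = not (odd k)

  odd-∣∣ : (X : Subset n) → odd ∣ X ∣ ≡ ⨁ (X !_)
  odd-∣∣ [] = refl
  odd-∣∣ (true ∷ X) = cong not (odd-∣∣ X)
  odd-∣∣ (false ∷ X) = odd-∣∣ X

  pick : (X : Subset n) {k : ℕ} → k < ∣ X ∣ → ∃ λ i → X ! i ≡ true × k ≤ ∣ X ─ ⁅ i ⁆ ∣
  pick (true ∷ X) (s≤s le) = zero , refl , subst (λ Y → _ ≤ ∣ Y ∣) (sym (SubP.p─⊥≡p X)) le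
  pick (false ∷ X) le = let i , p , q = pick X le in suc i , p , q

  -- Translates between the degree condition of `IsGraphCycle`, stated with natural numbers, and the
  -- parity condition of `evenSpace`.
  ∣∣≡0⊎2 : (X : Subset n) → ⨁ (X !_) ≡ false →
    (∀ i j k → X ! i ≡ true → X ! j ≡ true → X ! k ≡ true → i ≢ j → i ≢ k → j ≢ k → ⊥) → ∣ X ∣ ≡ 0 ⊎ ∣ X ∣ ≡ 2
  ∣∣≡0⊎2 X even no3 = go ∣ X ∣ refl
    where
    go : ∀ c → ∣ X ∣ ≡ c → ∣ X ∣ ≡ 0 ⊎ ∣ X ∣ ≡ 2
    go 0 e = inj₁ e
    go 1 e = ⊥-elim (t≢f (trans (sym (odd-∣∣ X)) (cong odd e)) even)
    go 2 e = inj₂ e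
    go (suc (suc (suc c))) e =
      let i , Xi , le1 = pick X {suc (suc c)} (subst (suc (suc (suc c)) ≤_) (sym e) ℕP.≤-refl)
          j , Xj , le2 = pick (X ─ ⁅ i ⁆) {suc c} le1
          k , Xk , _ = pick ((X ─ ⁅ i ⁆) ─ ⁅ j ⁆) {c} le2
          Xk' = ─-! (X ─ ⁅ i ⁆) ⁅ j ⁆ k Xk
          off : ∀ (Y : Subset _) a b → (Y ─ ⁅ a ⁆) ! b ≡ true → a ≢ b
          off Y a b p e = t≢f p (subst (λ c → (Y ─ ⁅ a ⁆) ! c ≡ false) e (not-in-minus Y a))
      in ⊥-elim (no3 i j k Xi (─-! X ⁅ i ⁆ j Xj) (─-! X ⁅ i ⁆ k Xk') (off X i j Xj) (off X i k Xk') (off (X ─ ⁅ i ⁆) j k Xk))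

  module _ {v m : ℕ} (G : Graph v m) where

    reach-trans : ∀ {S a b c} → Reach G S a b → Reach G S b c → Reach G S a c
    reach-trans here r = r
    reach-trans (step i p q s r) r' = step i p q s (reach-trans r r')

    ReachClosure : Subset m → Fin v → Subset v → Set
    ReachClosure S a W = W ! a ≡ true × (∀ b → W ! b ≡ true → Reach G S a b)
      × (∀ i → S ! i ≡ true → W ! proj₁ (ends G i) ≡ W ! proj₂ (ends G i))

    -- The component of `a` is grown along crossing edges. Every step adds a vertex, so `v` steps
    -- are enough.
    reachClosure : ∀ S a → ∃ (ReachClosure S a)
    reachClosure S a = go v ⁅ a ⁆ (ℕP.m≤n+m v _) (!-⁅⁆-same a) (λ b p → subst (Reach G S a) (sym (!-⁅⁆⇒≡ a b p)) here)
      where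
      go : ∀ k W → v ≤ ∣ W ∣ + k → W ! a ≡ true → (∀ b → W ! b ≡ true → Reach G S a b) → ∃ (ReachClosure S a)
      grow : ∀ k W → v ≤ ∣ W ∣ + k → W ! a ≡ true → (∀ b → W ! b ≡ true → Reach G S a b) →
        ∀ b c i → W ! b ≡ true → W ! c ≡ false → S ! i ≡ true → Incident G b i → Incident G c i → ∃ (ReachClosure S a)
      go k W le Wa r with FinP.any? (λ i → (S ! i 𝔹.≟ true) ×-dec ¬? (W ! proj₁ (ends G i) 𝔹.≟ W ! proj₂ (ends G i)))
      ... | no none = W , Wa , r , λ i Si → decidable-stable (_ 𝔹.≟ _) (λ ne → none (i , Si , ne))
      ... | yes (i , Si , ne) with W ! proj₁ (ends G i) in eq1 | W ! proj₂ (ends G i) in eq2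
      ...   | true | true = ⊥-elim (ne refl)
      ...   | false | false = ⊥-elim (ne refl)
      ...   | true | false = grow k W le Wa r _ _ i eq1 eq2 Si (inj₁ refl) (inj₂ refl)
      ...   | false | true = grow k W le Wa r _ _ i eq2 eq1 Si (inj₂ refl) (inj₁ refl)
      grow zero W le Wa r b c i Wb Wc Si bi ci = ⊥-elim (ℕP.<⇒≱
        (ℕP.<-≤-trans (≼∧≢⇒∣∣< {X = W} {Y = fullˢ} (incl λ j _ → !-full j) (λ e → t≢f (trans (cong (_! c) e) (!-full c)) Wc)) (ℕP.≤-reflexive (SubP.∣⊤∣≡n v)))
        (subst (v ≤_) (ℕP.+-identityʳ _) le))
      grow (suc k) W le Wa r b c i Wb Wc Si bi ci = go k (W ∪ ⁅ c ⁆)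
        (ℕP.≤-trans (subst (v ≤_) (ℕP.+-suc ∣ W ∣ k) le) (ℕP.+-monoˡ-≤ k
          (≼∧≢⇒∣∣< (≼-insert W c) (λ e → t≢f (insert-new W c) (trans (cong (_! c) (sym e)) Wc)))))
        (at (≼-insert W c) a Wa)
        (λ d p → case ∨-true (trans (sym (!-∪ W ⁅ c ⁆ d)) p) of λ where
          (inj₁ q) → r d q
          (inj₂ q) → subst (Reach G S a) (sym (!-⁅⁆⇒≡ c d q)) (reach-trans (r b Wb) (step i (!⇒∈ Si) bi ci here)))

  module _ {v m : ℕ} (G : Graph v m) (loopless : ∀ i → proj₁ (ends G i) ≢ proj₂ (ends G i)) where

    private
      E : Ends v m
      E = ends G
      p₁ p₂ : Fin m → Fin v
      p₁ i = proj₁ (ends G i)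
      p₂ i = proj₂ (ends G i)

    incB≡inc : ∀ a i → incB G a i ≡ inc E a i
    incB≡inc a i with a Fin.≟ p₁ i | a Fin.≟ p₂ i
    ... | yes refl | yes e = ⊥-elim (loopless i e)
    ... | yes _ | no _ = refl
    ... | no _ | yes _ = refl
    ... | no _ | no _ = refl

    incident⇒inc : ∀ {a i} → Incident G a i → inc E a i ≡ true
    incident⇒inc {a} {i} (inj₁ refl) = trans (sym (incB≡inc a i)) (cong (_∨ eqB a (p₂ i)) (eqB-refl a))
    incident⇒inc {a} {i} (inj₂ refl) = trans (sym (incB≡inc a i)) (trans (cong (eqB a (p₁ i) ∨_) (eqB-refl a)) (𝔹.∨-zeroʳ _))

    inc⇒incident : ∀ {a i} → inc E a i ≡ true → Incident G a i
    inc⇒incident {a} {i} h with a Fin.≟ p₁ i | a Fin.≟ p₂ i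
    ... | yes e | _ = inj₁ e
    ... | no _ | yes e = inj₂ e

    starIn : Subset m → Fin v → Subset m
    starIn C a = tabulate (λ i → lookup C i ∧ incB G a i)

    starIn-! : ∀ C a i → starIn C a ! i ≡ C ! i ∧ inc E a i
    starIn-! C a i = trans (!-tab _ i) (cong (C ! i ∧_) (incB≡inc a i))

    ⨁-starIn : ∀ C a → ⨁ (starIn C a !_) ≡ boundary E C a
    ⨁-starIn C a = ⨁.sum-cong-≗ (starIn-! C a)

    -- At a vertex met by the subcycle `D` its degree is positive, even and at most two, so `D`
    -- contains all edges of `C` there. Connectedness of `C` carries this to every edge.
    graphCycle⇒min : ∀ {C} → IsGraphCycle G C → Min (evenSpace E) C
    graphCycle⇒min {C} ((e₀ , e₀∈) , deg , conn) = even , (e₀ , ∈⇒! e₀∈) , λ D Dm Di D≼ →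
        ≼-antisym D≼ (incl (λ j Cj → spread D Dm Di D≼ j Cj))
      where
      even : ∀ a → boundary E C a ≡ false
      even a = trans (sym (⨁-starIn C a)) (trans (sym (odd-∣∣ (starIn C a))) ([ cong odd , cong odd ]′ (deg a)))
      module _ (D : Subset m) (Dm : mem (evenSpace E) D) (Di : Inhabited D) (D≼ : D ≼ C) where
        Touches : Fin v → Set
        Touches a = ∃ λ i → D ! i ≡ true × Incident G a i
        star≼ : ∀ a → starIn D a ≼ starIn C a
        star≼ a = incl λ i p → let d , x = ∧-true (trans (sym (starIn-! D a i)) p) in trans (starIn-! C a i) (cong₂ _∧_ (at D≼ i d) x)
        all-in : ∀ a → Touches a → ∀ j → C ! j ≡ true → Incident G a j → D ! j ≡ true
        all-in a (i , Dai , ai) j Cj aj with (starIn D a) ≟ˢ (starIn C a)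
        ... | yes eq = proj₁ (∧-true (trans (sym (starIn-! D a j)) (trans (cong (_! j) eq) (trans (starIn-! C a j) (cong₂ _∧_ Cj (incident⇒inc aj))))))
        ... | no ne = ⊥-elim (contr (deg a) ∣ starIn D a ∣ refl)
          where
          lt : ∣ starIn D a ∣ < ∣ starIn C a ∣
          lt = ≼∧≢⇒∣∣< (star≼ a) ne
          in-star : starIn D a ! i ≡ true
          in-star = trans (starIn-! D a i) (cong₂ _∧_ Dai (incident⇒inc ai))
          parity : odd ∣ starIn D a ∣ ≡ false
          parity = trans (odd-∣∣ (starIn D a)) (trans (⨁-starIn D a) (Dm a))
          contr : degIn G C a ≡ 0 ⊎ degIn G C a ≡ 2 → ∀ c → ∣ starIn D a ∣ ≡ c → ⊥
          contr (inj₁ z) c e = ℕP.n≮0 (subst (∣ starIn D a ∣ <_) z lt)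
          contr (inj₂ t) 0 e = ℕP.n≮0 (subst (∣ starIn D a ─ ⁅ i ⁆ ∣ <_) e (SubP.x∈p⇒∣p-x∣<∣p∣ {x = i} {p = starIn D a} (!⇒∈ in-star)))
          contr (inj₂ t) 1 e = t≢f {odd 1} refl (trans (sym (cong odd e)) parity)
          contr (inj₂ t) (suc (suc c)) e = ℕP.<⇒≱ (subst₂ _<_ e t lt) (ℕ.s≤s (ℕ.s≤s ℕ.z≤n))
        along : ∀ {a b} → Reach G C a b → Touches a → Touches b
        along here t = t
        along (step i i∈ ai ci r) t = along r (i , all-in _ t i (∈⇒! i∈) ai , ci)
        spread : ∀ j → C ! j ≡ true → D ! j ≡ true
        spread j Cj = let i , di = Di in
          all-in (p₁ j) (along (conn (p₁ i) (p₁ j) i j (!⇒∈ (at D≼ i di)) (!⇒∈ Cj) (inj₁ refl) (inj₁ refl)) (i , di , inj₁ refl)) j Cj (inj₁ refl)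

    -- A vector orthogonal to the traces of all cuts on `C` restricts to an even subset of `C`,
    -- which by minimality is empty or all of `C`. In both cases it takes the same value at `i` and
    -- `j`, so `fredholm` must return the cut.
    separating-cut : ∀ {C} → Min (evenSpace E) C → ∀ i j → C ! i ≡ true → C ! j ≡ true →
      ∃ λ f → (⁅ i ⁆ ⊕ ⁅ j ⁆) ≡ cut E f ∩ C
    separating-cut {C} (Cm , _ , mini) i j Ci Cj with fredholm (∩-space (cutSpace E) C) (⁅ i ⁆ ⊕ ⁅ j ⁆)
    ... | inj₁ (_ , (f , refl) , eq) = f , eq
    ... | inj₂ (y , orth , yij) = ⊥-elim (t≢f (trans (sym (cong₂ _xor_ (dot-⁅⁆ y i) (dot-⁅⁆ y j))) (trans (sym (dot-⊕ʳ y ⁅ i ⁆ ⁅ j ⁆)) yij)) same)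
      where
      even : mem (evenSpace E) (y ∩ C)
      even = orth-cuts⇒even E (y ∩ C) (λ f → trans (dot-∩ y (cut E f) C) (orth (cut E f ∩ C) (cut E f , (f , refl) , refl)))
      val : ∀ l → C ! l ≡ true → y ! l ≡ (y ∩ C) ! l
      val l Cl = sym (trans (!-∩ y C l) (trans (cong (y ! l ∧_) Cl) (𝔹.∧-identityʳ _)))
      same : y ! i xor y ! j ≡ false
      same with inhabited? (y ∩ C)
      ... | no none = cong₂ _xor_ (trans (val i Ci) (≢true⇒false (λ p → none (i , p)))) (trans (val j Cj) (≢true⇒false (λ p → none (j , p))))
      ... | yes inh = cong₂ _xor_ (trans (val i Ci) (trans (cong (_! i) eq) Ci)) (trans (val j Cj) (trans (cong (_! j) eq) Cj))
        where
        eq : y ∩ C ≡ C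
        eq = mini (y ∩ C) even inh (incl (λ l p → proj₂ (∧-true (trans (sym (!-∩ y C l)) p))))

    -- If three edges i, j, k of C met at a, a cut meeting C in exactly {i, j} would split off a smaller even set.
    min⇒degree≤2 : ∀ {C} → Min (evenSpace E) C → ∀ a i j k → C ! i ≡ true → C ! j ≡ true → C ! k ≡ true →
      Incident G a i → Incident G a j → Incident G a k → i ≢ j → i ≢ k → j ≢ k → ⊥
    min⇒degree≤2 {C} minC@(Cm , _ , mini) a i j k Ci Cj Ck ai aj ak i≢j i≢k j≢k = t≢f kij ¬kij
      where
      f : Subset v
      f = proj₁ (separating-cut minC i j Ci Cj)
      g : Fin v → Bool
      g x = f ! x xor f ! a
      ga : g a ≡ false
      ga = 𝔹.xor-same (f ! a)
      cutg : ∀ e → C ! e ≡ true → (⁅ i ⁆ ⊕ ⁅ j ⁆) ! e ≡ g (p₁ e) xor g (p₂ e)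
      cutg e Ce = trans (cong (_! e) (proj₂ (separating-cut minC i j Ci Cj))) (trans (!-∩ (cut E f) C e)
        (trans (cong (cut E f ! e ∧_) Ce) (trans (𝔹.∧-identityʳ _) (trans (cut-! E f e)
          (sym (trans (xor-swap (f ! p₁ e) (f ! a) (f ! p₂ e) (f ! a)) (trans (cong ((f ! p₁ e xor f ! p₂ e) xor_) (𝔹.xor-same (f ! a))) (𝔹.xor-identityʳ _))))))))
      -- The edges of `C` with an end on the side of the cut away from `a`. It contains `i` and `j`,
      -- but not `k`, which stays on the side of `a`.
      C' : Subset m
      C' = tabulate (λ e → C ! e ∧ (g (p₁ e) ∨ g (p₂ e)))
      C'-! : ∀ e → C' ! e ≡ C ! e ∧ (g (p₁ e) ∨ g (p₂ e))
      C'-! e = !-tab _ e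
      touching : ∀ e → C ! e ≡ true → Incident G a e → g (p₁ e) ∨ g (p₂ e) ≡ g (p₁ e) xor g (p₂ e)
      touching e _ (inj₁ refl) = trans (cong (λ b → b ∨ g (p₂ e)) ga) (cong (λ b → b xor g (p₂ e)) (sym ga))
      touching e _ (inj₂ refl) = trans (cong (g (p₁ e) ∨_) ga) (trans (𝔹.∨-identityʳ _) (sym (trans (cong (g (p₁ e) xor_) ga) (𝔹.xor-identityʳ _))))
      i∈ : (⁅ i ⁆ ⊕ ⁅ j ⁆) ! i ≡ true
      i∈ = trans (!-⊕ ⁅ i ⁆ ⁅ j ⁆ i) (cong₂ _xor_ (!-⁅⁆-same i) (!-⁅⁆-diff i≢j))
      j∈ : (⁅ i ⁆ ⊕ ⁅ j ⁆) ! j ≡ true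
      j∈ = trans (!-⊕ ⁅ i ⁆ ⁅ j ⁆ j) (cong₂ _xor_ (!-⁅⁆-diff (i≢j ∘ sym)) (!-⁅⁆-same j))
      ¬kij : (⁅ i ⁆ ⊕ ⁅ j ⁆) ! k ≡ false
      ¬kij = trans (!-⊕ ⁅ i ⁆ ⁅ j ⁆ k) (cong₂ _xor_ (!-⁅⁆-diff (i≢k ∘ sym)) (!-⁅⁆-diff (j≢k ∘ sym)))
      -- away from the far side, i and j look alike: both are seen exactly at a
      inc-at : ∀ b e → g b ≡ false → C ! e ≡ true → (⁅ i ⁆ ⊕ ⁅ j ⁆) ! e ≡ true → Incident G a e → inc E b e ≡ eqB b a
      inc-at b e gb Ce ije (inj₁ refl) = trans (cong (eqB b (p₁ e) xor_) (⌊⌋-no (b Fin.≟ p₂ e) (λ { refl → t≢f (trans (sym (cutg e Ce)) ije) (cong₂ _xor_ ga gb) }))) (𝔹.xor-identityʳ _)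
      inc-at b e gb Ce ije (inj₂ refl) = cong (_xor eqB b (p₂ e)) (⌊⌋-no (b Fin.≟ p₁ e) (λ { refl → t≢f (trans (sym (cutg e Ce)) ije) (cong₂ _xor_ gb ga) }))
      even : mem (evenSpace E) C'
      even b with g b in gb
      ... | true = trans (⨁.sum-cong-≗ (λ e → lem e)) (Cm b)
        where
        lem : ∀ e → C' ! e ∧ inc E b e ≡ C ! e ∧ inc E b e
        lem e with inc E b e in ib
        ... | false = trans (𝔹.∧-zeroʳ _) (sym (𝔹.∧-zeroʳ _))
        ... | true = cong (_∧ true) (trans (C'-! e) (trans (cong (C ! e ∧_) (on (inc⇒incident ib))) (𝔹.∧-identityʳ _)))
          where
          on : Incident G b e → g (p₁ e) ∨ g (p₂ e) ≡ true
          on (inj₁ refl) = cong (_∨ g (p₂ e)) gb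
          on (inj₂ refl) = trans (cong (g (p₁ e) ∨_) gb) (𝔹.∨-zeroʳ _)
      ... | false = trans (⨁.sum-cong-≗ (λ e → lem e)) (trans (⨁-two _ i j i≢j
              (λ e e≢i e≢j → cong (_∧ inc E b e) (trans (!-⊕ ⁅ i ⁆ ⁅ j ⁆ e) (cong₂ _xor_ (!-⁅⁆-diff e≢i) (!-⁅⁆-diff e≢j)))))
            (trans (cong₂ _xor_ (cong₂ _∧_ i∈ (inc-at b i gb Ci i∈ ai)) (cong₂ _∧_ j∈ (inc-at b j gb Cj j∈ aj))) (𝔹.xor-same (eqB b a))))
        where
        lem : ∀ e → C' ! e ∧ inc E b e ≡ (⁅ i ⁆ ⊕ ⁅ j ⁆) ! e ∧ inc E b e
        lem e with inc E b e in ib | C ! e in Ce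
        ... | false | _ = trans (𝔹.∧-zeroʳ _) (sym (𝔹.∧-zeroʳ _))
        ... | true | false = cong (_∧ true) (trans (C'-! e) (trans (cong (_∧ (g (p₁ e) ∨ g (p₂ e))) Ce) (sym (trans
                (cong (_! e) (proj₂ (separating-cut minC i j Ci Cj))) (trans (!-∩ (cut E f) C e) (trans (cong (cut E f ! e ∧_) Ce) (𝔹.∧-zeroʳ _)))))))
        ... | true | true = cong (_∧ true) (trans (C'-! e) (trans (cong (_∧ (g (p₁ e) ∨ g (p₂ e))) Ce) (trans (on (inc⇒incident ib)) (sym (cutg e Ce)))))
          where
          on : Incident G b e → g (p₁ e) ∨ g (p₂ e) ≡ g (p₁ e) xor g (p₂ e)
          on (inj₁ refl) = trans (cong (_∨ g (p₂ e)) gb) (sym (cong (_xor g (p₂ e)) gb))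
          on (inj₂ refl) = trans (cong (g (p₁ e) ∨_) gb) (trans (𝔹.∨-identityʳ _) (sym (trans (cong (g (p₁ e) xor_) gb) (𝔹.xor-identityʳ _))))
      C'≡C : C' ≡ C
      C'≡C = mini C' even (i , trans (C'-! i) (cong₂ _∧_ Ci (trans (touching i Ci ai) (trans (sym (cutg i Ci)) i∈))))
        (incl λ e p → proj₁ (∧-true (trans (sym (C'-! e)) p)))
      kij : (⁅ i ⁆ ⊕ ⁅ j ⁆) ! k ≡ true
      kij = trans (cutg k Ck) (trans (sym (touching k Ck ak)) (proj₂ (∧-true (trans (sym (C'-! k)) (trans (cong (_! k) C'≡C) Ck)))))

    -- The edges of `C` inside the component of `a` form an even set, which by minimality is all of
    -- `C`.
    min⇒connected : ∀ {C} → Min (evenSpace E) C → ∀ a b i j → C ! i ≡ true → C ! j ≡ true → Incident G a i → Incident G b j → Reach G C a b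
    min⇒connected {C} (Cm , _ , mini) a b i j Ci Cj ai bj = reach b (W-end bj (proj₂ (∧-true (trans (sym (C'-! j)) (trans (cong (_! j) C'≡C) Cj)))) Cj)
      where
      W = proj₁ (reachClosure G C a)
      Wa = proj₁ (proj₂ (reachClosure G C a))
      reach = proj₁ (proj₂ (proj₂ (reachClosure G C a)))
      closed = proj₂ (proj₂ (proj₂ (reachClosure G C a)))
      C' : Subset m
      C' = tabulate (λ e → C ! e ∧ W ! p₁ e)
      C'-! : ∀ e → C' ! e ≡ C ! e ∧ W ! p₁ e
      C'-! e = !-tab _ e
      W-end : ∀ {b e} → Incident G b e → W ! p₁ e ≡ true → C ! e ≡ true → W ! b ≡ true
      W-end (inj₁ refl) w _ = w
      W-end {e = e} (inj₂ refl) w Ce = trans (sym (closed e Ce)) w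
      W-end' : ∀ {b e} → Incident G b e → W ! b ≡ true → C ! e ≡ true → W ! p₁ e ≡ true
      W-end' (inj₁ refl) w _ = w
      W-end' {e = e} (inj₂ refl) w Ce = trans (closed e Ce) w
      even : mem (evenSpace E) C'
      even c with W ! c in Wc
      ... | true = trans (⨁.sum-cong-≗ lem) (Cm c)
        where
        lem : ∀ e → C' ! e ∧ inc E c e ≡ C ! e ∧ inc E c e
        lem e with inc E c e in ic | C ! e in Ce
        ... | false | _ = trans (𝔹.∧-zeroʳ _) (sym (𝔹.∧-zeroʳ _))
        ... | true | false = cong (_∧ true) (trans (C'-! e) (cong (_∧ W ! p₁ e) Ce))
        ... | true | true = cong (_∧ true) (trans (C'-! e) (cong₂ _∧_ Ce (W-end' (inc⇒incident ic) Wc Ce)))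
      ... | false = ⨁-false _ λ e → ≢true⇒false λ p →
        let x , y = ∧-true p ; Ce , w = ∧-true (trans (sym (C'-! e)) x) in t≢f (W-end (inc⇒incident y) w Ce) Wc
      C'≡C : C' ≡ C
      C'≡C = mini C' even (i , trans (C'-! i) (cong₂ _∧_ Ci (W-end' ai Wa Ci))) (incl λ e p → proj₁ (∧-true (trans (sym (C'-! e)) p)))

    cycM-rep : Rep (cycM G) (evenSpace (ends G))
    cycM-rep = record
      { supp = λ z _ → incl (λ i _ → !-full i)
      ; circ⇒ = graphCycle⇒min
      ; circ⇐ = λ {C} minC@(Cm , (e , Ce) , _) → (e , !⇒∈ Ce)
          , (λ a → ∣∣≡0⊎2 (starIn C a) (trans (⨁-starIn C a) (Cm a)) λ i j k pi pj pk →
              let Ci , ai = ∧-true (trans (sym (starIn-! C a i)) pi)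
                  Cj , aj = ∧-true (trans (sym (starIn-! C a j)) pj)
                  Ck , ak = ∧-true (trans (sym (starIn-! C a k)) pk)
              in min⇒degree≤2 minC a i j k Ci Cj Ck (inc⇒incident ai) (inc⇒incident aj) (inc⇒incident ak))
          , (λ a b i j i∈ j∈ → min⇒connected minC a b i j (∈⇒! i∈) (∈⇒! j∈)) }

  rep-cong : {M : Mat n} {Z W : Space n} → (∀ z → mem Z z → mem W z) → (∀ z → mem W z → mem Z z) → Rep M Z → Rep M W
  rep-cong {Z = Z} {W} to from R = record
    { supp = λ z m → supp R z (from z m)
    ; circ⇒ = λ c → let m , i , mini = circ⇒ R c in to _ m , i , λ D Dm → mini D (from D Dm)
    ; circ⇐ = λ (m , i , mini) → circ⇐ R (from _ m , i , λ D Dm → mini D (to D Dm)) }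

  cocycM-rep : (G : Graph v m) → (∀ i → proj₁ (ends G i) ≢ proj₂ (ends G i)) → Rep (dual (cycM G)) (cutSpace (ends G))
  cocycM-rep G loopless = rep-cong
    (λ y (_ , orth) → orth-even⇒cut (ends G) y orth)
    (λ y c → incl (λ i _ → !-full i) , cut⇒orth-even (ends G) y c)
    (dual-rep (cycM-rep G loopless))

open GraphSpaces

-- Two-terminal networks and moves on matrices.

module Networks where

  import Algebra.Properties.CommutativeMonoid.Sum as CMSum

  private variable
    n m v k : ℕ

  module ∑ = CMSum ℕP.+-0-commutativeMonoid

  ∑ : (Fin k → ℕ) → ℕ
  ∑ = ∑.sum

  ∑-two : (f g : Fin k → ℕ) (p q : Fin k) → p ≢ q → (∀ r → r ≢ p → r ≢ q → f r ≡ g r) → f p + f q ≡ g p + g q → ∑ f ≡ ∑ g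
  ∑-two {suc zero} f g zero zero p≢q _ _ = ⊥-elim (p≢q refl)
  ∑-two {suc (suc k)} f g p q p≢q h e = trans (split f) (trans (cong₂ _+_ e (∑.sum-cong-≗ rest)) (sym (split g)))
    where
    q' : Fin (suc k)
    q' = punchOut p≢q
    split : ∀ f → ∑ f ≡ (f p + f q) + ∑ (λ r → f (punchIn p (punchIn q' r)))
    split f = trans (∑.sum-remove {i = p} f) (trans (cong (f p +_) (trans (∑.sum-remove {i = q'} (λ r → f (punchIn p r)))
      (cong (λ y → f y + ∑ (λ r → f (punchIn p (punchIn q' r)))) (FinP.punchIn-punchOut p≢q)))) (sym (ℕP.+-assoc (f p) (f q) _)))
    rest : ∀ r → f (punchIn p (punchIn q' r)) ≡ g (punchIn p (punchIn q' r))
    rest r = h _ (FinP.punchInᵢ≢i p _) λ eq →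
      FinP.punchInᵢ≢i q' r (FinP.punchIn-injective p _ _ (trans eq (sym (FinP.punchIn-punchOut p≢q))))

  ∑-mono-≤ : (f g : Fin k → ℕ) → (∀ i → f i ≤ g i) → ∑ f ≤ ∑ g
  ∑-mono-≤ {zero} f g h = z≤n
  ∑-mono-≤ {suc k} f g h = ℕP.+-mono-≤ (h zero) (∑-mono-≤ (f ∘ suc) (g ∘ suc) (h ∘ suc))

  ∑-mono-< : (f g : Fin k → ℕ) → (∀ i → f i ≤ g i) → ∀ p → f p < g p → ∑ f < ∑ g
  ∑-mono-< {suc k} f g h zero lt = ℕP.+-mono-<-≤ lt (∑-mono-≤ (f ∘ suc) (g ∘ suc) (h ∘ suc))
  ∑-mono-< {suc k} f g h (suc p) lt = ℕP.+-mono-≤-< (h zero) (∑-mono-< (f ∘ suc) (g ∘ suc) (h ∘ suc) p lt)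

  bit : Bool → ℕ
  bit true = 1
  bit false = 0

  -- `zero#` is an open circuit, through which no current passes, and `free#` a short circuit. They
  -- are needed as what remains of a deleted or of a contracted edge.
  data Term (m : ℕ) : Set where
    zero# free# : Term m
    leaf : Fin m → Term m
    ser par : Term m → Term m → Term m

  -- the pairs (row, value of the root element) of a two-terminal series-parallel network
  sem : Term m → Subset m → Bool → Set
  sem zero# z t = t ≡ false
  sem free# z t = ⊤
  sem (leaf e) z t = z ! e ≡ t
  sem (ser S T) z t = sem S z t × sem T z t
  sem (par S T) z t = ∃ λ s → sem S z s × sem T z (s xor t)

  leaves : Term m → Subset m
  leaves zero# = ∅ˢ
  leaves free# = ∅ˢ
  leaves (leaf e) = ⁅ e ⁆
  leaves (ser S T) = leaves S ∪ leaves T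
  leaves (par S T) = leaves S ∪ leaves T

  record Disjoint (X Y : Subset m) : Set where
    constructor disj
    field apart : ∀ x → X ! x ≡ true → Y ! x ≡ false
  open Disjoint public

  -- Every element occurs in at most one leaf, so that the two halves of a composition live on
  -- disjoint sets of columns and moves in one half do not disturb the other.
  Linear : Term m → Set
  Linear zero# = ⊤
  Linear free# = ⊤
  Linear (leaf e) = ⊤
  Linear (ser S T) = Linear S × Linear T × Disjoint (leaves S) (leaves T)
  Linear (par S T) = Linear S × Linear T × Disjoint (leaves S) (leaves T)

  Disjoint-sym : {X Y : Subset m} → Disjoint X Y → Disjoint Y X
  Disjoint-sym d = disj (λ x y → ≢true⇒false (λ p → t≢f y (apart d x p)))

  ∪-l : (X Y : Subset m) → X ≼ X ∪ Y
  ∪-l X Y = incl λ i p → trans (!-∪ X Y i) (cong (_∨ Y ! i) p)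

  ∪-r : (X Y : Subset m) → Y ≼ X ∪ Y
  ∪-r X Y = incl λ i p → trans (!-∪ X Y i) (trans (cong (X ! i ∨_) p) (𝔹.∨-zeroʳ _))

  record Agree (L y z : Subset m) : Set where
    constructor agree
    field on : ∀ x → L ! x ≡ true → y ! x ≡ z ! x
  open Agree public

  agree-≼ : {K L y z : Subset m} → K ≼ L → Agree L y z → Agree K y z
  agree-≼ h a = agree (λ x p → on a x (at h x p))

  sem-agree : (T : Term m) {y z : Subset m} {t : Bool} → Agree (leaves T) y z → sem T y t → sem T z t
  sem-agree zero# a h = h
  sem-agree free# a h = h
  sem-agree (leaf e) a h = trans (sym (on a e (!-⁅⁆-same e))) h
  sem-agree (ser S T) a (h , h') = sem-agree S (agree-≼ (∪-l (leaves S) (leaves T)) a) h , sem-agree T (agree-≼ (∪-r (leaves S) (leaves T)) a) h'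
  sem-agree (par S T) a (s , h , h') = s , sem-agree S (agree-≼ (∪-l (leaves S) (leaves T)) a) h , sem-agree T (agree-≼ (∪-r (leaves S) (leaves T)) a) h'

  sem-∅ : (T : Term m) → sem T ∅ˢ false
  sem-∅ zero# = refl
  sem-∅ free# = tt
  sem-∅ (leaf e) = !-∅ e
  sem-∅ (ser S T) = sem-∅ S , sem-∅ T
  sem-∅ (par S T) = false , sem-∅ S , sem-∅ T

  sem-⊕ : (T : Term m) {y z : Subset m} {s t : Bool} → sem T y s → sem T z t → sem T (y ⊕ z) (s xor t)
  sem-⊕ zero# refl refl = refl
  sem-⊕ free# _ _ = tt
  sem-⊕ (leaf e) {y} {z} refl refl = !-⊕ y z e
  sem-⊕ (ser S T) (a , b) (c , d) = sem-⊕ S a c , sem-⊕ T b d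
  sem-⊕ (par S T) {y} {z} {s} {t} (s' , a , b) (t' , c , d) = s' xor t' , sem-⊕ S a c ,
    subst (sem T (y ⊕ z)) (xor-swap s' s t' t) (sem-⊕ T b d)

  record Off (L w : Subset m) : Set where
    constructor off
    field isOff : ∀ x → L ! x ≡ true → w ! x ≡ false
  open Off public

  off-agree : {L w : Subset m} → Off L w → Agree L ∅ˢ w
  off-agree o = agree (λ x p → trans (!-∅ x) (sym (isOff o x p)))

  sem-off : (T : Term m) {w : Subset m} → Off (leaves T) w → sem T w false
  sem-off T o = sem-agree T (off-agree o) (sem-∅ T)

  Rows : ℕ → ℕ → Set
  Rows k m = Fin k → Subset m

  at₂ : Fin k → Fin k → Fin k → Bool
  at₂ p q r = eqB r p ∨ eqB r q

  flip₂ : Rows k m → Fin k → Fin k → Subset m → Rows k m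
  flip₂ A p q w r = if at₂ p q r then A r ⊕ w else A r

  flipB : (Fin k → Bool) → Fin k → Fin k → Fin k → Bool
  flipB τ p q r = if at₂ p q r then τ r xor true else τ r

  at₂-l : (p q : Fin k) → at₂ p q p ≡ true
  at₂-l p q = cong (_∨ eqB p q) (eqB-refl p)

  at₂-r : (p q : Fin k) → at₂ p q q ≡ true
  at₂-r p q = trans (cong (eqB q p ∨_) (eqB-refl q)) (𝔹.∨-zeroʳ _)

  at₂-off : {p q r : Fin k} → r ≢ p → r ≢ q → at₂ p q r ≡ false
  at₂-off {p = p} {q} {r} a b = cong₂ _∨_ (⌊⌋-no (r Fin.≟ p) a) (⌊⌋-no (r Fin.≟ q) b)

  -- Where `A p ⊕ A q` is set, exactly one of the two rows has an entry. Adding `w` therefore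
  -- exchanges entries between the rows, and the column sums are kept as natural numbers, not just
  -- modulo two.
  data Moves (Q : Subset m → Set) (A : Rows k m) : Rows k m → Set where
    stop : Moves Q A A
    move : ∀ p q w {B} → p ≢ q → Q w → w ≼ A p ⊕ A q → Moves Q (flip₂ A p q w) B → Moves Q A B

  moves-trans : {Q : Subset m → Set} {A B C : Rows k m} → Moves Q A B → Moves Q B C → Moves Q A C
  moves-trans stop s = s
  moves-trans (move p q w ne Qw le r) s = move p q w ne Qw le (moves-trans r s)

  moves-map : {Q Q' : Subset m → Set} {A B : Rows k m} → (∀ w → Q w → Q' w) → Moves Q A B → Moves Q' A B
  moves-map f stop = stop
  moves-map f (move p q w ne Qw le r) = move p q w ne (f w Qw) le (moves-map f r)

  col : Rows k m → Fin m → ℕ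
  col A x = ∑ (λ r → bit (A r ! x))

  flip-cell : (A : Rows k m) (p q : Fin k) (w : Subset m) (r : Fin k) (x : Fin m) →
    flip₂ A p q w r ! x ≡ A r ! x xor (at₂ p q r ∧ w ! x)
  flip-cell A p q w r x with at₂ p q r
  ... | true = !-⊕ (A r) w x
  ... | false = sym (𝔹.xor-identityʳ _)

  flip-bits : (A : Rows k m) (p q : Fin k) (w : Subset m) → p ≢ q → w ≼ A p ⊕ A q → ∀ x →
    bit (flip₂ A p q w p ! x) + bit (flip₂ A p q w q ! x) ≡ bit (A p ! x) + bit (A q ! x)
  flip-bits A p q w p≢q le x =
    trans (cong₂ (λ a b → bit a + bit b)
        (trans (flip-cell A p q w p x) (cong (λ c → A p ! x xor (c ∧ w ! x)) (at₂-l p q)))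
        (trans (flip-cell A p q w q x) (cong (λ c → A q ! x xor (c ∧ w ! x)) (at₂-r p q))))
      (lem (A p ! x) (A q ! x) (w ! x) (λ h → trans (sym (!-⊕ (A p) (A q) x)) (at le x h)))
    where
    lem : ∀ a b c → (c ≡ true → a xor b ≡ true) → bit (a xor c) + bit (b xor c) ≡ bit a + bit b
    lem a b false _ = cong₂ (λ a b → bit a + bit b) (𝔹.xor-identityʳ a) (𝔹.xor-identityʳ b)
    lem true true true h = ⊥-elim (t≢f refl (sym (h refl)))
    lem true false true h = refl
    lem false true true h = refl
    lem false false true h = ⊥-elim (t≢f refl (sym (h refl)))

  col-flip : (A : Rows k m) (p q : Fin k) (w : Subset m) → p ≢ q → w ≼ A p ⊕ A q → ∀ x → col (flip₂ A p q w) x ≡ col A x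
  col-flip A p q w p≢q le x = ∑-two (λ r → bit (flip₂ A p q w r ! x)) (λ r → bit (A r ! x)) p q p≢q
    (λ r a b → cong bit (trans (flip-cell A p q w r x) (trans (cong (λ c → A r ! x xor (c ∧ w ! x)) (at₂-off a b)) (𝔹.xor-identityʳ _))))
    (flip-bits A p q w p≢q le x)

  col-moves : {Q : Subset m → Set} {A B : Rows k m} → Moves Q A B → ∀ x → col B x ≡ col A x
  col-moves stop x = refl
  col-moves {A = A} (move p q w ne _ le r) x = trans (col-moves r x) (col-flip A p q w ne le x)

  Valid : Term m → Rows k m → (Fin k → Bool) → Set
  Valid T A τ = ∀ r → sem T (A r) (τ r)

  valid-flip₀ : (T : Term m) {A : Rows k m} {τ : Fin k → Bool} (p q : Fin k) (w : Subset m) → sem T w false →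
    Valid T A τ → Valid T (flip₂ A p q w) τ
  valid-flip₀ T {A} {τ} p q w h v r with at₂ p q r
  ... | true = subst (sem T (A r ⊕ w)) (𝔹.xor-identityʳ (τ r)) (sem-⊕ T (v r) h)
  ... | false = v r

  valid-flip₁ : (T : Term m) {A : Rows k m} {τ : Fin k → Bool} (p q : Fin k) (w : Subset m) → sem T w true →
    Valid T A τ → Valid T (flip₂ A p q w) (flipB τ p q)
  valid-flip₁ T {A} {τ} p q w h v r with at₂ p q r
  ... | true = sem-⊕ T (v r) h
  ... | false = v r

  valid-moves : (T : Term m) {Q : Subset m → Set} → (∀ w → Q w → sem T w false) → {A B : Rows k m} {τ : Fin k → Bool} →
    Moves Q A B → Valid T A τ → Valid T B τ
  valid-moves T f stop v = v
  valid-moves T f (move p q w _ Qw _ r) v = valid-moves T f r (valid-flip₀ T p q w (f w Qw) v)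

  agree-trans : {L X Y Z : Subset m} → Agree L X Y → Agree L Y Z → Agree L X Z
  agree-trans f g = agree (λ x p → trans (on f x p) (on g x p))

  agree-flip : {L : Subset m} (A : Rows k m) (p q : Fin k) {w : Subset m} → Off L w → ∀ r → Agree L (flip₂ A p q w r) (A r)
  agree-flip A p q {w} o r = agree λ x Lx → trans (flip-cell A p q w r x)
    (trans (cong (λ b → A r ! x xor (at₂ p q r ∧ b)) (isOff o x Lx)) (trans (cong (A r ! x xor_) (𝔹.∧-zeroʳ _)) (𝔹.xor-identityʳ _)))

  agree-moves : {L : Subset m} {Q : Subset m → Set} → (∀ w → Q w → Off L w) → {A B : Rows k m} →
    Moves Q A B → ∀ r → Agree L (B r) (A r)
  agree-moves f stop r = agree (λ x Lx → refl)
  agree-moves f {A = A} (move p q w _ Qw _ s) r = agree-trans (agree-moves f s r) (agree-flip A p q (f w Qw) r)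

  Fixing Changing Loose : Term m → Subset m → Set
  Fixing T w = w ≼ leaves T × sem T w false
  Changing T w = w ≼ leaves T × sem T w true
  Loose T w = w ≼ leaves T × ∃ λ t → sem T w t

  record SameCols (L : Subset m) (A B : Rows k m) : Set where
    constructor same
    field cols : ∀ x → L ! x ≡ true → col A x ≡ col B x
  open SameCols public

  count : Bool → (Fin k → Bool) → ℕ
  count c τ = ∑ (λ r → bit (⌊ τ r 𝔹.≟ c ⌋))

  -- The changing vector `w` is exhibited but not yet added: inside a composition it has to be added
  -- together with a vector of the other half, as one single move.
  Flippable : Term m → Rows k m → Fin k → Fin k → Set
  Flippable T A p q = ∃ λ A' → Moves (Fixing T) A A' × ∃ λ w → Changing T w × w ≼ A' p ⊕ A' q

  Matches : Subset m → (Subset m → Set) → Rows k m → Rows k m → Set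
  Matches L Q A B = ∃ λ A' → Moves Q A A' × (∀ r → Agree L (A' r) (B r))

  FixedRoot : Term m → Set
  FixedRoot {m} T = ∀ {k} (A B : Rows k m) τ → Valid T A τ → Valid T B τ → SameCols (leaves T) A B → Matches (leaves T) (Fixing T) A B

  -- Slow variation of the root column: an excess of the value c can be reduced two rows at a time.
  SlowRoot : Term m → Set
  SlowRoot {m} T = ∀ {k} (A B : Rows k m) τ σ c → Valid T A τ → Valid T B σ → SameCols (leaves T) A B →
    count c σ < count c τ → ∀ p q → p ≢ q → τ p ≡ c → τ q ≡ c → Flippable T A p q

  -- Suited to a short-circuited network, where the root column carries no information and may
  -- differ between the two matrices.
  FreeRoot : Term m → Set
  FreeRoot {m} T = ∀ {k} (A B : Rows k m) τ σ → Valid T A τ → Valid T B σ → SameCols (leaves T) A B → Matches (leaves T) (Fixing T) A B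

  -- `sem T ∅ˢ true` says that the root element is a loop. Only if it is not are the root values
  -- visible in the rows, and only then must their variation be controlled.
  data Good (T : Term m) : Set where
    nonloop : ¬ sem T ∅ˢ true → FixedRoot T → SlowRoot T → Good T
    loop    : sem T ∅ˢ true → FreeRoot T → Good T

  -- The sum of the two rows, cut down to the leaves, has root value `true` and can itself serve as
  -- the changing vector.
  flip-differ : (T : Term m) {A : Rows k m} {τ : Fin k → Bool} → Valid T A τ → ∀ p q → τ p ≢ τ q → Flippable T A p q
  flip-differ T {A} {τ} v p q ne = A , stop , (A p ⊕ A q) ∩ leaves T ,
    (incl (λ x h → proj₂ (∧-true (trans (sym (!-∩ (A p ⊕ A q) _ x)) h))) ,
     sem-agree T (agree λ x Lx → sym (trans (!-∩ (A p ⊕ A q) (leaves T) x) (trans (cong ((A p ⊕ A q) ! x ∧_) Lx) (𝔹.∧-identityʳ _))))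
       (subst (sem T (A p ⊕ A q)) (xor≢ ne) (sem-⊕ T (v p) (v q)))) ,
    incl (λ x h → proj₁ (∧-true (trans (sym (!-∩ (A p ⊕ A q) _ x)) h)))
    where
    xor≢ : ∀ {a b} → a ≢ b → a xor b ≡ true
    xor≢ h = ≢false⇒true (λ e → h (xor≡f⇒≡ e))

  -- The sums of all rows of `A` and of `B` agree on the leaves, since the column sums do. Different
  -- parities of the root columns would give the empty set the root value `true`.
  parity-rows : (T : Term m) → ¬ sem T ∅ˢ true → {A B : Rows k m} {τ σ : Fin k → Bool} → Valid T A τ → Valid T B σ →
    SameCols (leaves T) A B → ⨁ τ ≡ ⨁ σ
  parity-rows {m} {k} T nl {A} {B} {τ} {σ} va vb sc = xor≡f⇒≡ (≢true⇒false λ e → nl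
    (sem-agree T (agree λ x Lx → trans (!-⊕ (total A) (total B) x) (trans (cong₂ _xor_ (trans (total-! A x) (trans (cong odd (cols sc x Lx)) (sym (total-! B x)))) refl)
        (trans (𝔹.xor-same (total B ! x)) (sym (!-∅ x)))))
      (subst (sem T (total A ⊕ total B)) e (sem-⊕ T (total-sem A τ va) (total-sem B σ vb)))))
    where
    total : ∀ {k} → Rows k m → Subset m
    total {zero} A = ∅ˢ
    total {suc k} A = A zero ⊕ total (A ∘ suc)
    total-sem : ∀ {k} (A : Rows k m) τ → Valid T A τ → sem T (total A) (⨁ τ)
    total-sem {zero} A τ v = sem-∅ T
    total-sem {suc k} A τ v = sem-⊕ T (v zero) (total-sem (A ∘ suc) (τ ∘ suc) (v ∘ suc))
    odd-bit : ∀ b c → odd (bit b + c) ≡ b xor odd c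
    odd-bit true c = refl
    odd-bit false c = refl
    total-! : ∀ {k} (A : Rows k m) x → total A ! x ≡ odd (col A x)
    total-! {zero} A x = !-∅ x
    total-! {suc k} A x = trans (!-⊕ (A zero) _ x) (trans (cong (A zero ! x xor_) (total-! (A ∘ suc) x)) (sym (odd-bit (A zero ! x) _)))

  another-difference : (τ σ : Fin k → Bool) → ⨁ τ ≡ ⨁ σ → ∀ p → τ p ≢ σ p → ∃ λ q → p ≢ q × τ q ≢ σ q
  another-difference τ σ e p ne with FinP.any? (λ q → ¬? (p Fin.≟ q) ×-dec ¬? (τ q 𝔹.≟ σ q))
  ... | yes h = h
  ... | no none = ⊥-elim (ne (xor≡f⇒≡ (trans (sym (⨁-single (λ r → τ r xor σ r) p
      (λ j j≢p → trans (cong (_xor σ j) (decidable-stable (τ j 𝔹.≟ σ j) (λ h → none (j , j≢p ∘ sym , h)))) (𝔹.xor-same (σ j)))))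
      (trans (⨁.∑-distrib-+ τ σ) (trans (cong (_xor ⨁ σ) e) (𝔹.xor-same (⨁ σ)))))))

  -- Outside the differing rows the two columns agree, and on them `τ` is constant, so `σ` takes
  -- this value strictly less often. This supplies the hypothesis of `SlowRoot`.
  excess : (τ σ : Fin k → Bool) (p : Fin k) → τ p ≢ σ p → (∀ j → τ j ≢ σ j → τ j ≡ τ p) → count (τ p) σ < count (τ p) τ
  excess τ σ p ne const = ∑-mono-< _ _
    (λ j → case τ j 𝔹.≟ σ j of λ where
      (yes e) → ℕP.≤-reflexive (cong (λ b → bit ⌊ b 𝔹.≟ τ p ⌋) (sym e))
      (no h) → ℕP.≤-trans (bit≤1 ⌊ σ j 𝔹.≟ τ p ⌋) (ℕP.≤-reflexive (sym (cong bit (⌊⌋-yes (τ j 𝔹.≟ τ p) (const j h))))))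
    p (subst₂ _<_ (sym (cong bit (⌊⌋-no (σ p 𝔹.≟ τ p) (ne ∘ sym)))) (sym (cong bit (⌊⌋-yes (τ p 𝔹.≟ τ p) refl))) (s≤s z≤n))
    where
    bit≤1 : ∀ b → bit b ≤ 1
    bit≤1 true = ℕP.≤-refl
    bit≤1 false = z≤n

  hamming : (Fin k → Bool) → (Fin k → Bool) → ℕ
  hamming τ σ = ∑ (λ r → bit (τ r xor σ r))

  hamming-flip : (τ σ : Fin k → Bool) (p q : Fin k) → τ p ≢ σ p → τ q ≢ σ q → hamming (flipB τ p q) σ < hamming τ σ
  hamming-flip τ σ p q np nq = ∑-mono-< _ _ (λ r → le r) p
      (subst₂ _<_ (sym (cong bit (flipped p (at₂-l p q) np))) (sym (cong bit (differ np))) (s≤s z≤n))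
    where
    differ : ∀ {a b} → a ≢ b → a xor b ≡ true
    differ h = ≢false⇒true (h ∘ xor≡f⇒≡)
    lem : ∀ a b → a xor b ≡ true → (a xor true) xor b ≡ false
    lem true false _ = refl
    lem false true _ = refl
    flipped : ∀ r → at₂ p q r ≡ true → τ r ≢ σ r → flipB τ p q r xor σ r ≡ false
    flipped r h ne = trans (cong (λ c → (if c then τ r xor true else τ r) xor σ r) h) (lem (τ r) (σ r) (differ ne))
    le : ∀ r → bit (flipB τ p q r xor σ r) ≤ bit (τ r xor σ r)
    le r with r Fin.≟ p | r Fin.≟ q
    ... | yes refl | _ = subst (λ c → bit c ≤ bit (τ r xor σ r)) (sym (lem (τ r) (σ r) (differ np))) z≤n
    ... | no _ | yes refl = subst (λ c → bit c ≤ bit (τ r xor σ r)) (sym (lem (τ r) (σ r) (differ nq))) z≤n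
    ... | no _ | no _ = ℕP.≤-refl

  valid-cong : (T : Term m) {A : Rows k m} {τ σ : Fin k → Bool} → (∀ r → τ r ≡ σ r) → Valid T A τ → Valid T A σ
  valid-cong T e v r = subst (sem T _) (e r) (v r)

  fixing-sem : (T : Term m) → ∀ w → Fixing T w → sem T w false
  fixing-sem T w (_ , h) = h

  off-disjoint : {K L w : Subset m} → Disjoint K L → w ≼ K → Off L w
  off-disjoint d h = off λ x Lx → ≢true⇒false (λ p → t≢f Lx (apart d x (at h x p)))

  SameCols-after : {L : Subset m} {Q : Subset m → Set} {A A' B : Rows k m} → Moves Q A A' → SameCols L A B → SameCols L A' B
  SameCols-after ms sc = same (λ x Lx → trans (col-moves ms x) (cols sc x Lx))

  -- Once moves may change the root, the root columns are made equal two rows at a time. Two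
  -- differing rows with opposite values are flipped directly. If there are none, the differing rows
  -- are constant, at least two in number by parity, and `SlowRoot` applies.
  nonloop⇒loose : (T : Term m) → ¬ sem T ∅ˢ true → FixedRoot T → SlowRoot T →
    (A B : Rows k m) → ∀ τ σ → Valid T A τ → Valid T B σ → SameCols (leaves T) A B → Matches (leaves T) (Loose T) A B
  nonloop⇒loose {m} {k} T nl fixed slow A₀ B τ₀ σ va₀ vb sc₀ = go (hamming τ₀ σ) A₀ τ₀ ℕP.≤-refl va₀ sc₀
    where
    weaken : ∀ w → Fixing T w → Loose T w
    weaken w (a , b) = a , false , b
    go : ∀ f (A : Rows k m) τ → hamming τ σ ≤ f → Valid T A τ → SameCols (leaves T) A B → Matches (leaves T) (Loose T) A B
    go f A τ le va sc with FinP.any? (λ r → ¬? (τ r 𝔹.≟ σ r))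
    ... | no none = let A' , ms , ag = fixed A B τ va (valid-cong T (λ r → sym (decidable-stable (τ r 𝔹.≟ σ r) (λ ne → none (r , ne)))) vb) sc
                    in A' , moves-map weaken ms , ag
    ... | yes (p , np) = next f le (proj₁ pair) (proj₁ (proj₂ pair)) (proj₁ (proj₂ (proj₂ pair))) (proj₂ (proj₂ (proj₂ pair)))
      where
      pair : ∃ λ q → p ≢ q × τ q ≢ σ q × Flippable T A p q
      pair with FinP.any? (λ q → ¬? (τ q 𝔹.≟ σ q) ×-dec ¬? (τ p 𝔹.≟ τ q))
      ... | yes (q , nq , τp≢τq) = q , (λ { refl → τp≢τq refl }) , nq , flip-differ T va p q τp≢τq
      ... | no none = let q , p≢q , nq = another-difference τ σ (parity-rows T nl va vb sc) p np
                          const : ∀ j → τ j ≢ σ j → τ j ≡ τ p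
                          const j nj = sym (decidable-stable (τ p 𝔹.≟ τ j) (λ h → none (j , nj , h)))
                      in q , p≢q , nq , slow A B τ σ (τ p) va vb sc (excess τ σ p np const) p q p≢q refl (const q nq)
      next : ∀ f → hamming τ σ ≤ f → ∀ q → p ≢ q → τ q ≢ σ q → Flippable T A p q → Matches (leaves T) (Loose T) A B
      next f le q p≢q nq (A' , ms , w , (w≼ , sw) , wle) = continue f le
        where
        continue : ∀ f → hamming τ σ ≤ f → Matches (leaves T) (Loose T) A B
        continue zero le = ⊥-elim (ℕP.n≮0 (ℕP.<-≤-trans (hamming-flip τ σ p q np nq) le))
        continue (suc f) le =
          let A'' , ms' , ag = go f (flip₂ A' p q w) (flipB τ p q) (ℕP.≤-pred (ℕP.<-≤-trans (hamming-flip τ σ p q np nq) le))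
                (valid-flip₁ T p q w sw (valid-moves T (fixing-sem T) ms va))
                (same λ x Lx → trans (col-flip A' p q w p≢q wle x) (cols (SameCols-after ms sc) x Lx))
          in A'' , moves-trans (moves-map weaken ms) (move p q w p≢q (w≼ , true , sw) wle ms') , ag

open Networks

-- Connecting matrices by induction on the network.

module RowConnectivity where

  private variable
    n m v k : ℕ

  disagree-agree : {L w X Y X' Y' : Subset m} → w ≼ L → w ≼ X ⊕ Y → Agree L X' X → Agree L Y' Y → w ≼ X' ⊕ Y'
  disagree-agree {X = X} {Y} {X'} {Y'} w≼L le a b = incl λ x p → trans (!-⊕ X' Y' x)
    (trans (cong₂ _xor_ (on a x (at w≼L x p)) (on b x (at w≼L x p))) (trans (sym (!-⊕ X Y x)) (at le x p)))

  ⊕-off-l : {L w w' : Subset m} → Off L w' → Agree L w (w ⊕ w')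
  ⊕-off-l {w = w} {w'} o = agree λ x Lx → sym (trans (!-⊕ w w' x) (trans (cong (w ! x xor_) (isOff o x Lx)) (𝔹.xor-identityʳ _)))

  ⊕-off-r : {L w w' : Subset m} → Off L w → Agree L w' (w ⊕ w')
  ⊕-off-r {w = w} {w'} o = agree λ x Lx → sym (trans (!-⊕ w w' x) (cong (_xor w' ! x) (isOff o x Lx)))

  -- The second sequence of moves stays off `K`, so what the first one has matched is preserved.
  matches-union : {K L : Subset m} {P P' Q : Subset m → Set} {A B : Rows k m} →
    (∀ w → P w → Q w) → (∀ w → P' w → Q w) → (∀ w → P' w → Off K w) →
    (M : Matches K P A B) → Matches L P' (proj₁ M) B → Matches (K ∪ L) Q A B
  matches-union {K = K} {L} f g o (A₁ , ms₁ , ag₁) (A₂ , ms₂ , ag₂) =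
    A₂ , moves-trans (moves-map f ms₁) (moves-map g ms₂) , λ r → agree λ x p →
      [ (λ q → trans (on (agree-moves o ms₂ r) x q) (on (ag₁ r) x q)) , on (ag₂ r) x ]′ (∨-true (trans (sym (!-∪ K L x)) p))

  samecols-l : {K L : Subset m} {A B : Rows k m} → SameCols (K ∪ L) A B → SameCols K A B
  samecols-l {K = K} {L} sc = same λ x p → cols sc x (at (∪-l K L) x p)

  samecols-r : {K L : Subset m} {A B : Rows k m} → SameCols (K ∪ L) A B → SameCols L A B
  samecols-r {K = K} {L} sc = same λ x p → cols sc x (at (∪-r K L) x p)

  -- The preparations in `T` do not touch the leaves of `S`, so the vector found for `S` stays
  -- inside the sum of the two rows, and both vectors can be added at once.
  flippable-both : (S T : Term m) → Disjoint (leaves S) (leaves T) → {A : Rows k m} {p q : Fin k} {Q : Subset m → Set} →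
    (∀ w → Fixing S w → Q w) → (∀ w → Fixing T w → Q w) →
    Flippable S A p q → (∀ {A'} → Moves (Fixing S) A A' → Flippable T A' p q) →
    ∃ λ A' → Moves Q A A' × ∃ λ w → w ≼ leaves S ∪ leaves T × sem S w true × sem T w true × w ≼ A' p ⊕ A' q
  flippable-both S T d {A} {p} {q} f g (A₁ , ms₁ , w₁ , (w₁≼ , sw₁) , le₁) F with F ms₁
  ... | A₂ , ms₂ , w₂ , (w₂≼ , sw₂) , le₂ = A₂ , moves-trans (moves-map f ms₁) (moves-map g ms₂) , w₁ ⊕ w₂ ,
    ⊕-≼ (≼-trans w₁≼ (∪-l (leaves S) (leaves T))) (≼-trans w₂≼ (∪-r (leaves S) (leaves T))) ,
    sem-agree S (⊕-off-l (off-disjoint (Disjoint-sym d) w₂≼)) sw₁ ,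
    sem-agree T (⊕-off-r (off-disjoint d w₁≼)) sw₂ ,
    ⊕-≼ (disagree-agree w₁≼ le₁ (stay p) (stay q)) le₂
    where
    stay : ∀ r → Agree (leaves S) (A₂ r) (A₁ r)
    stay = agree-moves (λ w h → off-disjoint (Disjoint-sym d) (proj₁ h)) ms₂

  loop-any : (T : Term m) → sem T ∅ˢ true → ∀ {w} → Off (leaves T) w → ∀ t → sem T w t
  loop-any T l o false = sem-off T o
  loop-any T l o true = sem-agree T (off-agree o) l

  swap-sem-ser : (S T : Term m) {z : Subset m} {t : Bool} → sem (ser S T) z t → sem (ser T S) z t
  swap-sem-ser S T (a , b) = b , a

  swap-sem-par : (S T : Term m) {z : Subset m} {t : Bool} → sem (par S T) z t → sem (par T S) z t
  swap-sem-par S T {z} {t} (s , a , b) = s xor t , b , subst (sem S z) (lem s t) a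
    where
    lem : ∀ s t → s ≡ (s xor t) xor t
    lem s t = sym (xor-cancel s t)

  good-transport : (S T : Term m) → leaves S ≡ leaves T → (∀ {z t} → sem S z t → sem T z t) → (∀ {z t} → sem T z t → sem S z t) → Good S → Good T
  good-transport {m} S T L≡ to from = go
    where
    fx : ∀ w → Fixing S w → Fixing T w
    fx w (a , b) = subst (w ≼_) L≡ a , to b
    mt : ∀ {k} {A B : Rows k m} → Matches (leaves S) (Fixing S) A B → Matches (leaves T) (Fixing T) A B
    mt (A' , ms , ag) = A' , moves-map fx ms , λ r → subst (λ L → Agree L _ _) L≡ (ag r)
    sc' : ∀ {k} {A B : Rows k m} → SameCols (leaves T) A B → SameCols (leaves S) A B
    sc' = subst (λ L → SameCols L _ _) (sym L≡)
    go : Good S → Good T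
    go (nonloop nl fixed slow) = nonloop (nl ∘ from)
      (λ A B τ va vb sc → mt (fixed A B τ (from ∘ va) (from ∘ vb) (sc' sc)))
      (λ A B τ σ c va vb sc lt p q ne τp τq → let A' , ms , w , (w≼ , sw) , le = slow A B τ σ c (from ∘ va) (from ∘ vb) (sc' sc) lt p q ne τp τq
        in A' , moves-map fx ms , w , (subst (w ≼_) L≡ w≼ , to sw) , le)
    go (loop l free) = loop (to l) (λ A B τ σ va vb sc → mt (free A B τ σ (from ∘ va) (from ∘ vb) (sc' sc)))

  ∪-comm-leaves : (X Y : Subset m) → X ∪ Y ≡ Y ∪ X
  ∪-comm-leaves X Y = SubP.∪-comm X Y

  module Series (S T : Term m) (d : Disjoint (leaves S) (leaves T)) where

    fixS : ∀ w → Fixing S w → Fixing (ser S T) w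
    fixS w (a , b) = ≼-trans a (∪-l (leaves S) (leaves T)) , b , sem-off T (off-disjoint d a)

    fixT : ∀ w → Fixing T w → Fixing (ser S T) w
    fixT w (a , b) = ≼-trans a (∪-r (leaves S) (leaves T)) , sem-off S (off-disjoint (Disjoint-sym d) a) , b

    offS : ∀ w → Fixing T w → Off (leaves S) w
    offS w h = off-disjoint (Disjoint-sym d) (proj₁ h)

    after : {A A' : Rows k m} {τ : Fin k → Bool} → Moves (Fixing S) A A' → Valid T A τ → Valid T A' τ
    after ms v = valid-moves T (λ w h → sem-off T (off-disjoint d (proj₁ h))) ms v

    -- In series the halves share the root column. An excess in it is an excess for both, and the
    -- two changing vectors combine into one.
    both-nonloop : ¬ sem S ∅ˢ true → FixedRoot S → SlowRoot S → FixedRoot T → SlowRoot T → Good (ser S T)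
    both-nonloop nl fS sS fT sT = nonloop (nl ∘ proj₁)
      (λ A B τ va vb sc → let M = fS A B τ (proj₁ ∘ va) (proj₁ ∘ vb) (samecols-l sc) in
        matches-union fixS fixT offS M (fT _ B τ (after (proj₁ (proj₂ M)) (proj₂ ∘ va)) (proj₂ ∘ vb) (SameCols-after (proj₁ (proj₂ M)) (samecols-r sc))))
      (λ A B τ σ c va vb sc lt p q ne τp τq →
        let A' , ms , w , w≼ , sw , tw , le = flippable-both S T d fixS fixT
              (sS A B τ σ c (proj₁ ∘ va) (proj₁ ∘ vb) (samecols-l sc) lt p q ne τp τq)
              (λ {A'} ms → sT A' B τ σ c (after ms (proj₂ ∘ va)) (proj₂ ∘ vb) (SameCols-after ms (samecols-r sc)) lt p q ne τp τq)
        in A' , ms , w , (w≼ , sw , tw) , le)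

    -- A short-circuited `T` accepts any root value, so a changing vector of `S` needs no
    -- counterpart in `T`.
    nonloop-loop : ¬ sem S ∅ˢ true → FixedRoot S → SlowRoot S → sem T ∅ˢ true → FreeRoot T → Good (ser S T)
    nonloop-loop nl fS sS l fT = nonloop (nl ∘ proj₁)
      (λ A B τ va vb sc → let M = fS A B τ (proj₁ ∘ va) (proj₁ ∘ vb) (samecols-l sc) in
        matches-union fixS fixT offS M (fT _ B τ τ (after (proj₁ (proj₂ M)) (proj₂ ∘ va)) (proj₂ ∘ vb) (SameCols-after (proj₁ (proj₂ M)) (samecols-r sc))))
      (λ A B τ σ c va vb sc lt p q ne τp τq →
        let A' , ms , w , (w≼ , sw) , le = sS A B τ σ c (proj₁ ∘ va) (proj₁ ∘ vb) (samecols-l sc) lt p q ne τp τq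
        in A' , moves-map fixS ms , w , (≼-trans w≼ (∪-l (leaves S) (leaves T)) , sw , loop-any T l (off-disjoint d w≼) true) , le)

    both-loop : sem S ∅ˢ true → FreeRoot S → sem T ∅ˢ true → FreeRoot T → Good (ser S T)
    both-loop lS fS lT fT = loop (lS , lT) λ A B τ σ va vb sc → let M = fS A B τ σ (proj₁ ∘ va) (proj₁ ∘ vb) (samecols-l sc) in
        matches-union fixS fixT offS M (fT _ B τ σ (after (proj₁ (proj₂ M)) (proj₂ ∘ va)) (proj₂ ∘ vb) (SameCols-after (proj₁ (proj₂ M)) (samecols-r sc)))

  good-ser : (S T : Term m) → Disjoint (leaves S) (leaves T) → Good S → Good T → Good (ser S T)
  good-ser S T d (nonloop nl a b) (nonloop _ c e) = Series.both-nonloop S T d nl a b c e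
  good-ser S T d (nonloop nl a b) (loop l c) = Series.nonloop-loop S T d nl a b l c
  good-ser S T d (loop l c) (nonloop nl a b) = good-transport (ser T S) (ser S T) (∪-comm-leaves (leaves T) (leaves S))
    (swap-sem-ser T S) (swap-sem-ser S T) (Series.nonloop-loop T S (Disjoint-sym d) nl a b l c)
  good-ser S T d (loop l a) (loop l' b) = Series.both-loop S T d l a l' b

  module Parallel (S T : Term m) (d : Disjoint (leaves S) (leaves T)) where

    fixS : ∀ w → Fixing S w → Fixing (par S T) w
    fixS w (a , b) = ≼-trans a (∪-l (leaves S) (leaves T)) , false , b , sem-off T (off-disjoint d a)

    fixT : ∀ w → Fixing T w → Fixing (par S T) w
    fixT w (a , b) = ≼-trans a (∪-r (leaves S) (leaves T)) , false , sem-off S (off-disjoint (Disjoint-sym d) a) , b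

    offS : ∀ w → Fixing T w → Off (leaves S) w
    offS w h = off-disjoint (Disjoint-sym d) (proj₁ h)

    afterT : {A A' : Rows k m} {τ : Fin k → Bool} → Moves (Fixing S) A A' → Valid T A τ → Valid T A' τ
    afterT ms v = valid-moves T (λ w h → sem-off T (off-disjoint d (proj₁ h))) ms v

    split : Rows k m → (Fin k → Bool) → Set
    split {k} A τ = ∃ λ (s : Fin k → Bool) → Valid S A s × Valid T A (λ r → s r xor τ r)

    toSplit : {A : Rows k m} {τ : Fin k → Bool} → Valid (par S T) A τ → split A τ
    toSplit v = (λ r → proj₁ (v r)) , (λ r → proj₁ (proj₂ (v r))) , (λ r → proj₂ (proj₂ (v r)))

    both-loop : sem S ∅ˢ true → FreeRoot S → sem T ∅ˢ true → FreeRoot T → Good (par S T)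
    both-loop lS fS lT fT = loop (true , lS , sem-∅ T) λ A B τ σ va vb sc →
      let s , vs , vt = toSplit va
          s' , vs' , vt' = toSplit vb
          M = fS A B s s' vs vs' (samecols-l sc)
      in matches-union fixS fixT offS M (fT _ B _ _ (afterT (proj₁ (proj₂ M)) vt) vt' (SameCols-after (proj₁ (proj₂ M)) (samecols-r sc)))

    -- The loop in `T` absorbs every change of the root value of `S`. Hence `S` may be matched by
    -- moves of arbitrary root value, each of which is fixing for the composition.
    nonloop-loop : ¬ sem S ∅ˢ true → FixedRoot S → SlowRoot S → sem T ∅ˢ true → FreeRoot T → Good (par S T)
    nonloop-loop nl fS sS l fT = loop (false , sem-∅ S , l) λ A B τ σ va vb sc →
      let s , vs , vt = toSplit va
          s' , vs' , vt' = toSplit vb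
          M = nonloop⇒loose S nl fS sS A B s s' vs vs' (samecols-l sc)
      in matches-union loose fixT offS M (fT _ B _ _
           (λ r → sem-agree T (agree λ x Lx → sym (on (agree-moves (λ w h → off-disjoint d (proj₁ h)) (proj₁ (proj₂ M)) r) x Lx)) (vt r))
           vt' (SameCols-after (proj₁ (proj₂ M)) (samecols-r sc)))
      where
      loose : ∀ w → Loose S w → Fixing (par S T) w
      loose w (a , t , b) = ≼-trans a (∪-l (leaves S) (leaves T)) , t , b , loop-any T l (off-disjoint d a) (t xor false)

    module _ (nlS : ¬ sem S ∅ˢ true) (fS : FixedRoot S) (sS : SlowRoot S) (nlT : ¬ sem T ∅ˢ true) (fT : FixedRoot T) (sT : SlowRoot T) where

      -- The two situations in which one half can be flipped in the rows `p` and `q`: by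
      -- `flip-differ`, or by `SlowRoot`.
      Step : (s s' : Fin k → Bool) → Fin k → Fin k → Set
      Step s s' p q = (s p ≢ s q) ⊎ (s p ≡ s q × count (s p) s' < count (s p) s)

      constant-step : (s s' : Fin k → Bool) (p q : Fin k) → s p ≢ s' p → s q ≢ s' q → (∀ j → s j ≢ s' j → s j ≡ s p) → Step s s' p q
      constant-step s s' p q np nq const = inj₂ (sym (const q nq) , excess s s' p np const)

      step-flippable : (U : Term m) → SlowRoot U → {A B : Rows k m} {s s' : Fin k → Bool} → Valid U A s → Valid U B s' →
        SameCols (leaves U) A B → ∀ p q → p ≢ q → Step s s' p q → Flippable U A p q
      step-flippable U slow va vb sc p q ne (inj₁ h) = flip-differ U va p q h
      step-flippable U slow {A} {B} {s} {s'} va vb sc p q ne (inj₂ (e , lt)) = slow A B s s' (s p) va vb sc lt p q ne refl (sym e)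

      Pair : (s s' t t' : Fin k → Bool) → Set
      Pair s s' t t' = ∃ λ p → ∃ λ q → p ≢ q × s p ≢ s' p × s q ≢ s' q × Step s s' p q × Step t t' p q

      -- The root values of S and T differ in the same rows; some two of these rows are opposite in both
      -- coordinates, or one of the coordinates is constant on all of them.
      find-pair : (s s' t t' : Fin k → Bool) → ⨁ s ≡ ⨁ s' → (∀ j → s j ≢ s' j → t j ≢ t' j) → (∀ j → t j ≢ t' j → s j ≢ s' j) →
        ∀ i → s i ≢ s' i → Pair s s' t t'
      find-pair s s' t t' par-eq J⇒ J⇐ i ni
        with FinP.any? (λ j → ¬? (s j 𝔹.≟ s' j) ×-dec ¬? (s i 𝔹.≟ s j)) | FinP.any? (λ l → ¬? (s l 𝔹.≟ s' l) ×-dec ¬? (t i 𝔹.≟ t l))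
      ... | no nj | no nl = let q , i≢q , nq = another-difference s s' par-eq i ni in
            i , q , i≢q , ni , nq ,
            constant-step s s' i q ni nq (λ j h → sym (decidable-stable (s i 𝔹.≟ s j) (λ ne → nj (j , h , ne)))) ,
            constant-step t t' i q (J⇒ i ni) (J⇒ q nq) (λ j h → sym (decidable-stable (t i 𝔹.≟ t j) (λ ne → nl (j , J⇐ j h , ne))))
      ... | yes (j , nj , sij) | no nl = i , j , (λ { refl → sij refl }) , ni , nj , inj₁ sij ,
            constant-step t t' i j (J⇒ i ni) (J⇒ j nj) (λ l h → sym (decidable-stable (t i 𝔹.≟ t l) (λ ne → nl (l , J⇐ l h , ne))))
      ... | no nj | yes (l , nl , til) = i , l , (λ { refl → til refl }) , ni , nl ,
            constant-step s s' i l ni nl (λ j h → sym (decidable-stable (s i 𝔹.≟ s j) (λ ne → nj (j , h , ne)))) , inj₁ til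
      ... | yes (j , nj , sij) | yes (l , nl , til) with t i 𝔹.≟ t j | s i 𝔹.≟ s l
      ...   | no tij | _ = i , j , (λ { refl → sij refl }) , ni , nj , inj₁ sij , inj₁ tij
      ...   | yes _ | no sil = i , l , (λ { refl → til refl }) , ni , nl , inj₁ sil , inj₁ til
      -- Here `i` agrees with `l` in the first coordinate and with `j` in the second, so `j` and `l`
      -- are opposite in both.
      ...   | yes tij | yes sil = j , l , (λ { refl → til tij }) , nj , nl , inj₁ (λ e → sij (trans sil (sym e))) , inj₁ (λ e → til (trans tij e))

      -- With the root column of the composition fixed, the root columns of `S` and `T` deviate from
      -- their targets in the same rows. A flip of both halves in two such rows is one move that
      -- keeps the common root and brings both columns closer.
      fixed-par : FixedRoot (par S T)
      fixed-par {k} A₀ B τ va₀ vb sc₀ = let s , vs , vt = toSplit va₀ in go (hamming s s') A₀ s ℕP.≤-refl vs vt sc₀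
        where
        s' : Fin k → Bool
        s' = proj₁ (toSplit vb)
        vs' : Valid S B s'
        vs' = proj₁ (proj₂ (toSplit vb))
        vt' : Valid T B (λ r → s' r xor τ r)
        vt' = proj₂ (proj₂ (toSplit vb))
        xor-inj : ∀ a b c → a xor c ≡ b xor c → a ≡ b
        xor-inj a b c e = trans (sym (xor-cancel a c)) (trans (cong (_xor c) e) (xor-cancel b c))
        go : ∀ f (A : Rows k m) s → hamming s s' ≤ f → Valid S A s → Valid T A (λ r → s r xor τ r) → SameCols (leaves (par S T)) A B →
          Matches (leaves (par S T)) (Fixing (par S T)) A B
        go f A s le vs vt sc with FinP.any? (λ r → ¬? (s r 𝔹.≟ s' r))
        ... | no none =
          let e : ∀ r → s r ≡ s' r
              e r = decidable-stable (s r 𝔹.≟ s' r) (λ ne → none (r , ne))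
              M = fS A B s vs (valid-cong S (λ r → sym (e r)) vs') (samecols-l sc)
          in matches-union fixS fixT offS M (fT _ B _ (afterT (proj₁ (proj₂ M)) vt) (valid-cong T (λ r → cong (_xor τ r) (sym (e r))) vt')
               (SameCols-after (proj₁ (proj₂ M)) (samecols-r sc)))
        ... | yes (i , ni) = next f le
          where
          t t' : Fin k → Bool
          t r = s r xor τ r
          t' r = s' r xor τ r
          pair : Pair s s' t t'
          pair = find-pair s s' t t' (parity-rows S nlS vs vs' (samecols-l sc)) (λ j h e → h (xor-inj _ _ (τ j) e)) (λ j h e → h (cong (_xor τ j) e)) i ni
          p = proj₁ pair
          q = proj₁ (proj₂ pair)
          p≢q = proj₁ (proj₂ (proj₂ pair))
          np = proj₁ (proj₂ (proj₂ (proj₂ pair)))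
          nq = proj₁ (proj₂ (proj₂ (proj₂ (proj₂ pair))))
          stepS = proj₁ (proj₂ (proj₂ (proj₂ (proj₂ (proj₂ pair)))))
          stepT = proj₂ (proj₂ (proj₂ (proj₂ (proj₂ (proj₂ pair)))))
          flipped : ∃ λ A' → Moves (λ w → Fixing S w ⊎ Fixing T w) A A' × ∃ λ w → w ≼ leaves S ∪ leaves T × sem S w true × sem T w true × w ≼ A' p ⊕ A' q
          flipped = flippable-both S T d (λ w → inj₁) (λ w → inj₂)
            (step-flippable S sS vs vs' (samecols-l sc) p q p≢q stepS)
            (λ ms → step-flippable T sT (afterT ms vt) vt' (SameCols-after ms (samecols-r sc)) p q p≢q stepT)
          next : ∀ f → hamming s s' ≤ f → Matches (leaves (par S T)) (Fixing (par S T)) A B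
          next zero le = ⊥-elim (ℕP.n≮0 (ℕP.<-≤-trans (hamming-flip s s' p q np nq) le))
          next (suc f) le =
            let A' , ms , w , w≼ , sw , tw , wle = flipped
                A'' , ms' , ag = go f (flip₂ A' p q w) (flipB s p q) (ℕP.≤-pred (ℕP.<-≤-trans (hamming-flip s s' p q np nq) le))
                  (valid-flip₁ S p q w sw (valid-moves S (λ w → [ proj₂ , (λ h → sem-off S (offS w h)) ]′) ms vs))
                  (valid-cong T (flip-xor s p q) (valid-flip₁ T p q w tw (valid-moves T (λ w → [ (λ h → sem-off T (off-disjoint d (proj₁ h))) , proj₂ ]′) ms vt)))
                  (same λ x Lx → trans (col-flip A' p q w p≢q wle x) (cols (SameCols-after ms sc) x Lx))
            in A'' , moves-trans (moves-map (λ w → [ fixS w , fixT w ]′) ms) (move p q w p≢q (w≼ , true , sw , tw) wle ms') , ag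
            where
            flip-xor : ∀ s p q r → flipB (λ r → s r xor τ r) p q r ≡ flipB s p q r xor τ r
            flip-xor s p q r with at₂ p q r
            ... | true = trans (𝔹.xor-assoc (s r) (τ r) true) (trans (cong (s r xor_) (𝔹.xor-comm (τ r) true)) (sym (𝔹.xor-assoc (s r) true (τ r))))
            ... | false = refl

      changeS : ∀ w → Changing S w → Changing (par S T) w
      changeS w (a , b) = ≼-trans a (∪-l (leaves S) (leaves T)) , true , b , sem-off T (off-disjoint d a)

      changeT : ∀ w → Changing T w → Changing (par S T) w
      changeT w (a , b) = ≼-trans a (∪-r (leaves S) (leaves T)) , false , sem-off S (off-disjoint (Disjoint-sym d) a) , b

      flipS : {A : Rows k m} {p q : Fin k} → Flippable S A p q → Flippable (par S T) A p q
      flipS (A' , ms , w , c , le) = A' , moves-map fixS ms , w , changeS w c , le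

      flipT : {A : Rows k m} {p q : Fin k} → Flippable T A p q → Flippable (par S T) A p q
      flipT (A' , ms , w , c , le) = A' , moves-map fixT ms , w , changeT w c , le

      -- If `a` equals `d` and `a xor b` equals `d xor c`, then `b` equals `c`; hence both summands
      -- on the left are one only when the last one is. Here `b` stands for the root value of the
      -- composition and `a` for that of `S`.
      count-split : ∀ (c d a b : Bool) → bit ⌊ a 𝔹.≟ d ⌋ + bit ⌊ (a xor b) 𝔹.≟ (d xor c) ⌋ ≤ 1 + bit ⌊ b 𝔹.≟ c ⌋
      count-split true true true true = ℕP.≤-refl
      count-split true true true false = ℕP.≤-refl
      count-split true true false true = z≤n
      count-split true true false false = ℕP.≤-refl
      count-split true false true true = z≤n
      count-split true false true false = ℕP.≤-refl
      count-split true false false true = ℕP.≤-refl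
      count-split true false false false = ℕP.≤-refl
      count-split false true true true = ℕP.≤-refl
      count-split false true true false = ℕP.≤-refl
      count-split false true false true = ℕP.≤-refl
      count-split false true false false = z≤n
      count-split false false true true = ℕP.≤-refl
      count-split false false true false = z≤n
      count-split false false false true = ℕP.≤-refl
      count-split false false false false = ℕP.≤-refl

      -- For `b` different from `c` exactly one of the two events on the right occurs; for `b` equal
      -- to `c` the hypothesis makes both occur.
      count-exact : ∀ (c d a b : Bool) → (b ≡ c → a ≡ d) → 1 + bit ⌊ b 𝔹.≟ c ⌋ ≤ bit ⌊ a 𝔹.≟ d ⌋ + bit ⌊ (a xor b) 𝔹.≟ (d xor c) ⌋
      count-exact c d a b h with b 𝔹.≟ c
      ... | yes refl = subst (λ a → 2 ≤ bit ⌊ a 𝔹.≟ d ⌋ + bit ⌊ (a xor b) 𝔹.≟ (d xor b) ⌋) (sym (h refl))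
            (ℕP.≤-reflexive (sym (cong₂ (λ x y → bit x + bit y) (⌊⌋-yes (d 𝔹.≟ d) refl) (⌊⌋-yes ((d xor b) 𝔹.≟ (d xor b)) refl))))
      ... | no ne = lem c d a b ne
        where
        lem : ∀ (c d a b : Bool) → b ≢ c → 1 ≤ bit ⌊ a 𝔹.≟ d ⌋ + bit ⌊ (a xor b) 𝔹.≟ (d xor c) ⌋
        lem true true true false _ = ℕP.≤-refl
        lem true true false false _ = ℕP.≤-refl
        lem true false true false _ = ℕP.≤-refl
        lem true false false false _ = ℕP.≤-refl
        lem false true true true _ = ℕP.≤-refl
        lem false true false true _ = ℕP.≤-refl
        lem false false true true _ = ℕP.≤-refl
        lem false false false true _ = ℕP.≤-refl
        lem true _ _ true h = ⊥-elim (h refl)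
        lem false _ _ false h = ⊥-elim (h refl)

      -- Flipping one half alone changes the root. If all rows of value `c` have the same value in
      -- `S`, adding up `count-exact` over `A` and `count-split` over `B` shows that the excess
      -- descends to one of the halves. Otherwise some row of value `c` can be used to make the
      -- values of `S` in `p` and `q` opposite.
      slow-par : SlowRoot (par S T)
      slow-par {k} A B τ σ c va vb sc lt p q p≢q τp τq = main
        where
        s s' : Fin k → Bool
        s = proj₁ (toSplit va)
        s' = proj₁ (toSplit vb)
        vs = proj₁ (proj₂ (toSplit va))
        vt = proj₂ (proj₂ (toSplit va))
        vs' = proj₁ (proj₂ (toSplit vb))
        vt' = proj₂ (proj₂ (toSplit vb))
        main : Flippable (par S T) A p q
        main with s p 𝔹.≟ s q
        ... | no ne = flipS (flip-differ S vs p q ne)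
        ... | yes sp≡sq with FinP.any? (λ r → (τ r 𝔹.≟ c) ×-dec ¬? (s p 𝔹.≟ s r))
        ...   | no none with (count (s p) s' ℕP.<? count (s p) s) | (count (s p xor c) (λ r → s' r xor σ r) ℕP.<? count (s p xor c) (λ r → s r xor τ r))
        ...     | yes ltS | _ = flipS (sS A B s s' (s p) vs vs' (samecols-l sc) ltS p q p≢q refl (sym sp≡sq))
        ...     | no _ | yes ltT = flipT (sT A B _ _ (s p xor c) vt vt' (samecols-r sc) ltT p q p≢q (cong (s p xor_) τp) (cong₂ _xor_ (sym sp≡sq) τq))
        ...     | no geS | no geT = ⊥-elim (ℕP.<⇒≱ strict (ℕP.+-mono-≤ (ℕP.≮⇒≥ geS) (ℕP.≮⇒≥ geT)))
          where
          d' = s p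
          N : (Fin k → Bool) → (Fin k → Bool) → ℕ
          N a b = count d' a + count (d' xor c) (λ r → a r xor b r)
          below : N s' σ ≤ ∑ {k} (λ _ → 1) + count c σ
          below = subst₂ _≤_ (∑.∑-distrib-+ (λ r → bit ⌊ s' r 𝔹.≟ d' ⌋) (λ r → bit ⌊ (s' r xor σ r) 𝔹.≟ (d' xor c) ⌋))
            (∑.∑-distrib-+ {k} (λ _ → 1) (λ r → bit ⌊ σ r 𝔹.≟ c ⌋)) (∑-mono-≤ _ _ (λ r → count-split c d' (s' r) (σ r)))
          above : ∑ {k} (λ _ → 1) + count c τ ≤ N s τ
          above = subst₂ _≤_ (∑.∑-distrib-+ {k} (λ _ → 1) (λ r → bit ⌊ τ r 𝔹.≟ c ⌋))
            (∑.∑-distrib-+ (λ r → bit ⌊ s r 𝔹.≟ d' ⌋) (λ r → bit ⌊ (s r xor τ r) 𝔹.≟ (d' xor c) ⌋)) (∑-mono-≤ _ _ (λ r → count-exact c d' (s r) (τ r)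
            (λ e → sym (decidable-stable (s p 𝔹.≟ s r) (λ ne → none (r , e , ne))))))
          strict : N s' σ < N s τ
          strict = ℕP.≤-<-trans below (ℕP.<-≤-trans (ℕP.+-monoʳ-< (∑ {k} (λ _ → 1)) lt) above)
        -- Adding the sum of the rows `q` and `r` to both of them swaps them on the leaves. This is
        -- a fixing move, since both have root value `c`, and it gives row `q` the value of `S`
        -- opposite to that in `p`.
        main | yes sp≡sq | yes (r , τr , sp≢sr) = A' , move q r w q≢r (w≼ , fix) wle stop ,
            (let _ , _ , w' , ch , le = flip-differ S (λ _ → proj₂ (S-rows _)) p q (λ e → sp≢sr (trans (sym sA'p) (trans e sA'q)))
             in w' , changeS w' ch , le)
          where
          q≢r : q ≢ r
          q≢r refl = sp≢sr sp≡sq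
          p≢r : p ≢ r
          p≢r refl = sp≢sr refl
          L = leaves (par S T)
          w : Subset m
          w = (A q ⊕ A r) ∩ L
          A' = flip₂ A q r w
          w≼ : w ≼ L
          w≼ = incl (λ x h → proj₂ (∧-true (trans (sym (!-∩ (A q ⊕ A r) L x)) h)))
          wle : w ≼ A q ⊕ A r
          wle = incl (λ x h → proj₁ (∧-true (trans (sym (!-∩ (A q ⊕ A r) L x)) h)))
          agw : Agree L (A q ⊕ A r) w
          agw = agree λ x Lx → sym (trans (!-∩ (A q ⊕ A r) L x) (trans (cong ((A q ⊕ A r) ! x ∧_) Lx) (𝔹.∧-identityʳ _)))
          fix : sem (par S T) w false
          fix = sem-agree (par S T) agw (subst (sem (par S T) (A q ⊕ A r)) (trans (cong₂ _xor_ τq τr) (𝔹.xor-same c)) (sem-⊕ (par S T) (va q) (va r)))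
          semw : sem S w (s q xor s r)
          semw = sem-agree S (agree-≼ (∪-l (leaves S) (leaves T)) agw) (sem-⊕ S (vs q) (vs r))
          s₁ : Fin k → Bool
          s₁ j = if at₂ q r j then s j xor (s q xor s r) else s j
          S-rows : ∀ j → ∃ λ b → sem S (A' j) (s₁ j)
          S-rows j with at₂ q r j
          ... | true = true , sem-⊕ S (vs j) semw
          ... | false = true , vs j
          sA'p : s₁ p ≡ s p
          sA'p = cong (λ b → if b then s p xor (s q xor s r) else s p) (at₂-off p≢q p≢r)
          sA'q : s₁ q ≡ s r
          sA'q = trans (cong (λ b → if b then s q xor (s q xor s r) else s q) (at₂-l q r))
            (trans (sym (𝔹.xor-assoc (s q) (s q) (s r))) (cong (_xor s r) (𝔹.xor-same (s q))))

    both-nonloop : ¬ sem S ∅ˢ true → FixedRoot S → SlowRoot S → ¬ sem T ∅ˢ true → FixedRoot T → SlowRoot T → Good (par S T)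
    both-nonloop nlS fS sS nlT fT sT = nonloop nl (fixed-par nlS fS sS nlT fT sT) (slow-par nlS fS sS nlT fT sT)
      where
      nl : ¬ sem (par S T) ∅ˢ true
      nl (true , h , _) = nlS h
      nl (false , _ , h) = nlT h

  good-par : (S T : Term m) → Disjoint (leaves S) (leaves T) → Good S → Good T → Good (par S T)
  good-par S T d (nonloop nl a b) (nonloop nl' c e) = Parallel.both-nonloop S T d nl a b nl' c e
  good-par S T d (nonloop nl a b) (loop l c) = Parallel.nonloop-loop S T d nl a b l c
  good-par S T d (loop l c) (nonloop nl a b) = good-transport (par T S) (par S T) (∪-comm-leaves (leaves T) (leaves S))
    (swap-sem-par T S) (swap-sem-par S T) (Parallel.nonloop-loop T S (Disjoint-sym d) nl a b l c)
  good-par S T d (loop l a) (loop l' b) = Parallel.both-loop S T d l a l' b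

  -- For a leaf the root column is a column of the matrix: its sum is prescribed, so no value is
  -- ever in excess. The compositions are the inductive steps above.
  good : (T : Term m) → Linear T → Good T
  good zero# _ = nonloop (λ ()) (λ A B τ va vb sc → A , stop , λ r → agree λ x h → ⊥-elim (t≢f h (!-∅ x)))
    (λ A B τ σ c va vb sc lt → ⊥-elim (ℕP.<-irrefl (∑.sum-cong-≗ (λ r → cong (λ b → bit ⌊ b 𝔹.≟ c ⌋) (trans (vb r) (sym (va r))))) lt))
  good free# _ = loop tt (λ A B τ σ va vb sc → A , stop , λ r → agree λ x h → ⊥-elim (t≢f h (!-∅ x)))
  good (leaf e) _ = nonloop (λ h → t≢f h (!-∅ e))
    (λ A B τ va vb sc → A , stop , λ r → agree λ x h → subst (λ y → A r ! y ≡ B r ! y) (sym (!-⁅⁆⇒≡ e x h)) (trans (va r) (sym (vb r))))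
    (λ A B τ σ c va vb sc lt → ⊥-elim (ℕP.<-irrefl (equal c A B τ σ va vb (cols sc e (!-⁅⁆-same e))) lt))
    where
    bit-true : ∀ b → bit ⌊ b 𝔹.≟ true ⌋ ≡ bit b
    bit-true true = refl
    bit-true false = refl
    bit-false : ∀ b → bit ⌊ b 𝔹.≟ false ⌋ + bit b ≡ 1
    bit-false true = refl
    bit-false false = refl
    count-true : ∀ {k} (A : Rows k _) τ → Valid (leaf e) A τ → count true τ ≡ col A e
    count-true A τ v = ∑.sum-cong-≗ (λ r → trans (bit-true (τ r)) (cong bit (sym (v r))))
    count-false : ∀ {k} (A : Rows k _) τ → Valid (leaf e) A τ → count false τ + col A e ≡ ∑ {k} (λ _ → 1)
    count-false A τ v = trans (sym (∑.∑-distrib-+ (λ r → bit ⌊ τ r 𝔹.≟ false ⌋) (λ r → bit (A r ! e)))) (∑.sum-cong-≗ (λ r → trans (cong (λ b → bit ⌊ τ r 𝔹.≟ false ⌋ + bit b) (v r)) (bit-false (τ r))))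
    equal : ∀ {k} c (A B : Rows k _) τ σ → Valid (leaf e) A τ → Valid (leaf e) B σ → col A e ≡ col B e → count c σ ≡ count c τ
    equal true A B τ σ va vb ce = trans (count-true B σ vb) (trans (sym ce) (sym (count-true A τ va)))
    equal false A B τ σ va vb ce = ℕP.+-cancelʳ-≡ (col A e) _ _ (trans (cong (count false σ +_) ce) (trans (count-false B σ vb) (sym (count-false A τ va))))
  good (ser S T) (a , b , d) = good-ser S T d (good S a) (good T b)
  good (par S T) (a , b , d) = good-par S T d (good S a) (good T b)

open RowConnectivity

-- Series-parallel matroids, their minors, and why M(K4) is not among them.

module SeriesParallelMatroids where

  open import Relation.Binary.Construct.Closure.ReflexiveTransitive using (Star; ε; _◅_)

  private variable
    n m v k : ℕ

  ─-mono : {P Q X : Subset m} → P ≼ Q → P ─ X ≼ Q ─ X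
  ─-mono {P = P} {Q} {X} h = incl λ i p → let a , b = ∧-true (trans (sym (!-─ P X i)) p) in trans (!-─ Q X i) (cong₂ _∧_ (at h i a) b)

  -- Used with `zero#` for deletion and with `free#` for contraction, so that minors of networks are
  -- again networks.
  substLeaves : Term m → Subset m → Term m → Term m
  substLeaves u X zero# = zero#
  substLeaves u X free# = free#
  substLeaves u X (leaf e) = if X ! e then u else leaf e
  substLeaves u X (ser S T) = ser (substLeaves u X S) (substLeaves u X T)
  substLeaves u X (par S T) = par (substLeaves u X S) (substLeaves u X T)

  module _ (u : Term m) (no-leaves : leaves u ≡ ∅ˢ) where

    leaves-subst : ∀ X T → leaves (substLeaves u X T) ≡ leaves T ─ X
    leaves-subst X T = ext (λ i → trans (go T i) (sym (!-─ (leaves T) X i)))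
      where
      ∨-∧ : ∀ a b c → (a ∧ c) ∨ (b ∧ c) ≡ (a ∨ b) ∧ c
      ∨-∧ a b c = sym (𝔹.∧-distribʳ-∨ c a b)
      go : ∀ T i → leaves (substLeaves u X T) ! i ≡ leaves T ! i ∧ not (X ! i)
      both : ∀ S T i → (leaves (substLeaves u X S) ∪ leaves (substLeaves u X T)) ! i ≡ (leaves S ∪ leaves T) ! i ∧ not (X ! i)
      both S T i = trans (!-∪ (leaves (substLeaves u X S)) (leaves (substLeaves u X T)) i) (trans (cong₂ _∨_ (go S i) (go T i)) (trans (∨-∧ (leaves S ! i) (leaves T ! i) _) (cong (_∧ not (X ! i)) (sym (!-∪ (leaves S) (leaves T) i)))))
      go zero# i = trans (!-∅ i) (cong (_∧ not (X ! i)) (sym (!-∅ i)))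
      go free# i = trans (!-∅ i) (cong (_∧ not (X ! i)) (sym (!-∅ i)))
      go (leaf e) i with X ! e in eq
      ... | true = trans (cong (_! i) no-leaves) (trans (!-∅ i) (sym (≢true⇒false (λ p → let a , b = ∧-true p in
                     t≢f (trans (cong (X !_) (!-⁅⁆⇒≡ e i a)) eq) (𝔹.not-injective b)))))
      ... | false = b-ext (λ p → cong₂ _∧_ p (cong not (trans (cong (X !_) (!-⁅⁆⇒≡ e i p)) eq))) (proj₁ ∘ ∧-true)
      go (ser S T) i = both S T i
      go (par S T) i = both S T i

    disjoint-subst : ∀ X S T → Disjoint (leaves S) (leaves T) → Disjoint (leaves (substLeaves u X S)) (leaves (substLeaves u X T))
    disjoint-subst X S T d = disj λ x p → trans (cong (_! x) (leaves-subst X T)) (trans (!-─ (leaves T) X x)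
      (cong (_∧ not (X ! x)) (apart d x (─-! (leaves S) X x (trans (sym (cong (_! x) (leaves-subst X S))) p)))))

    linear-subst : Linear u → ∀ X T → Linear T → Linear (substLeaves u X T)
    linear-subst lu X zero# l = tt
    linear-subst lu X free# l = tt
    linear-subst lu X (leaf e) l with X ! e
    ... | true = lu
    ... | false = tt
    linear-subst lu X (ser S T) (a , b , d) = linear-subst lu X S a , linear-subst lu X T b , disjoint-subst X S T d
    linear-subst lu X (par S T) (a , b , d) = linear-subst lu X S a , linear-subst lu X T b , disjoint-subst X S T d

  sem-delete : (X : Subset m) (T : Term m) {z : Subset m} {t : Bool} → Off X z → sem T z t → sem (substLeaves zero# X T) z t
  sem-delete X zero# o h = h
  sem-delete X free# o h = h
  sem-delete X (leaf e) o h with X ! e in eq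
  ... | true = trans (sym h) (isOff o e eq)
  ... | false = h
  sem-delete X (ser S T) o (a , b) = sem-delete X S o a , sem-delete X T o b
  sem-delete X (par S T) o (s , a , b) = s , sem-delete X S o a , sem-delete X T o b

  sem-undelete : (X : Subset m) (T : Term m) {z : Subset m} {t : Bool} → Off X z → sem (substLeaves zero# X T) z t → sem T z t
  sem-undelete X zero# o h = h
  sem-undelete X free# o h = h
  sem-undelete X (leaf e) o h with X ! e in eq
  ... | true = trans (isOff o e eq) (sym h)
  ... | false = h
  sem-undelete X (ser S T) o (a , b) = sem-undelete X S o a , sem-undelete X T o b
  sem-undelete X (par S T) o (s , a , b) = s , sem-undelete X S o a , sem-undelete X T o b

  sem-contract : (X : Subset m) (T : Term m) {y z : Subset m} {t : Bool} → Agree (leaves T ─ X) y z → sem T y t → sem (substLeaves free# X T) z t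
  sem-contract X zero# a h = h
  sem-contract X free# a h = h
  sem-contract X (leaf e) a h with X ! e in eq
  ... | true = tt
  ... | false = trans (sym (on a e (trans (!-─ ⁅ e ⁆ X e) (cong₂ _∧_ (!-⁅⁆-same e) (cong not eq))))) h
  sem-contract X (ser S T) a (h , h') =
    sem-contract X S (agree-≼ (─-mono (∪-l (leaves S) (leaves T))) a) h , sem-contract X T (agree-≼ (─-mono (∪-r (leaves S) (leaves T))) a) h'
  sem-contract X (par S T) a (s , h , h') =
    s , sem-contract X S (agree-≼ (─-mono (∪-l (leaves S) (leaves T))) a) h , sem-contract X T (agree-≼ (─-mono (∪-r (leaves S) (leaves T))) a) h'

  -- Every short circuit has been assigned a root value; this value is what the contracted element
  -- has to carry in the lifted cycle.
  sem-uncontract : (X : Subset m) (T : Term m) → Linear T → {z : Subset m} {t : Bool} → sem (substLeaves free# X T) z t →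
    ∃ λ y → y ≼ leaves T × Agree (leaves T ─ X) y z × sem T y t
  sem-uncontract {m} X T = go T
    where
    Result : Term m → Subset m → Bool → Set
    Result T z t = ∃ λ y → y ≼ leaves T × Agree (leaves T ─ X) y z × sem T y t
    ∅≼ : {L : Subset m} → ∅ˢ ≼ L
    ∅≼ = incl λ i p → ⊥-elim (t≢f p (!-∅ i))
    ∅─ : {y z : Subset m} → Agree (∅ˢ ─ X) y z
    ∅─ = agree λ i p → ⊥-elim (t≢f (─-! ∅ˢ X i p) (!-∅ i))
    union : ∀ S T → Disjoint (leaves S) (leaves T) → ∀ {z y y'} → y ≼ leaves S → y' ≼ leaves T → Agree (leaves S ─ X) y z → Agree (leaves T ─ X) y' z →
      (y ⊕ y' ≼ leaves S ∪ leaves T) × Agree ((leaves S ∪ leaves T) ─ X) (y ⊕ y') z × Agree (leaves S) y (y ⊕ y') × Agree (leaves T) y' (y ⊕ y')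
    union S T d {z} {y} {y'} a b c e =
      ⊕-≼ (≼-trans a (∪-l (leaves S) (leaves T))) (≼-trans b (∪-r (leaves S) (leaves T))) ,
      agree (λ i p → let q , nX = ∧-true (trans (sym (!-─ (leaves S ∪ leaves T) X i)) p) in
        [ (λ h → trans (sym (on agS i h)) (on c i (trans (!-─ (leaves S) X i) (cong₂ _∧_ h nX))))
        , (λ h → trans (sym (on agT i h)) (on e i (trans (!-─ (leaves T) X i) (cong₂ _∧_ h nX)))) ]′ (∨-true (trans (sym (!-∪ (leaves S) (leaves T) i)) q))) ,
      agS , agT
      where
      agS : Agree (leaves S) y (y ⊕ y')
      agS = ⊕-off-l (off-disjoint (Disjoint-sym d) b)
      agT : Agree (leaves T) y' (y ⊕ y')
      agT = ⊕-off-r (off-disjoint d a)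
    go : ∀ T → Linear T → ∀ {z t} → sem (substLeaves free# X T) z t → Result T z t
    go zero# _ h = ∅ˢ , ∅≼ , ∅─ , h
    go free# _ h = ∅ˢ , ∅≼ , ∅─ , tt
    go (leaf e) _ {z} {t} h with X ! e in eq
    ... | true = (if t then ⁅ e ⁆ else ∅ˢ) , le t
        , agree (λ i p → ⊥-elim (let a , b = ∧-true (trans (sym (!-─ ⁅ e ⁆ X i)) p) in t≢f (trans (cong (X !_) (!-⁅⁆⇒≡ e i a)) eq) (𝔹.not-injective b)))
        , val t
      where
      le : ∀ t → (if t then ⁅ e ⁆ else ∅ˢ) ≼ ⁅ e ⁆
      le true = ≼-refl
      le false = ∅≼
      val : ∀ t → (if t then ⁅ e ⁆ else ∅ˢ) ! e ≡ t
      val true = !-⁅⁆-same e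
      val false = !-∅ e
    ... | false = z ∩ ⁅ e ⁆ , incl (λ i p → proj₂ (∧-true (trans (sym (!-∩ z ⁅ e ⁆ i)) p)))
        , agree (λ i p → trans (!-∩ z ⁅ e ⁆ i) (trans (cong (z ! i ∧_) (─-! ⁅ e ⁆ X i p)) (𝔹.∧-identityʳ _)))
        , trans (!-∩ z ⁅ e ⁆ e) (trans (cong (z ! e ∧_) (!-⁅⁆-same e)) (trans (𝔹.∧-identityʳ _) h))
    go (ser S T) (lS , lT , d) (h , h') =
      let y , y≼ , ya , ys = go S lS h ; y' , y'≼ , ya' , ys' = go T lT h'
          u≼ , ua , us , ut = union S T d y≼ y'≼ ya ya'
      in y ⊕ y' , u≼ , ua , sem-agree S us ys , sem-agree T ut ys'
    go (par S T) (lS , lT , d) (s , h , h') =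
      let y , y≼ , ya , ys = go S lS h ; y' , y'≼ , ya' , ys' = go T lT h'
          u≼ , ua , us , ut = union S T d y≼ y'≼ ya ya'
      in y ⊕ y' , u≼ , ua , s , sem-agree S us ys , sem-agree T ut ys'

  -- The matroid is that of the network with its root element deleted, which is why the root value
  -- is `false`. Substitution in the leaves keeps this form under deletion and contraction.
  record SeriesParallel (M : Mat m) : Set₁ where
    field
      space   : Space m
      rep     : Rep M space
      term    : Term m
      linear  : Linear term
      leaves≼ : leaves term ≼ ground M
      sound   : ∀ z → mem space z → z ≼ leaves term × sem term z false
      complete : ∀ z → z ≼ leaves term → sem term z false → mem space z

  ≼-─-off : {z L X : Subset m} → z ≼ L ─ X → Off X z
  ≼-─-off {z = z} {L} {X} h = off λ x p → ≢true⇒false λ q → t≢f p (𝔹.not-injective (proj₂ (∧-true (trans (sym (!-─ L X x)) (at h x q)))))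

  seriesParallel-delete : {M : Mat m} → SeriesParallel M → ∀ x → SeriesParallel (delete M x)
  seriesParallel-delete {M = M} SP x = record
    { space = deletion space x ; rep = delete-rep rep x
    ; term = substLeaves zero# ⁅ x ⁆ term ; linear = linear-subst zero# refl tt ⁅ x ⁆ term linear
    ; leaves≼ = subst (_≼ ground M ─ ⁅ x ⁆) (sym L≡) (─-mono leaves≼)
    ; sound = λ z (m , zx) → let a , b = sound z m in
        subst (z ≼_) (sym L≡) (≼-minus a zx) , sem-delete ⁅ x ⁆ term (off (λ y p → trans (cong (z !_) (!-⁅⁆⇒≡ x y p)) zx)) b
    ; complete = λ z z≼ h → let z≼' = subst (z ≼_) L≡ z≼ in
        complete z (≼-trans z≼' ≼-─) (sem-undelete ⁅ x ⁆ term (≼-─-off z≼') h) , isOff (≼-─-off z≼') x (!-⁅⁆-same x) }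
    where
    open SeriesParallel SP
    L≡ = leaves-subst zero# refl ⁅ x ⁆ term

  seriesParallel-contract : {M : Mat m} → SeriesParallel M → ∀ X → SeriesParallel (contractSet M X)
  seriesParallel-contract {M = M} SP X = record
    { space = contraction space X ; rep = contract-rep rep X
    ; term = substLeaves free# X term ; linear = linear-subst free# refl tt X term linear
    ; leaves≼ = subst (_≼ ground M ─ X) (sym L≡) (─-mono leaves≼)
    ; sound = λ { w (z , m , refl) → let a , b = sound z m in
        subst (z ∩ ∁ X ≼_) (sym L≡) (subst (_≼ leaves term ─ X) (─≡∩∁ z X) (─-mono a)) ,
        sem-contract X term (agree λ i p → sym (trans (!-∩ z (∁ X) i) (trans (cong (z ! i ∧_) (trans (VecP.lookup-map i not X)
          (proj₂ (∧-true (trans (sym (!-─ (leaves term) X i)) p))))) (𝔹.∧-identityʳ _)))) b }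
    ; complete = λ w w≼ h → let y , y≼ , ya , ys = sem-uncontract X term linear h in y , complete y y≼ ys ,
        lem w y (subst (w ≼_) L≡ w≼) y≼ ya }
    where
    open SeriesParallel SP
    L≡ = leaves-subst free# refl X term
    lem : ∀ w y → w ≼ leaves term ─ X → y ≼ leaves term → Agree (leaves term ─ X) y w → w ≡ y ∩ ∁ X
    lem w y w≼ y≼ ya = trans (≼-antisym (incl λ i p → trans (!-─ y X i) (let q = at w≼ i p in cong₂ _∧_ (trans (on ya i q) p) (proj₂ (∧-true (trans (sym (!-─ (leaves term) X i)) q)))))
      (incl λ i p → let a , b = ∧-true (trans (sym (!-─ y X i)) p) in trans (sym (on ya i (trans (!-─ (leaves term) X i) (cong₂ _∧_ (at y≼ i a) b)))) a)) (─≡∩∁ y X)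

  seriesParallel-minor : {M N : Mat m} → SeriesParallel M → Minor M N → SeriesParallel N
  seriesParallel-minor SP ε = SP
  seriesParallel-minor SP (del x _ ◅ s) = seriesParallel-minor (seriesParallel-delete SP x) s
  seriesParallel-minor SP (con x _ ◅ s) = seriesParallel-minor (seriesParallel-contract SP ⁅ x ⁆) s

  -- A retract is in particular the contraction of a set, so it is covered by
  -- `seriesParallel-contract` like the other contractions.
  seriesParallel-gseries : {M N : Mat m} → SeriesParallel M → GSeriesMinor M N → SeriesParallel N
  seriesParallel-gseries SP ε = SP
  seriesParallel-gseries SP (del x _ ◅ s) = seriesParallel-gseries (seriesParallel-delete SP x) s
  seriesParallel-gseries SP (series x _ _ ◅ s) = seriesParallel-gseries (seriesParallel-contract SP ⁅ x ⁆) s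
  seriesParallel-gseries SP (coloop x _ ◅ s) = seriesParallel-gseries (seriesParallel-contract SP ⁅ x ⁆) s
  seriesParallel-gseries SP (retract R ◅ s) = seriesParallel-gseries (seriesParallel-contract SP (img (RetractData.e' R) fullˢ)) s

  data Reducible (T : Term m) : Set where
    coloopᵣ : ∀ e → leaves T ! e ≡ true → (∀ {z t} → sem T z t → z ! e ≡ false) → Reducible T
    loopᵣ : ∀ e → leaves T ! e ≡ true → sem T ⁅ e ⁆ false → Reducible T
    seriesᵣ : ∀ e f → e ≢ f → leaves T ! e ≡ true → leaves T ! f ≡ true → (∀ {z t} → sem T z t → z ! e ≡ z ! f) → Reducible T
    parallelᵣ : ∀ e f → e ≢ f → leaves T ! e ≡ true → leaves T ! f ≡ true → sem T (⁅ e ⁆ ⊕ ⁅ f ⁆) false → Reducible T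

  -- A network without a loop, coloop, series pair or parallel pair has no leaves or behaves like
  -- one edge: composing two single edges creates a series or a parallel pair.
  data Shape (T : Term m) : Set where
    reducible : Reducible T → Shape T
    empty     : (∀ e → leaves T ! e ≡ false) → Shape T
    single    : ∀ e → leaves T ! e ≡ true → (∀ x → leaves T ! x ≡ true → x ≡ e) → (∀ {z t} → sem T z t → z ! e ≡ t) → sem T ⁅ e ⁆ true → Shape T

  shape-transport : (S T : Term m) → leaves S ≡ leaves T → (∀ {z t} → sem S z t → sem T z t) → (∀ {z t} → sem T z t → sem S z t) → Shape S → Shape T
  shape-transport S T L≡ to from = go
    where
    ↓ : ∀ {e b} → leaves S ! e ≡ b → leaves T ! e ≡ b
    ↓ {e} h = trans (sym (cong (_! e) L≡)) h
    ↑ : ∀ {e b} → leaves T ! e ≡ b → leaves S ! e ≡ b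
    ↑ {e} h = trans (cong (_! e) L≡) h
    go : Shape S → Shape T
    go (reducible (coloopᵣ e p h)) = reducible (coloopᵣ e (↓ p) (λ q → h (from q)))
    go (reducible (loopᵣ e p h)) = reducible (loopᵣ e (↓ p) (to h))
    go (reducible (seriesᵣ e f ne p q h)) = reducible (seriesᵣ e f ne (↓ p) (↓ q) (λ q → h (from q)))
    go (reducible (parallelᵣ e f ne p q h)) = reducible (parallelᵣ e f ne (↓ p) (↓ q) (to h))
    go (empty h) = empty (λ e → ↓ (h e))
    go (single e p u h g) = single e (↓ p) (λ x q → u x (↑ q)) (λ q → h (from q)) (to g)

  sem? : (T : Term m) (z : Subset m) (t : Bool) → Dec (sem T z t)
  sem? zero# z t = t 𝔹.≟ false
  sem? free# z t = yes tt
  sem? (leaf e) z t = z ! e 𝔹.≟ t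
  sem? (ser S T) z t = sem? S z t ×-dec sem? T z t
  sem? (par S T) z t with sem? S z true ×-dec sem? T z (true xor t) | sem? S z false ×-dec sem? T z (false xor t)
  ... | yes h | _ = yes (true , h)
  ... | no _ | yes h = yes (false , h)
  ... | no a | no b = no λ { (true , h) → a h ; (false , h) → b h }

  module _ (S T : Term m) (d : Disjoint (leaves S) (leaves T)) where

    private
      l : ∀ {e} → leaves S ! e ≡ true → (leaves S ∪ leaves T) ! e ≡ true
      l {e} p = at (∪-l (leaves S) (leaves T)) e p
      r : ∀ {e} → leaves T ! e ≡ true → (leaves S ∪ leaves T) ! e ≡ true
      r {e} p = at (∪-r (leaves S) (leaves T)) e p
      offT : ∀ {w} → w ≼ leaves S → sem T w false
      offT h = sem-off T (off-disjoint d h)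
      pair≼ : ∀ {e f} {L : Subset m} → L ! e ≡ true → L ! f ≡ true → ⁅ e ⁆ ⊕ ⁅ f ⁆ ≼ L
      pair≼ p q = ⊕-≼ (⁅⁆-≼ p) (⁅⁆-≼ q)
      no-leaf-agree : (∀ e → leaves S ! e ≡ false) → ∀ {y z t} → sem S y t → sem S z t
      no-leaf-agree h = sem-agree S (agree λ x p → ⊥-elim (t≢f p (h x)))

    reducible-ser : Reducible S → Reducible (ser S T)
    reducible-ser (coloopᵣ e p h) = coloopᵣ e (l p) (λ q → h (proj₁ q))
    reducible-ser (loopᵣ e p h) = loopᵣ e (l p) (h , offT (⁅⁆-≼ p))
    reducible-ser (seriesᵣ e f ne p q h) = seriesᵣ e f ne (l p) (l q) (λ q → h (proj₁ q))
    reducible-ser (parallelᵣ e f ne p q h) = parallelᵣ e f ne (l p) (l q) (h , offT (pair≼ p q))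

    reducible-par : Reducible S → Reducible (par S T)
    reducible-par (coloopᵣ e p h) = coloopᵣ e (l p) (λ q → h (proj₁ (proj₂ q)))
    reducible-par (loopᵣ e p h) = loopᵣ e (l p) (false , h , offT (⁅⁆-≼ p))
    reducible-par (seriesᵣ e f ne p q h) = seriesᵣ e f ne (l p) (l q) (λ q → h (proj₁ (proj₂ q)))
    reducible-par (parallelᵣ e f ne p q h) = parallelᵣ e f ne (l p) (l q) (false , h , offT (pair≼ p q))

    -- A network without leaves is either short-circuited or open. In series the first is neutral,
    -- and the second turns the remaining edge into a coloop.
    empty-single-ser : (∀ e → leaves S ! e ≡ false) → ∀ e → leaves T ! e ≡ true → (∀ x → leaves T ! x ≡ true → x ≡ e) →
      (∀ {z t} → sem T z t → z ! e ≡ t) → sem T ⁅ e ⁆ true → Shape (ser S T)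
    empty-single-ser em e p u h g with sem? S ∅ˢ true
    ... | yes s = single e (r p) (λ x q → [ (λ q → ⊥-elim (t≢f q (em x))) , u x ]′ (∨-true (trans (sym (!-∪ (leaves S) (leaves T) x)) q))) (λ q → h (proj₂ q)) (no-leaf-agree em s , g)
    ... | no ns = reducible (coloopᵣ e (r p) (λ { {t = true} (a , b) → ⊥-elim (ns (no-leaf-agree em a)) ; {t = false} (a , b) → h b }))

    empty-single-par : (∀ e → leaves S ! e ≡ false) → ∀ e → leaves T ! e ≡ true → (∀ x → leaves T ! x ≡ true → x ≡ e) →
      (∀ {z t} → sem T z t → z ! e ≡ t) → sem T ⁅ e ⁆ true → Shape (par S T)
    empty-single-par em e p u h g with sem? S ∅ˢ true
    ... | yes s = reducible (loopᵣ e (r p) (true , no-leaf-agree em s , g))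
    ... | no ns = single e (r p) (λ x q → [ (λ q → ⊥-elim (t≢f q (em x))) , u x ]′ (∨-true (trans (sym (!-∪ (leaves S) (leaves T) x)) q)))
          (λ { (true , a , b) → ⊥-elim (ns (no-leaf-agree em a)) ; (false , a , b) → h b }) (false , no-leaf-agree em (sem-∅ S) , g)

    module _ (e f : Fin m) (p : leaves S ! e ≡ true) (q : leaves T ! f ≡ true) where
      apart-≢ : e ≢ f
      apart-≢ refl = t≢f q (apart d e p)

      single-single-ser : (∀ {z t} → sem S z t → z ! e ≡ t) → (∀ {z t} → sem T z t → z ! f ≡ t) → Shape (ser S T)
      single-single-ser h g = reducible (seriesᵣ e f apart-≢ (l p) (r q) (λ (a , b) → trans (h a) (sym (g b))))

      single-single-par : sem S ⁅ e ⁆ true → sem T ⁅ f ⁆ true → Shape (par S T)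
      single-single-par h g = reducible (parallelᵣ e f apart-≢ (l p) (r q)
        (true , sem-agree S (⊕-off-l (off-disjoint (Disjoint-sym d) (⁅⁆-≼ q))) h , sem-agree T (⊕-off-r (off-disjoint d (⁅⁆-≼ p))) g))

    empty-∪ : (∀ e → leaves S ! e ≡ false) → (∀ e → leaves T ! e ≡ false) → ∀ e → (leaves S ∪ leaves T) ! e ≡ false
    empty-∪ a b e = trans (!-∪ (leaves S) (leaves T) e) (cong₂ _∨_ (a e) (b e))

  shape : (T : Term m) → Linear T → Shape T
  shape zero# _ = empty !-∅
  shape free# _ = empty !-∅
  shape (leaf e) _ = single e (!-⁅⁆-same e) (λ x → !-⁅⁆⇒≡ e x) id (!-⁅⁆-same e)
  shape (ser S T) (a , b , d) = go (shape S a) (shape T b)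
    where
    flip : Shape (ser T S) → Shape (ser S T)
    flip = shape-transport (ser T S) (ser S T) (∪-comm-leaves (leaves T) (leaves S)) (swap-sem-ser T S) (swap-sem-ser S T)
    go : Shape S → Shape T → Shape (ser S T)
    go (reducible R) _ = reducible (reducible-ser S T d R)
    go _ (reducible R) = flip (reducible (reducible-ser T S (Disjoint-sym d) R))
    go (empty x) (empty y) = empty (empty-∪ S T d x y)
    go (empty x) (single e p u h g) = empty-single-ser S T d x e p u h g
    go (single e p u h g) (empty y) = flip (empty-single-ser T S (Disjoint-sym d) y e p u h g)
    go (single e p _ h _) (single f q _ h' _) = single-single-ser S T d e f p q h h'
  shape (par S T) (a , b , d) = go (shape S a) (shape T b)
    where
    flip : Shape (par T S) → Shape (par S T)
    flip = shape-transport (par T S) (par S T) (∪-comm-leaves (leaves T) (leaves S)) (swap-sem-par T S) (swap-sem-par S T)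
    go : Shape S → Shape T → Shape (par S T)
    go (reducible R) _ = reducible (reducible-par S T d R)
    go _ (reducible R) = flip (reducible (reducible-par T S (Disjoint-sym d) R))
    go (empty x) (empty y) = empty (empty-∪ S T d x y)
    go (empty x) (single e p u h g) = empty-single-par S T d x e p u h g
    go (single e p u h g) (empty y) = flip (empty-single-par T S (Disjoint-sym d) y e p u h g)
    go (single e p _ _ g) (single f q _ _ g') = single-single-par S T d e f p q g g'

  -- Facts about K4 range over finite sets and are obtained by evaluating their decision procedures;
  -- the `refl` at the end is this evaluation.
  K4-loopless : ∀ i → proj₁ ((ends K4) i) ≢ proj₂ ((ends K4) i)
  K4-loopless = ⌊⌋-true (FinP.all? (λ i → ¬? (proj₁ ((ends K4) i) Fin.≟ proj₂ ((ends K4) i)))) refl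

  MK4-rep : Rep (cycM K4) (evenSpace (ends K4))
  MK4-rep = cycM-rep K4 K4-loopless

  -- the triangle avoiding vertex a
  triangle : Fin 4 → Subset 6
  triangle a = tabulate (λ i → not (inc (ends K4) a i))

  triangle-even : ∀ a → mem (evenSpace (ends K4)) (triangle a)
  triangle-even = ⌊⌋-true (FinP.all? (λ a → mem? (evenSpace (ends K4)) (triangle a))) refl

  triangle-through : ∀ i → ∃ λ a → triangle a ! i ≡ true
  triangle-through = ⌊⌋-true (FinP.all? (λ i → FinP.any? (λ a → triangle a ! i 𝔹.≟ true))) refl

  triangles-separate : ∀ i j → i ≡ j ⊎ (∃ λ a → triangle a ! i ≢ triangle a ! j)
  triangles-separate = ⌊⌋-true (FinP.all? (λ i → FinP.all? (λ j → (i Fin.≟ j) ⊎-dec FinP.any? (λ a → ¬? (triangle a ! i 𝔹.≟ triangle a ! j))))) refl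

  no-loop : ∀ i → ¬ mem (evenSpace (ends K4)) ⁅ i ⁆
  no-loop = ⌊⌋-true (FinP.all? (λ i → ¬? (mem? (evenSpace (ends K4)) ⁅ i ⁆))) refl

  no-digon : ∀ i j → i ≡ j ⊎ ¬ mem (evenSpace (ends K4)) (⁅ i ⁆ ⊕ ⁅ j ⁆)
  no-digon = ⌊⌋-true (FinP.all? (λ i → FinP.all? (λ j → (i Fin.≟ j) ⊎-dec ¬? (mem? (evenSpace (ends K4)) (⁅ i ⁆ ⊕ ⁅ j ⁆))))) refl

  -- In M(K4) each element lies in a triangle, any two are separated by a triangle, and there are no
  -- loops or parallel pairs. This contradicts every reducible shape, and six elements are too many
  -- for the other two.
  seriesParallel⇒¬K4 : {N : Mat m} → SeriesParallel N → ¬ Iso N MK4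
  seriesParallel⇒¬K4 {m} {N} SP iso = contr (shape term linear)
    where
    open SeriesParallel SP
    open SpaceIso (iso⇒spaceIso rep MK4-rep iso)
    inGround : ∀ {e} → leaves term ! e ≡ true → ∃ λ i → f i ≡ e
    inGround {e} p = onto e (at leaves≼ e p)
    isLeaf : ∀ i → leaves term ! f i ≡ true
    isLeaf i = let a , h = triangle-through i in
      at (proj₁ (sound _ (to (triangle a) (triangle-even a)))) (f i) (img-intro f (triangle a) i h)
    pull : ∀ w X → w ≼ leaves term → sem term w false → (∀ i → w ! f i ≡ X ! i) → mem (evenSpace (ends K4)) X
    pull w X w≼ h e = subst (mem (evenSpace (ends K4))) (ext {X = pre f w} {Y = X} (λ i → trans (pre-! f w i) (e i))) (from w (complete w w≼ h))
    ⁅⁆-f : ∀ i j → ⁅ f i ⁆ ! f j ≡ ⁅ i ⁆ ! j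
    ⁅⁆-f i j = b-ext (λ p → subst (λ x → ⁅ i ⁆ ! x ≡ true) (sym (inj j i (!-⁅⁆⇒≡ (f i) (f j) p))) (!-⁅⁆-same i))
      (λ p → subst (λ x → ⁅ f i ⁆ ! f x ≡ true) (sym (!-⁅⁆⇒≡ i j p)) (!-⁅⁆-same (f i)))
    contr : Shape term → ⊥
    contr (empty h) = t≢f (isLeaf zero) (h (f zero))
    contr (single e _ u _ _) = case inj zero (suc zero) (trans (u _ (isLeaf zero)) (sym (u _ (isLeaf (suc zero))))) of λ ()
    contr (reducible (coloopᵣ e p h)) with inGround p
    ... | i , refl = let a , q = triangle-through i in
      t≢f (img-intro f (triangle a) i q) (h (proj₂ (sound _ (to (triangle a) (triangle-even a)))))
    contr (reducible (loopᵣ e p h)) with inGround p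
    ... | i , refl = no-loop i (pull ⁅ f i ⁆ ⁅ i ⁆ (⁅⁆-≼ p) h (⁅⁆-f i))
    contr (reducible (seriesᵣ e g ne p q h)) with inGround p | inGround q
    ... | i , refl | j , refl with triangles-separate i j
    ...   | inj₁ refl = ne refl
    ...   | inj₂ (a , d) = d (trans (sym (img-! f inj (triangle a) i)) (trans (h (proj₂ (sound _ (to (triangle a) (triangle-even a))))) (img-! f inj (triangle a) j)))
    contr (reducible (parallelᵣ e g ne p q h)) with inGround p | inGround q
    ... | i , refl | j , refl with no-digon i j
    ...   | inj₁ refl = ne refl
    ...   | inj₂ nd = nd (pull (⁅ f i ⁆ ⊕ ⁅ f j ⁆) (⁅ i ⁆ ⊕ ⁅ j ⁆) (⊕-≼ (⁅⁆-≼ p) (⁅⁆-≼ q)) h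
            (λ x → trans (!-⊕ ⁅ f i ⁆ ⁅ f j ⁆ (f x)) (trans (cong₂ _xor_ (⁅⁆-f i x) (⁅⁆-f j x)) (sym (!-⊕ ⁅ i ⁆ ⁅ j ⁆ x)))))

open SeriesParallelMatroids

-- Monomials as multisets of rows.

module Monomials where

  private variable
    n m v k : ℕ

  one : Tbl n
  one {zero} = 0
  one {suc n} = one , one

  var : Subset n → Tbl n
  var [] = 1
  var (false ∷ X) = var X , one
  var (true ∷ X) = one , var X

  mulT-comm : (s t : Tbl n) → mulT s t ≡ mulT t s
  mulT-comm {zero} s t = ℕP.+-comm s t
  mulT-comm {suc n} (a , b) (c , d) = cong₂ _,_ (mulT-comm a c) (mulT-comm b d)

  mulT-assoc : (s t u : Tbl n) → mulT (mulT s t) u ≡ mulT s (mulT t u)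
  mulT-assoc {zero} s t u = ℕP.+-assoc s t u
  mulT-assoc {suc n} (a , b) (c , d) (e , f) = cong₂ _,_ (mulT-assoc a c e) (mulT-assoc b d f)

  mulT-one : (t : Tbl n) → mulT t one ≡ t
  mulT-one {zero} t = ℕP.+-identityʳ t
  mulT-one {suc n} (a , b) = cong₂ _,_ (mulT-one a) (mulT-one b)

  one-mulT : (t : Tbl n) → mulT one t ≡ t
  one-mulT t = trans (mulT-comm one t) (mulT-one t)

  mulT-cancelˡ : (s : Tbl n) {t u : Tbl n} → mulT s t ≡ mulT s u → t ≡ u
  mulT-cancelˡ {zero} s h = ℕP.+-cancelˡ-≡ s _ _ h
  mulT-cancelˡ {suc n} (a , b) h = cong₂ _,_ (mulT-cancelˡ a (cong proj₁ h)) (mulT-cancelˡ b (cong proj₂ h))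

  expT-mulT : (s t : Tbl n) (X : Subset n) → expT (mulT s t) X ≡ expT s X + expT t X
  expT-mulT s t [] = refl
  expT-mulT (a , b) (c , d) (false ∷ X) = expT-mulT a c X
  expT-mulT (a , b) (c , d) (true ∷ X) = expT-mulT b d X

  expT-one : (X : Subset n) → expT one X ≡ 0
  expT-one [] = refl
  expT-one (false ∷ X) = expT-one X
  expT-one (true ∷ X) = expT-one X

  expT-var-≡ : (X : Subset n) → expT (var X) X ≡ 1
  expT-var-≡ [] = refl
  expT-var-≡ (false ∷ X) = expT-var-≡ X
  expT-var-≡ (true ∷ X) = expT-var-≡ X

  expT-var-≢ : (X Y : Subset n) → expT (var X) Y ≢ 0 → X ≡ Y
  expT-var-≢ [] [] h = refl
  expT-var-≢ (false ∷ X) (false ∷ Y) h = cong (false ∷_) (expT-var-≢ X Y h)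
  expT-var-≢ (true ∷ X) (true ∷ Y) h = cong (true ∷_) (expT-var-≢ X Y h)
  expT-var-≢ (false ∷ X) (true ∷ Y) h = ⊥-elim (h (expT-one Y))
  expT-var-≢ (true ∷ X) (false ∷ Y) h = ⊥-elim (h (expT-one Y))

  private
    swap4 : ∀ a b c d → (a + b) + (c + d) ≡ (a + c) + (b + d)
    swap4 a b c d = trans (ℕP.+-assoc a b (c + d)) (trans (cong (a +_) (trans (sym (ℕP.+-assoc b c d))
      (trans (cong (_+ d) (ℕP.+-comm b c)) (ℕP.+-assoc c b d)))) (sym (ℕP.+-assoc a c (b + d))))

  degT-mulT : (s t : Tbl n) → degT (mulT s t) ≡ degT s + degT t
  degT-mulT {zero} s t = refl
  degT-mulT {suc n} (a , b) (c , d) = trans (cong₂ _+_ (degT-mulT a c) (degT-mulT b d)) (swap4 (degT a) (degT c) (degT b) (degT d))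

  degT-one : ∀ n → degT (one {n}) ≡ 0
  degT-one zero = refl
  degT-one (suc n) = cong₂ _+_ (degT-one n) (degT-one n)

  degT-var : (X : Subset n) → degT (var X) ≡ 1
  degT-var [] = refl
  degT-var {suc n} (false ∷ X) = cong₂ _+_ (degT-var X) (degT-one n)
  degT-var {suc n} (true ∷ X) = cong₂ _+_ (degT-one n) (degT-var X)

  degT-0 : (t : Tbl n) → degT t ≡ 0 → t ≡ one
  degT-0 {zero} t h = h
  degT-0 {suc n} (a , b) h = cong₂ _,_ (degT-0 a (ℕP.m+n≡0⇒m≡0 _ h)) (degT-0 b (ℕP.m+n≡0⇒n≡0 (degT a) h))

  yexp-mulT : (s t : Tbl n) (e : Fin n) → yexp (mulT s t) e ≡ yexp s e + yexp t e
  yexp-mulT (a , b) (c , d) zero = degT-mulT b d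
  yexp-mulT (a , b) (c , d) (suc e) = trans (cong₂ _+_ (yexp-mulT a c e) (yexp-mulT b d e)) (swap4 (yexp a e) (yexp c e) (yexp b e) (yexp d e))

  yexp-one : (e : Fin n) → yexp one e ≡ 0
  yexp-one {suc n} zero = degT-one n
  yexp-one (suc e) = cong₂ _+_ (yexp-one e) (yexp-one e)

  yexp-var : (X : Subset n) (e : Fin n) → yexp (var X) e ≡ bit (X ! e)
  yexp-var {suc n} (false ∷ X) zero = degT-one n
  yexp-var (true ∷ X) zero = degT-var X
  yexp-var (false ∷ X) (suc e) = trans (cong (yexp (var X) e +_) (yexp-one e)) (trans (ℕP.+-identityʳ _) (yexp-var X e))
  yexp-var (true ∷ X) (suc e) = trans (cong (_+ yexp (var X) e) (yexp-one e)) (yexp-var X e)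

  peel : (t : Tbl n) (d : ℕ) → degT t ≡ suc d → ∃ λ X → ∃ λ s → t ≡ mulT (var X) s
  peel {zero} t d h = [] , d , h
  peel {suc n} (a , b) d h with degT a in eq
  ... | suc d' = let X , s , e = peel a d' eq in false ∷ X , (s , b) , cong₂ _,_ e (sym (one-mulT b))
  ... | zero = let X , s , e = peel b d h in true ∷ X , (a , s) , cong₂ _,_ (sym (one-mulT a)) e

  -- A monomial of degree `k` is a matrix with `k` rows up to the order of the rows; `decompose`
  -- picks an order.
  mono : Rows k n → Tbl n
  mono {zero} A = one
  mono {suc k} A = mulT (var (A zero)) (mono (A ∘ suc))

  degT-mono : (A : Rows k n) → degT (mono A) ≡ k
  degT-mono {zero} {n} A = degT-one n
  degT-mono {suc k} A = trans (degT-mulT (var (A zero)) _) (cong₂ _+_ (degT-var (A zero)) (degT-mono (A ∘ suc)))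

  -- This, together with `degT-mono`, turns equality of images under the toric map into equality of
  -- column sums for matrices with the same number of rows.
  yexp-mono : (A : Rows k n) (e : Fin n) → yexp (mono A) e ≡ col A e
  yexp-mono {zero} A e = yexp-one e
  yexp-mono {suc k} A e = trans (yexp-mulT (var (A zero)) _ e) (cong₂ _+_ (yexp-var (A zero) e) (yexp-mono (A ∘ suc) e))

  mono-cong : (A B : Rows k n) → (∀ r → A r ≡ B r) → mono A ≡ mono B
  mono-cong {zero} A B h = refl
  mono-cong {suc k} A B h = cong₂ mulT (cong var (h zero)) (mono-cong (A ∘ suc) (B ∘ suc) (h ∘ suc))

  expT-mono-row : (A : Rows k n) (r : Fin k) → expT (mono A) (A r) ≢ 0
  expT-mono-row A zero h = ℕP.1+n≢0 (trans (sym (cong (_+ expT (mono (A ∘ suc)) (A zero)) (expT-var-≡ (A zero)))) (trans (sym (expT-mulT (var (A zero)) _ (A zero))) h))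
  expT-mono-row A (suc r) h = expT-mono-row (A ∘ suc) r (ℕP.m+n≡0⇒n≡0 (expT (var (A zero)) (A (suc r))) (trans (sym (expT-mulT (var (A zero)) _ (A (suc r)))) h))

  expT-mono-≢0 : (A : Rows k n) (X : Subset n) → expT (mono A) X ≢ 0 → ∃ λ r → A r ≡ X
  expT-mono-≢0 {zero} A X h = ⊥-elim (h (expT-one X))
  expT-mono-≢0 {suc k} A X h with expT (var (A zero)) X ℕ.≟ 0
  ... | no ne = zero , expT-var-≢ (A zero) X ne
  ... | yes e = let r , p = expT-mono-≢0 (A ∘ suc) X (λ q → h (trans (expT-mulT (var (A zero)) _ X) (cong₂ _+_ e q))) in suc r , p

  decompose : (t : Tbl n) (k : ℕ) → degT t ≡ k → ∃ λ (A : Rows k n) → mono A ≡ t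
  decompose {n} t zero h = (λ ()) , sym (degT-0 t h)
  decompose {n} t (suc k) h =
    let X , s , e = peel t k h
        A , p = decompose s k (ℕP.suc-injective (trans (cong (_+ degT s) (sym (degT-var X))) (trans (sym (degT-mulT (var X) s)) (trans (sym (cong degT e)) h))))
    in (λ { zero → X ; (suc r) → A r }) , trans (cong (mulT (var X)) p) (sym e)

  mono-remove : (A : Rows (suc k) n) (p : Fin (suc k)) → mono A ≡ mulT (var (A p)) (mono (A ∘ punchIn p))
  mono-remove A zero = refl
  mono-remove {suc k} A (suc p) = trans (cong (mulT (var (A zero))) (mono-remove (A ∘ suc) p))
    (trans (sym (mulT-assoc (var (A zero)) (var (A (suc p))) _))
      (trans (cong (λ x → mulT x (mono (A ∘ suc ∘ punchIn p))) (mulT-comm (var (A zero)) (var (A (suc p)))))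
        (mulT-assoc (var (A (suc p))) (var (A zero)) _)))

  -- Exhibits a move as the exchange of a quadratic factor with the remaining rows as cofactor `γ`.
  -- The last component serves to show that `γ` involves only variables of cycles.
  mono-two : (A B : Rows k n) (p q : Fin k) → p ≢ q → (∀ r → r ≢ p → r ≢ q → A r ≡ B r) → ∃ λ γ →
    mono A ≡ mulT γ (mulT (var (A p)) (var (A q))) × mono B ≡ mulT γ (mulT (var (B p)) (var (B q))) ×
    (∀ X → expT γ X ≢ 0 → ∃ λ r → A r ≡ X)
  mono-two {suc zero} A B zero zero p≢q h = ⊥-elim (p≢q refl)
  mono-two {suc (suc k)} A B p q p≢q h = mono (A ∘ g) , split A , trans (split B) (cong (λ x → mulT x (mulT (var (B p)) (var (B q)))) (mono-cong (B ∘ g) (A ∘ g) (sym ∘ rest))) ,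
    λ X ne → let r , e = expT-mono-≢0 (A ∘ g) X ne in g r , e
    where
    q' : Fin (suc k)
    q' = punchOut p≢q
    g : Fin k → Fin (suc (suc k))
    g r = punchIn p (punchIn q' r)
    split : ∀ A → mono A ≡ mulT (mono (A ∘ g)) (mulT (var (A p)) (var (A q)))
    split A = trans (mono-remove A p) (trans (cong (mulT (var (A p))) (mono-remove (A ∘ punchIn p) q'))
      (trans (cong (λ x → mulT (var (A p)) (mulT (var (A x)) (mono (A ∘ g)))) (FinP.punchIn-punchOut p≢q))
        (trans (sym (mulT-assoc (var (A p)) (var (A q)) _)) (mulT-comm _ (mono (A ∘ g))))))
    rest : ∀ r → A (g r) ≡ B (g r)
    rest r = h _ (FinP.punchInᵢ≢i p _) λ eq →
      FinP.punchInᵢ≢i q' r (FinP.punchIn-injective p _ _ (trans eq (sym (FinP.punchIn-punchOut p≢q))))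

  φmono-≡ : {s t : Tbl n} → degT s ≡ degT t → (∀ e → yexp s e ≡ yexp t e) → φmono s ≡ φmono t
  φmono-≡ d y = cong₂ _∷_ d (VecP.tabulate-cong y)

  φmono-deg : {s t : Tbl n} → φmono s ≡ φmono t → degT s ≡ degT t
  φmono-deg h = cong Vec.head h

  φmono-yexp : {s t : Tbl n} → φmono s ≡ φmono t → ∀ e → yexp s e ≡ yexp t e
  φmono-yexp {s = s} {t} h e = trans (sym (VecP.lookup∘tabulate (yexp s) e)) (trans (cong (λ v → lookup (Vec.tail v) e) h) (VecP.lookup∘tabulate (yexp t) e))

open Monomials

-- Generation of the cycle ideal by quadrics, and an obstruction to it.

module ToricIdeals where

  open import Level using (Level; _⊔_)
  open import Data.List as List using (List; []; _∷_; _++_; length; removeAt; filter; deduplicate; cartesianProductWith)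
  open import Data.List.Relation.Unary.All as All using (All; []; _∷_)
  import Data.List.Relation.Unary.All.Properties as AllP
  open import Data.List.Relation.Unary.Any as Any using (Any; here; there)
  open import Data.List.Relation.Unary.Unique.Propositional using (Unique; []; _∷_)
  import Data.List.Relation.Unary.Unique.Propositional.Properties as UniqueP
  import Data.List.Relation.Unary.Unique.DecPropositional.Properties as UniqueDec
  open import Data.List.Membership.Propositional using () renaming (_∈_ to _∈ˡ_)
  import Data.List.Membership.Propositional.Properties as ∈P
  import Algebra.Properties.Ring as RingProperties
  import Algebra.Bundles

  private variable
    n m v k : ℕ

  RowsConnected : Space n → Set
  RowsConnected {n} Z = ∀ {k} (A B : Rows k n) → (∀ r → mem Z (A r)) → (∀ r → mem Z (B r)) →
    (∀ e → col A e ≡ col B e) → ∃ λ A' → Moves (mem Z) A A' × (∀ r → A' r ≡ B r)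

  allSubsets : ∀ n → List (Subset n)
  allSubsets zero = [] ∷ []
  allSubsets (suc n) = List.map (false ∷_) (allSubsets n) ++ List.map (true ∷_) (allSubsets n)

  ∈-allSubsets : (X : Subset n) → X ∈ˡ allSubsets n
  ∈-allSubsets [] = here refl
  ∈-allSubsets (false ∷ X) = ∈P.∈-++⁺ˡ (∈P.∈-map⁺ (false ∷_) (∈-allSubsets X))
  ∈-allSubsets {suc n} (true ∷ X) = ∈P.∈-++⁺ʳ (List.map (false ∷_) (allSubsets n)) (∈P.∈-map⁺ (true ∷_) (∈-allSubsets X))

  _≟φ_ : (s t : Tbl n) → Dec (φmono s ≡ φmono t)
  s ≟φ t = VecP.≡-dec ℕ._≟_ (φmono s) (φmono t)

  -- A normal form for fibres: the first monomial of the list that has the same image. The default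
  -- `δ` is returned only when the list meets the fibre nowhere.
  representative : List (Tbl n) → Tbl n → Tbl n
  representative [] δ = δ
  representative (x ∷ L) δ with x ≟φ δ
  ... | yes _ = x
  ... | no _ = representative L δ

  representative-φ : (L : List (Tbl n)) (δ : Tbl n) → φmono (representative L δ) ≡ φmono δ
  representative-φ [] δ = refl
  representative-φ (x ∷ L) δ with x ≟φ δ
  ... | yes e = e
  ... | no _ = representative-φ L δ

  representative-∈ : (L : List (Tbl n)) (δ : Tbl n) → δ ∈ˡ L → representative L δ ∈ˡ L
  representative-∈ (x ∷ L) δ p with x ≟φ δ
  representative-∈ (x ∷ L) δ p | yes e = here refl
  representative-∈ (x ∷ L) δ (here refl) | no ne = ⊥-elim (ne refl)
  representative-∈ (x ∷ L) δ (there p) | no ne = there (representative-∈ L δ p)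

  representative-cong : (L : List (Tbl n)) {δ ε : Tbl n} → δ ∈ˡ L → φmono δ ≡ φmono ε → representative L δ ≡ representative L ε
  representative-cong (x ∷ L) {δ} {ε} p e with x ≟φ δ | x ≟φ ε
  ... | yes _ | yes _ = refl
  ... | yes a | no b = ⊥-elim (b (trans a e))
  ... | no a | yes b = ⊥-elim (a (trans b (sym e)))
  representative-cong (x ∷ L) (here refl) e | no a | no b = ⊥-elim (a refl)
  representative-cong (x ∷ L) (there p) e | no a | no b = representative-cong L p e

  -- Since `N` has no repetitions, every entry left after removing one position comes from an
  -- element different from the removed one.
  removeAt-map : ∀ {a b} {A : Set a} {B : Set b} (f : A → B) (N : List A) → Unique N → ∀ i →
    ∃ λ x → x ∈ˡ N × All (λ g → ∃ λ y → y ∈ˡ N × y ≢ x × g ≡ f y) (removeAt (List.map f N) i)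
  removeAt-map f (x ∷ N) (ne ∷ u) zero = x , here refl ,
    AllP.map⁺ (All.tabulate (λ {y} p → y , there p , (λ e → All.lookup ne p (sym e)) , refl))
  removeAt-map f (x ∷ N) (ne ∷ u) (suc i) with removeAt-map f N u i
  ... | y , p , al = y , there p , (x , here refl , All.lookup ne p , refl) ∷ All.map (λ (z , q , r) → z , there q , r) al

  module Coefficients {c ℓ} (K : Field c ℓ) where
    open Field K public using (Carrier; _≈_; 0#; 1#; 1≉0; commRing) renaming (_+_ to _+ᵏ_; _*_ to _*ᵏ_; -_ to -ᵏ_; refl to ≈-refl; sym to ≈-sym; trans to ≈-trans;
      +-cong to +ᵏ-cong; +-assoc to +ᵏ-assoc; +-comm to +ᵏ-comm; +-identityˡ to +ᵏ-identityˡ; +-identityʳ to +ᵏ-identityʳ; *-cong to *ᵏ-cong; distribˡ to distribˡᵏ; zeroʳ to zeroʳᵏ; *-identityʳ to *ᵏ-identityʳ; -‿inverseʳ to -ᵏ-inverseʳ; -‿inverseˡ to -ᵏ-inverseˡ; -‿cong to -ᵏ-cong)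
    open RingProperties (Algebra.Bundles.CommutativeRing.ring commRing) public using () renaming (-‿distribʳ-* to -ᵏ-distribʳ; -‿involutive to -ᵏ-involutive)
    open Polys K public

    module _ {Mono : Set} (dec : (a b : Mono) → Dec (a ≡ b)) where

      coeff-++ : ∀ p q α → coeff dec (p ++ q) α ≈ coeff dec p α +ᵏ coeff dec q α
      coeff-++ [] q α = ≈-sym (+ᵏ-identityˡ _)
      coeff-++ ((a , β) ∷ p) q α with dec β α
      ... | yes _ = ≈-trans (+ᵏ-cong ≈-refl (coeff-++ p q α)) (≈-sym (+ᵏ-assoc a _ _))
      ... | no _ = coeff-++ p q α

      coeff-none : ∀ p α → All (λ t → proj₂ t ≢ α) p → coeff dec p α ≈ 0#
      coeff-none [] α [] = ≈-refl
      coeff-none ((a , β) ∷ p) α (ne ∷ h) with dec β α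
      ... | yes e = ⊥-elim (ne e)
      ... | no _ = coeff-none p α h

      mon : Carrier → Mono → Mono → Carrier
      mon a β α = coeff dec ((a , β) ∷ []) α

      mon-cong : ∀ {a b} β α → a ≈ b → mon a β α ≈ mon b β α
      mon-cong β α e with dec β α
      ... | yes _ = +ᵏ-cong e ≈-refl
      ... | no _ = ≈-refl

      mon-+ : ∀ a b β α → mon (a +ᵏ b) β α ≈ mon a β α +ᵏ mon b β α
      mon-+ a b β α with dec β α
      ... | yes _ = ≈-trans (+ᵏ-identityʳ _) (+ᵏ-cong (≈-sym (+ᵏ-identityʳ a)) (≈-sym (+ᵏ-identityʳ b)))
      ... | no _ = ≈-sym (+ᵏ-identityˡ 0#)

      mon-0 : ∀ β α → mon 0# β α ≈ 0#
      mon-0 β α with dec β α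
      ... | yes _ = +ᵏ-identityˡ 0#
      ... | no _ = ≈-refl

      coeff-∷ : ∀ a β p α → coeff dec ((a , β) ∷ p) α ≈ mon a β α +ᵏ coeff dec p α
      coeff-∷ a β p α = coeff-++ ((a , β) ∷ []) p α

      mon-≡ : ∀ a {β α} → β ≡ α → mon a β α ≈ a
      mon-≡ a {β} {α} e with dec β α
      ... | yes _ = +ᵏ-identityʳ a
      ... | no ne = ⊥-elim (ne e)

      mon-≢ : ∀ a {β α} → β ≢ α → mon a β α ≈ 0#
      mon-≢ a {β} {α} ne with dec β α
      ... | yes e = ⊥-elim (ne e)
      ... | no _ = ≈-refl

    interchange : ∀ a b c d → (a +ᵏ b) +ᵏ (c +ᵏ d) ≈ (a +ᵏ c) +ᵏ (b +ᵏ d)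
    interchange a b c d = ≈-trans (+ᵏ-assoc a b _) (≈-trans (+ᵏ-cong ≈-refl (≈-trans (≈-sym (+ᵏ-assoc b c d))
      (≈-trans (+ᵏ-cong (+ᵏ-comm b c) ≈-refl) (+ᵏ-assoc c b d)))) (≈-sym (+ᵏ-assoc a c _)))

  module Toric {c ℓ} (K : Field c ℓ) {n : ℕ} (M : Mat n) where
    open Coefficients K public
    open Cyc M public

    dT : (s t : Tbl n) → Dec (s ≡ t)
    dT = _≟T_

    dφ : (s t : Vec ℕ (suc n)) → Dec (s ≡ t)
    dφ = VecP.≡-dec ℕ._≟_

    scale : Carrier → Tbl n → PolX → PolX
    scale a γ = List.map (λ u → (a *ᵏ proj₁ u , mulT γ (proj₂ u)))

    coeff-scale : ∀ a γ q δ → coeffX (scale a γ q) (mulT γ δ) ≈ a *ᵏ coeffX q δ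
    coeff-scale a γ [] δ = ≈-sym (zeroʳᵏ a)
    coeff-scale a γ ((b , ε) ∷ q) δ with mulT γ ε ≟T mulT γ δ | ε ≟T δ
    ... | yes e | yes _ = ≈-trans (+ᵏ-cong ≈-refl (coeff-scale a γ q δ)) (≈-sym (distribˡᵏ a b _))
    ... | yes e | no ne = ⊥-elim (ne (mulT-cancelˡ γ e))
    ... | no ne | yes e = ⊥-elim (ne (cong (mulT γ) e))
    ... | no _ | no _ = coeff-scale a γ q δ

    coeff-scale-0 : ∀ a γ q α → (∀ δ → mulT γ δ ≡ α → coeffX q δ ≈ 0#) → coeffX (scale a γ q) α ≈ 0#
    coeff-scale-0 a γ q α h with Any.any? (λ u → mulT γ (proj₂ u) ≟T α) q
    ... | no none = coeff-none dT (scale a γ q) α (AllP.map⁺ (AllP.¬Any⇒All¬ q none))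
    ... | yes some with Any.satisfied some
    ...   | (b , δ) , refl = ≈-trans (coeff-scale a γ q δ) (≈-trans (*ᵏ-cong ≈-refl (h δ refl)) (zeroʳᵏ a))

    -- The coefficient of a product at `α` involves the coefficients of `q` only at divisors of `α`.
    coeff-*-0 : ∀ p q α → (∀ (γ δ : Tbl n) → mulT γ δ ≡ α → coeffX q δ ≈ 0#) → coeffX (p *X q) α ≈ 0#
    coeff-*-0 [] q α h = ≈-refl
    coeff-*-0 ((a , γ) ∷ p) q α h = ≈-trans (coeff-++ dT (scale a γ q) (p *X q) α)
      (≈-trans (+ᵏ-cong (coeff-scale-0 a γ q α (h γ)) (coeff-*-0 p q α h)) (+ᵏ-identityˡ 0#))

    coeff-combo-0 : ∀ hs gs α → All (λ g → ∀ (γ δ : Tbl n) → mulT γ δ ≡ α → coeffX g δ ≈ 0#) gs → coeffX (combo hs gs) α ≈ 0#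
    coeff-combo-0 [] gs α al = ≈-refl
    coeff-combo-0 (h ∷ hs) [] α al = ≈-refl
    coeff-combo-0 (h ∷ hs) (g ∷ gs) α (z ∷ al) = ≈-trans (coeff-++ dT (h *X g) (combo hs gs) α)
      (≈-trans (+ᵏ-cong (coeff-*-0 h g α z) (coeff-combo-0 hs gs α al)) (+ᵏ-identityˡ 0#))

    InRingMono : Tbl n → Set
    InRingMono α = ∀ X → ¬ IsCycle M X → expT α X ≡ 0

    -- When `δ` is the only monomial of `g` in its fibre, nothing can cancel against it under the
    -- toric map. For `g` in the kernel its coefficient is therefore zero.
    coeff-φ-isolated : ∀ g δ → All (λ t → φmono (proj₂ t) ≡ φmono δ → proj₂ t ≡ δ) g → coeff dφ (φ g) (φmono δ) ≈ coeffX g δ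
    coeff-φ-isolated [] δ [] = ≈-refl
    coeff-φ-isolated ((a , ε) ∷ g) δ (h ∷ al) with dφ (φmono ε) (φmono δ) | ε ≟T δ
    ... | yes e | yes _ = +ᵏ-cong ≈-refl (coeff-φ-isolated g δ al)
    ... | yes e | no ne = ⊥-elim (ne (h e))
    ... | no ne | yes e = ⊥-elim (ne (cong φmono e))
    ... | no _ | no _ = coeff-φ-isolated g δ al

    -- No divisor of `u` of degree at most two has a second monomial of the ring in its fibre, so no
    -- quadric of the ideal can reach `u`.
    Rigid : Tbl n → Set
    Rigid u = ∀ (γ δ : Tbl n) → mulT γ δ ≡ u → degT δ ≤ 2 → ∀ δ' → InRingMono δ' → φmono δ' ≡ φmono δ → δ' ≡ δ

    -- Generators of degree at most two have coefficient zero at all divisors of `u`, so every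
    -- combination of them has coefficient zero at `u`.
    rigid⇒¬μ≤2 : ∀ u → Rigid u → ∀ f → InI f → ¬ (coeffX f u ≈ 0#) → ¬ μ≤2
    rigid⇒¬μ≤2 u rigid f f∈I nz (gs , (allI , _ , gen , _) , quad) with gen f f∈I
    ... | hs , _ , f≈ = nz (≈-trans (f≈ u) (coeff-combo-0 hs gs u (All.zipWith vanish (allI , quad))))
      where
      vanish : ∀ {g} → InI g × (∃[ d ] (d ≤ 2 × Homogeneous d g)) → ∀ (γ δ : Tbl n) → mulT γ δ ≡ u → coeffX g δ ≈ 0#
      vanish {g} ((inR , ker) , d , d≤2 , hom) γ δ e with degT δ ℕ.≟ d
      ... | no ne = hom δ ne
      ... | yes refl = ≈-trans (≈-sym (coeff-φ-isolated g δ (All.map (λ {t} ir → rigid γ δ e d≤2 (proj₂ t) ir) inR))) (ker (φmono δ))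

    binom : Carrier → Tbl n → Tbl n → PolX
    binom a α β = (a , α) ∷ (-ᵏ a , β) ∷ []

    coeff-binom : ∀ a α β δ → coeffX (binom a α β) δ ≈ mon dT a α δ +ᵏ mon dT (-ᵏ a) β δ
    coeff-binom a α β δ = coeff-∷ dT a α ((-ᵏ a , β) ∷ []) δ

    binom-∈I : ∀ a {α β} → InRingMono α → InRingMono β → φmono α ≡ φmono β → InI (binom a α β)
    binom-∈I a {α} {β} ra rb e = (ra ∷ rb ∷ []) , λ γ → ≈-trans (coeff-∷ dφ a (φmono α) _ γ)
      (≈-trans (+ᵏ-cong ≈-refl (lem γ)) (≈-trans (≈-sym (mon-+ dφ a (-ᵏ a) (φmono α) γ)) (≈-trans (mon-cong dφ (φmono α) γ (-ᵏ-inverseʳ a)) (mon-0 dφ (φmono α) γ))))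
      where
      lem : ∀ γ → coeff dφ ((-ᵏ a , φmono β) ∷ []) γ ≈ coeff dφ ((-ᵏ a , φmono α) ∷ []) γ
      lem γ rewrite e = ≈-refl

    module _ {Z : Space n} (R : Rep M Z) where

      ring-row : ∀ {α X} → InRingMono α → expT α X ≢ 0 → mem Z X
      ring-row {α} {X} ir ne with mem? Z X
      ... | yes m = m
      ... | no nm = ⊥-elim (ne (ir X (λ cy → nm (isCycle⇒mem R cy))))

      mono-inRing : (A : Rows k n) → (∀ r → mem Z (A r)) → InRingMono (mono A)
      mono-inRing A h X nc with expT (mono A) X ℕ.≟ 0
      ... | yes e = e
      ... | no ne = let r , e = expT-mono-≢0 A X ne in ⊥-elim (nc (mem⇒isCycle R (subst (mem Z) e (h r))))

      mulT-inRing : ∀ {s t} → InRingMono s → InRingMono t → InRingMono (mulT s t)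
      mulT-inRing {s} {t} a b X nc = trans (expT-mulT s t X) (cong₂ _+_ (a X nc) (b X nc))

      var-inRing : ∀ {X} → mem Z X → InRingMono (var X)
      var-inRing {X} m Y nc with expT (var X) Y ℕ.≟ 0
      ... | yes e = e
      ... | no ne = ⊥-elim (nc (mem⇒isCycle R (subst (mem Z) (expT-var-≢ X Y ne) m)))

      module Generators (connected : RowsConnected Z) where

        cycles : List (Subset n)
        cycles = filter (mem? Z) (allSubsets n)

        products : List (Tbl n)
        products = cartesianProductWith (λ X Y → mulT (var X) (var Y)) cycles cycles

        quadrics : List (Tbl n)
        quadrics = deduplicate _≟T_ products

        ∈-quadrics : ∀ {X Y} → mem Z X → mem Z Y → mulT (var X) (var Y) ∈ˡ quadrics
        ∈-quadrics {X} {Y} a b = ∈P.∈-deduplicate⁺ _≟T_ (∈P.∈-cartesianProductWith⁺ _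
          (∈P.∈-filter⁺ (mem? Z) (∈-allSubsets X) a) (∈P.∈-filter⁺ (mem? Z) (∈-allSubsets Y) b))

        quadrics-∈ : ∀ {δ} → δ ∈ˡ quadrics → ∃ λ X → ∃ λ Y → mem Z X × mem Z Y × δ ≡ mulT (var X) (var Y)
        quadrics-∈ p = let X , Y , a , b , e = ∈P.∈-cartesianProductWith⁻ (λ X Y → mulT (var X) (var Y)) cycles cycles (∈P.∈-deduplicate⁻ _≟T_ products p)
          in X , Y , proj₂ (∈P.∈-filter⁻ (mem? Z) {xs = allSubsets n} a) , proj₂ (∈P.∈-filter⁻ (mem? Z) {xs = allSubsets n} b) , e

        quadric-inRing : ∀ {δ} → δ ∈ˡ quadrics → InRingMono δ
        quadric-inRing p with quadrics-∈ p
        ... | X , Y , a , b , refl = mulT-inRing (var-inRing a) (var-inRing b)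

        quadric-deg : ∀ {δ} → δ ∈ˡ quadrics → degT δ ≡ 2
        quadric-deg p with quadrics-∈ p
        ... | X , Y , a , b , refl = trans (degT-mulT (var X) (var Y)) (cong₂ _+_ (degT-var X) (degT-var Y))

        rep′ : Tbl n → Tbl n
        rep′ = representative quadrics

        moving? : ∀ δ → Dec (δ ≢ rep′ δ)
        moving? δ = ¬? (δ ≟T rep′ δ)

        moving : List (Tbl n)
        moving = filter moving? quadrics

        -- One binomial for each quadratic monomial that is not the representative of its fibre.
        -- Each fibre becomes a star around its representative, which keeps the generating set free
        -- of redundancy.
        generator : Tbl n → PolX
        generator δ = binom 1# δ (rep′ δ)

        generators : List PolX
        generators = List.map generator moving

        moving-∈ : ∀ {δ} → δ ∈ˡ moving → δ ∈ˡ quadrics × δ ≢ rep′ δ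
        moving-∈ = ∈P.∈-filter⁻ moving? {xs = quadrics}

        rep-rep : ∀ {δ} → δ ∈ˡ quadrics → rep′ (rep′ δ) ≡ rep′ δ
        rep-rep {δ} p = representative-cong quadrics (representative-∈ quadrics δ p) (representative-φ quadrics δ)

        All-generators : ∀ {p} {P : PolX → Set p} → (∀ δ → δ ∈ˡ moving → P (generator δ)) → All P generators
        All-generators h = AllP.map⁺ (All.tabulate (λ {δ} p → h δ p))

        generator-∈I : ∀ δ → δ ∈ˡ moving → InI (generator δ)
        generator-∈I δ p = let q , _ = moving-∈ p in
          binom-∈I 1# (quadric-inRing q) (quadric-inRing (representative-∈ quadrics δ q)) (sym (representative-φ quadrics δ))

        generator-homogeneous : ∀ δ → δ ∈ˡ moving → Homogeneous 2 (generator δ)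
        generator-homogeneous δ p α ne = let q , _ = moving-∈ p in
          coeff-none dT (generator δ) α ((λ { refl → ne (quadric-deg q) }) ∷ (λ { refl → ne (quadric-deg (representative-∈ quadrics δ q)) }) ∷ [])

        same-degree-divisor : ∀ (γ δ α : Tbl n) → mulT γ δ ≡ α → degT δ ≡ degT α → δ ≡ α
        same-degree-divisor γ δ α e d = trans (sym (one-mulT δ)) (trans (cong (λ g → mulT g δ) (sym (degT-0 γ
          (ℕP.+-cancelʳ-≡ (degT δ) (degT γ) 0 (trans (sym (degT-mulT γ δ)) (trans (cong degT e) (sym d))))))) e)

        -- Among the generators only the one belonging to `δ` contains the monomial `δ`, because `δ`
        -- is not a representative. All generators being quadratic, a combination of the others
        -- cannot produce `δ` through a proper divisor either.
        minimal : ∀ i → ¬ Generates (removeAt generators i)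
        minimal i gen with removeAt-map generator moving (UniqueP.filter⁺ moving? (UniqueDec.deduplicate-! _≟T_ products)) i
        ... | δ , p , others with gen (generator δ) (generator-∈I δ p)
        ...   | hs , _ , f≈ = 1≉0 (≈-trans (≈-sym coeff-one) (≈-trans (f≈ δ) (coeff-combo-0 hs _ δ (All.map vanish others))))
          where
          coeff-one : coeffX (generator δ) δ ≈ 1#
          coeff-one = ≈-trans (coeff-binom 1# δ (rep′ δ) δ) (≈-trans (+ᵏ-cong (mon-≡ dT 1# refl) (mon-≢ dT (-ᵏ 1#) (λ e → proj₂ (moving-∈ p) (sym e)))) (+ᵏ-identityʳ 1#))
          vanish : ∀ {g} → (∃ λ ε → ε ∈ˡ moving × ε ≢ δ × g ≡ generator ε) → ∀ (γ α : Tbl n) → mulT γ α ≡ δ → coeffX g α ≈ 0#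
          vanish (ε , q , ne , refl) γ α e = coeff-none dT (generator ε) α
            ( (λ eq → ne (same-degree-divisor γ ε δ (trans (cong (mulT γ) eq) e) (trans (quadric-deg εq) (sym (quadric-deg δq)))))
            ∷ (λ eq → let re = same-degree-divisor γ (rep′ ε) δ (trans (cong (mulT γ) eq) e) (trans (quadric-deg (representative-∈ quadrics ε εq)) (sym (quadric-deg δq)))
                          in proj₂ (moving-∈ p) (trans (sym re) (trans (sym (rep-rep εq)) (cong rep′ re))))
            ∷ [])
            where
            εq = proj₁ (moving-∈ q)
            δq = proj₁ (moving-∈ p)

        -- A recursive form of the combinations of a fixed list; it adds up entry by entry, with no
        -- need to align lists of multipliers.
        Span′ : List PolX → PolX → Set (c ⊔ ℓ)
        Span′ [] f = Level.Lift c (f ≈X [])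
        Span′ (g ∷ gs) f = ∃ λ h → InRing h × ∃ λ f' → Span′ gs f' × f ≈X ((h *X g) ++ f')

        span-≈ : ∀ gs {f f'} → f ≈X f' → Span′ gs f' → Span′ gs f
        span-≈ [] e (Level.lift z) = Level.lift (λ α → ≈-trans (e α) (z α))
        span-≈ (g ∷ gs) e (h , ir , f'' , s , z) = h , ir , f'' , s , λ α → ≈-trans (e α) (z α)

        span-0 : ∀ gs → Span′ gs []
        span-0 [] = Level.lift (λ α → ≈-refl)
        span-0 (g ∷ gs) = [] , [] , [] , span-0 gs , λ α → ≈-refl

        *X-++ : ∀ p q g → ((p ++ q) *X g) ≈X ((p *X g) ++ (q *X g))
        *X-++ [] q g α = ≈-refl
        *X-++ ((a , γ) ∷ p) q g α = ≈-trans (coeff-++ dT (scale a γ g) ((p ++ q) *X g) α)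
          (≈-trans (+ᵏ-cong ≈-refl (*X-++ p q g α)) (≈-trans (+ᵏ-cong ≈-refl (coeff-++ dT (p *X g) (q *X g) α))
            (≈-trans (≈-sym (+ᵏ-assoc _ _ _)) (≈-trans (+ᵏ-cong (≈-sym (coeff-++ dT (scale a γ g) (p *X g) α)) ≈-refl)
              (≈-sym (coeff-++ dT (scale a γ g ++ (p *X g)) (q *X g) α))))))

        span-+ : ∀ gs {f f'} → Span′ gs f → Span′ gs f' → Span′ gs (f ++ f')
        span-+ [] {f} {f'} (Level.lift a) (Level.lift b) = Level.lift (λ α → ≈-trans (coeff-++ dT f f' α) (≈-trans (+ᵏ-cong (a α) (b α)) (+ᵏ-identityˡ 0#)))
        span-+ (g ∷ gs) {f} {f'} (h , ir , f₁ , s , e) (h' , ir' , f₁' , s' , e') =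
          h ++ h' , AllP.++⁺ ir ir' , f₁ ++ f₁' , span-+ gs s s' , λ α →
            ≈-trans (coeff-++ dT f f' α) (≈-trans (+ᵏ-cong (≈-trans (e α) (coeff-++ dT (h *X g) f₁ α)) (≈-trans (e' α) (coeff-++ dT (h' *X g) f₁' α)))
              (≈-trans (interchange _ _ _ _) (≈-trans (+ᵏ-cong (≈-trans (≈-sym (coeff-++ dT (h *X g) (h' *X g) α)) (≈-sym (*X-++ h h' g α))) (≈-sym (coeff-++ dT f₁ f₁' α)))
                (≈-sym (coeff-++ dT ((h ++ h') *X g) (f₁ ++ f₁') α)))))

        span-generator : ∀ gs {g} h → g ∈ˡ gs → InRing h → Span′ gs (h *X g)
        span-generator (g ∷ gs) h (here refl) ir = h , ir , [] , span-0 gs , λ α → ≈-sym (≈-trans (coeff-++ dT (h *X g) [] α) (+ᵏ-identityʳ _))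
        span-generator (g ∷ gs) h (there p) ir = [] , [] , h *X _ , span-generator gs h p ir , λ α → ≈-refl

        span⇒combo : ∀ gs {f} → Span′ gs f → ∃[ hs ] (All InRing hs × f ≈X combo hs gs)
        span⇒combo [] (Level.lift e) = [] , [] , e
        span⇒combo (g ∷ gs) (h , ir , f' , s , e) = let hs , irs , e' = span⇒combo gs s in
          h ∷ hs , ir ∷ irs , λ α → ≈-trans (e α) (≈-trans (coeff-++ dT (h *X g) f' α) (≈-trans (+ᵏ-cong ≈-refl (e' α)) (≈-sym (coeff-++ dT (h *X g) (combo hs gs) α))))

        -- All coefficients `a` are included so that the relation is symmetric and can be used
        -- directly on a term of a polynomial.
        record Linked (α β : Tbl n) : Set (c ⊔ ℓ) where
          constructor linked
          field link : ∀ a → Span′ generators (binom a α β)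
        open Linked

        linked-refl : ∀ {α} → Linked α α
        linked-refl {α} = linked λ a → span-≈ generators (λ δ → ≈-trans (coeff-binom a α α δ) (≈-trans (≈-sym (mon-+ dT a (-ᵏ a) α δ))
          (≈-trans (mon-cong dT α δ (-ᵏ-inverseʳ a)) (mon-0 dT α δ)))) (span-0 generators)

        linked-sym : ∀ {α β} → Linked α β → Linked β α
        linked-sym {α} {β} l = linked λ a → span-≈ generators (λ δ → ≈-trans (coeff-binom a β α δ) (≈-trans (+ᵏ-comm _ _)
          (≈-trans (+ᵏ-cong ≈-refl (mon-cong dT β δ (≈-sym (-ᵏ-involutive a)))) (≈-sym (coeff-binom (-ᵏ a) α β δ))))) (link l (-ᵏ a))

        linked-trans : ∀ {α β γ} → Linked α β → Linked β γ → Linked α γ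
        linked-trans {α} {β} {γ} l l' = linked λ a → span-≈ generators (λ δ →
          ≈-trans (coeff-binom a α γ δ) (≈-sym (≈-trans (coeff-++ dT (binom a α β) (binom a β γ) δ)
            (≈-trans (+ᵏ-cong (coeff-binom a α β δ) (coeff-binom a β γ δ))
              (≈-trans (+ᵏ-assoc _ _ _) (+ᵏ-cong ≈-refl (≈-trans (≈-sym (+ᵏ-assoc _ _ _)) (≈-trans (+ᵏ-cong
                (≈-trans (≈-sym (mon-+ dT (-ᵏ a) a β δ)) (≈-trans (mon-cong dT β δ (-ᵏ-inverseˡ a)) (mon-0 dT β δ))) ≈-refl) (+ᵏ-identityˡ _)))))))))
          (span-+ generators (link l a) (link l' a))

        linked-representative : ∀ {γ δ} → InRingMono γ → δ ∈ˡ quadrics → Linked (mulT γ δ) (mulT γ (rep′ δ))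
        linked-representative {γ} {δ} ir p with δ ≟T rep′ δ
        ... | yes e = subst (λ x → Linked (mulT γ δ) (mulT γ x)) e linked-refl
        ... | no ne = linked λ a → span-≈ generators (λ α →
            ≈-trans (coeff-binom a (mulT γ δ) (mulT γ (rep′ δ)) α) (≈-sym (≈-trans (coeff-∷ dT (a *ᵏ 1#) (mulT γ δ) _ α)
              (+ᵏ-cong (mon-cong dT (mulT γ δ) α (*ᵏ-identityʳ a)) (mon-cong dT (mulT γ (rep′ δ)) α (≈-trans (≈-sym (-ᵏ-distribʳ a 1#)) (-ᵏ-cong (*ᵏ-identityʳ a))))))))
            (span-generator generators ((a , γ) ∷ []) (∈P.∈-map⁺ generator (∈P.∈-filter⁺ moving? p ne)) (ir ∷ []))

        linked-quadric : ∀ {γ δ ε} → InRingMono γ → δ ∈ˡ quadrics → ε ∈ˡ quadrics → φmono δ ≡ φmono ε → Linked (mulT γ δ) (mulT γ ε)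
        linked-quadric {γ} {δ} {ε} ir p q e = linked-trans (linked-representative ir p)
          (subst (λ x → Linked (mulT γ x) (mulT γ ε)) (sym (representative-cong quadrics p e)) (linked-sym (linked-representative ir q)))

        linked-move : (A : Rows k n) → (∀ r → mem Z (A r)) → ∀ p q w → p ≢ q → mem Z w → w ≼ A p ⊕ A q → Linked (mono A) (mono (flip₂ A p q w))
        linked-move A h p q w ne mw le with mono-two A (flip₂ A p q w) p q ne (λ r a b → sym (cong (λ b → if b then A r ⊕ w else A r) (at₂-off a b)))
        ... | γ , e , e' , rows = subst₂ Linked (sym e) (sym e')
            (linked-quadric (λ X nc → decidable-stable (expT γ X ℕ.≟ 0) (λ ne → let r , q = rows X ne in nc (mem⇒isCycle R (subst (mem Z) q (h r)))))
              (∈-quadrics (h p) (h q)) (∈-quadrics (h' p) (h' q)) same-φ)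
          where
          h' : ∀ r → mem Z (flip₂ A p q w r)
          h' r with at₂ p q r
          ... | true = mem-⊕ Z (h r) mw
          ... | false = h r
          two : ∀ (X Y : Subset n) → degT (mulT (var X) (var Y)) ≡ 2
          two X Y = trans (degT-mulT (var X) (var Y)) (cong₂ _+_ (degT-var X) (degT-var Y))
          yy : ∀ (X Y : Subset n) x → yexp (mulT (var X) (var Y)) x ≡ bit (X ! x) + bit (Y ! x)
          yy X Y x = trans (yexp-mulT (var X) (var Y) x) (cong₂ _+_ (yexp-var X x) (yexp-var Y x))
          same-φ : φmono (mulT (var (A p)) (var (A q))) ≡ φmono (mulT (var (flip₂ A p q w p)) (var (flip₂ A p q w q)))
          same-φ = φmono-≡ (trans (two (A p) (A q)) (sym (two (flip₂ A p q w p) (flip₂ A p q w q))))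
            (λ x → trans (yy (A p) (A q) x) (sym (trans (yy (flip₂ A p q w p) (flip₂ A p q w q) x) (flip-bits A p q w ne le x))))

        linked-moves : {A B : Rows k n} → (∀ r → mem Z (A r)) → Moves (mem Z) A B → Linked (mono A) (mono B)
        linked-moves h stop = linked-refl
        linked-moves {A = A} h (move p q w ne mw le ms) = linked-trans (linked-move A h p q w ne mw le) (linked-moves h' ms)
          where
          h' : ∀ r → mem Z (flip₂ A p q w r)
          h' r with at₂ p q r
          ... | true = mem-⊕ Z (h r) mw
          ... | false = h r

        linked-fibre : ∀ {α β} → InRingMono α → InRingMono β → φmono α ≡ φmono β → Linked α β
        linked-fibre {α} {β} ra rb e =
          let A , pA = decompose α (degT α) refl
              B , pB = decompose β (degT α) (sym (φmono-deg e))
              mA = λ r → ring-row {X = A r} ra (subst (λ t → expT t (A r) ≢ 0) pA (expT-mono-row A r))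
              mB = λ r → ring-row {X = B r} rb (subst (λ t → expT t (B r) ≢ 0) pB (expT-mono-row B r))
              A' , ms , eq = connected A B mA mB (λ x → trans (sym (yexp-mono A x)) (trans (cong (λ t → yexp t x) pA)
                (trans (φmono-yexp e x) (trans (cong (λ t → yexp t x) (sym pB)) (yexp-mono B x)))))
          in subst₂ Linked pA (trans (mono-cong A' B eq) pB) (linked-moves mA ms)

        -- The term with monomial `α` is split into a binomial inside one fibre and a term that
        -- merges with an existing one; `shorter` says that the polynomial has lost a term.
        record Absorbed (a : Carrier) (α : Tbl n) (f : PolX) : Set (c ⊔ ℓ) where
          field
            rest    : PolX
            shorter : length rest ≡ length f
            inRing  : InRing rest
            target  : Tbl n
            target-inRing : InRingMono target
            same-φ  : φmono α ≡ φmono target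
            splits  : ((a , α) ∷ f) ≈X (binom a α target ++ rest)
            image   : ∀ β → coeff dφ (φ ((a , α) ∷ f)) β ≈ coeff dφ (φ rest) β

        absorb : ∀ a α f → InRing f → Any (λ t → φmono α ≡ φmono (proj₂ t)) f → Absorbed a α f
        absorb a α ((b , β) ∷ f) (ir ∷ irs) (here e) = record
          { rest = (a +ᵏ b , β) ∷ f ; shorter = refl ; inRing = ir ∷ irs ; target = β ; target-inRing = ir ; same-φ = e
          ; splits = λ δ → ≈-trans (coeff-∷ dT a α _ δ) (≈-sym (≈-trans (coeff-∷ dT a α _ δ) (+ᵏ-cong ≈-refl
              (≈-trans (coeff-∷ dT (-ᵏ a) β _ δ) (≈-trans (+ᵏ-cong ≈-refl (coeff-∷ dT (a +ᵏ b) β f δ))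
                (≈-trans (≈-sym (+ᵏ-assoc _ _ _)) (≈-trans (+ᵏ-cong (≈-trans (≈-sym (mon-+ dT (-ᵏ a) (a +ᵏ b) β δ))
                  (mon-cong dT β δ (≈-trans (≈-sym (+ᵏ-assoc _ _ _)) (≈-trans (+ᵏ-cong (-ᵏ-inverseˡ a) ≈-refl) (+ᵏ-identityˡ b))))) ≈-refl) (≈-sym (coeff-∷ dT b β f δ)))))))))
          ; image = λ γ → ≈-trans (coeff-∷ dφ a (φmono α) _ γ) (≈-trans (+ᵏ-cong ≈-refl (coeff-∷ dφ b (φmono β) (φ f) γ))
              (≈-trans (≈-sym (+ᵏ-assoc _ _ _)) (≈-trans (+ᵏ-cong (≈-trans (+ᵏ-cong (subst (λ x → mon dφ a (φmono α) γ ≈ mon dφ a x γ) e ≈-refl) ≈-refl)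
                (≈-sym (mon-+ dφ a b (φmono β) γ))) ≈-refl) (≈-sym (coeff-∷ dφ (a +ᵏ b) (φmono β) (φ f) γ))))) }
        absorb a α ((b , β) ∷ f) (ir ∷ irs) (there p) = let open Absorbed (absorb a α f irs p) in record
          { rest = (b , β) ∷ rest ; shorter = cong suc shorter ; inRing = ir ∷ inRing ; target = target ; target-inRing = target-inRing ; same-φ = same-φ
          ; splits = λ δ → ≈-trans (coeff-∷ dT a α _ δ) (≈-trans (+ᵏ-cong ≈-refl (coeff-∷ dT b β f δ)) (≈-trans (rotate _ _ _)
              (≈-trans (+ᵏ-cong ≈-refl (≈-trans (≈-sym (coeff-∷ dT a α f δ)) (≈-trans (splits δ) (coeff-++ dT (binom a α target) rest δ))))
                (≈-trans (rotate _ _ _) (≈-trans (+ᵏ-cong ≈-refl (≈-sym (coeff-∷ dT b β rest δ))) (≈-sym (coeff-++ dT (binom a α target) _ δ)))))))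
          ; image = λ γ → ≈-trans (coeff-∷ dφ a (φmono α) _ γ) (≈-trans (+ᵏ-cong ≈-refl (coeff-∷ dφ b (φmono β) (φ f) γ)) (≈-trans (rotate _ _ _)
              (≈-trans (+ᵏ-cong ≈-refl (≈-trans (≈-sym (coeff-∷ dφ a (φmono α) (φ f) γ)) (image γ))) (≈-sym (coeff-∷ dφ b (φmono β) (φ rest) γ))))) }
          where
          rotate : ∀ x y z → x +ᵏ (y +ᵏ z) ≈ y +ᵏ (x +ᵏ z)
          rotate x y z = ≈-trans (≈-sym (+ᵏ-assoc x y z)) (≈-trans (+ᵏ-cong (+ᵏ-comm x y) ≈-refl) (+ᵏ-assoc y x z))

        -- Induction on the number of terms. A leading term with a partner in its fibre is absorbed
        -- at the cost of a binomial, which lies in the span by `linked-fibre`; one without a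
        -- partner has coefficient zero.
        spans : ∀ k f → length f ≤ k → InI f → Span′ generators f
        spans k [] _ _ = span-0 generators
        spans (suc k) ((a , α) ∷ f) (s≤s le) (ir ∷ irs , ker) with Any.any? (λ t → α ≟φ proj₂ t) f
        ... | yes p = let open Absorbed (absorb a α f irs p) in
            span-≈ generators splits (span-+ generators (link (linked-fibre ir target-inRing same-φ) a)
              (spans k rest (subst (_≤ k) (sym shorter) le) (inRing , λ β → ≈-trans (≈-sym (image β)) (ker β))))
        ... | no none = span-≈ generators (λ δ → ≈-trans (coeff-∷ dT a α f δ) (≈-trans (+ᵏ-cong (≈-trans (mon-cong dT α δ a≈0) (mon-0 dT α δ)) ≈-refl) (+ᵏ-identityˡ _)))
            (spans k f le (irs , λ β → ≈-trans (≈-sym (≈-trans (coeff-∷ dφ a (φmono α) (φ f) β)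
              (≈-trans (+ᵏ-cong (≈-trans (mon-cong dφ (φmono α) β a≈0) (mon-0 dφ (φmono α) β)) ≈-refl) (+ᵏ-identityˡ _)))) (ker β)))
          where
          -- No other term has the same image, so `a` is the coefficient of the image polynomial at
          -- `φmono α`, and that polynomial is zero.
          a≈0 : a ≈ 0#
          a≈0 = ≈-trans (≈-sym (≈-trans (+ᵏ-cong (mon-≡ dφ a {φmono α} {φmono α} refl) (coeff-none dφ (φ f) (φmono α)
            (AllP.map⁺ (All.map (λ h e → h (sym e)) (AllP.¬Any⇒All¬ f none))))) (+ᵏ-identityʳ a)))
            (≈-trans (≈-sym (coeff-∷ dφ a (φmono α) (φ f) (φmono α))) (ker (φmono α)))

        connected⇒μ≤2 : μ≤2
        connected⇒μ≤2 = generators ,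
          ( All-generators generator-∈I , All-generators (λ δ p → 2 , generator-homogeneous δ p)
          , (λ f f∈I → span⇒combo generators (spans (length f) f ℕP.≤-refl f∈I)) , minimal)
          , All-generators (λ δ p → 2 , ℕP.≤-refl , generator-homogeneous δ p)

open ToricIdeals

-- Connected fibres for series-parallel matroids, and the quartic obstruction.

module QuarticRelation where

  private variable
    n m v k : ℕ

  moves-mem : (Z : Space m) {A B : Rows k m} → (∀ r → mem Z (A r)) → Moves (mem Z) A B → ∀ r → mem Z (B r)
  moves-mem Z h stop = h
  moves-mem Z {A} h (move p q w _ mw _ ms) = moves-mem Z h' ms
    where
    h' : ∀ r → mem Z (flip₂ A p q w r)
    h' r with at₂ p q r
    ... | true = mem-⊕ Z (h r) mw
    ... | false = h r

  -- All rows have root value `false` in both matrices, so matching with a fixed root column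
  -- suffices.
  seriesParallel⇒rowsConnected : {M : Mat m} (SP : SeriesParallel M) → RowsConnected (SeriesParallel.space SP)
  seriesParallel⇒rowsConnected SP {k} A B hA hB ce = finish (matched (good term linear))
    where
    open SeriesParallel SP
    sc : SameCols (leaves term) A B
    sc = same (λ x _ → ce x)
    τ : Fin k → Bool
    τ _ = false
    matched : Good term → Matches (leaves term) (Fixing term) A B
    matched (nonloop _ fixed _) = fixed A B τ (λ r → proj₂ (sound _ (hA r))) (λ r → proj₂ (sound _ (hB r))) sc
    matched (loop _ free) = free A B τ τ (λ r → proj₂ (sound _ (hA r))) (λ r → proj₂ (sound _ (hB r))) sc
    finish : Matches (leaves term) (Fixing term) A B → ∃ λ A' → Moves (mem space) A A' × (∀ r → A' r ≡ B r)
    finish (A' , ms , ag) = A' , ms' , λ r → ext λ x → case leaves term ! x 𝔹.≟ true of λ where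
        (yes p) → on (ag r) x p
        (no np) → trans (≢true⇒false (λ p → np (at (proj₁ (sound _ (moves-mem space hA ms' r))) x p)))
                    (sym (≢true⇒false (λ p → np (at (proj₁ (sound _ (hB r))) x p))))
      where
      ms' : Moves (mem space) A A'
      ms' = moves-map (λ w (a , b) → complete w a b) ms

  -- `quad zero` is empty, and the sum of two distinct triangles of K4 is a quadrilateral.
  quad : Fin 4 → Subset 6
  quad a = triangle zero ⊕ triangle a

  quad-even : ∀ a → mem (evenSpace (ends K4)) (quad a)
  quad-even a = mem-⊕ (evenSpace (ends K4)) {triangle zero} {triangle a} (triangle-even zero) (triangle-even a)

  -- Each edge of K4 lies in two triangles and in two quadrilaterals, so the two quadruples have the
  -- same column sums.
  triangles-quads : ∀ i → ∑ (λ a → bit (triangle a ! i)) ≡ ∑ (λ a → bit (quad a ! i))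
  triangles-quads = ⌊⌋-true (FinP.all? (λ i → ∑ (λ a → bit (triangle a ! i)) ℕ.≟ ∑ (λ a → bit (quad a ! i)))) refl

  triangle≢∅ : ∀ a → ∃ λ i → triangle a ! i ≢ quad zero ! i
  triangle≢∅ = ⌊⌋-true (FinP.all? (λ a → FinP.any? (λ i → ¬? (triangle a ! i 𝔹.≟ quad zero ! i)))) refl

  -- Two triangles cannot be exchanged for other cycles with the same multiset union.
  two-triangles : ∀ X → mem (evenSpace (ends K4)) X → ∀ a b → (∀ i → triangle a ! i ≡ triangle b ! i → X ! i ≡ triangle a ! i) → X ≡ triangle a ⊎ X ≡ triangle b
  two-triangles = ⌊⌋-true (allSubset? (λ X → mem? (evenSpace (ends K4)) X →-dec FinP.all? (λ a → FinP.all? (λ b →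
    (FinP.all? (λ i → (triangle a ! i 𝔹.≟ triangle b ! i) →-dec (X ! i 𝔹.≟ triangle a ! i))
      →-dec ((X ≟ˢ triangle a) ⊎-dec (X ≟ˢ triangle b))))))) refl

  col-values : (A B : Rows k m) (x : Fin m) (f g : Fin k → Bool) → (∀ a → A a ! x ≡ f a) → (∀ a → B a ! x ≡ g a) →
    ∑ (λ a → bit (f a)) ≡ ∑ (λ a → bit (g a)) → col A x ≡ col B x
  col-values A B x f g hf hg e = trans (∑.sum-cong-≗ (λ a → cong bit (hf a))) (trans e (∑.sum-cong-≗ (λ a → cong bit (sym (hg a)))))

  bit-inj : ∀ {a b} → bit a ≡ bit b → a ≡ b
  bit-inj {true} {true} _ = refl
  bit-inj {false} {false} _ = refl

  bits-same : ∀ a b c d → bit a + (bit b + 0) ≡ bit c + (bit d + 0) → c ≡ d → a ≡ c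
  bits-same true true true true _ _ = refl
  bits-same false false false false _ _ = refl
  bits-same true false true true () _
  bits-same false true true true () _
  bits-same false false true true () _
  bits-same true true false false () _
  bits-same true false false false () _
  bits-same false true false false () _

  module Obstruction {M : Mat m} {Z : Space m} (R : Rep M Z) {N : Mat m} (F : Faithful M Z N)
    (I : SpaceIso (ground N) (Faithful.space F) (evenSpace (ends K4))) where
    open Faithful F
    open SpaceIso I

    lift₄ : ∀ X → mem (evenSpace (ends K4)) X → ∃ λ z → mem Z z × Avoids D z × (∀ i → z ! f i ≡ X ! i)
    lift₄ X mX = let z , zm , av , h = lift (img f X) (to X mX) in z , zm , av , λ i → trans (h (f i) (inS i)) (img-! f inj X i)

    -- Lets statements about K4 decide equalities in `M`: by `traced` every coordinate of a cycle
    -- avoiding `D` is zero or a copy of one in the minor.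
    determined : ∀ y z → mem Z y → mem Z z → Avoids D y → Avoids D z → (∀ i → y ! f i ≡ z ! f i) → y ≡ z
    determined y z my mz ay az h = ext λ x → case traced x of λ where
      (inj₁ g) → trans (g y my ay) (sym (g z mz az))
      (inj₂ (g , gN , e)) → let i , fi = onto g gN in
        trans (e y my ay) (trans (cong (y !_) (sym fi)) (trans (h i) (trans (cong (z !_) fi) (sym (e z mz az)))))

    record Lift (A : Rows 4 m) (X : Fin 4 → Subset 6) : Set where
      field
        isCycle : ∀ a → mem Z (A a)
        avoids  : ∀ a → Avoids D (A a)
        values  : ∀ a i → A a ! f i ≡ X a ! i

    liftRows : (X : Fin 4 → Subset 6) → (∀ a → mem (evenSpace (ends K4)) (X a)) → ∃ λ A → Lift A X
    liftRows X h = (λ a → proj₁ (lift₄ (X a) (h a))) , record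
      { isCycle = λ a → proj₁ (proj₂ (lift₄ (X a) (h a)))
      ; avoids = λ a → proj₁ (proj₂ (proj₂ (lift₄ (X a) (h a))))
      ; values = λ a → proj₂ (proj₂ (proj₂ (lift₄ (X a) (h a)))) }

    -- The quartic relation: the four triangles of K4 against the empty cycle and the three quadrilaterals.
    module Quartic (△ □ : Fin 4 → Subset 6) (balanced : ∀ i → ∑ (λ a → bit (△ a ! i)) ≡ ∑ (λ a → bit (□ a ! i)))
      (distinct : ∀ a → ∃ λ i → △ a ! i ≢ □ zero ! i)
      (no-exchange : ∀ X → mem (evenSpace (ends K4)) X → ∀ a b → (∀ i → △ a ! i ≡ △ b ! i → X ! i ≡ △ a ! i) → X ≡ △ a ⊎ X ≡ △ b)
      (t s : Rows 4 m) (tL : Lift t △) (sL : Lift s □) where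
      open Lift tL renaming (isCycle to t-mem; avoids to t-avoids; values to t-!)
      open Lift sL renaming (isCycle to s-mem; avoids to s-avoids; values to s-!)

      cols-equal : ∀ x → col t x ≡ col s x
      cols-equal x = [ absent , copied ]′ (traced x)
        where
        absent : (∀ z → mem Z z → Avoids D z → z ! x ≡ false) → col t x ≡ col s x
        absent g = col-values t s x (λ _ → false) (λ _ → false) (λ a → g (t a) (t-mem a) (t-avoids a)) (λ a → g (s a) (s-mem a) (s-avoids a)) refl
        copied : (∃ λ g → ground N ! g ≡ true × (∀ z → mem Z z → Avoids D z → z ! x ≡ z ! g)) → col t x ≡ col s x
        copied (g , gN , e) = let i , fi = onto g gN in
          col-values t s x (λ a → △ a ! i) (λ a → □ a ! i)
            (λ a → trans (e (t a) (t-mem a) (t-avoids a)) (trans (cong (t a !_) (sym fi)) (t-! a i)))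
            (λ a → trans (e (s a) (s-mem a) (s-avoids a)) (trans (cong (s a !_) (sym fi)) (s-! a i))) (balanced i)

      u v₄ : Tbl m
      u = mono t
      v₄ = mono s

      φ-equal : φmono u ≡ φmono v₄
      φ-equal = φmono-≡ (trans (degT-mono t) (sym (degT-mono s))) (λ e → trans (yexp-mono t e) (trans (cols-equal e) (sym (yexp-mono s e))))

      u≢v : u ≢ v₄
      u≢v e = let a , p = expT-mono-≢0 t (s zero) (λ q → expT-mono-row s zero (trans (cong (λ w → expT w (s zero)) (sym e)) q))
                  i , d = distinct a
              in d (trans (sym (t-! a i)) (trans (cong (_! f i) p) (s-! zero i)))

      zero-col : ∀ {k} (A : Rows k m) x → col A x ≡ 0 → ∀ r → A r ! x ≡ false
      zero-col A x h zero = bit-inj {b = false} (ℕP.m+n≡0⇒m≡0 (bit (A zero ! x)) h)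
      zero-col A x h (suc r) = zero-col (A ∘ suc) x (ℕP.m+n≡0⇒n≡0 (bit (A zero ! x)) h) r

      col-zero : ∀ {k} (A : Rows k m) x → (∀ r → A r ! x ≡ false) → col A x ≡ 0
      col-zero {zero} A x h = refl
      col-zero {suc k} A x h = cong₂ _+_ (cong bit (h zero)) (col-zero (A ∘ suc) x (h ∘ suc))

      pattern 0f = zero
      pattern 1f = suc zero

      -- A single row is given by its column sums. For two rows, the competitor also avoids `D` and
      -- so restricts to K4, where `no-exchange` leaves only the two original triangles; the second
      -- row is then forced.
      exchange : ∀ {k} → k ≤ 2 → (R S : Rows k m) → (∀ r → ∃ λ a → t a ≡ R r) → (∀ r → mem Z (S r)) → (∀ x → col R x ≡ col S x) → mono S ≡ mono R
      exchange {0} _ R S hR hS ce = refl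
      exchange {1} _ R S hR hS ce = mono-cong S R λ { zero → ext (λ x → bit-inj (sym
        (trans (sym (ℕP.+-identityʳ _)) (trans (ce x) (ℕP.+-identityʳ _))))) }
      exchange {2} _ R S hR hS ce = go (no-exchange (pre f (S 0f)) even a b agrees)
        where
        a b : Fin 4
        a = proj₁ (hR 0f)
        b = proj₁ (hR 1f)
        -- The column sums over `D` vanish for `R`, hence for `S`, and natural numbers adding up to
        -- zero are all zero.
        S-avoids : ∀ r → Avoids D (S r)
        S-avoids r x Dx = zero-col S x (trans (sym (ce x)) (col-zero R x (λ q → trans (cong (_! x) (sym (proj₂ (hR q)))) (t-avoids (proj₁ (hR q)) x Dx)))) r
        R-avoids : ∀ r → Avoids D (R r)
        R-avoids r = subst (Avoids D) (proj₂ (hR r)) (t-avoids (proj₁ (hR r)))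
        R-mem : ∀ r → mem Z (R r)
        R-mem r = subst (mem Z) (proj₂ (hR r)) (t-mem (proj₁ (hR r)))
        R-! : ∀ r i → R r ! f i ≡ △ (proj₁ (hR r)) ! i
        R-! r i = trans (cong (_! f i) (sym (proj₂ (hR r)))) (t-! (proj₁ (hR r)) i)
        even : mem (evenSpace (ends K4)) (pre f (S 0f))
        even = let w , wm , h = restrict (S 0f) (hS 0f) (S-avoids 0f) in
          subst (mem (evenSpace (ends K4))) (ext {X = pre f w} {Y = pre f (S 0f)} (λ i → trans (pre-! f w i) (trans (sym (h (f i) (inS i))) (sym (pre-! f (S 0f) i))))) (from w wm)
        agrees : ∀ i → △ a ! i ≡ △ b ! i → pre f (S 0f) ! i ≡ △ a ! i
        agrees i e = trans (pre-! f (S 0f) i) (trans (bits-same (S 0f ! f i) (S 1f ! f i) (R 0f ! f i) (R 1f ! f i) (sym (ce (f i)))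
          (trans (R-! 0f i) (trans e (sym (R-! 1f i))))) (R-! 0f i))
        first : ∀ r → pre f (S 0f) ≡ △ (proj₁ (hR r)) → S 0f ≡ R r
        first r e = determined (S 0f) (R r) (hS 0f) (R-mem r) (S-avoids 0f) (R-avoids r)
          (λ i → trans (sym (pre-! f (S 0f) i)) (trans (cong (_! i) e) (sym (R-! r i))))
        go : pre f (S 0f) ≡ △ a ⊎ pre f (S 0f) ≡ △ b → mono S ≡ mono R
        go (inj₁ e) = mono-cong S R λ { 0f → first 0f e ; 1f → ext (λ x → bit-inj (sym (ℕP.+-cancelʳ-≡ 0 _ _ (ℕP.+-cancelˡ-≡ (bit (R 0f ! x)) _ _
          (trans (ce x) (cong (λ y → bit (y ! x) + (bit (S 1f ! x) + 0)) (first 0f e))))))) }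
        go (inj₂ e) = trans (cong₂ (λ y z → mulT (var y) (mulT (var z) one)) (first 1f e) second)
          (trans (cong (mulT (var (R 1f))) (mulT-one (var (R 0f)))) (trans (mulT-comm (var (R 1f)) (var (R 0f))) (cong (mulT (var (R 0f))) (sym (mulT-one (var (R 1f)))))))
          where
          second : S 1f ≡ R 0f
          second = ext λ x → bit-inj (ℕP.+-cancelˡ-≡ (bit (R 1f ! x)) _ _ (trans (sym (cong (λ y → bit (y ! x) + bit (S 1f ! x)) (first 1f e)))
            (trans (cong (bit (S 0f ! x) +_) (sym (ℕP.+-identityʳ _))) (trans (sym (ce x)) (trans (cong (bit (R 0f ! x) +_) (ℕP.+-identityʳ _)) (ℕP.+-comm (bit (R 0f ! x)) _))))))
      exchange {suc (suc (suc _))} (s≤s (s≤s ())) R S hR hS ce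

      module _ {c ℓ} (K : Field c ℓ) where
        open Toric K M

        -- The rows of a divisor of `u` are among the rows of `t`, so `exchange` shows that the
        -- divisor is alone in its fibre.
        u-rigid : Rigid u
        u-rigid γ δ e d≤2 δ' ir φe =
          let A , pA = decompose δ (degT δ) refl
              B , pB = decompose δ' (degT δ) (φmono-deg φe)
          in trans (sym pB) (trans (exchange d≤2 A B
               (λ r → expT-mono-≢0 t (A r) (λ q → subst (λ w → expT w (A r) ≢ 0) pA (expT-mono-row A r)
                 (ℕP.m+n≡0⇒n≡0 (expT γ (A r)) (trans (sym (expT-mulT γ δ (A r))) (trans (cong (λ w → expT w (A r)) e) q)))))
               (λ r → ring-row R {δ'} {B r} ir (subst (λ w → expT w (B r) ≢ 0) pB (expT-mono-row B r)))
               (λ x → trans (sym (yexp-mono A x)) (trans (cong (λ w → yexp w x) pA) (trans (sym (φmono-yexp φe x)) (trans (cong (λ w → yexp w x) (sym pB)) (yexp-mono B x))))))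
             pA)

        ¬μ≤2 : ¬ μ≤2
        ¬μ≤2 = rigid⇒¬μ≤2 u u-rigid (binom 1# u v₄)
          (binom-∈I 1# (mono-inRing R t t-mem) (mono-inRing R s s-mem) φ-equal)
          (λ z → 1≉0 (≈-trans (≈-sym (≈-trans (coeff-binom 1# u v₄ u) (≈-trans (+ᵏ-cong (mon-≡ dT 1# {u} {u} refl) (mon-≢ dT (-ᵏ 1#) {v₄} {u} (λ e → u≢v (sym e)))) (+ᵏ-identityʳ 1#)))) z))

    obstructs : ∀ {c ℓ} (K : Field c ℓ) → ¬ Polys.Cyc.μ≤2 K M
    obstructs K = let t , tL = liftRows triangle triangle-even ; s , sL = liftRows quad quad-even in
      Quartic.¬μ≤2 triangle quad triangles-quads triangle≢∅ two-triangles t s tL sL K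

  K4-series-minor⇒¬μ≤2 : ∀ {c ℓ} (K : Field c ℓ) {M N : Mat m} {Z : Space m} → Rep M Z → SeriesMinor M N → Iso N MK4 → ¬ Polys.Cyc.μ≤2 K M
  K4-series-minor⇒¬μ≤2 K R ms iso = let F = faithful R ms in Obstruction.obstructs R F (iso⇒spaceIso (Faithful.rep F) MK4-rep iso) K

open QuarticRelation

-- Graphs: suppression of vertices, or a contraction onto K4.

module Dichotomy where

  private variable
    n m v k : ℕ

  collapse : Fin (suc n) → Fin n → Fin (suc n) → Fin n
  collapse x a y with x Fin.≟ y
  ... | yes _ = a
  ... | no ne = punchOut ne

  collapse-same : (x : Fin (suc n)) (a : Fin n) → collapse x a x ≡ a
  collapse-same x a with x Fin.≟ x
  ... | yes _ = refl
  ... | no ne = ⊥-elim (ne refl)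

  collapse-punchIn : (x : Fin (suc n)) (a p : Fin n) → collapse x a (punchIn x p) ≡ p
  collapse-punchIn x a p with x Fin.≟ punchIn x p
  ... | yes e = ⊥-elim (FinP.punchInᵢ≢i x p (sym e))
  ... | no ne = trans (FinP.punchOut-cong x refl) (FinP.punchOut-punchIn x)

  punch-view : (x y : Fin (suc n)) → y ≢ x → ∃ λ p → y ≡ punchIn x p
  punch-view x y ne = punchOut (ne ∘ sym) , sym (FinP.punchIn-punchOut (ne ∘ sym))

  punchIn-≢ : (x : Fin (suc n)) {p q : Fin n} → punchIn x p ≢ punchIn x q → p ≢ q
  punchIn-≢ x h refl = h refl

  punchIn-≢′ : (x : Fin (suc n)) {p q : Fin n} → p ≢ q → punchIn x p ≢ punchIn x q
  punchIn-≢′ x h e = h (FinP.punchIn-injective x _ _ e)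

  contr : Fin (suc n) → Fin n → Ends (suc n) m → Ends n m
  contr x a E i = collapse x a (proj₁ (E i)) , collapse x a (proj₂ (E i))

  Joins : Ends n m → Fin m → Fin n → Fin n → Set
  Joins E i p q = E i ≡ (p , q) ⊎ E i ≡ (q , p)

  Adj : Ends n m → Fin n → Fin n → Set
  Adj E p q = ∃ λ i → Joins E i p q

  pair-≟ : (s t : Fin n × Fin n) → Dec (s ≡ t)
  pair-≟ = ×-≡-dec Fin._≟_ Fin._≟_

  joins? : (E : Ends n m) (i : Fin m) (p q : Fin n) → Dec (Joins E i p q)
  joins? E i p q = pair-≟ (E i) (p , q) ⊎-dec pair-≟ (E i) (q , p)

  adj? : (E : Ends n m) (p q : Fin n) → Dec (Adj E p q)
  adj? E p q = FinP.any? (λ i → joins? E i p q)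

  joins-sym : {E : Ends n m} {i : Fin m} {p q : Fin n} → Joins E i p q → Joins E i q p
  joins-sym (inj₁ e) = inj₂ e
  joins-sym (inj₂ e) = inj₁ e

  adj-sym : {E : Ends n m} {p q : Fin n} → Adj E p q → Adj E q p
  adj-sym {E = E} (i , j) = i , joins-sym {E = E} j

  joins-contr : (E : Ends (suc n) m) (x : Fin (suc n)) (a : Fin n) {i : Fin m} {p q : Fin (suc n)} →
    Joins E i p q → Joins (contr x a E) i (collapse x a p) (collapse x a q)
  joins-contr E x a (inj₁ e) = inj₁ (cong (λ (s , t) → collapse x a s , collapse x a t) e)
  joins-contr E x a (inj₂ e) = inj₂ (cong (λ (s , t) → collapse x a s , collapse x a t) e)

  adj-contr : (E : Ends (suc n) m) (x : Fin (suc n)) (a : Fin n) {p q : Fin (suc n)} {p' q' : Fin n} →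
    collapse x a p ≡ p' → collapse x a q ≡ q' → Adj E p q → Adj (contr x a E) p' q'
  adj-contr E x a refl refl (i , j) = i , joins-contr E x a j

  uncontr : (E : Ends (suc n) m) (x : Fin (suc n)) (a : Fin n) {p' q' : Fin n} → Adj (contr x a E) p' q' →
    ∃ λ p → ∃ λ q → Adj E p q × collapse x a p ≡ p' × collapse x a q ≡ q'
  uncontr E x a (i , inj₁ e) = proj₁ (E i) , proj₂ (E i) , (i , inj₁ refl) , cong proj₁ e , cong proj₂ e
  uncontr E x a (i , inj₂ e) = proj₂ (E i) , proj₁ (E i) , (i , inj₂ refl) , cong proj₂ e , cong proj₁ e

  -- Connectedness in terms of vertex sets. In this form it passes to contractions by pulling the
  -- set back.
  Linked : Ends n m → Set
  Linked {n} E = ∀ (W : Subset n) → Inhabited W → (∃ λ b → W ! b ≡ false) → ∃ λ p → ∃ λ q → Adj E p q × W ! p ≡ true × W ! q ≡ false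

  linked-contr : (E : Ends (suc n) m) (x : Fin (suc n)) (a : Fin n) → Linked E → Linked (contr x a E)
  linked-contr {n} E x a lk W (p , Wp) (q , Wq) =
    let s , t , ad , Ws , Wt = lk W' (punchIn x p , pull p Wp) (punchIn x q , pull q Wq)
    in collapse x a s , collapse x a t , adj-contr E x a refl refl ad , trans (sym (!-tab g s)) Ws , trans (sym (!-tab g t)) Wt
    where
    g : Fin (suc n) → Bool
    g y = W ! collapse x a y
    W' : Subset (suc n)
    W' = tabulate g
    pull : ∀ p {b} → W ! p ≡ b → W' ! punchIn x p ≡ b
    pull p h = trans (!-tab g (punchIn x p)) (trans (cong (W !_) (collapse-punchIn x a p)) h)

  -- Neighbours are counted, not edges, as contractions create loops and parallel edges. The two
  -- vertices may coincide, with each other or with `x`.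
  Low : Ends n m → Fin n → Fin n → Fin n → Set
  Low E x a b = ∀ y → Adj E x y → y ≢ x → y ≡ a ⊎ y ≡ b

  low? : (E : Ends n m) (x a b : Fin n) → Dec (Low E x a b)
  low? E x a b = FinP.all? (λ y → adj? E x y →-dec (¬? (y Fin.≟ x) →-dec ((y Fin.≟ a) ⊎-dec (y Fin.≟ b))))

  -- As the neighbours of x lie among a and b, contracting x into a amounts to suppressing x.
  data Reduces {m} : ∀ {n} → Ends n m → Set where
    base : (E : Ends 2 m) → Reduces E
    elim : ∀ {n} (E : Ends (3 + n) m) (x : Fin (3 + n)) (a b : Fin (2 + n)) → a ≢ b →
      Low E x (punchIn x a) (punchIn x b) → Adj E x (punchIn x a) → Reduces (contr x a E) → Reduces E

  data K4Model {m} : ∀ {n} → Ends n m → Set where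
    done : ∀ {n} {E : Ends n m} (c : Fin 4 → Fin n) → (∀ i j → c i ≡ c j → i ≡ j) → (∀ y → ∃ λ i → c i ≡ y) →
      (∀ i j → i ≢ j → Adj E (c i) (c j)) → K4Model E
    contracted : ∀ {n} {E : Ends (suc n) m} (x : Fin (suc n)) (a : Fin n) (i : Fin m) → Joins E i x (punchIn x a) →
      K4Model (contr x a E) → K4Model E

  two-in-three : ∀ (c : Fin 3) → ∃ λ a → ∃ λ b → a ≢ b × (∀ y → y ≢ c → y ≡ a ⊎ y ≡ b)
  two-in-three = ⌊⌋-true (FinP.all? (λ c → FinP.any? (λ a → FinP.any? (λ b → ¬? (a Fin.≟ b) ×-dec FinP.all? (λ y → ¬? (y Fin.≟ c) →-dec ((y Fin.≟ a) ⊎-dec (y Fin.≟ b))))))) refl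

  third-in-three : ∀ (a b : Fin 3) → a ≢ b → ∃ λ c → c ≢ a × c ≢ b × (∀ y → y ≢ c → y ≡ a ⊎ y ≡ b)
  third-in-three = ⌊⌋-true (FinP.all? (λ a → FinP.all? (λ b → ¬? (a Fin.≟ b) →-dec FinP.any? (λ c → ¬? (c Fin.≟ a) ×-dec ¬? (c Fin.≟ b) ×-dec
    FinP.all? (λ y → ¬? (y Fin.≟ c) →-dec ((y Fin.≟ a) ⊎-dec (y Fin.≟ b))))))) refl

  LowPair : Ends n m → Set
  LowPair {n} E = ∃ λ p → ∃ λ q → p ≢ q × ¬ Adj E p q × (∃ λ a → ∃ λ b → Low E p a b) × (∃ λ a → ∃ λ b → Low E q a b)

  low-lift : (E : Ends (suc n) m) (x : Fin (suc n)) (a' : Fin n) {p a b : Fin n} → ¬ Adj E x (punchIn x p) →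
    Low (contr x a' E) p a b → Low E (punchIn x p) (punchIn x a) (punchIn x b)
  low-lift E x a' {p} {a} {b} na low y ad y≢ with y Fin.≟ x
  ... | yes refl = ⊥-elim (na (adj-sym {E = E} ad))
  ... | no ne with punch-view x y ne
  ...   | y' , refl = [ (λ e → inj₁ (cong (punchIn x) e)) , (λ e → inj₂ (cong (punchIn x) e)) ]′
          (low y' (adj-contr E x a' (collapse-punchIn x a' p) (collapse-punchIn x a' y') ad) (punchIn-≢ x y≢))

  -- The analogue of the two nonadjacent vertices of degree at most two in a series-parallel graph.
  -- Such a pair of the reduced graph either lifts, or one of its members is not adjacent to `x` and
  -- forms a pair with it.
  low-pair : (E : Ends (4 + n) m) → Reduces E → LowPair E
  low-pair {zero} E (elim E x a b a≢b low ad R) =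
    let c , c≢a , c≢b , cover = third-in-three a b a≢b
        x≁c : ¬ Adj E x (punchIn x c)
        x≁c h = [ (λ e → c≢a (FinP.punchIn-injective x _ _ e)) , (λ e → c≢b (FinP.punchIn-injective x _ _ e)) ]′ (low _ h (FinP.punchInᵢ≢i x c))
    in x , punchIn x c , (λ e → FinP.punchInᵢ≢i x c (sym e)) , x≁c , (_ , _ , low) , (punchIn x a , punchIn x b , λ y h y≢ →
      case y Fin.≟ x of λ where
        (yes refl) → ⊥-elim (x≁c (adj-sym {E = E} h))
        (no ne) → let y' , e = punch-view x y ne in
          [ (λ q → inj₁ (trans e (cong (punchIn x) q))) , (λ q → inj₂ (trans e (cong (punchIn x) q))) ]′ (cover y' (λ q → y≢ (trans e (cong (punchIn x) q)))))
  low-pair {suc n} E (elim E x a b a≢b low ad R) with low-pair (contr x a E) R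
  ... | p , q , p≢q , p≁q , (a₁ , b₁ , lowp) , (a₂ , b₂ , lowq) with adj? E x (punchIn x p) | adj? E x (punchIn x q)
  ...   | no np | _ = x , punchIn x p , (λ e → FinP.punchInᵢ≢i x p (sym e)) , np , (_ , _ , low) , (_ , _ , low-lift E x a np lowp)
  ...   | yes _ | no nq = x , punchIn x q , (λ e → FinP.punchInᵢ≢i x q (sym e)) , nq , (_ , _ , low) , (_ , _ , low-lift E x a nq lowq)
  -- Now `p` and `q` are the two neighbours `a` and `b` of `x`; merging `x` into `a` makes them
  -- adjacent, contrary to the choice of the pair.
  ...   | yes ap | yes aq = ⊥-elim (contr' (low _ ap (FinP.punchInᵢ≢i x p)) (low _ aq (FinP.punchInᵢ≢i x q)))
    where
    inj : ∀ {s t} → punchIn x s ≡ punchIn x t → s ≡ t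
    inj = FinP.punchIn-injective x _ _
    E' = contr x a E
    contr' : punchIn x p ≡ punchIn x a ⊎ punchIn x p ≡ punchIn x b → punchIn x q ≡ punchIn x a ⊎ punchIn x q ≡ punchIn x b → ⊥
    contr' (inj₁ e) (inj₁ e') = p≢q (trans (inj e) (sym (inj e')))
    contr' (inj₂ e) (inj₂ e') = p≢q (trans (inj e) (sym (inj e')))
    contr' (inj₁ e) (inj₂ e') = p≁q (adj-contr E x a (trans (collapse-same x a) (sym (inj e))) (collapse-punchIn x a q) aq)
    contr' (inj₂ e) (inj₁ e') = p≁q (adj-sym {E = E'} (adj-contr E x a (trans (collapse-same x a) (sym (inj e'))) (collapse-punchIn x a p) ap))

  record Cubic (E : Ends n m) (x u v y : Fin n) : Set where
    constructor cubic
    field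
      nbrs : ∀ z → Adj E x z → z ≢ x → z ≡ u ⊎ z ≡ v ⊎ z ≡ y
      xu : Adj E x u
      xv : Adj E x v
      xy : Adj E x y
      x≢u : x ≢ u
      x≢v : x ≢ v
      x≢y : x ≢ y
      u≢v : u ≢ v
      u≢y : u ≢ y
      v≢y : v ≢ y

  cubic-swap₁ : {E : Ends n m} {x u v y : Fin n} → Cubic E x u v y → Cubic E x v u y
  cubic-swap₁ (cubic n a b c d e f g h i) =
    cubic (λ z p q → [ inj₂ ∘ inj₁ , [ inj₁ , inj₂ ∘ inj₂ ]′ ]′ (n z p q)) b a c e d f (g ∘ sym) i h

  cubic-swap₂ : {E : Ends n m} {x u v y : Fin n} → Cubic E x u v y → Cubic E x u y v
  cubic-swap₂ (cubic n a b c d e f g h i) =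
    cubic (λ z p q → [ inj₁ , [ inj₂ ∘ inj₂ , inj₂ ∘ inj₁ ]′ ]′ (n z p q)) a c b d f e h g (i ∘ sym)

  collapse-inj : (x : Fin (suc n)) (a : Fin n) {g h : Fin (suc n)} → h ≢ x → h ≢ punchIn x a → collapse x a g ≡ collapse x a h → g ≡ h
  collapse-inj x a {g} {h} h≢x h≢a e with punch-view x h h≢x
  ... | h' , refl with g Fin.≟ x
  ...   | yes refl = ⊥-elim (h≢a (cong (punchIn x) (sym (trans (sym (collapse-same x a)) (trans e (collapse-punchIn x a h'))))))
  ...   | no g≢x with punch-view x g g≢x
  ...     | g' , refl = cong (punchIn x) (trans (sym (collapse-punchIn x a g')) (trans e (collapse-punchIn x a h')))

  -- The contracted edge ends at the third neighbour, so the neighbourhood of the cubic vertex keeps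
  -- three distinct members. This drives the absorption of the rest of the graph.
  cubic-contr : (E : Ends (suc n) m) (s : Fin (suc n)) (a : Fin n) {x u v : Fin (suc n)} →
    x ≢ s → u ≢ s → v ≢ s → Cubic E x u v (punchIn s a) →
    Cubic (contr s a E) (collapse s a x) (collapse s a u) (collapse s a v) a
  cubic-contr E s a {x} {u} {v} x≢s u≢s v≢s (cubic n xu xv xy x≢u x≢v x≢y u≢v u≢y v≢y) = cubic
    (λ z' ad z'≢ → let p , q , ad' , ep , eq = uncontr E s a ad
                       p≡x = collapse-inj s a x≢s x≢y ep
                       hit = n q (subst (λ w → Adj E w q) p≡x ad') (λ e → z'≢ (trans (sym eq) (cong (collapse s a) e)))
                   in [ (λ e → inj₁ (trans (sym eq) (cong c e))) , [ (λ e → inj₂ (inj₁ (trans (sym eq) (cong c e)))) , (λ e → inj₂ (inj₂ (trans (sym eq) (trans (cong c e) cy)))) ]′ ]′ hit)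
    (adj-contr E s a refl refl xu) (adj-contr E s a refl refl xv) (adj-contr E s a refl cy xy)
    (λ e → x≢u (collapse-inj s a u≢s u≢y e)) (λ e → x≢v (collapse-inj s a v≢s v≢y e)) (λ e → x≢y (sym (collapse-inj s a x≢s x≢y (trans cy (sym e)))))
    (λ e → u≢v (collapse-inj s a v≢s v≢y e)) (λ e → u≢y (sym (collapse-inj s a u≢s u≢y (trans cy (sym e))))) (λ e → v≢y (sym (collapse-inj s a v≢s v≢y (trans cy (sym e)))))
    where
    c = collapse s a
    cy = collapse-punchIn s a a

  module _ {E : Ends n m} {x u v y : Fin n} (cx : Cubic E x u v y) (cu : Cubic E u x v y) (cv : Cubic E v x u y) where
    private
      module X = Cubic cx
      module U = Cubic cu
      module V = Cubic cv
      c : Fin 4 → Fin n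
      c zero = x
      c (suc zero) = u
      c (suc (suc zero)) = v
      c (suc (suc (suc zero))) = y
      inj : ∀ i j → c i ≡ c j → i ≡ j
      inj zero zero e = refl
      inj zero (suc zero) e = ⊥-elim (X.x≢u e)
      inj zero (suc (suc zero)) e = ⊥-elim (X.x≢v e)
      inj zero (suc (suc (suc zero))) e = ⊥-elim (X.x≢y e)
      inj (suc zero) zero e = ⊥-elim (X.x≢u (sym e))
      inj (suc zero) (suc zero) e = refl
      inj (suc zero) (suc (suc zero)) e = ⊥-elim (X.u≢v e)
      inj (suc zero) (suc (suc (suc zero))) e = ⊥-elim (X.u≢y e)
      inj (suc (suc zero)) zero e = ⊥-elim (X.x≢v (sym e))
      inj (suc (suc zero)) (suc zero) e = ⊥-elim (X.u≢v (sym e))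
      inj (suc (suc zero)) (suc (suc zero)) e = refl
      inj (suc (suc zero)) (suc (suc (suc zero))) e = ⊥-elim (X.v≢y e)
      inj (suc (suc (suc zero))) zero e = ⊥-elim (X.x≢y (sym e))
      inj (suc (suc (suc zero))) (suc zero) e = ⊥-elim (X.u≢y (sym e))
      inj (suc (suc (suc zero))) (suc (suc zero)) e = ⊥-elim (X.v≢y (sym e))
      inj (suc (suc (suc zero))) (suc (suc (suc zero))) e = refl
      adj : ∀ i j → i ≢ j → Adj E (c i) (c j)
      adj zero zero h = ⊥-elim (h refl)
      adj zero (suc zero) h = X.xu
      adj zero (suc (suc zero)) h = X.xv
      adj zero (suc (suc (suc zero))) h = X.xy
      adj (suc zero) zero h = U.xu
      adj (suc zero) (suc zero) h = ⊥-elim (h refl)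
      adj (suc zero) (suc (suc zero)) h = U.xv
      adj (suc zero) (suc (suc (suc zero))) h = U.xy
      adj (suc (suc zero)) zero h = V.xu
      adj (suc (suc zero)) (suc zero) h = V.xv
      adj (suc (suc zero)) (suc (suc zero)) h = ⊥-elim (h refl)
      adj (suc (suc zero)) (suc (suc (suc zero))) h = V.xy
      adj (suc (suc (suc zero))) zero h = adj-sym {E = E} X.xy
      adj (suc (suc (suc zero))) (suc zero) h = adj-sym {E = E} U.xy
      adj (suc (suc (suc zero))) (suc (suc zero)) h = adj-sym {E = E} V.xy
      adj (suc (suc (suc zero))) (suc (suc (suc zero))) h = ⊥-elim (h refl)

    Outside : Fin n → Set
    Outside z = z ≢ x × z ≢ u × z ≢ v × z ≢ y

    outside? : Dec (∃ Outside)
    outside? = FinP.any? (λ z → ¬? (z Fin.≟ x) ×-dec ¬? (z Fin.≟ u) ×-dec ¬? (z Fin.≟ v) ×-dec ¬? (z Fin.≟ y))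

    complete-model : ¬ (∃ Outside) → K4Model E
    complete-model none = done c inj surj adj
      where
      surj : ∀ z → ∃ λ i → c i ≡ z
      surj z with z Fin.≟ x | z Fin.≟ u | z Fin.≟ v | z Fin.≟ y
      ... | yes e | _ | _ | _ = zero , sym e
      ... | no _ | yes e | _ | _ = suc zero , sym e
      ... | no _ | no _ | yes e | _ = suc (suc zero) , sym e
      ... | no _ | no _ | no _ | yes e = suc (suc (suc zero)) , sym e
      ... | no a | no b | no d | no e = ⊥-elim (none (z , a , b , d , e))

    -- The vertices `x`, `u`, `v` have no neighbours outside the four, so by connectedness the edge
    -- leaving the K4 must start at `y`.
    exit : Linked E → ∃ Outside → ∃ λ t → Outside t × Adj E t y
    exit lk (z , z≢x , z≢u , z≢v , z≢y) = go (lk W (x , inl x (pair-l x u)) (z , ≢true⇒false (λ h → [ z≢x , [ z≢u , [ z≢v , z≢y ]′ ]′ ]′ (elem z h))))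
      where
      W : Subset n
      W = (⁅ x ⁆ ∪ ⁅ u ⁆) ∪ (⁅ v ⁆ ∪ ⁅ y ⁆)
      elem : ∀ s → W ! s ≡ true → s ≡ x ⊎ s ≡ u ⊎ s ≡ v ⊎ s ≡ y
      elem s h = [ (λ p → [ inj₁ , (inj₂ ∘ inj₁) ]′ (pair-! s p)) , (λ p → [ (inj₂ ∘ inj₂ ∘ inj₁) , (inj₂ ∘ inj₂ ∘ inj₂) ]′ (pair-! s p)) ]′
        (∨-true (trans (sym (!-∪ (⁅ x ⁆ ∪ ⁅ u ⁆) (⁅ v ⁆ ∪ ⁅ y ⁆) s)) h))
      inl : ∀ s → (⁅ x ⁆ ∪ ⁅ u ⁆) ! s ≡ true → W ! s ≡ true
      inl s p = trans (!-∪ (⁅ x ⁆ ∪ ⁅ u ⁆) (⁅ v ⁆ ∪ ⁅ y ⁆) s) (cong (_∨ (⁅ v ⁆ ∪ ⁅ y ⁆) ! s) p)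
      inr : ∀ s → (⁅ v ⁆ ∪ ⁅ y ⁆) ! s ≡ true → W ! s ≡ true
      inr s p = trans (!-∪ (⁅ x ⁆ ∪ ⁅ u ⁆) (⁅ v ⁆ ∪ ⁅ y ⁆) s) (trans (cong ((⁅ x ⁆ ∪ ⁅ u ⁆) ! s ∨_) p) (𝔹.∨-zeroʳ _))
      Wx = inl x (pair-l x u)
      Wu = inl u (pair-r x u)
      Wv = inr v (pair-l v y)
      Wy = inr y (pair-r v y)
      go : (∃ λ s → ∃ λ t → Adj E s t × W ! s ≡ true × W ! t ≡ false) → ∃ λ t → Outside t × Adj E t y
      go (s , t , ad , Ws , Wt) = [ (λ { refl → bad cx Wx Wu Wv Wy ad }) , [ (λ { refl → bad cu Wu Wx Wv Wy ad }) , [ (λ { refl → bad cv Wv Wx Wu Wy ad })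
          , (λ { refl → t , (t≢ Wx , t≢ Wu , t≢ Wv , t≢ Wy) , adj-sym {E = E} ad }) ]′ ]′ ]′ (elem s Ws)
        where
        t≢ : ∀ {w} → W ! w ≡ true → t ≢ w
        t≢ h refl = t≢f h Wt
        bad : ∀ {p a b d} {A : Set} → Cubic E p a b d → W ! p ≡ true → W ! a ≡ true → W ! b ≡ true → W ! d ≡ true → Adj E p t → A
        bad cb Wp Wa Wb Wd ad = ⊥-elim ([ t≢ Wa , [ t≢ Wb , t≢ Wd ]′ ]′ (Cubic.nbrs cb t ad (t≢ Wp)))

  -- A K4 attached to the rest of the graph at the single vertex y: absorb the rest into y.
  hanging⇒model : ∀ n (E : Ends (suc n) m) → Linked E → ∀ x u v y → Cubic E x u v y → Cubic E u x v y → Cubic E v x u y → K4Model E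
  hanging⇒model n E lk x u v y cx cu cv with outside? cx cu cv
  ... | no none = complete-model cx cu cv none
  ... | yes z with exit cx cu cv lk z
  ...   | t , (t≢x , t≢u , t≢v , t≢y) , (i , j) with punch-view t y (t≢y ∘ sym)
  hanging⇒model zero E lk x u v y cx cu cv | yes z | t , (t≢x , t≢u , t≢v , t≢y) , (i , j) | () , _
  hanging⇒model (suc n) E lk x u v y cx cu cv | yes z | t , (t≢x , t≢u , t≢v , t≢y) , (i , j) | y' , refl =
    contracted t y' i j (hanging⇒model n (contr t y' E) (linked-contr E t y' lk) _ _ _ _
      (cubic-contr E t y' (t≢x ∘ sym) (t≢u ∘ sym) (t≢v ∘ sym) cx)
      (cubic-contr E t y' (t≢u ∘ sym) (t≢x ∘ sym) (t≢v ∘ sym) cu)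
      (cubic-contr E t y' (t≢v ∘ sym) (t≢x ∘ sym) (t≢u ∘ sym) cv))

  module _ {n m : ℕ} (E : Ends n m) (dense : ∀ x a b → ¬ Low E x a b) where

    -- If `y` coincided with one of the other vertices or were not adjacent to `x`, two vertices
    -- would cover the neighbours of `x`, which `dense` excludes.
    to-cubic : ∀ {x u v y} → x ≢ u → x ≢ v → u ≢ v → Adj E x u → Adj E x v → (∀ z → Adj E x z → z ≢ x → z ≡ u ⊎ z ≡ v ⊎ z ≡ y) → Cubic E x u v y
    to-cubic {x} {u} {v} {y} x≢u x≢v u≢v xu xv nb = cubic nb xu xv xy x≢u x≢v x≢y u≢v u≢y v≢y
      where
      x≢y : x ≢ y
      x≢y refl = dense x u v (λ z ad z≢ → [ inj₁ , [ inj₂ , (λ e → ⊥-elim (z≢ e)) ]′ ]′ (nb z ad z≢))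
      u≢y : u ≢ y
      u≢y refl = dense x u v (λ z ad z≢ → [ inj₁ , [ inj₂ , inj₁ ]′ ]′ (nb z ad z≢))
      v≢y : v ≢ y
      v≢y refl = dense x u v (λ z ad z≢ → [ inj₁ , [ inj₂ , inj₂ ]′ ]′ (nb z ad z≢))
      xy : Adj E x y
      xy = decidable-stable (adj? E x y) λ na → dense x u v (λ z ad z≢ →
        [ inj₁ , [ inj₂ , (λ { refl → ⊥-elim (na ad) }) ]′ ]′ (nb z ad z≢))

  -- On four vertices a missing edge leaves at most two neighbours to its ends.
  complete⇒model : (E : Ends 4 m) → (∀ x a b → ¬ Low E x a b) → K4Model E
  complete⇒model E dense = done id (λ _ _ e → e) (λ y → y , refl) λ p q p≢q →
    decidable-stable (adj? E p q) λ na →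
      let q' , e = punch-view p q (p≢q ∘ sym)
          a , b , _ , cover = two-in-three q'
      in dense p (punchIn p a) (punchIn p b) λ y ad y≢ →
        let y' , e' = punch-view p y y≢ in
        [ (λ r → inj₁ (trans e' (cong (punchIn p) r))) , (λ r → inj₂ (trans e' (cong (punchIn p) r))) ]′
          (cover y' (λ r → na (subst (Adj E p) (trans e' (trans (cong (punchIn p) r) (sym e))) ad)))

  module Dense {n m : ℕ} (E : Ends (5 + n) m) (lk : Linked E) (dense : ∀ x a b → ¬ Low E x a b)
    (IH : ∀ x a → Reduces (contr x a E) ⊎ K4Model (contr x a E)) where

    -- A vertex `p` that is low after merging `u` into `v` is not low before, so it was adjacent to
    -- `u`. It is then adjacent to the merged vertex, which must be one of its two neighbours there;
    -- before the contraction its neighbours are `u`, `v` and one more.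
    cubic-at : ∀ {u v} → u ≢ v → (v' : Fin (4 + n)) → v ≡ punchIn u v' → ∀ p → p ≢ v' → (∃ λ a → ∃ λ b → Low (contr u v' E) p a b) →
      ∃ λ x → ∃ λ y → Cubic E x u v y
    cubic-at {u} u≢v v' refl p p≢v' (a , b , low) = x , third (low v' (adj-contr E u v' (collapse-punchIn u v' p) (collapse-same u v') xu) (p≢v' ∘ sym))
      where
      x = punchIn u p
      nb : ∀ z → Adj E x z → z ≢ x → z ≡ u ⊎ z ≡ punchIn u a ⊎ z ≡ punchIn u b
      nb z ad z≢ with z Fin.≟ u
      ... | yes e = inj₁ e
      ... | no ne with punch-view u z ne
      ...   | z' , refl = inj₂ ([ (λ e → inj₁ (cong (punchIn u) e)) , (λ e → inj₂ (cong (punchIn u) e)) ]′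
              (low z' (adj-contr E u v' (collapse-punchIn u v' p) (collapse-punchIn u v' z') ad) (punchIn-≢ u z≢)))
      xu : Adj E x u
      xu = decidable-stable (adj? E x u) λ na → dense x (punchIn u a) (punchIn u b) λ z ad z≢ →
        [ (λ { refl → ⊥-elim (na ad) }) , id ]′ (nb z ad z≢)
      finish : ∀ {c d} → (∀ z → Adj E x z → z ≢ x → z ≡ u ⊎ z ≡ punchIn u c ⊎ z ≡ punchIn u d) → v' ≡ c → ∃ λ y → Cubic E x u (punchIn u v') y
      finish {c} {d} nb refl = punchIn u d , to-cubic E dense (FinP.punchInᵢ≢i u p) (punchIn-≢′ u p≢v') u≢v xu
        (decidable-stable (adj? E x (punchIn u v')) λ na → dense x u (punchIn u d) λ z ad z≢ →
          [ inj₁ , [ (λ { refl → ⊥-elim (na ad) }) , inj₂ ]′ ]′ (nb z ad z≢))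
        nb
      third : v' ≡ a ⊎ v' ≡ b → ∃ λ y → Cubic E x u (punchIn u v') y
      third (inj₁ e) = finish nb e
      third (inj₂ e) = finish (λ z ad z≢ → [ inj₁ , [ inj₂ ∘ inj₂ , inj₂ ∘ inj₁ ]′ ]′ (nb z ad z≢)) e

    -- Contracting an edge either exposes a K4 or shows that the edge lies in a triangle with a cubic apex.
    apex : ∀ u v → u ≢ v → Adj E u v → K4Model E ⊎ (∃ λ x → ∃ λ y → Cubic E x u v y)
    apex u v u≢v (i , j) with punch-view u v (u≢v ∘ sym)
    ... | v' , refl with IH u v'
    ...   | inj₂ M = inj₁ (contracted u v' i j M)
    ...   | inj₁ R with low-pair (contr u v' E) R
    -- At most one of the two low vertices is the merged vertex `v'`; the other one is a vertex to
    -- which `cubic-at` applies. This is why a pair is needed.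
    ...     | p , q , p≢q , _ , lp , lq with p Fin.≟ v'
    ...       | no ne = inj₂ (cubic-at u≢v v' refl p ne lp)
    ...       | yes refl = inj₂ (cubic-at u≢v v' refl q (p≢q ∘ sym) lq)

    Result : Set
    Result = K4Model E

    bind : ∀ {A : Set} → Result ⊎ A → (A → Result) → Result
    bind (inj₁ r) f = r
    bind (inj₂ a) f = f a

    open Cubic

    three-cubics-closed⇒model : ∀ {x u v y p} → Cubic E x u v y → Cubic E u x v y → Cubic E v x u p → p ≡ y → Result
    three-cubics-closed⇒model cx cu cv refl = hanging⇒model (4 + n) E lk _ _ _ _ cx cu cv

    -- The apex over the edge from `v` to `p` is a neighbour of `v` other than `p`, hence `x` or
    -- `u`. So `p` is adjacent to one of them and must be `y`: the three cubic vertices and `y` form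
    -- a K4.
    three-cubics⇒model : ∀ {x u v y p} → Cubic E x u v y → Cubic E u x v y → Cubic E v x u p → Result
    three-cubics⇒model {x} {u} {v} {y} {p} cx cu cv = bind (apex v p (x≢y cv) (xy cv)) λ (x₃ , r , c₃) →
      [ (λ { refl → three-cubics-closed⇒model cx cu cv (nearX (nbrs cx p (xv c₃) (λ e → u≢y cv (sym e)))) })
      , [ (λ { refl → three-cubics-closed⇒model cx cu cv (nearU (nbrs cu p (xv c₃) (λ e → v≢y cv (sym e)))) })
        , (λ { refl → ⊥-elim (x≢v c₃ refl) }) ]′ ]′ (nbrs cv x₃ (adj-sym {E = E} (xu c₃)) (x≢u c₃))
      where
      nearX : p ≡ u ⊎ p ≡ v ⊎ p ≡ y → p ≡ y
      nearX = [ (λ e → ⊥-elim (v≢y cv (sym e))) , [ (λ e → ⊥-elim (x≢y cv (sym e))) , id ]′ ]′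
      nearU : p ≡ x ⊎ p ≡ v ⊎ p ≡ y → p ≡ y
      nearU = [ (λ e → ⊥-elim (u≢y cv (sym e))) , [ (λ e → ⊥-elim (x≢y cv (sym e))) , id ]′ ]′

    -- The apex over the edge from `x` to `u` is a common neighbour of both, so it is `v` or `y`.
    -- This is the third cubic vertex, up to exchanging the names of `v` and `y`.
    two-cubics⇒model : ∀ {x u v y} → Cubic E x u v y → Cubic E u x v y → Result
    two-cubics⇒model {x} {u} {v} {y} cx cu = bind (apex x u (x≢u cx) (xu cx)) λ (x₂ , p , c₂) →
      [ (λ { refl → ⊥-elim (x≢v c₂ refl) })
      , [ (λ { refl → three-cubics⇒model cx cu c₂ })
        , (λ { refl → three-cubics⇒model (cubic-swap₂ cx) (cubic-swap₂ cu) c₂ }) ]′ ]′ (nbrs cx x₂ (adj-sym {E = E} (xu c₂)) (x≢u c₂))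

    -- The apex over the edge from `x` to `y` is `u` or `v`. As these two are adjacent, the
    -- remaining neighbour of the apex is the other of them, so two adjacent cubic vertices have the
    -- same two further neighbours.
    one-cubic⇒model : ∀ {x u v y} → Adj E u v → Cubic E x u v y → Result
    one-cubic⇒model {x} {u} {v} {y} uv cx = bind (apex x y (x≢y cx) (xy cx)) λ (x₁ , w , c₁) →
      [ (λ { refl → two-cubics⇒model cx (cubic-third c₁ (u≢v cx) uv (v≢y cx) (x≢v cx)) })
      , [ (λ { refl → two-cubics⇒model (cubic-swap₁ cx) (cubic-third c₁ (λ e → u≢v cx (sym e)) (adj-sym {E = E} uv) (u≢y cx) (x≢u cx)) })
        , (λ { refl → ⊥-elim (x≢v c₁ refl) }) ]′ ]′ (nbrs cx x₁ (adj-sym {E = E} (xu c₁)) (x≢u c₁))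
      where
      cubic-third : ∀ {u v w} → Cubic E u x y w → u ≢ v → Adj E u v → v ≢ y → x ≢ v → Cubic E u x v y
      cubic-third {u} {v} {w} c u≢v uv v≢y x≢v = [ (λ e → ⊥-elim (x≢v (sym e))) , [ (λ e → ⊥-elim (v≢y e)) , (λ { refl → cubic-swap₂ c }) ]′ ]′ (nbrs c v uv (λ e → u≢v (sym e)))

    dense⇒model : K4Model E
    dense⇒model =
      let s , t , ad , Ws , Wt = lk ⁅ zero ⁆ (zero , refl) (suc zero , refl)
          s≢t = λ e → t≢f Ws (trans (cong (⁅ zero ⁆ !_) e) Wt)
      in bind (apex s t s≢t ad) λ (x , y , c) → one-cubic⇒model ad c

  -- Induction on the number of vertices. A low vertex is merged into a neighbour; without low
  -- vertices the induction hypothesis is applied to contractions of edges in order to find cubic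
  -- vertices.
  dichotomy : ∀ n (E : Ends (2 + n) m) → Linked E → Reduces E ⊎ K4Model E
  dichotomy zero E lk = inj₁ (base E)
  dichotomy {m} (suc n) E lk with FinP.any? (λ x → FinP.any? (λ a → FinP.any? (λ b → low? E x a b)))
  ... | yes (x , a , b , low) = suppress (normal x a b low)
    where
    Normal : Fin (3 + n) → Set
    Normal x = ∃ λ a → ∃ λ b → a ≢ b × Low E x (punchIn x a) (punchIn x b)
    -- Replaces `a` and `b` by distinct vertices other than `x`; if they become equal in the
    -- contraction, the second one is filled up arbitrarily.
    normal : ∀ x a b → Low E x a b → Normal x
    normal x a b low with collapse x zero a Fin.≟ collapse x zero b
    ... | no ne = _ , _ , ne , λ y ad y≢ → let y' , e = punch-view x y y≢ in
          [ (λ q → inj₁ (trans e (cong (punchIn x) (trans (sym (collapse-punchIn x zero y')) (cong (collapse x zero) (trans (sym e) q))))))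
          , (λ q → inj₂ (trans e (cong (punchIn x) (trans (sym (collapse-punchIn x zero y')) (cong (collapse x zero) (trans (sym e) q)))))) ]′ (low y ad y≢)
    ... | yes eqc = collapse x zero a , punchIn (collapse x zero a) zero , (λ e → FinP.punchInᵢ≢i (collapse x zero a) zero (sym e)) , λ y ad y≢ → let y' , e = punch-view x y y≢ in
          inj₁ (trans e (cong (punchIn x) ([ (λ q → trans (sym (collapse-punchIn x zero y')) (cong (collapse x zero) (trans (sym e) q)))
            , (λ q → trans (trans (sym (collapse-punchIn x zero y')) (cong (collapse x zero) (trans (sym e) q))) (sym eqc)) ]′ (low y ad y≢))))
    via : ∀ x a b → a ≢ b → Low E x (punchIn x a) (punchIn x b) → Adj E x (punchIn x a) → Reduces E ⊎ K4Model E
    via x a b a≢b low (i , j) = [ (λ R → inj₁ (elim E x a b a≢b low (i , j) R)) , (λ M → inj₂ (contracted x a i j M)) ]′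
      (dichotomy n (contr x a E) (linked-contr E x a lk))
    suppress : Normal x → Reduces E ⊎ K4Model E
    suppress (a , b , a≢b , low) =
      -- Connectedness gives `x` a neighbour, necessarily one of the two; `x` is merged into that
      -- one, so that an actual edge is contracted.
      let s , t , ad , Ws , Wt = lk ⁅ x ⁆ (x , !-⁅⁆-same x) (punchIn x a , !-⁅⁆-diff (FinP.punchInᵢ≢i x a))
          s≡x = !-⁅⁆⇒≡ x s Ws
          xt = subst (λ w → Adj E w t) s≡x ad
          t≢x = λ e → t≢f (!-⁅⁆-same x) (trans (cong (⁅ x ⁆ !_) (sym e)) Wt)
      in [ (λ e → via x a b a≢b low (subst (Adj E x) e xt))
         , (λ e → via x b a (a≢b ∘ sym) (λ y ad y≢ → ⊎-swap (low y ad y≢)) (subst (Adj E x) e xt)) ]′ (low t xt t≢x)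
  dichotomy {m} (suc n) E lk | no none = inj₂ (reach-model n E lk (λ x a b low → none (x , a , b , low)) (λ x a → dichotomy n (contr x a E) (linked-contr E x a lk)))
    where
    reach-model : ∀ n (E : Ends (3 + n) m) → Linked E → (∀ x a b → ¬ Low E x a b) → (∀ x a → Reduces (contr x a E) ⊎ K4Model (contr x a E)) → K4Model E
    -- On three vertices every vertex is low.
    reach-model zero E lk dense IH = ⊥-elim (dense zero (suc zero) (suc (suc zero)) λ where
      zero _ ne → ⊥-elim (ne refl)
      (suc zero) _ _ → inj₁ refl
      (suc (suc zero)) _ _ → inj₂ refl)
    reach-model (suc zero) E lk dense IH = complete⇒model E dense
    reach-model (suc (suc n)) E lk dense IH = Dense.dense⇒model E lk dense IH

open Dichotomy

-- From suppression of vertices to one network for M(G) and its dual.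

module Reductions where

  private variable
    n m k : ℕ

  -- The dual network. Where `sem T` relates a row to the current at the root, `sem (dualT T)`
  -- relates it to the potential difference of the terminals, so one term serves both matroids.
  dualT : Term m → Term m
  dualT zero# = free#
  dualT free# = zero#
  dualT (leaf e) = leaf e
  dualT (ser S T) = par (dualT S) (dualT T)
  dualT (par S T) = ser (dualT S) (dualT T)

  leaves-dual : (T : Term m) → leaves (dualT T) ≡ leaves T
  leaves-dual zero# = refl
  leaves-dual free# = refl
  leaves-dual (leaf e) = refl
  leaves-dual (ser S T) = cong₂ _∪_ (leaves-dual S) (leaves-dual T)
  leaves-dual (par S T) = cong₂ _∪_ (leaves-dual S) (leaves-dual T)

  linear-dual : (T : Term m) → Linear T → Linear (dualT T)
  linear-dual zero# l = tt
  linear-dual free# l = tt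
  linear-dual (leaf e) l = tt
  linear-dual (ser S T) (a , b , d) = linear-dual S a , linear-dual T b , subst₂ Disjoint (sym (leaves-dual S)) (sym (leaves-dual T)) d
  linear-dual (par S T) (a , b , d) = linear-dual S a , linear-dual T b , subst₂ Disjoint (sym (leaves-dual S)) (sym (leaves-dual T)) d

  -- a two-terminal network whose terminals are not connected
  record Separated (T : Term m) : Set where
    constructor separated
    field
      current   : ∀ z t → sem T z t → t ≡ false
      potential : ∀ z t → sem (dualT T) z t → sem (dualT T) z (not t)
  open Separated

  sep-zero : Separated {m} zero#
  sep-zero = separated (λ z t h → h) (λ z t h → tt)

  xor-not : ∀ s t → s xor not t ≡ not (s xor t)
  xor-not s t = sym (𝔹.not-distribʳ-xor s t)

  sep-par : {S T : Term m} → Separated S → Separated T → Separated (par S T)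
  sep-par {S = S} {T} a b = separated
    (λ z t (s , h , h') → xor-f (current a z s h) (current b z _ h'))
    (λ z t (h , h') → potential a z t h , potential b z t h')
    where
    xor-f : ∀ {s t} → s ≡ false → s xor t ≡ false → t ≡ false
    xor-f refl e = e

  sep-ser : {S T : Term m} → Separated T → Separated (ser S T)
  sep-ser {S = S} {T} b = separated (λ z t (_ , h) → current b z t h)
    (λ z t (s , h , h') → s , h , subst (sem (dualT T) z) (sym (xor-not s t)) (potential b z _ h'))

  sep-any : {T : Term m} → Separated T → ∀ {z s} t → sem (dualT T) z s → sem (dualT T) z t
  sep-any {T = T} a {z} {s} t h with s 𝔹.≟ t
  ... | yes refl = h
  ... | no ne = subst (sem (dualT T) z) (sym (𝔹.¬-not (ne ∘ sym))) (potential a z s h)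

  foldpar : (Fin k → Term m) → Term m
  foldpar {zero} g = zero#
  foldpar {suc k} g = par (g zero) (foldpar (g ∘ suc))

  sep-foldpar : (g : Fin k → Term m) → (∀ c → Separated (g c)) → Separated (foldpar g)
  sep-foldpar {zero} g h = sep-zero
  sep-foldpar {suc k} g h = sep-par (h zero) (sep-foldpar (g ∘ suc) (h ∘ suc))

  leaves-foldpar⇒ : (g : Fin k → Term m) (e : Fin m) → leaves (foldpar g) ! e ≡ true → ∃ λ c → leaves (g c) ! e ≡ true
  leaves-foldpar⇒ {zero} g e p = ⊥-elim (t≢f p (!-∅ e))
  leaves-foldpar⇒ {suc k} g e p = [ (λ q → zero , q) , (λ q → let c , r = leaves-foldpar⇒ (g ∘ suc) e q in suc c , r) ]′
    (∨-true (trans (sym (!-∪ (leaves (g zero)) (leaves (foldpar (g ∘ suc))) e)) p))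

  leaves-foldpar⇐ : (g : Fin k → Term m) (e : Fin m) (c : Fin k) → leaves (g c) ! e ≡ true → leaves (foldpar g) ! e ≡ true
  leaves-foldpar⇐ g e zero p = at (∪-l (leaves (g zero)) (leaves (foldpar (g ∘ suc)))) e p
  leaves-foldpar⇐ g e (suc c) p = at (∪-r (leaves (g zero)) (leaves (foldpar (g ∘ suc)))) e (leaves-foldpar⇐ (g ∘ suc) e c p)

  linear-foldpar : (g : Fin k → Term m) → (∀ c → Linear (g c)) → (∀ c d → c ≢ d → Disjoint (leaves (g c)) (leaves (g d))) → Linear (foldpar g)
  linear-foldpar {zero} g l d = tt
  linear-foldpar {suc k} g l d = l zero , linear-foldpar (g ∘ suc) (l ∘ suc) (λ c c' ne → d (suc c) (suc c') (ne ∘ FinP.suc-injective)) ,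
    disj λ x p → ≢true⇒false λ q → let c , r = leaves-foldpar⇒ (g ∘ suc) x q in t≢f r (apart (d zero (suc c) (λ ())) x p)

  sem-foldpar⇒ : (g : Fin k → Term m) {z : Subset m} {t : Bool} → sem (foldpar g) z t → ∃ λ (s : Fin k → Bool) → (∀ c → sem (g c) z (s c)) × t ≡ ⨁ s
  sem-foldpar⇒ {zero} g h = (λ ()) , (λ ()) , h
  sem-foldpar⇒ {suc k} g {z} {t} (s₀ , h , h') =
    let s , hs , e = sem-foldpar⇒ (g ∘ suc) h' in
    (λ { zero → s₀ ; (suc c) → s c }) , (λ { zero → h ; (suc c) → hs c }) , trans (sym (xor-cancelˡ s₀ t)) (cong (s₀ xor_) e)

  sem-foldpar⇐ : (g : Fin k → Term m) {z : Subset m} (s : Fin k → Bool) → (∀ c → sem (g c) z (s c)) → sem (foldpar g) z (⨁ s)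
  sem-foldpar⇐ {zero} g s h = refl
  sem-foldpar⇐ {suc k} g {z} s h = s zero , h zero , subst (sem (foldpar (g ∘ suc)) z) (sym (xor-cancelˡ (s zero) (⨁ (s ∘ suc)))) (sem-foldpar⇐ (g ∘ suc) (s ∘ suc) (h ∘ suc))

  semd-foldpar⇒ : (g : Fin k → Term m) {z : Subset m} {t : Bool} → sem (dualT (foldpar g)) z t → ∀ c → sem (dualT (g c)) z t
  semd-foldpar⇒ g (h , h') zero = h
  semd-foldpar⇒ g (h , h') (suc c) = semd-foldpar⇒ (g ∘ suc) h' c

  semd-foldpar⇐ : (g : Fin k → Term m) {z : Subset m} {t : Bool} → (∀ c → sem (dualT (g c)) z t) → sem (dualT (foldpar g)) z t
  semd-foldpar⇐ {zero} g h = tt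
  semd-foldpar⇐ {suc k} g h = h zero , semd-foldpar⇐ (g ∘ suc) (h ∘ suc)

  Matrix : ℕ → ℕ → Set
  Matrix n m = Fin n → Fin n → Term m

  -- Kirchhoff's current law, respectively the existence of a potential, for a graph with networks as edges
  IsFlow : Matrix n m → Subset m → Set
  IsFlow {n} T z = ∃ λ (t : Fin n → Fin n → Bool) → (∀ p q → sem (T p q) z (t p q)) × (∀ p → ⨁ (λ q → t p q xor t q p) ≡ false)

  IsTension : Matrix n m → Subset m → Set
  IsTension {n} T z = ∃ λ (f : Fin n → Bool) → ∀ p q → sem (dualT (T p q)) z (f p xor f q)

  -- Elimination leaves networks between vertices that are not adjacent; these transmit nothing but
  -- still constrain their own elements. Hence `sep` requires such cells to be `Separated`, not to
  -- be `zero#`.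
  record Net {n m : ℕ} (E : Ends n m) (Flow Tension : Subset m → Set) : Set where
    field
      T        : Matrix n m
      loc      : Fin m → Fin n × Fin n
      linear   : ∀ p q → Linear (T p q)
      located  : ∀ p q e → leaves (T p q) ! e ≡ true → loc e ≡ (p , q)
      covered  : ∀ e → leaves (T (proj₁ (loc e)) (proj₂ (loc e))) ! e ≡ true
      sep      : ∀ p q → p ≡ q ⊎ ¬ Adj E p q → Separated (T p q)
      flow⇒    : ∀ z → Flow z → IsFlow T z
      flow⇐    : ∀ z → IsFlow T z → Flow z
      tension⇒ : ∀ z → Tension z → IsTension T z
      tension⇐ : ∀ z → IsTension T z → Tension z

  edge-term : (E : Ends n m) (p q : Fin n) → Fin m → Term m
  edge-term E p q e = if ⌊ pair-≟ (E e) (p , q) ⌋ then leaf e else zero#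

  initial-net : (E : Ends n m) → (∀ e → proj₁ (E e) ≢ proj₂ (E e)) → Net E (mem (evenSpace E)) (mem (cutSpace E))
  initial-net {n} {m} E loopless = record
    { T = T ; loc = E
    ; linear = λ p q → linear-foldpar (g p q) (g-linear p q) (λ c d ne → disj λ x a → ≢true⇒false λ b → ne (trans (sym (g-leaf p q c x a)) (g-leaf p q d x b)))
    ; located = λ p q e h → let c , r = leaves-foldpar⇒ (g p q) e h in subst (λ e → E e ≡ (p , q)) (sym (g-leaf p q c e r)) (g-at p q c e r)
    ; covered = λ e → leaves-foldpar⇐ (g _ _) e e (subst (λ T → leaves T ! e ≡ true) (sym (g-yes _ _ e refl)) (!-⁅⁆-same e))
    ; sep = λ p q h → sep-foldpar (g p q) (λ e → subst Separated (sym (g-no p q e (not-here p q h e))) sep-zero)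
    ; flow⇒ = λ z ev → (λ p q → ⨁ (s z p q)) , (λ p q → sem-foldpar⇐ (g p q) (s z p q) (s-sem z p q)) , (λ p → trans (kirchhoff z p) (ev p))
    ; flow⇐ = λ z (t , h , k) p → trans (sym (kirchhoff z p)) (trans (⨁.sum-cong-≗ (λ q → cong₂ _xor_ (sym (t-val z p q (t p q) (h p q))) (sym (t-val z q p (t q p) (h q p))))) (k p))
    ; tension⇒ = λ { _ (f , refl) → (f !_) , λ p q → semd-foldpar⇐ (g p q) (λ e → cut-sem f p q e) }
    ; tension⇐ = λ z (f , h) → tabulate f , ext λ e → trans (cut-val z f e (semd-foldpar⇒ (g _ _) (h (proj₁ (E e)) (proj₂ (E e))) e))
        (sym (trans (cut-! E (tabulate f) e) (cong₂ _xor_ (!-tab f _) (!-tab f _))))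
    }
    where
    g : Fin n → Fin n → Fin m → Term m
    g = edge-term E
    T : Matrix n m
    T p q = foldpar (g p q)
    g-yes : ∀ p q e → E e ≡ (p , q) → g p q e ≡ leaf e
    g-yes p q e h = cong (λ b → if b then leaf e else zero#) (⌊⌋-yes (pair-≟ (E e) (p , q)) h)
    g-no : ∀ p q e → E e ≢ (p , q) → g p q e ≡ zero#
    g-no p q e h = cong (λ b → if b then leaf e else zero#) (⌊⌋-no (pair-≟ (E e) (p , q)) h)
    g-linear : ∀ p q e → Linear (g p q e)
    g-linear p q e with ⌊ pair-≟ (E e) (p , q) ⌋
    ... | true = tt
    ... | false = tt
    g-at : ∀ p q c e → leaves (g p q c) ! e ≡ true → E c ≡ (p , q)
    g-at p q c e h with pair-≟ (E c) (p , q)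
    ... | yes r = r
    ... | no _ = ⊥-elim (t≢f h (!-∅ e))
    g-leaf : ∀ p q c e → leaves (g p q c) ! e ≡ true → e ≡ c
    g-leaf p q c e h with pair-≟ (E c) (p , q)
    ... | yes _ = !-⁅⁆⇒≡ c e h
    ... | no _ = ⊥-elim (t≢f h (!-∅ e))
    not-here : ∀ p q → p ≡ q ⊎ ¬ Adj E p q → ∀ e → E e ≢ (p , q)
    not-here p q (inj₁ refl) e h = loopless e (trans (cong proj₁ h) (sym (cong proj₂ h)))
    not-here p q (inj₂ na) e h = na (e , inj₁ h)
    s : Subset m → Fin n → Fin n → Fin m → Bool
    s z p q e = z ! e ∧ ⌊ pair-≟ (E e) (p , q) ⌋
    s-sem : ∀ z p q e → sem (g p q e) z (s z p q e)
    s-sem z p q e with ⌊ pair-≟ (E e) (p , q) ⌋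
    ... | true = sym (𝔹.∧-identityʳ _)
    ... | false = 𝔹.∧-zeroʳ _
    g-val : ∀ z p q e t → sem (g p q e) z t → t ≡ s z p q e
    g-val z p q e t h with ⌊ pair-≟ (E e) (p , q) ⌋
    ... | true = trans (sym h) (sym (𝔹.∧-identityʳ _))
    ... | false = trans h (sym (𝔹.∧-zeroʳ _))
    t-val : ∀ z p q t → sem (T p q) z t → t ≡ ⨁ (s z p q)
    t-val z p q t h = let s' , hs , e = sem-foldpar⇒ (g p q) h in trans e (⨁.sum-cong-≗ (λ c → g-val z p q c (s' c) (hs c)))
    pair-eqB : ∀ (a b p q : Fin n) → ⌊ pair-≟ (a , b) (p , q) ⌋ ≡ eqB p a ∧ eqB q b
    pair-eqB a b p q = b-ext
      (λ h → let e = ⌊⌋-true (pair-≟ (a , b) (p , q)) h in cong₂ _∧_ (⌊⌋-yes (p Fin.≟ a) (sym (cong proj₁ e))) (⌊⌋-yes (q Fin.≟ b) (sym (cong proj₂ e))))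
      (λ h → let x , y = ∧-true h in ⌊⌋-yes (pair-≟ (a , b) (p , q)) (sym (cong₂ _,_ (⌊⌋-true (p Fin.≟ a) x) (⌊⌋-true (q Fin.≟ b) y))))
    out : ∀ z p e → ⨁ (λ q → s z p q e) ≡ z ! e ∧ eqB p (proj₁ (E e))
    out z p e = trans (⨁.sum-cong-≗ (λ q → trans (cong (z ! e ∧_) (pair-eqB (proj₁ (E e)) (proj₂ (E e)) p q)) (sym (𝔹.∧-assoc (z ! e) _ _))))
      (⨁-pick (λ q → z ! e ∧ eqB p (proj₁ (E e))) (proj₂ (E e)))
    inn : ∀ z p e → ⨁ (λ q → s z q p e) ≡ z ! e ∧ eqB p (proj₂ (E e))
    inn z p e = trans (⨁.sum-cong-≗ (λ q → trans (cong (z ! e ∧_) (trans (pair-eqB (proj₁ (E e)) (proj₂ (E e)) q p) (𝔹.∧-comm (eqB q (proj₁ (E e))) _))) (sym (𝔹.∧-assoc (z ! e) _ _))))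
      (⨁-pick (λ q → z ! e ∧ eqB p (proj₂ (E e))) (proj₁ (E e)))
    -- Exchanging the sums over vertices and edges turns the Kirchhoff sum into the boundary of the
    -- edge set.
    kirchhoff : ∀ z p → ⨁ (λ q → ⨁ (s z p q) xor ⨁ (s z q p)) ≡ boundary E z p
    kirchhoff z p = trans (⨁.∑-distrib-+ (λ q → ⨁ (s z p q)) (λ q → ⨁ (s z q p)))
      (trans (cong₂ _xor_ (trans (⨁.∑-comm (λ q e → s z p q e)) (⨁.sum-cong-≗ (out z p))) (trans (⨁.∑-comm (λ q e → s z q p e)) (⨁.sum-cong-≗ (inn z p))))
        (trans (sym (⨁.∑-distrib-+ (λ e → z ! e ∧ eqB p (proj₁ (E e))) (λ e → z ! e ∧ eqB p (proj₂ (E e)))))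
          (⨁.sum-cong-≗ (λ e → sym (𝔹.∧-distribˡ-xor (z ! e) (eqB p (proj₁ (E e))) (eqB p (proj₂ (E e))))))))
    cut-sem : ∀ f p q e → sem (dualT (g p q e)) (cut E f) (f ! p xor f ! q)
    cut-sem f p q e with pair-≟ (E e) (p , q)
    ... | yes h = trans (cut-! E f e) (cong₂ (λ a b → f ! a xor f ! b) (cong proj₁ h) (cong proj₂ h))
    ... | no _ = tt
    cut-val : ∀ z f e → sem (dualT (g (proj₁ (E e)) (proj₂ (E e)) e)) z (f (proj₁ (E e)) xor f (proj₂ (E e))) → z ! e ≡ f (proj₁ (E e)) xor f (proj₂ (E e))
    cut-val z f e h = subst (λ T → sem (dualT T) z (f (proj₁ (E e)) xor f (proj₂ (E e)))) (g-yes _ _ e refl) h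

  splitAt : {A : Set} (x : Fin (suc n)) → A → (Fin n → A) → Fin (suc n) → A
  splitAt x a f y with x Fin.≟ y
  ... | yes _ = a
  ... | no ne = f (punchOut ne)

  splitAt-same : {A : Set} (x : Fin (suc n)) (a : A) (f : Fin n → A) → splitAt x a f x ≡ a
  splitAt-same x a f with x Fin.≟ x
  ... | yes _ = refl
  ... | no ne = ⊥-elim (ne refl)

  splitAt-punchIn : {A : Set} (x : Fin (suc n)) (a : A) (f : Fin n → A) (p : Fin n) → splitAt x a f (punchIn x p) ≡ f p
  splitAt-punchIn x a f p with x Fin.≟ punchIn x p
  ... | yes e = ⊥-elim (FinP.punchInᵢ≢i x p (sym e))
  ... | no ne = cong f (trans (FinP.punchOut-cong x refl) (FinP.punchOut-punchIn x))

  punch-cases : (x : Fin (suc n)) {P : Fin (suc n) → Set} → P x → (∀ p → P (punchIn x p)) → ∀ y → P y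
  punch-cases x {P} a f y with y Fin.≟ x
  ... | yes refl = a
  ... | no ne = let p , e = punch-view x y ne in subst P (sym e) (f p)

  module Eliminate {n m : ℕ} {E : Ends (3 + n) m} {Flow Tension : Subset m → Set} (N : Net E Flow Tension)
    (x : Fin (3 + n)) (a b : Fin (2 + n)) (a≢b : a ≢ b) (low : Low E x (punchIn x a) (punchIn x b)) where
    open Net N

    π : Fin (2 + n) → Fin (3 + n)
    π = punchIn x

    U : Fin (2 + n) → Term m
    U c = par (T x (π c)) (T (π c) x)

    sepU : ∀ c → ¬ Adj E x (π c) → Separated (U c)
    sepU c na = sep-par (sep x (π c) (inj₂ na)) (sep (π c) x (inj₂ (λ h → na (adj-sym {E = E} h))))

    not-adj : ∀ c → c ≢ a → c ≢ b → ¬ Adj E x (π c)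
    not-adj c c≢a c≢b h = [ (λ e → c≢a (FinP.punchIn-injective x _ _ e)) , (λ e → c≢b (FinP.punchIn-injective x _ _ e)) ]′ (low (π c) h (FinP.punchInᵢ≢i x c))

    G : Fin (2 + n) → Term m
    G c = if at₂ a b c then zero# else ser (U c) zero#

    G-out : ∀ c → at₂ a b c ≡ false → G c ≡ ser (U c) zero#
    G-out c h = cong (λ b → if b then zero# else ser (U c) zero#) h

    at₂-true : ∀ c → at₂ a b c ≡ true → c ≡ a ⊎ c ≡ b
    at₂-true c h = [ (λ p → inj₁ (⌊⌋-true (c Fin.≟ a) p)) , (λ p → inj₂ (⌊⌋-true (c Fin.≟ b) p)) ]′ (∨-true h)

    at₂-false : ∀ c → at₂ a b c ≡ false → c ≢ a × c ≢ b
    at₂-false c h = (λ { refl → t≢f (at₂-l c b) h }) , (λ { refl → t≢f (at₂-r a c) h })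

    sepG : ∀ c → Separated (G c)
    sepG c with at₂ a b c
    ... | true = sep-zero
    ... | false = sep-ser {S = U c} sep-zero

    -- the networks at x that carry no current, kept for the conditions they impose on their own elements
    D : Term m
    D = par (ser (T x x) zero#) (foldpar G)

    sepD : Separated D
    sepD = sep-par (sep-ser {S = T x x} sep-zero) (sep-foldpar G sepG)

    -- The way from `a` over `x` to `b` becomes a series composition parallel to what joins `a` and
    -- `b` already; `D` is carried along so that no element is lost.
    merged : Term m
    merged = par (T (π a) (π b)) (par (ser (U a) (U b)) D)

    isAB : Fin (2 + n) → Fin (2 + n) → Bool
    isAB p q = eqB p a ∧ eqB q b

    T' : Matrix (2 + n) m
    T' p q = if isAB p q then merged else T (π p) (π q)

    T'-ab : T' a b ≡ merged
    T'-ab = cong (λ c → if c then merged else T (π a) (π b)) (cong₂ _∧_ (eqB-refl a) (eqB-refl b))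

    data At (c : Fin (2 + n)) : Fin (3 + n) × Fin (3 + n) → Set where
      out : At c (x , π c)
      inn : At c (π c , x)

    at-unique : ∀ {c d l} → At c l → At d l → c ≡ d
    at-unique {c} {d} u v = go u v refl
      where
      go : ∀ {l l'} → At c l → At d l' → l ≡ l' → c ≡ d
      go out out e = FinP.punchIn-injective x _ _ (cong proj₂ e)
      go inn inn e = FinP.punchIn-injective x _ _ (cong proj₁ e)
      go out inn e = ⊥-elim (FinP.punchInᵢ≢i x d (sym (cong proj₁ e)))
      go inn out e = ⊥-elim (FinP.punchInᵢ≢i x c (cong proj₁ e))

    at-not-xx : ∀ {c l} → At c l → l ≢ (x , x)
    at-not-xx {c} out e = FinP.punchInᵢ≢i x c (cong proj₂ e)
    at-not-xx {c} inn e = FinP.punchInᵢ≢i x c (cong proj₁ e)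

    at-not-ππ : ∀ {c l p q} → At c l → l ≢ (π p , π q)
    at-not-ππ {p = p} out e = FinP.punchInᵢ≢i x p (sym (cong proj₁ e))
    at-not-ππ {q = q} inn e = FinP.punchInᵢ≢i x q (sym (cong proj₂ e))

    U-at : ∀ c e → leaves (U c) ! e ≡ true → At c (loc e)
    U-at c e h = [ (λ p → subst (At c) (sym (located _ _ e p)) out) , (λ p → subst (At c) (sym (located _ _ e p)) inn) ]′
      (∨-true (trans (sym (!-∪ (leaves (T x (π c))) (leaves (T (π c) x)) e)) h))

    G-at : ∀ c e → leaves (G c) ! e ≡ true → At c (loc e) × c ≢ a × c ≢ b
    G-at c e h with at₂ a b c in eq
    ... | true = ⊥-elim (t≢f h (!-∅ e))
    ... | false = U-at c e (from (∨-true (trans (sym (!-∪ (leaves (U c)) ∅ˢ e)) h))) , at₂-false c eq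
      where
      from : leaves (U c) ! e ≡ true ⊎ ∅ˢ ! e ≡ true → leaves (U c) ! e ≡ true
      from (inj₁ p) = p
      from (inj₂ p) = ⊥-elim (t≢f p (!-∅ e))

    xx-at : ∀ e → leaves (ser (T x x) zero#) ! e ≡ true → loc e ≡ (x , x)
    xx-at e h = [ located x x e , (λ p → ⊥-elim (t≢f p (!-∅ e))) ]′ (∨-true (trans (sym (!-∪ (leaves (T x x)) ∅ˢ e)) h))

    D-at : ∀ e → leaves D ! e ≡ true → loc e ≡ (x , x) ⊎ (∃ λ c → At c (loc e) × c ≢ a × c ≢ b)
    D-at e h = [ (λ p → inj₁ (xx-at e p)) , (λ p → let c , q = leaves-foldpar⇒ G e p in inj₂ (c , G-at c e q)) ]′
      (∨-true (trans (sym (!-∪ (leaves (ser (T x x) zero#)) (leaves (foldpar G)) e)) h))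

    UU-at : ∀ e → leaves (ser (U a) (U b)) ! e ≡ true → At a (loc e) ⊎ At b (loc e)
    UU-at e h = [ (λ p → inj₁ (U-at a e p)) , (λ p → inj₂ (U-at b e p)) ]′ (∨-true (trans (sym (!-∪ (leaves (U a)) (leaves (U b)) e)) h))

    AtX : Fin (3 + n) × Fin (3 + n) → Set
    AtX l = l ≡ (x , x) ⊎ ∃ λ c → At c l

    rest-at : ∀ e → leaves (par (ser (U a) (U b)) D) ! e ≡ true → AtX (loc e)
    rest-at e h = [ (λ p → [ (λ q → inj₂ (a , q)) , (λ q → inj₂ (b , q)) ]′ (UU-at e p)) , (λ p → [ inj₁ , (λ (c , q , _) → inj₂ (c , q)) ]′ (D-at e p)) ]′
      (∨-true (trans (sym (!-∪ (leaves (ser (U a) (U b))) (leaves D) e)) h))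

    disjoint-by : (P Q : Fin (3 + n) × Fin (3 + n) → Set) {X Y : Subset m} → (∀ e → X ! e ≡ true → P (loc e)) → (∀ e → Y ! e ≡ true → Q (loc e)) →
      (∀ {l} → P l → Q l → ⊥) → Disjoint X Y
    disjoint-by P Q p q excl = disj λ e h → ≢true⇒false λ h' → excl (p e h) (q e h')

    linearU : ∀ c → Linear (U c)
    linearU c = linear _ _ , linear _ _ , disjoint-by (_≡ (x , π c)) (_≡ (π c , x)) (located x (π c)) (located (π c) x) (λ { refl e → FinP.punchInᵢ≢i x c (sym (cong proj₁ e)) })

    linearG : ∀ c → Linear (G c)
    linearG c with at₂ a b c
    ... | true = tt
    ... | false = linearU c , tt , disj (λ e _ → !-∅ e)

    linear-merged : Linear merged
    linear-merged = linear _ _ ,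
      ( (linearU a , linearU b , disjoint-by (At a) (At b) (U-at a) (U-at b) (λ p q → a≢b (at-unique p q)))
      , ((linear x x , tt , disj (λ e _ → !-∅ e)) , linear-foldpar G linearG (λ c d ne → disjoint-by (λ l → At c l × c ≢ a × c ≢ b) (λ l → At d l × d ≢ a × d ≢ b) (G-at c) (G-at d) (λ (p , _) (q , _) → ne (at-unique p q)))
        , disjoint-by (_≡ (x , x)) (λ l → ∃ λ c → At c l) xx-at (λ e h → let c , q = leaves-foldpar⇒ G e h in c , proj₁ (G-at c e q)) (λ e (c , p) → at-not-xx p e))
      , disjoint-by (λ l → At a l ⊎ At b l) (λ l → l ≡ (x , x) ⊎ (∃ λ c → At c l × c ≢ a × c ≢ b)) UU-at D-at λ where
          (inj₁ p) (inj₁ e) → at-not-xx p e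
          (inj₂ p) (inj₁ e) → at-not-xx p e
          (inj₁ p) (inj₂ (c , q , c≢a , _)) → c≢a (at-unique q p)
          (inj₂ p) (inj₂ (c , q , _ , c≢b)) → c≢b (at-unique q p))
      , disjoint-by (_≡ (π a , π b)) AtX (located (π a) (π b)) rest-at λ where
          e (inj₁ e') → FinP.punchInᵢ≢i x a (trans (sym (cong proj₁ e)) (cong proj₁ e'))
          e (inj₂ (c , p)) → at-not-ππ p e

    locMap : Fin (3 + n) × Fin (3 + n) → Fin (2 + n) × Fin (2 + n)
    locMap (y , z) = splitAt x (a , b) (λ p → splitAt x (a , b) (λ q → p , q) z) y

    locMap-ππ : ∀ p q → locMap (π p , π q) ≡ (p , q)
    locMap-ππ p q = trans (splitAt-punchIn x (a , b) _ p) (splitAt-punchIn x (a , b) _ q)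

    locMap-x : ∀ {l} → AtX l → locMap l ≡ (a , b)
    locMap-x (inj₁ refl) = splitAt-same x (a , b) _
    locMap-x (inj₂ (c , out)) = splitAt-same x (a , b) _
    locMap-x (inj₂ (c , inn)) = trans (splitAt-punchIn x (a , b) _ c) (splitAt-same x (a , b) _)

    merged-loc : ∀ e → leaves merged ! e ≡ true → locMap (loc e) ≡ (a , b)
    merged-loc e h = [ (λ p → trans (cong locMap (located _ _ e p)) (locMap-ππ a b)) , (λ p → locMap-x (rest-at e p)) ]′
      (∨-true (trans (sym (!-∪ (leaves (T (π a) (π b))) (leaves (par (ser (U a) (U b)) D)) e)) h))

    isAB-true : ∀ {p q} → isAB p q ≡ true → p ≡ a × q ≡ b
    isAB-true {p} {q} h = let u , w = ∧-true h in ⌊⌋-true (p Fin.≟ a) u , ⌊⌋-true (q Fin.≟ b) w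

    located' : ∀ p q e → leaves (T' p q) ! e ≡ true → locMap (loc e) ≡ (p , q)
    located' p q e h with isAB p q in eq
    ... | true = trans (merged-loc e h) (sym (cong₂ _,_ (proj₁ (isAB-true eq)) (proj₂ (isAB-true eq))))
    ... | false = trans (cong locMap (located _ _ e h)) (locMap-ππ p q)

    linear' : ∀ p q → Linear (T' p q)
    linear' p q with isAB p q
    ... | true = linear-merged
    ... | false = linear _ _

    Leaf : Fin m → Term m → Set
    Leaf e S = leaves S ! e ≡ true

    leaf-l : ∀ {e} S S' → Leaf e S → (leaves S ∪ leaves S') ! e ≡ true
    leaf-l S S' h = at (∪-l (leaves S) (leaves S')) _ h

    leaf-r : ∀ {e} S S' → Leaf e S' → (leaves S ∪ leaves S') ! e ≡ true
    leaf-r S S' h = at (∪-r (leaves S) (leaves S')) _ h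

    U-merged : ∀ c e → Leaf e (U c) → Leaf e merged
    U-merged c e h = leaf-r (T (π a) (π b)) (par (ser (U a) (U b)) D) (inRest (at₂ a b c) refl)
      where
      inRest : ∀ v → at₂ a b c ≡ v → Leaf e (par (ser (U a) (U b)) D)
      inRest true eq with at₂-true c eq
      ... | inj₁ refl = leaf-l (ser (U a) (U b)) D (leaf-l (U a) (U b) h)
      ... | inj₂ refl = leaf-l (ser (U a) (U b)) D (leaf-r (U a) (U b) h)
      inRest false eq = leaf-r (ser (U a) (U b)) D (leaf-r (ser (T x x) zero#) (foldpar G) (leaves-foldpar⇐ G e c
        (subst (Leaf e) (sym (G-out c eq)) (leaf-l (U c) zero# h))))

    covers : ∀ e y z → Leaf e (T y z) → Leaf e (T' (proj₁ (locMap (y , z))) (proj₂ (locMap (y , z))))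
    covers e = punch-cases x
      (punch-cases x (λ h → in-merged (inj₁ refl) (leaf-r (T (π a) (π b)) (par (ser (U a) (U b)) D) (leaf-r (ser (U a) (U b)) D (leaf-l (ser (T x x) zero#) (foldpar G) (leaf-l (T x x) zero# h)))))
        (λ c h → in-merged (inj₂ (c , out)) (U-merged c e (leaf-l (T x (π c)) (T (π c) x) h))))
      (λ p → punch-cases x (λ h → in-merged (inj₂ (p , inn)) (U-merged p e (leaf-r (T x (π p)) (T (π p) x) h)))
        (λ q h → subst (λ l → Leaf e (T' (proj₁ l) (proj₂ l))) (sym (locMap-ππ p q)) (direct p q h)))
      where
      in-merged : ∀ {l} → AtX l → Leaf e merged → Leaf e (T' (proj₁ (locMap l)) (proj₂ (locMap l)))
      in-merged h k = subst (λ l → Leaf e (T' (proj₁ l) (proj₂ l))) (sym (locMap-x h)) (subst (Leaf e) (sym T'-ab) k)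
      direct : ∀ p q → Leaf e (T (π p) (π q)) → Leaf e (T' p q)
      direct p q h with isAB p q in eq
      ... | false = h
      ... | true with isAB-true {p} {q} eq
      ...   | refl , refl = leaf-l (T (π a) (π b)) (par (ser (U a) (U b)) D) h

    sep' : ∀ p q → p ≡ q ⊎ ¬ Adj (contr x a E) p q → Separated (T' p q)
    sep' p q h with isAB p q in eq
    ... | false = sep (π p) (π q) (⊎-map (cong π) (λ na ad → na (adj-contr E x a (collapse-punchIn x a p) (collapse-punchIn x a q) ad)) h)
    ... | true with isAB-true {p} {q} eq | h
    ...   | refl , refl | inj₁ e = ⊥-elim (a≢b e)
    ...   | refl , refl | inj₂ na = sep-par
              (sep (π a) (π b) (inj₂ (λ ad → na (adj-contr E x a (collapse-punchIn x a a) (collapse-punchIn x a b) ad))))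
              (sep-par (sep-ser {S = U a} (sepU b (λ ad → na (adj-contr E x a (collapse-same x a) (collapse-punchIn x a b) ad)))) sepD)

    -- What a current `w` running from `a` to `b` contributes to the Kirchhoff sum at `p`.
    ab-weight : Bool → Fin (2 + n) → Bool
    ab-weight w p = (eqB p a ∧ w) xor (eqB p b ∧ w)

    ab-weight-at : ∀ w p → at₂ a b p ≡ true → ab-weight w p ≡ w
    ab-weight-at w p h with at₂-true p h
    ... | inj₁ refl = trans (cong₂ (λ u v → (u ∧ w) xor (v ∧ w)) (eqB-refl a) (⌊⌋-no (a Fin.≟ b) a≢b)) (𝔹.xor-identityʳ w)
    ... | inj₂ refl = cong₂ (λ u v → (u ∧ w) xor (v ∧ w)) (⌊⌋-no (b Fin.≟ a) (a≢b ∘ sym)) (eqB-refl b)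

    ab-weight-off : ∀ w p → at₂ a b p ≡ false → ab-weight w p ≡ false
    ab-weight-off w p h = let na , nb = at₂-false p h in
      cong₂ (λ u v → (u ∧ w) xor (v ∧ w)) (⌊⌋-no (p Fin.≟ a) na) (⌊⌋-no (p Fin.≟ b) nb)

    shift : (t₀ t₁ : Fin (2 + n) → Fin (2 + n) → Bool) (w : Bool) → (∀ p q → t₁ p q ≡ t₀ p q xor (isAB p q ∧ w)) →
      ∀ p → ⨁ (λ q → t₁ p q xor t₁ q p) ≡ ⨁ (λ q → t₀ p q xor t₀ q p) xor ab-weight w p
    shift t₀ t₁ w h p = trans (⨁.sum-cong-≗ (λ q → trans (cong₂ _xor_ (h p q) (h q p)) (xor-swap (t₀ p q) (isAB p q ∧ w) (t₀ q p) (isAB q p ∧ w))))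
      (trans (⨁.∑-distrib-+ (λ q → t₀ p q xor t₀ q p) (λ q → (isAB p q ∧ w) xor (isAB q p ∧ w)))
        (cong (⨁ (λ q → t₀ p q xor t₀ q p) xor_) (trans (⨁.∑-distrib-+ (λ q → isAB p q ∧ w) (λ q → isAB q p ∧ w))
          (cong₂ _xor_
            (trans (⨁.sum-cong-≗ (λ q → rot₁ (eqB p a) (eqB q b) w)) (⨁-pick (λ _ → eqB p a ∧ w) b))
            (trans (⨁.sum-cong-≗ (λ q → rot₂ (eqB q a) (eqB p b) w)) (⨁-pick (λ _ → eqB p b ∧ w) a))))))
      where
      rot₁ : ∀ i j w → (i ∧ j) ∧ w ≡ (i ∧ w) ∧ j
      rot₁ i j w = trans (𝔹.∧-assoc i j w) (trans (cong (i ∧_) (𝔹.∧-comm j w)) (sym (𝔹.∧-assoc i w j)))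
      rot₂ : ∀ i j w → (i ∧ j) ∧ w ≡ (j ∧ w) ∧ i
      rot₂ i j w = trans (cong (_∧ w) (𝔹.∧-comm i j)) (rot₁ j i w)

    -- Only the bundles towards `a` and `b` can carry current at `x`, so Kirchhoff's law at `x`
    -- makes their currents equal. This common value is the root value of the series composition.
    flow-down : ∀ z → IsFlow T z → IsFlow T' z
    flow-down z (t , ht , even) = t' , ht' , even'
      where
      u : Fin (2 + n) → Bool
      u c = t x (π c) xor t (π c) x
      hU : ∀ c → sem (U c) z (u c)
      hU c = t x (π c) , ht _ _ , subst (sem (T (π c) x) z) (sym (xor-cancelˡ (t x (π c)) (t (π c) x))) (ht _ _)
      u-off : ∀ c → at₂ a b c ≡ false → u c ≡ false
      u-off c h = let na , nb = at₂-false c h in current (sepU c (not-adj c na nb)) z _ (hU c)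
      txx : t x x ≡ false
      txx = current (sep x x (inj₁ refl)) z _ (ht x x)
      at-x : u a xor u b ≡ false
      at-x = trans (sym (⨁-two u a b a≢b (λ c na nb → u-off c (at₂-off na nb))))
        (trans (sym (trans (⨁.sum-remove {i = x} (λ q → t x q xor t q x)) (cong (_xor ⨁ u) (𝔹.xor-same (t x x))))) (even x))
      w : Bool
      w = u a
      ub : u b ≡ w
      ub = sym (xor≡f⇒≡ at-x)
      u-weight : ∀ c → u c ≡ ab-weight w c
      u-weight c with at₂ a b c in eq
      ... | false = trans (u-off c eq) (sym (ab-weight-off w c eq))
      ... | true = trans ([ (λ e → cong u e) , (λ e → trans (cong u e) ub) ]′ (at₂-true c eq)) (sym (ab-weight-at w c eq))
      t' : Fin (2 + n) → Fin (2 + n) → Bool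
      t' p q = t (π p) (π q) xor (isAB p q ∧ w)
      hG : ∀ c → sem (G c) z false
      hG c with at₂ a b c in eq
      ... | true = refl
      ... | false = subst (sem (U c) z) (u-off c eq) (hU c) , refl
      hD : sem D z false
      hD = false , (subst (sem (T x x) z) txx (ht x x) , refl) , subst (sem (foldpar G) z) (⨁-false {2 + n} (λ _ → false) (λ _ → refl)) (sem-foldpar⇐ G (λ _ → false) hG)
      hM : sem merged z (t (π a) (π b) xor w)
      hM = t (π a) (π b) , ht _ _ , subst (sem (par (ser (U a) (U b)) D) z) (sym (xor-cancelˡ (t (π a) (π b)) w))
        (w , (hU a , subst (sem (U b) z) ub (hU b)) , subst (sem D z) (sym (𝔹.xor-same w)) hD)
      ht' : ∀ p q → sem (T' p q) z (t' p q)
      ht' p q with isAB p q in eq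
      ... | false = subst (sem (T (π p) (π q)) z) (sym (𝔹.xor-identityʳ _)) (ht _ _)
      ... | true with isAB-true {p} {q} eq
      ...   | refl , refl = hM
      even' : ∀ p → ⨁ (λ q → t' p q xor t' q p) ≡ false
      even' p = trans (shift (λ p q → t (π p) (π q)) t' w (λ _ _ → refl) p)
        (trans (cong (rest xor_) (trans (sym (u-weight p)) (𝔹.xor-comm (t x (π p)) (t (π p) x))))
          (trans (𝔹.xor-comm rest _) (trans (sym (⨁.sum-remove {i = x} (λ q → t (π p) q xor t q (π p)))) (even (π p)))))
        where
        rest = ⨁ (λ q → t (π p) (π q) xor t (π q) (π p))

    -- Being separated, `D` carries no current, so the current of `merged` splits into that of the
    -- direct cell and that of the way over `x`.
    flow-up : ∀ z → IsFlow T' z → IsFlow T z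
    flow-up z (t' , ht' , even') = t , ht , even
      where
      hM : sem merged z (t' a b)
      hM = subst (λ S → sem S z (t' a b)) T'-ab (ht' a b)
      s = proj₁ hM
      w = proj₁ (proj₂ (proj₂ hM))
      hUa : sem (U a) z w
      hUa = proj₁ (proj₁ (proj₂ (proj₂ (proj₂ hM))))
      hUb : sem (U b) z w
      hUb = proj₂ (proj₁ (proj₂ (proj₂ (proj₂ hM))))
      hD : sem D z (w xor (s xor t' a b))
      hD = proj₂ (proj₂ (proj₂ (proj₂ hM)))
      t'ab : t' a b ≡ s xor w
      t'ab = trans (sym (xor-cancelˡ s (t' a b))) (cong (s xor_) (sym (xor≡f⇒≡ (current sepD z _ hD))))
      hG : ∃ λ (g : Fin (2 + n) → Bool) → (∀ c → sem (G c) z (g c))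
      hG = let g , h , _ = sem-foldpar⇒ G (proj₂ (proj₂ hD)) in g , h
      hxx : sem (T x x) z false
      hxx = subst (sem (T x x) z) (proj₂ (proj₁ (proj₂ hD))) (proj₁ (proj₁ (proj₂ hD)))
      hU : ∀ c → sem (U c) z (ab-weight w c)
      hU c = byCase (at₂ a b c) refl
        where
        byCase : ∀ v → at₂ a b c ≡ v → sem (U c) z (ab-weight w c)
        byCase true eq = subst (sem (U c) z) (sym (ab-weight-at w c eq)) ([ (λ e → subst (λ c → sem (U c) z w) (sym e) hUa) , (λ e → subst (λ c → sem (U c) z w) (sym e) hUb) ]′ (at₂-true c eq))
        byCase false eq = let h = subst (λ S → sem S z (proj₁ hG c)) (G-out c eq) (proj₂ hG c)
                          in subst (sem (U c) z) (trans (proj₂ h) (sym (ab-weight-off w c eq))) (proj₁ h)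
      ℓ : Fin (2 + n) → Bool
      ℓ c = proj₁ (hU c)
      -- The current `w` is taken off the cell from `a` to `b` and rerouted over `x`.
      t₀ : Fin (2 + n) → Fin (2 + n) → Bool
      t₀ p q = t' p q xor (isAB p q ∧ w)
      t : Fin (3 + n) → Fin (3 + n) → Bool
      t y z = splitAt x (splitAt x false ℓ z) (λ p → splitAt x (ℓ p xor ab-weight w p) (t₀ p) z) y
      t-xx : t x x ≡ false
      t-xx = trans (splitAt-same x _ _) (splitAt-same x _ _)
      t-xπ : ∀ c → t x (π c) ≡ ℓ c
      t-xπ c = trans (splitAt-same x _ _) (splitAt-punchIn x false ℓ c)
      t-πx : ∀ c → t (π c) x ≡ ℓ c xor ab-weight w c
      t-πx c = trans (splitAt-punchIn x _ _ c) (splitAt-same x _ _)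
      t-ππ : ∀ p q → t (π p) (π q) ≡ t₀ p q
      t-ππ p q = trans (splitAt-punchIn x _ (λ p → splitAt x (ℓ p xor ab-weight w p) (t₀ p) (π q)) p) (splitAt-punchIn x _ (t₀ p) q)
      ht₀ : ∀ p q → sem (T (π p) (π q)) z (t₀ p q)
      ht₀ p q = byCase (isAB p q) refl
        where
        byCase : ∀ v → isAB p q ≡ v → sem (T (π p) (π q)) z (t₀ p q)
        byCase true eq with isAB-true {p} {q} eq
        ... | refl , refl = subst (sem (T (π a) (π b)) z) (sym (trans (cong₂ (λ i j → i xor (j ∧ w)) t'ab eq) (xor-cancel s w))) (proj₁ (proj₂ hM))
        byCase false eq = subst (sem (T (π p) (π q)) z) (sym (trans (cong (λ j → t' p q xor (j ∧ w)) eq) (𝔹.xor-identityʳ _)))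
          (subst (λ S → sem S z (t' p q)) (cong (λ c → if c then merged else T (π p) (π q)) eq) (ht' p q))
      ht : ∀ y y' → sem (T y y') z (t y y')
      ht = punch-cases x
        (punch-cases x (subst (sem (T x x) z) (sym t-xx) hxx) (λ c → subst (sem (T x (π c)) z) (sym (t-xπ c)) (proj₁ (proj₂ (hU c)))))
        (λ p → punch-cases x (subst (sem (T (π p) x) z) (sym (t-πx p)) (proj₂ (proj₂ (hU p)))) (λ q → subst (sem (T (π p) (π q)) z) (sym (t-ππ p q)) (ht₀ p q)))
      even : ∀ y → ⨁ (λ q → t y q xor t q y) ≡ false
      even = punch-cases x
        (trans (⨁.sum-remove {i = x} (λ q → t x q xor t q x)) (trans (cong₂ _xor_ (𝔹.xor-same (t x x))
          (⨁.sum-cong-≗ (λ c → trans (cong₂ _xor_ (t-xπ c) (t-πx c)) (xor-cancelˡ (ℓ c) (ab-weight w c)))))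
          (trans (⨁-two (ab-weight w) a b a≢b (λ c na nb → ab-weight-off w c (at₂-off na nb)))
            (trans (cong₂ _xor_ (ab-weight-at w a (at₂-l a b)) (ab-weight-at w b (at₂-r a b))) (𝔹.xor-same w)))))
        (λ p → trans (⨁.sum-remove {i = x} (λ q → t (π p) q xor t q (π p))) (trans (cong₂ _xor_
            (trans (cong₂ _xor_ (t-πx p) (t-xπ p)) (trans (𝔹.xor-comm (ℓ p xor ab-weight w p) (ℓ p)) (xor-cancelˡ (ℓ p) (ab-weight w p))))
            (⨁.sum-cong-≗ (λ q → cong₂ _xor_ (t-ππ p q) (t-ππ q p))))
          (trans (𝔹.xor-comm (ab-weight w p) _) (trans (sym (shift t₀ t' w (λ p q → sym (xor-cancel (t' p q) (isAB p q ∧ w))) p)) (even' p)))))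

    -- The potential is restricted to the remaining vertices; the drops from `a` to `x` and from `x`
    -- to `b` add up to the drop across `merged`.
    tension-down : ∀ z → IsTension T z → IsTension T' z
    tension-down z (f , h) = f ∘ π , h'
      where
      v = f (π a) xor f (π b)
      hUv : ∀ c → sem (dualT (U c)) z (f x xor f (π c))
      hUv c = h x (π c) , subst (sem (dualT (T (π c) x)) z) (𝔹.xor-comm (f (π c)) (f x)) (h (π c) x)
      through : ∀ i j k → (i xor j) xor (j xor k) ≡ i xor k
      through i j k = trans (𝔹.xor-assoc i j (j xor k)) (cong (i xor_) (xor-cancelˡ j k))
      hG : ∀ c → sem (dualT (G c)) z v
      hG c with at₂ a b c
      ... | true = tt
      ... | false = f x xor f (π c) , hUv c , tt
      hM : sem (dualT merged) z v
      hM = h (π a) (π b) , (f x xor f (π a) , hUv a , subst (sem (dualT (U b)) z) (sym (through (f x) (f (π a)) (f (π b)))) (hUv b))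
        , (false , subst (sem (dualT (T x x)) z) (𝔹.xor-same (f x)) (h x x) , tt) , semd-foldpar⇐ G hG
      h' : ∀ p q → sem (dualT (T' p q)) z (f (π p) xor f (π q))
      h' p q with isAB p q in eq
      ... | false = h _ _
      ... | true with isAB-true {p} {q} eq
      ...   | refl , refl = hM

    tension-up : ∀ z → IsTension T' z → IsTension T z
    tension-up z (f' , h') = f , h
      where
      v = f' a xor f' b
      hM : sem (dualT merged) z v
      hM = subst (λ S → sem (dualT S) z v) T'-ab (h' a b)
      s = proj₁ (proj₁ (proj₂ hM))
      hUa : sem (dualT (U a)) z s
      hUa = proj₁ (proj₂ (proj₁ (proj₂ hM)))
      hUb : sem (dualT (U b)) z (s xor v)
      hUb = proj₂ (proj₂ (proj₁ (proj₂ hM)))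
      hD : sem (dualT D) z v
      hD = proj₂ (proj₂ hM)
      -- The potential at `x` is read off from the drop `s` that the bundle towards `a` takes in the
      -- series composition.
      fx : Bool
      fx = f' a xor s
      f : Fin (3 + n) → Bool
      f = splitAt x fx f'
      f-x : f x ≡ fx
      f-x = splitAt-same x fx f'
      f-π : ∀ c → f (π c) ≡ f' c
      f-π = splitAt-punchIn x fx f'
      fxa : fx xor f' a ≡ s
      fxa = trans (𝔹.xor-comm (f' a xor s) (f' a)) (xor-cancelˡ (f' a) s)
      fxb : fx xor f' b ≡ s xor v
      fxb = trans (cong (_xor f' b) (𝔹.xor-comm (f' a) s)) (𝔹.xor-assoc s (f' a) (f' b))
      hU : ∀ c → sem (dualT (U c)) z (fx xor f' c)
      hU c = byCase (at₂ a b c) refl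
        where
        byCase : ∀ y → at₂ a b c ≡ y → sem (dualT (U c)) z (fx xor f' c)
        byCase true eq = [ (λ e → subst (λ c → sem (dualT (U c)) z (fx xor f' c)) (sym e) (subst (sem (dualT (U a)) z) (sym fxa) hUa))
          , (λ e → subst (λ c → sem (dualT (U c)) z (fx xor f' c)) (sym e) (subst (sem (dualT (U b)) z) (sym fxb) hUb)) ]′ (at₂-true c eq)
        -- The bundle towards a vertex not adjacent to `x` is separated, so it tolerates whatever
        -- potential difference results.
        byCase false eq = let na , nb = at₂-false c eq
                              g = subst (λ S → sem (dualT S) z v) (G-out c eq) (semd-foldpar⇒ G (proj₂ hD) c)
                          in sep-any (sepU c (not-adj c na nb)) (fx xor f' c) (proj₁ (proj₂ g))
      hππ : ∀ p q → sem (dualT (T (π p) (π q))) z (f' p xor f' q)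
      hππ p q = byCase (isAB p q) refl
        where
        byCase : ∀ y → isAB p q ≡ y → sem (dualT (T (π p) (π q))) z (f' p xor f' q)
        byCase true eq = let ea , eb = isAB-true {p} {q} eq in
          subst₂ (λ p q → sem (dualT (T (π p) (π q))) z (f' p xor f' q)) (sym ea) (sym eb) (proj₁ hM)
        byCase false eq = subst (λ S → sem (dualT S) z (f' p xor f' q)) (cong (λ c → if c then merged else T (π p) (π q)) eq) (h' p q)
      h : ∀ y y' → sem (dualT (T y y')) z (f y xor f y')
      h = punch-cases x
        (punch-cases x (sep-any (sep x x (inj₁ refl)) (f x xor f x) (proj₁ (proj₂ (proj₁ hD))))
          (λ c → subst (sem (dualT (T x (π c))) z) (sym (cong₂ _xor_ f-x (f-π c))) (proj₁ (hU c))))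
        (λ p → punch-cases x (subst (sem (dualT (T (π p) x)) z) (trans (𝔹.xor-comm fx (f' p)) (sym (cong₂ _xor_ (f-π p) f-x))) (proj₂ (hU p)))
          (λ q → subst (sem (dualT (T (π p) (π q))) z) (sym (cong₂ _xor_ (f-π p) (f-π q))) (hππ p q)))

    eliminated : Net (contr x a E) Flow Tension
    eliminated = record
      { T = T' ; loc = λ e → locMap (loc e) ; linear = linear' ; located = located'
      ; covered = λ e → covers e _ _ (covered e) ; sep = sep'
      ; flow⇒ = λ z h → flow-down z (flow⇒ z h) ; flow⇐ = λ z h → flow⇐ z (flow-up z h)
      ; tension⇒ = λ z h → tension-down z (tension⇒ z h) ; tension⇐ = λ z h → tension⇐ z (tension-up z h) }

  -- Flows use root value `false`, tensions any root value: deleting the root on one side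
  -- corresponds to contracting it on the dual side.
  record Root {m : ℕ} (Flow Tension : Subset m → Set) : Set where
    field
      root      : Term m
      linear    : Linear root
      allLeaves : ∀ e → leaves root ! e ≡ true
      flow⇒     : ∀ z → Flow z → sem root z false
      flow⇐     : ∀ z → sem root z false → Flow z
      tension⇒  : ∀ z → Tension z → ∃ λ t → sem (dualT root) z t
      tension⇐  : ∀ z t → sem (dualT root) z t → Tension z

  -- The two remaining vertices become the terminals. The diagonal cells are separated, so they
  -- carry no current and accept any potential difference.
  base-root : {E : Ends 2 m} {Flow Tension : Subset m → Set} → Net E Flow Tension → Root Flow Tension
  base-root {m} {E} N = record
    { root = par S R
    ; linear = (linear _ _ , linear _ _ , apart' (λ ())) , (linear _ _ , linear _ _ , apart' (λ ())) , disj λ e h → ≢true⇒false λ h' →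
        contr' (inS e h) (inR e h')
    ; allLeaves = λ e → all-leaves (loc e) (covered e)
    ; flow⇒ = λ z h → let t , ht , ev = flow⇒ z h in
        false , (false , zero-at z zero (ht zero zero) , zero-at z (suc zero) (ht (suc zero) (suc zero)))
        , t zero (suc zero) , ht _ _ , subst (sem (T (suc zero) zero) z) (trans (sym (equal t ev)) (sym (𝔹.xor-identityʳ _))) (ht (suc zero) zero)
    ; flow⇐ = λ z (i , (j , h00 , h11) , (k , h01 , h10)) →
        let j≡f = current (sep zero zero (inj₁ refl)) z j h00
            ji≡f = current (sep (suc zero) (suc zero) (inj₁ refl)) z (j xor i) h11
            i≡f = trans (sym (cong (_xor i) j≡f)) ji≡f
        in flow⇐ z (values false k (k xor (i xor false)) false , (λ where
             zero zero → subst (sem (T zero zero) z) j≡f h00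
             zero (suc zero) → h01
             (suc zero) zero → h10
             (suc zero) (suc zero) → subst (sem (T (suc zero) (suc zero)) z) ji≡f h11)
           , λ where
             zero → even₀ k i i≡f
             (suc zero) → even₁ k i i≡f)
    ; tension⇒ = λ z h → let f , hf = tension⇒ z h in f zero xor f (suc zero) ,
        (sep-any (sep zero zero (inj₁ refl)) _ (hf zero zero) , sep-any (sep (suc zero) (suc zero) (inj₁ refl)) _ (hf (suc zero) (suc zero)))
        , hf zero (suc zero) , subst (sem (dualT (T (suc zero) zero)) z) (𝔹.xor-comm (f (suc zero)) (f zero)) (hf (suc zero) zero)
    ; tension⇐ = λ z t ((h00 , h11) , h01 , h10) → tension⇐ z ((λ { zero → false ; (suc zero) → t }) , λ where
        zero zero → sep-any (sep zero zero (inj₁ refl)) _ h00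
        zero (suc zero) → h01
        (suc zero) zero → subst (sem (dualT (T (suc zero) zero)) z) (sym (𝔹.xor-identityʳ t)) h10
        (suc zero) (suc zero) → sep-any (sep (suc zero) (suc zero) (inj₁ refl)) _ h11)
    }
    where
    open Net N
    S R : Term m
    S = par (T zero zero) (T (suc zero) (suc zero))
    R = par (T zero (suc zero)) (T (suc zero) zero)
    zero-at : ∀ z p {t} → sem (T p p) z t → sem (T p p) z false
    zero-at z p {t} h = subst (sem (T p p) z) (current (sep p p (inj₁ refl)) z t h) h
    apart' : ∀ {p q p' q'} → (p , q) ≢ (p' , q') → Disjoint (leaves (T p q)) (leaves (T p' q'))
    apart' ne = disj λ e h → ≢true⇒false λ h' → ne (trans (sym (located _ _ e h)) (located _ _ e h'))
    inS : ∀ e → leaves S ! e ≡ true → loc e ≡ (zero , zero) ⊎ loc e ≡ (suc zero , suc zero)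
    inS e h = ⊎-map (located _ _ e) (located _ _ e) (∨-true (trans (sym (!-∪ (leaves (T zero zero)) (leaves (T (suc zero) (suc zero))) e)) h))
    inR : ∀ e → leaves R ! e ≡ true → loc e ≡ (zero , suc zero) ⊎ loc e ≡ (suc zero , zero)
    inR e h = ⊎-map (located _ _ e) (located _ _ e) (∨-true (trans (sym (!-∪ (leaves (T zero (suc zero))) (leaves (T (suc zero) zero)) e)) h))
    contr' : ∀ {l : Fin 2 × Fin 2} → l ≡ (zero , zero) ⊎ l ≡ (suc zero , suc zero) → l ≡ (zero , suc zero) ⊎ l ≡ (suc zero , zero) → ⊥
    contr' (inj₁ refl) (inj₁ ())
    contr' (inj₁ refl) (inj₂ ())
    contr' (inj₂ refl) (inj₁ ())
    contr' (inj₂ refl) (inj₂ ())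
    all-leaves : ∀ {e} (l : Fin 2 × Fin 2) → leaves (T (proj₁ l) (proj₂ l)) ! e ≡ true → (leaves S ∪ leaves R) ! e ≡ true
    all-leaves {e} (zero , zero) h = at (∪-l (leaves S) (leaves R)) e (at (∪-l (leaves (T zero zero)) (leaves (T (suc zero) (suc zero)))) e h)
    all-leaves {e} (suc zero , suc zero) h = at (∪-l (leaves S) (leaves R)) e (at (∪-r (leaves (T zero zero)) (leaves (T (suc zero) (suc zero)))) e h)
    all-leaves {e} (zero , suc zero) h = at (∪-r (leaves S) (leaves R)) e (at (∪-l (leaves (T zero (suc zero))) (leaves (T (suc zero) zero))) e h)
    all-leaves {e} (suc zero , zero) h = at (∪-r (leaves S) (leaves R)) e (at (∪-r (leaves (T zero (suc zero))) (leaves (T (suc zero) zero))) e h)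
    equal : ∀ (t : Fin 2 → Fin 2 → Bool) → (∀ p → ⨁ (λ q → t p q xor t q p) ≡ false) → t zero (suc zero) ≡ t (suc zero) zero
    equal t ev = go (t zero zero) (t zero (suc zero)) (t (suc zero) zero) (ev zero)
      where
      go : ∀ i j k → (i xor i) xor ((j xor k) xor false) ≡ false → j ≡ k
      go i j k e = xor≡f⇒≡ (trans (sym (𝔹.xor-identityʳ _)) (trans (cong (_xor ((j xor k) xor false)) (sym (𝔹.xor-same i))) e))
    values : Bool → Bool → Bool → Bool → Fin 2 → Fin 2 → Bool
    values i j k l zero zero = i
    values i j k l zero (suc zero) = j
    values i j k l (suc zero) zero = k
    values i j k l (suc zero) (suc zero) = l
    even₀ : ∀ k i → i ≡ false → false xor ((k xor (k xor (i xor false))) xor false) ≡ false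
    even₀ true _ refl = refl
    even₀ false _ refl = refl
    even₁ : ∀ k i → i ≡ false → ((k xor (i xor false)) xor k) xor (false xor false) ≡ false
    even₁ true _ refl = refl
    even₁ false _ refl = refl

  reduces⇒root : {E : Ends n m} {Flow Tension : Subset m → Set} → Reduces E → Net E Flow Tension → Root Flow Tension
  reduces⇒root (base E) N = base-root N
  reduces⇒root (elim E x a b a≢b low _ R) N = reduces⇒root R (Eliminate.eliminated N x a b a≢b low)

open Reductions

-- Branch sets and spanning trees of a contraction onto K4.

module BranchSets where

  private variable
    n m k : ℕ

  ≼-∅ : {z : Subset m} → z ≼ ∅ˢ → z ≡ ∅ˢ
  ≼-∅ h = ¬inhabited⇒∅ (λ (i , p) → t≢f (at h i p) (!-∅ i))

  via : (Fin n → Fin k) → Ends n m → Ends k m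
  via β E i = β (proj₁ (E i)) , β (proj₂ (E i))

  -- The fibres of β are the branch sets of a K4 minor, with spanning trees in T.
  record Branches {n m : ℕ} (E : Ends n m) : Set where
    field
      T        : Subset m
      β        : Fin n → Fin 4
      edge     : Fin 6 → Fin m
      ends-edge : ∀ i → via β E (edge i) ≡ ends K4 i ⊎ via β E (edge i) ≡ (proj₂ (ends K4 i) , proj₁ (ends K4 i))
      independent : ∀ z → z ≼ T → mem (evenSpace E) z → z ≡ ∅ˢ
      within   : ∀ t → T ! t ≡ true → proj₁ (via β E t) ≡ proj₂ (via β E t)
      factors  : ∀ (f : Subset n) → (∀ t → T ! t ≡ true → f ! proj₁ (E t) ≡ f ! proj₂ (E t)) → ∀ p q → β p ≡ β q → f ! p ≡ f ! q
      onto     : ∀ i → ∃ λ p → β p ≡ i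
      completion : ∀ z → mem (evenSpace (via β E)) z → ∃ λ X → X ≼ T × mem (evenSpace E) (z ⊕ X)

  -- Used in both directions: evenness passes to the contraction, and it comes back once the
  -- boundary at `x` is zero.
  boundary-contr : (E : Ends (suc n) m) (x : Fin (suc n)) (a : Fin n) (z : Subset m) (p : Fin n) →
    boundary (contr x a E) z p ≡ boundary E z (punchIn x p) xor (eqB p a ∧ boundary E z x)
  boundary-contr E x a z p = trans (⨁.sum-cong-≗ (λ i → trans (cong (z ! i ∧_) (inc-contr i)) (trans (𝔹.∧-distribˡ-xor (z ! i) (inc E (punchIn x p) i) (eqB p a ∧ inc E x i))
      (cong ((z ! i ∧ inc E (punchIn x p) i) xor_) (∧-rotate (z ! i) (eqB p a) (inc E x i))))))
    (trans (⨁.∑-distrib-+ (λ i → z ! i ∧ inc E (punchIn x p) i) (λ i → eqB p a ∧ (z ! i ∧ inc E x i)))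
      (cong (boundary E z (punchIn x p) xor_) (⨁-∧ (eqB p a) (λ i → z ! i ∧ inc E x i))))
    where
    eqB-collapse : ∀ y → eqB p (collapse x a y) ≡ eqB (punchIn x p) y xor (eqB p a ∧ eqB x y)
    eqB-collapse y with y Fin.≟ x
    ... | yes refl = trans (cong (eqB p) (collapse-same x a)) (sym (trans (cong₂ (λ u v → u xor (eqB p a ∧ v)) (⌊⌋-no (punchIn x p Fin.≟ x) (FinP.punchInᵢ≢i x p)) (eqB-refl x)) (𝔹.∧-identityʳ _)))
    ... | no ne with punch-view x y ne
    ...   | q , refl = trans (cong (eqB p) (collapse-punchIn x a q)) (sym (trans (cong₂ (λ u v → u xor (eqB p a ∧ v)) eqπ (⌊⌋-no (x Fin.≟ punchIn x q) (λ e → FinP.punchInᵢ≢i x q (sym e))))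
            (trans (cong (eqB p q xor_) (𝔹.∧-zeroʳ _)) (𝔹.xor-identityʳ _))))
      where
      eqπ : eqB (punchIn x p) (punchIn x q) ≡ eqB p q
      eqπ = b-ext (λ h → ⌊⌋-yes (p Fin.≟ q) (FinP.punchIn-injective x p q (⌊⌋-true (punchIn x p Fin.≟ punchIn x q) h)))
                  (λ h → ⌊⌋-yes (punchIn x p Fin.≟ punchIn x q) (cong (punchIn x) (⌊⌋-true (p Fin.≟ q) h)))
    inc-contr : ∀ i → inc (contr x a E) p i ≡ inc E (punchIn x p) i xor (eqB p a ∧ inc E x i)
    inc-contr i = trans (cong₂ _xor_ (eqB-collapse (proj₁ (E i))) (eqB-collapse (proj₂ (E i))))
      (trans (xor-swap (eqB (punchIn x p) (proj₁ (E i))) (eqB p a ∧ eqB x (proj₁ (E i))) (eqB (punchIn x p) (proj₂ (E i))) (eqB p a ∧ eqB x (proj₂ (E i))))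
        (cong (inc E (punchIn x p) i xor_) (sym (𝔹.∧-distribˡ-xor (eqB p a) (eqB x (proj₁ (E i))) (eqB x (proj₂ (E i)))))))

  boundary-⁅⁆ : (E : Ends n m) (t : Fin m) (p : Fin n) → boundary E ⁅ t ⁆ p ≡ inc E p t
  boundary-⁅⁆ E t p = trans (⨁-single _ t (λ j ne → cong (_∧ inc E p j) (!-⁅⁆-diff ne))) (cong (_∧ inc E p t) (!-⁅⁆-same t))

  joins-inc : (E : Ends n m) {t : Fin m} {p q : Fin n} → Joins E t p q → ∀ y → inc E y t ≡ eqB y p xor eqB y q
  joins-inc E (inj₁ e) y = cong (λ (s , t) → eqB y s xor eqB y t) e
  joins-inc E {p = p} {q} (inj₂ e) y = trans (cong (λ (s , t) → eqB y s xor eqB y t) e) (𝔹.xor-comm (eqB y q) (eqB y p))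

  -- Each contracted edge joins `x` to the vertex it is merged with, so adding it to `T` extends the
  -- spanning tree of one branch set.
  branches : {E : Ends n m} → K4Model E → Branches E
  branches {n} {m} {E} (done c inj surj adj) = record
    { T = ∅ˢ ; β = β
    ; edge = λ i → proj₁ (adj _ _ (K4-loopless i))
    ; ends-edge = λ i → at-ends (proj₂ (adj _ _ (K4-loopless i)))
    ; independent = λ z h _ → ≼-∅ h
    ; within = λ t h → ⊥-elim (t≢f h (!-∅ t))
    ; factors = λ f _ p q e → cong (f !_) (trans (sym (cβ p)) (trans (cong c e) (cβ q)))
    ; onto = λ i → c i , βc i
    ; completion = λ z h → ∅ˢ , ≼-refl , subst (mem (evenSpace E)) (sym (⊕-∅ z)) (λ p → trans (⨁.sum-cong-≗ (λ i → cong (z ! i ∧_) (inc-β p i))) (h (β p)))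
    }
    where
    β : Fin n → Fin 4
    β y = proj₁ (surj y)
    cβ : ∀ y → c (β y) ≡ y
    cβ y = proj₂ (surj y)
    βc : ∀ i → β (c i) ≡ i
    βc i = inj _ _ (cβ (c i))
    at-ends : ∀ {i p q} → Joins E i (c p) (c q) → via β E i ≡ (p , q) ⊎ via β E i ≡ (q , p)
    at-ends {p = p} {q} (inj₁ e) = inj₁ (trans (cong (λ (s , t) → β s , β t) e) (cong₂ _,_ (βc p) (βc q)))
    at-ends {p = p} {q} (inj₂ e) = inj₂ (trans (cong (λ (s , t) → β s , β t) e) (cong₂ _,_ (βc q) (βc p)))
    eqB-β : ∀ p y → eqB p y ≡ eqB (β p) (β y)
    eqB-β p y = b-ext (λ h → ⌊⌋-yes (β p Fin.≟ β y) (cong β (⌊⌋-true (p Fin.≟ y) h)))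
      (λ h → ⌊⌋-yes (p Fin.≟ y) (trans (sym (cβ p)) (trans (cong c (⌊⌋-true (β p Fin.≟ β y) h)) (cβ y))))
    inc-β : ∀ p i → inc E p i ≡ inc (via β E) (β p) i
    inc-β p i = cong₂ _xor_ (eqB-β p _) (eqB-β p _)
  branches {suc n} {m} {E} (contracted x a t j M) = record
    { T = B.T ∪ ⁅ t ⁆ ; β = β ; edge = B.edge ; ends-edge = B.ends-edge
    ; independent = independent
    ; within = λ s h → [ B.within s , (λ p → subst (λ s → β (proj₁ (E s)) ≡ β (proj₂ (E s))) (sym (!-⁅⁆⇒≡ t s p)) t-within) ]′ (∨-true (trans (sym (!-∪ B.T ⁅ t ⁆ s)) h))
    ; factors = factors
    ; onto = λ i → let p , e = B.onto i in punchIn x p , trans (cong B.β (collapse-punchIn x a p)) e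
    ; completion = completion
    }
    where
    module B = Branches (branches M)
    E' = contr x a E
    β : Fin (suc n) → Fin 4
    β y = B.β (collapse x a y)
    t-loop : proj₁ (E' t) ≡ a × proj₂ (E' t) ≡ a
    t-loop = [ (λ e → trans (cong (collapse x a ∘ proj₁) e) (collapse-same x a) , trans (cong (collapse x a ∘ proj₂) e) (collapse-punchIn x a a))
             , (λ e → trans (cong (collapse x a ∘ proj₁) e) (collapse-punchIn x a a) , trans (cong (collapse x a ∘ proj₂) e) (collapse-same x a)) ]′ j
    t-within : β (proj₁ (E t)) ≡ β (proj₂ (E t))
    t-within = cong B.β (trans (proj₁ t-loop) (sym (proj₂ t-loop)))
    t-even : mem (evenSpace E') ⁅ t ⁆
    t-even p = trans (boundary-⁅⁆ E' t p) (trans (cong₂ (λ u v → eqB p u xor eqB p v) (proj₁ t-loop) (proj₂ t-loop)) (𝔹.xor-same (eqB p a)))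
    even-contr : ∀ z → mem (evenSpace E) z → mem (evenSpace E') z
    even-contr z h p = trans (boundary-contr E x a z p) (trans (cong₂ (λ u v → u xor (eqB p a ∧ v)) (h (punchIn x p)) (h x)) (𝔹.∧-zeroʳ _))
    t-at-x : boundary E ⁅ t ⁆ x ≡ true
    t-at-x = trans (boundary-⁅⁆ E t x) (trans (joins-inc E j x) (cong₂ _xor_ (eqB-refl x) (⌊⌋-no (x Fin.≟ punchIn x a) (λ e → FinP.punchInᵢ≢i x a (sym e)))))
    independent : ∀ z → z ≼ B.T ∪ ⁅ t ⁆ → mem (evenSpace E) z → z ≡ ∅ˢ
    independent z z≼ h = byCase (z ! t) refl
      where
      z' : Bool → Subset m
      z' true = z ⊕ ⁅ t ⁆
      z' false = z
      removed : ∀ b → z ! t ≡ b → z' b ≼ B.T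
      removed b eq = incl λ i p → inT b eq i p
        where
        inT : ∀ b → z ! t ≡ b → ∀ i → z' b ! i ≡ true → B.T ! i ≡ true
        inT false eq i p = [ id , (λ q → ⊥-elim (t≢f p (trans (cong (z !_) (!-⁅⁆⇒≡ t i q)) eq))) ]′ (∨-true (trans (sym (!-∪ B.T ⁅ t ⁆ i)) (at z≼ i p)))
        inT true eq i p with i Fin.≟ t
        ... | yes refl = ⊥-elim (t≢f p (trans (!-⊕ z ⁅ t ⁆ t) (cong₂ _xor_ eq (!-⁅⁆-same t))))
        ... | no ne = [ id , (λ q → ⊥-elim (ne (!-⁅⁆⇒≡ t i q))) ]′ (∨-true (trans (sym (!-∪ B.T ⁅ t ⁆ i)) (at z≼ i
                (trans (sym (𝔹.xor-identityʳ _)) (trans (cong (z ! i xor_) (sym (!-⁅⁆-diff ne))) (trans (sym (!-⊕ z ⁅ t ⁆ i)) p))))))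
      byCase : ∀ b → z ! t ≡ b → z ≡ ∅ˢ
      byCase false eq = B.independent z (removed false eq) (even-contr z h)
      byCase true eq = ⊥-elim (t≢f t-at-x (trans (cong (λ w → boundary E w x) (sym z≡t)) (h x)))
        where
        -- In the contraction `t` is a loop and thus even, so `z ⊕ ⁅ t ⁆` is even inside the smaller
        -- forest, hence empty. But `t` alone has odd boundary at `x`.
        z≡t : z ≡ ⁅ t ⁆
        z≡t = ⊕≡∅⇒≡ (B.independent (z ⊕ ⁅ t ⁆) (removed true eq) (mem-⊕ (evenSpace E') {z} {⁅ t ⁆} (even-contr z h) t-even))
    factors : ∀ (f : Subset (suc n)) → (∀ s → (B.T ∪ ⁅ t ⁆) ! s ≡ true → f ! proj₁ (E s) ≡ f ! proj₂ (E s)) → ∀ p q → β p ≡ β q → f ! p ≡ f ! q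
    factors f h p q e = trans (down p) (trans (B.factors f' (λ s hs → trans (sym (down _)) (trans (h s (at (≼-insert B.T t) s hs)) (down _))) _ _ e) (sym (down q)))
      where
      f' : Subset n
      f' = tabulate (λ p → f ! punchIn x p)
      fx : f ! x ≡ f ! punchIn x a
      fx = [ (λ e → trans (sym (cong (λ (s , _) → f ! s) e)) (trans (h t (insert-new B.T t)) (cong (λ (_ , s) → f ! s) e)))
           , (λ e → trans (sym (cong (λ (_ , s) → f ! s) e)) (trans (sym (h t (insert-new B.T t))) (cong (λ (s , _) → f ! s) e))) ]′ j
      down : ∀ y → f ! y ≡ f' ! collapse x a y
      down y with y Fin.≟ x
      ... | yes refl = trans fx (trans (sym (!-tab (λ p → f ! punchIn x p) a)) (cong (f' !_) (sym (collapse-same x a))))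
      ... | no ne with punch-view x y ne
      ...   | p , refl = trans (sym (!-tab (λ p → f ! punchIn x p) p)) (cong (f' !_) (sym (collapse-punchIn x a p)))
    completion : ∀ z → mem (evenSpace (via β E)) z → ∃ λ X → X ≼ B.T ∪ ⁅ t ⁆ × mem (evenSpace E) (z ⊕ X)
    completion z h = let X , X≼ , ev = B.completion z h in extend X X≼ ev (boundary E (z ⊕ X) x) refl
      where
      extend : ∀ X → X ≼ B.T → mem (evenSpace E') (z ⊕ X) → ∀ b → boundary E (z ⊕ X) x ≡ b → ∃ λ X → X ≼ B.T ∪ ⁅ t ⁆ × mem (evenSpace E) (z ⊕ X)
      extend X X≼ ev false eq = X , ≼-trans X≼ (≼-insert B.T t) , ev'
        where
        ev' : mem (evenSpace E) (z ⊕ X)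
        ev' y with y Fin.≟ x
        ... | yes refl = eq
        ... | no ne with punch-view x y ne
        ...   | p , refl = trans (sym (trans (cong (λ v → boundary E (z ⊕ X) (punchIn x p) xor (eqB p a ∧ v)) eq) (trans (cong (boundary E (z ⊕ X) (punchIn x p) xor_) (𝔹.∧-zeroʳ _)) (𝔹.xor-identityʳ _))))
                (trans (sym (boundary-contr E x a (z ⊕ X) p)) (ev p))
      -- Adding `t` repairs the parity at `x` and, because `t` is a loop in the contraction, at the
      -- vertex it was merged with as well.
      extend X X≼ ev true eq = X ⊕ ⁅ t ⁆ , ⊕-≼ (≼-trans X≼ (≼-insert B.T t)) (⁅⁆-≼ (insert-new B.T t)) ,
        subst (mem (evenSpace E)) reassoc ev'
        where
        Y = z ⊕ X
        reassoc : Y ⊕ ⁅ t ⁆ ≡ z ⊕ (X ⊕ ⁅ t ⁆)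
        reassoc = ext λ i → trans (!-⊕ Y ⁅ t ⁆ i) (trans (cong (_xor ⁅ t ⁆ ! i) (!-⊕ z X i)) (trans (𝔹.xor-assoc (z ! i) _ _)
          (sym (trans (!-⊕ z (X ⊕ ⁅ t ⁆) i) (cong (z ! i xor_) (!-⊕ X ⁅ t ⁆ i))))))
        at-t : ∀ y → boundary E (Y ⊕ ⁅ t ⁆) y ≡ boundary E Y y xor (eqB y x xor eqB y (punchIn x a))
        at-t y = trans (boundary-⊕ E Y ⁅ t ⁆ y) (cong (boundary E Y y xor_) (trans (boundary-⁅⁆ E t y) (joins-inc E j y)))
        ev' : mem (evenSpace E) (Y ⊕ ⁅ t ⁆)
        ev' y with y Fin.≟ x
        ... | yes refl = trans (boundary-⊕ E Y ⁅ t ⁆ x) (cong₂ _xor_ eq t-at-x)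
        ... | no ne with punch-view x y ne
        ...   | p , refl = trans (at-t (punchIn x p)) (trans (cong₂ (λ u v → boundary E Y (punchIn x p) xor (u xor v)) (⌊⌋-no (punchIn x p Fin.≟ x) ne) eqπ)
                (trans (sym (trans (boundary-contr E x a Y p) (cong (boundary E Y (punchIn x p) xor_) (trans (cong (eqB p a ∧_) eq) (𝔹.∧-identityʳ _))))) (ev p)))
          where
          eqπ : eqB (punchIn x p) (punchIn x a) ≡ eqB p a
          eqπ = b-ext (λ h → ⌊⌋-yes (p Fin.≟ a) (FinP.punchIn-injective x p a (⌊⌋-true (punchIn x p Fin.≟ punchIn x a) h)))
                      (λ h → ⌊⌋-yes (punchIn x p Fin.≟ punchIn x a) (cong (punchIn x) (⌊⌋-true (p Fin.≟ a) h)))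

open BranchSets

-- M(K4) as a series minor of the cycle matroid and of its dual.

module K4Minors where

  private variable
    n m k : ℕ

  comb : (Fin k → Bool) → (Fin k → Subset m) → Subset m
  comb {zero} c A = ∅ˢ
  comb {suc k} c A = (if c zero then A zero else ∅ˢ) ⊕ comb (c ∘ suc) (A ∘ suc)

  comb-! : (c : Fin k → Bool) (A : Fin k → Subset m) (x : Fin m) → comb c A ! x ≡ ⨁ (λ a → c a ∧ A a ! x)
  comb-! {zero} c A x = !-∅ x
  comb-! {suc k} c A x = trans (!-⊕ (if c zero then A zero else ∅ˢ) (comb (c ∘ suc) (A ∘ suc)) x) (cong₂ _xor_ (first (c zero)) (comb-! (c ∘ suc) (A ∘ suc) x))
    where
    first : ∀ b → (if b then A zero else ∅ˢ) ! x ≡ b ∧ A zero ! x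
    first true = refl
    first false = !-∅ x

  comb-mem : (Z : Space m) (c : Fin k → Bool) (A : Fin k → Subset m) → (∀ a → mem Z (A a)) → mem Z (comb c A)
  comb-mem {k = zero} Z c A h = mem-∅ Z
  comb-mem {k = suc k} Z c A h = mem-⊕ Z (first (c zero)) (comb-mem Z (c ∘ suc) (A ∘ suc) (h ∘ suc))
    where
    first : ∀ b → mem Z (if b then A zero else ∅ˢ)
    first true = h zero
    first false = mem-∅ Z

  ⨁-reindex : (e : Fin k → Fin n) → Inj e → (g : Fin n → Bool) → (∀ x → (∀ i → e i ≢ x) → g x ≡ false) → ⨁ g ≡ ⨁ (g ∘ e)
  ⨁-reindex e inj g vanish = trans (⨁.sum-cong-≗ expand) (trans (⨁.∑-comm (λ x i → g x ∧ eqB x (e i))) (⨁.sum-cong-≗ (λ i → ⨁-pick g (e i))))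
    where
    expand : ∀ x → g x ≡ ⨁ (λ i → g x ∧ eqB x (e i))
    expand x with FinP.any? (λ i → e i Fin.≟ x)
    ... | yes (i , refl) = sym (trans (⨁-single _ i (λ j ne → trans (cong (g (e i) ∧_) (⌊⌋-no (e i Fin.≟ e j) (λ h → ne (inj j i (sym h))))) (𝔹.∧-zeroʳ _)))
          (trans (cong (g (e i) ∧_) (eqB-refl (e i))) (𝔹.∧-identityʳ _)))
    ... | no none = trans (vanish x (λ i h → none (i , h))) (sym (⨁-false _ (λ i → trans (cong (_∧ eqB x (e i)) (vanish x (λ i h → none (i , h)))) refl)))

  inc-end : (E : Ends n m) (p : Fin n) (x : Fin m) → inc E p x ≡ true → p ≡ proj₁ (E x) ⊎ p ≡ proj₂ (E x)
  inc-end E p x h with p Fin.≟ proj₁ (E x) | p Fin.≟ proj₂ (E x)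
  ... | yes e | _ = inj₁ e
  ... | no _ | yes e = inj₂ e

  triangle-combination : ∀ X → mem (evenSpace (ends K4)) X → ∃ λ c → ∀ i → X ! i ≡ ⨁ (λ a → c ! a ∧ triangle a ! i)
  triangle-combination = ⌊⌋-true (allSubset? (λ X → mem? (evenSpace (ends K4)) X →-dec
    SubP.anySubset? (λ c → FinP.all? (λ i → X ! i 𝔹.≟ ⨁ (λ a → c ! a ∧ triangle a ! i))))) refl

  triangles-cancel : ∀ i → ⨁ (λ a → triangle a ! i) ≡ false
  triangles-cancel = ⌊⌋-true (FinP.all? (λ i → ⨁ (λ a → triangle a ! i) 𝔹.≟ false)) refl

  -- The excluded pattern, all four values true, would give the seventh point of the Fano plane.
  functional : ∀ (l : Subset 4) j → l ! j ≡ false → ⨁ (l !_) ≡ false → (∀ a → l ! a ≡ false) ⊎ (∃ λ i → ∀ a → l ! a ≡ triangle a ! i)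
  functional = ⌊⌋-true (allSubset? (λ l → FinP.all? (λ j → (l ! j 𝔹.≟ false) →-dec ((⨁ (l !_) 𝔹.≟ false) →-dec
    (FinP.all? (λ a → l ! a 𝔹.≟ false) ⊎-dec FinP.any? (λ i → FinP.all? (λ a → l ! a 𝔹.≟ triangle a ! i))))))) refl

  triangle-misses : ∀ j i → triangle j ! i ≡ true → j ≢ proj₁ (ends K4 i) × j ≢ proj₂ (ends K4 i)
  triangle-misses = ⌊⌋-true (FinP.all? (λ j → FinP.all? (λ i → (triangle j ! i 𝔹.≟ true) →-dec (¬? (j Fin.≟ proj₁ (ends K4 i)) ×-dec ¬? (j Fin.≟ proj₂ (ends K4 i)))))) refl

  K4-simple : ∀ i j → ends K4 i ≡ ends K4 j ⊎ ends K4 i ≡ (proj₂ (ends K4 j) , proj₁ (ends K4 j)) → i ≡ j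
  K4-simple = ⌊⌋-true (FinP.all? (λ i → FinP.all? (λ j → (pair-≟ (ends K4 i) (ends K4 j) ⊎-dec pair-≟ (ends K4 i) (proj₂ (ends K4 j) , proj₁ (ends K4 j))) →-dec (i Fin.≟ j)))) refl

  K4-complete : ∀ a b → a ≡ b ⊎ (∃ λ i → ends K4 i ≡ (a , b) ⊎ ends K4 i ≡ (b , a))
  K4-complete = ⌊⌋-true (FinP.all? (λ a → FinP.all? (λ b → (a Fin.≟ b) ⊎-dec FinP.any? (λ i → pair-≟ (ends K4 i) (a , b) ⊎-dec pair-≟ (ends K4 i) (b , a))))) refl

  -- K4 is self-dual: exchange each edge with the opposite one.
  even⇒cut : ∀ X → mem (evenSpace (ends K4)) X → ∃ λ h → ∀ i → X ! i ≡ cut (ends K4) h ! Fin.opposite i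
  even⇒cut = ⌊⌋-true (allSubset? (λ X → mem? (evenSpace (ends K4)) X →-dec SubP.anySubset? (λ h → FinP.all? (λ i → X ! i 𝔹.≟ cut (ends K4) h ! Fin.opposite i)))) refl

  cut⇒even : ∀ h → mem (evenSpace (ends K4)) (tabulate (λ i → cut (ends K4) h ! Fin.opposite i))
  cut⇒even = ⌊⌋-true (allSubset? (λ h → mem? (evenSpace (ends K4)) (tabulate (λ i → cut (ends K4) h ! Fin.opposite i)))) refl

  module _ {n m : ℕ} {E : Ends n m} (B : Branches E) where
    open Branches B

    private
      βE : Ends 4 m
      βE = via β E

    inc-edge : ∀ j i → inc βE j (edge i) ≡ inc (ends K4) j i
    inc-edge j i = [ (λ e → cong (λ (s , t) → eqB j s xor eqB j t) e)
      , (λ e → trans (cong (λ (s , t) → eqB j s xor eqB j t) e) (𝔹.xor-comm (eqB j (proj₂ (ends K4 i))) (eqB j (proj₁ (ends K4 i))))) ]′ (ends-edge i)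

    edge-inj : Inj edge
    edge-inj i j e = K4-simple i j (go (ends-edge i) (ends-edge j))
      where
      go : _ → _ → ends K4 i ≡ ends K4 j ⊎ ends K4 i ≡ (proj₂ (ends K4 j) , proj₁ (ends K4 j))
      go (inj₁ p) (inj₁ q) = inj₁ (trans (sym p) (trans (cong βE e) q))
      go (inj₁ p) (inj₂ q) = inj₂ (trans (sym p) (trans (cong βE e) q))
      go (inj₂ p) (inj₁ q) = inj₂ (cong (λ (s , t) → t , s) (trans (sym p) (trans (cong βE e) q)))
      go (inj₂ p) (inj₂ q) = inj₁ (cong (λ (s , t) → t , s) (trans (sym p) (trans (cong βE e) q)))

    edge-∉T : ∀ i → T ! edge i ≡ false
    edge-∉T i = ≢true⇒false λ h → K4-loopless i ([ (λ e → trans (sym (cong proj₁ e)) (trans (within (edge i) h) (cong proj₂ e)))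
      , (λ e → trans (sym (cong proj₂ e)) (trans (sym (within (edge i) h)) (cong proj₁ e))) ]′ (ends-edge i))

    kernel : Subset m
    kernel = img edge fullˢ

    edge-∈ : ∀ i → kernel ! edge i ≡ true
    edge-∈ i = img-intro edge fullˢ i (!-full i)

    ∈-edge : ∀ x → kernel ! x ≡ true → ∃ λ i → edge i ≡ x
    ∈-edge x h = let i , e , _ = img-elim edge fullˢ x h in i , e

    T∩kernel : ∀ x → T ! x ≡ true → kernel ! x ≡ false
    T∩kernel x h = ≢true⇒false λ k → let i , e = ∈-edge x k in t≢f h (subst (λ x → T ! x ≡ false) e (edge-∉T i))

    kernel-iso : {Z : Space m} {W : Space 6} (ρ : Fin 6 → Fin 6) → (∀ i → ρ (ρ i) ≡ i) →
      (∀ X → mem W X → mem Z (img (edge ∘ ρ) X)) → (∀ z → mem Z z → mem W (pre (edge ∘ ρ) z)) → SpaceIso kernel Z W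
    kernel-iso ρ invol to from = record
      { f = edge ∘ ρ ; inj = λ i j e → trans (sym (invol i)) (trans (cong ρ (edge-inj _ _ e)) (invol j)) ; inS = λ i → edge-∈ (ρ i)
      ; onto = λ x h → let i , e = ∈-edge x h in ρ i , trans (cong edge (invol i)) e ; to = to ; from = from }

    trace-img : ∀ z X (ρ : Fin 6 → Fin 6) → (∀ i → ρ (ρ i) ≡ i) → (∀ i → z ! edge (ρ i) ≡ X ! i) → z ∩ kernel ≡ img (edge ∘ ρ) X
    trace-img z X ρ invol h = ext λ x → b-ext
      (λ p → let zx , kx = ∧-true (trans (sym (!-∩ z kernel x)) p)
                 i , e = ∈-edge x kx
                 e' = trans (cong edge (invol i)) e
             in subst (λ y → img (edge ∘ ρ) X ! y ≡ true) e' (img-intro (edge ∘ ρ) X (ρ i) (trans (sym (h (ρ i))) (trans (cong (z !_) e') zx))))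
      (λ p → let i , e , Xi = img-elim (edge ∘ ρ) X x p in
             trans (!-∩ z kernel x) (cong₂ _∧_ (trans (cong (z !_) (sym e)) (trans (h i) Xi)) (subst (λ y → kernel ! y ≡ true) e (edge-∈ (ρ i)))))

    pre-∩-kernel : ∀ z (ρ : Fin 6 → Fin 6) → pre (edge ∘ ρ) (z ∩ kernel) ≡ pre (edge ∘ ρ) z
    pre-∩-kernel z ρ = ext λ i → trans (pre-! (edge ∘ ρ) (z ∩ kernel) i) (trans (!-∩ z kernel _)
      (trans (cong (z ! edge (ρ i) ∧_) (edge-∈ (ρ i))) (trans (𝔹.∧-identityʳ _) (sym (pre-! (edge ∘ ρ) z i)))))

    module Graphic where

      -- Everything is deleted except the six connecting edges and the spanning trees of the branch
      -- sets.
      D : Subset m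
      D = ∁ (kernel ∪ T)

      ≼⇒avoids : ∀ z → z ≼ kernel ∪ T → Avoids D z
      ≼⇒avoids z h x Dx = ≢true⇒false λ zx → t≢f Dx (trans (VecP.lookup-map x not (kernel ∪ T)) (cong not (at h x zx)))

      avoids⇒ : ∀ z → Avoids D z → ∀ x → z ! x ≡ true → kernel ! x ≡ true ⊎ T ! x ≡ true
      avoids⇒ z av x zx = ∨-true (trans (sym (!-∪ kernel T x)) (≢false⇒true λ h → t≢f zx (av x (trans (VecP.lookup-map x not (kernel ∪ T)) (cong not h)))))

      T-inc : ∀ j t → T ! t ≡ true → inc βE j t ≡ false
      T-inc j t h = trans (cong (λ b → b xor eqB j (proj₂ (βE t))) (cong (eqB j) (within t h))) (𝔹.xor-same (eqB j (proj₂ (βE t))))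

      boundary-kernel : ∀ z → Avoids D z → ∀ j → boundary βE z j ≡ boundary (ends K4) (pre edge z) j
      boundary-kernel z av j = trans (⨁-reindex edge edge-inj (λ x → z ! x ∧ inc βE j x) vanish)
        (⨁.sum-cong-≗ (λ i → cong₂ _∧_ (sym (pre-! edge z i)) (inc-edge j i)))
        where
        vanish : ∀ x → (∀ i → edge i ≢ x) → z ! x ∧ inc βE j x ≡ false
        vanish x h = ≢true⇒false λ p → let zx , ix = ∧-true p in
          [ (λ k → let i , e = ∈-edge x k in h i e) , (λ tx → t≢f ix (T-inc j x tx)) ]′ (avoids⇒ z av x zx)

      -- Evenness at a vertex of the quotient is orthogonality to the cut around its branch set.
      even-β : ∀ z → mem (evenSpace E) z → mem (evenSpace βE) z
      even-β z h j = trans (sym (⨁.sum-cong-≗ (λ x → cong (z ! x ∧_) (trans (cut-! E f x) (cong₂ _xor_ (!-tab (λ p → eqB j (β p)) (proj₁ (E x))) (!-tab (λ p → eqB j (β p)) (proj₂ (E x)))))))) (even-orth-cut E f z h)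
        where
        f : Subset n
        f = tabulate (λ p → eqB j (β p))

      even-kernel : ∀ z → mem (evenSpace E) z → Avoids D z → mem (evenSpace (ends K4)) (pre edge z)
      even-kernel z h av j = trans (sym (boundary-kernel z av j)) (even-β z h j)

      Lifted : Subset 6 → Set
      Lifted X = ∃ λ z → mem (evenSpace E) z × Avoids D z × (∀ i → z ! edge i ≡ X ! i)

      -- The connecting edges selected by `X` are closed up to a cycle inside the spanning trees by
      -- `completion`.
      lift : ∀ X → mem (evenSpace (ends K4)) X → Lifted X
      lift X mX = completed (completion (img edge X) even-img)
        where
        img≼ : img edge X ≼ kernel
        img≼ = incl λ x p → let i , e , _ = img-elim edge X x p in subst (λ y → kernel ! y ≡ true) e (edge-∈ i)
        even-img : mem (evenSpace βE) (img edge X)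
        even-img j = trans (boundary-kernel (img edge X) (≼⇒avoids (img edge X) (≼-trans img≼ (∪-l kernel T))) j)
          (trans (cong (λ Y → boundary (ends K4) Y j) (pre-img edge edge-inj X)) (mX j))
        completed : (∃ λ Y → Y ≼ T × mem (evenSpace E) (img edge X ⊕ Y)) → Lifted X
        completed (Y , Y≼ , ev) = img edge X ⊕ Y , ev ,
          ≼⇒avoids (img edge X ⊕ Y) (⊕-≼ (≼-trans img≼ (∪-l kernel T)) (≼-trans Y≼ (∪-r kernel T))) ,
          λ i → trans (!-⊕ (img edge X) Y (edge i)) (trans (cong₂ _xor_ (img-! edge edge-inj X i) (≢true⇒false λ p → t≢f (at Y≼ (edge i) p) (edge-∉T i))) (𝔹.xor-identityʳ _))

      zero-on-kernel : ∀ z → mem (evenSpace E) z → Avoids D z → (∀ i → z ! edge i ≡ false) → z ≡ ∅ˢ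
      zero-on-kernel z h av zero-at = independent z (incl λ x zx → [ (λ k → let i , e = ∈-edge x k in ⊥-elim (t≢f zx (subst (λ y → z ! y ≡ false) e (zero-at i)))) , id ]′ (avoids⇒ z av x zx)) h

      -- On the branch set of j the lift of the triangle missing j is an even subset of T, hence empty.
      misses-branch : ∀ j z → mem (evenSpace E) z → Avoids D z → (∀ i → z ! edge i ≡ triangle j ! i) →
        ∀ t → T ! t ≡ true → proj₁ (βE t) ≡ j → z ! t ≡ false
      misses-branch j z h av vals t tT βt = ≢true⇒false λ zt → t≢f (trans (local-! t) (cong₂ _∧_ zt (cong₂ _∧_ tT (⌊⌋-yes (j Fin.≟ proj₁ (βE t)) (sym βt)))))
          (trans (cong (_! t) (independent local local≼T local-even)) (!-∅ t))
        where
        local : Subset m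
        local = tabulate (λ x → z ! x ∧ (T ! x ∧ eqB j (proj₁ (βE x))))
        local-! : ∀ x → local ! x ≡ z ! x ∧ (T ! x ∧ eqB j (proj₁ (βE x)))
        local-! x = !-tab (λ x → z ! x ∧ (T ! x ∧ eqB j (proj₁ (βE x)))) x
        local⇒ : ∀ x → local ! x ≡ true → z ! x ≡ true × T ! x ≡ true × eqB j (proj₁ (βE x)) ≡ true
        local⇒ x p = let a , b = ∧-true {z ! x} {T ! x ∧ eqB j (proj₁ (βE x))} (trans (sym (local-! x)) p) in a , ∧-true b
        local≼T : local ≼ T
        local≼T = incl λ x p → proj₁ (proj₂ (local⇒ x p))
        β-end : ∀ {p x} → T ! x ≡ true → inc E p x ≡ true → β p ≡ proj₁ (βE x)
        β-end {p} {x} tx ix = [ (λ e → cong β e) , (λ e → trans (cong β e) (sym (within x tx))) ]′ (inc-end E p x ix)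
        no-edge : ∀ p x → β p ≡ j → z ! x ≡ true → inc E p x ≡ true → T ! x ≡ true
        no-edge p x βp zx ix = [ (λ k → let i , e = ∈-edge x k in ⊥-elim (hit i e)) , id ]′ (avoids⇒ z av x zx)
          where
          hit : ∀ i → edge i ≡ x → ⊥
          hit i refl = let m₁ , m₂ = triangle-misses j i (trans (sym (vals i)) zx) in
            [ (λ e → [ (λ q → m₁ (trans (sym βp) (trans (cong β e) (cong proj₁ q)))) , (λ q → m₂ (trans (sym βp) (trans (cong β e) (cong proj₁ q)))) ]′ (ends-edge i))
            , (λ e → [ (λ q → m₂ (trans (sym βp) (trans (cong β e) (cong proj₂ q)))) , (λ q → m₁ (trans (sym βp) (trans (cong β e) (cong proj₂ q)))) ]′ (ends-edge i)) ]′ (inc-end E p x ix)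
        local-even : mem (evenSpace E) local
        local-even p = byCase (β p Fin.≟ j)
          where
          byCase : Dec (β p ≡ j) → boundary E local p ≡ false
          byCase (yes βp) = trans (⨁.sum-cong-≗ (λ x → b-ext
              (λ q → let l , ix = ∧-true q in cong₂ _∧_ (proj₁ (local⇒ x l)) ix)
              (λ q → let zx , ix = ∧-true q ; tx = no-edge p x βp zx ix in
                cong₂ _∧_ (trans (local-! x) (cong₂ _∧_ zx (cong₂ _∧_ tx (⌊⌋-yes (j Fin.≟ proj₁ (βE x)) (trans (sym βp) (β-end tx ix)))))) ix))) (h p)
          byCase (no βp≢) = ⨁-false _ λ x → ≢true⇒false λ q →
            let l , ix = ∧-true q
                zx , tx , ej = local⇒ x l
            in βp≢ (trans (β-end tx ix) (sym (⌊⌋-true (j Fin.≟ proj₁ (βE x)) ej)))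

      module _ (△ : Fin 4 → Subset 6) (L : ∀ a → Lifted (△ a)) (cancel : ∀ i → ⨁ (λ a → △ a ! i) ≡ false)
        (combination : ∀ X → mem (evenSpace (ends K4)) X → ∃ λ c → ∀ i → X ! i ≡ ⨁ (λ a → c ! a ∧ △ a ! i)) where

        A : Fin 4 → Subset m
        A a = proj₁ (L a)

        comb-avoids : ∀ c → Avoids D (comb c A)
        comb-avoids c x Dx = trans (comb-! c A x) (⨁-false _ (λ a → trans (cong (c a ∧_) (proj₁ (proj₂ (proj₂ (L a))) x Dx)) (𝔹.∧-zeroʳ _)))

        comb-edge : ∀ c i → comb c A ! edge i ≡ ⨁ (λ a → c a ∧ △ a ! i)
        comb-edge c i = trans (comb-! c A (edge i)) (⨁.sum-cong-≗ (λ a → cong (c a ∧_) (proj₂ (proj₂ (proj₂ (L a))) i)))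

        even-comb : ∀ c → mem (evenSpace E) (comb c A)
        even-comb c = comb-mem (evenSpace E) c A (λ a → proj₁ (proj₂ (L a)))

        -- An edge is a linear functional on the cycles avoiding `D`. These are combinations of the
        -- four lifts, so the values on the lifts determine it.
        values : Fin m → Subset 4
        values t = tabulate (λ a → A a ! t)

        values-even : ∀ t → ⨁ (values t !_) ≡ false
        values-even t = trans (⨁.sum-cong-≗ (λ a → !-tab (λ a → A a ! t) a)) (trans (sym (comb-! (λ _ → true) A t))
          (trans (cong (_! t) (zero-on-kernel (comb (λ _ → true) A) (even-comb (λ _ → true)) (comb-avoids (λ _ → true)) (λ i → trans (comb-edge (λ _ → true) i) (cancel i)))) (!-∅ t)))

        as-comb : ∀ z → mem (evenSpace E) z → Avoids D z → ∃ λ c → z ≡ comb c A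
        as-comb z h av = let c , e = combination (pre edge z) (even-kernel z h av) in (c !_) ,
          ⊕≡∅⇒≡ (zero-on-kernel (z ⊕ comb (c !_) A) (mem-⊕ (evenSpace E) {z} {comb (c !_) A} h (even-comb (c !_)))
            (λ x Dx → trans (!-⊕ z (comb (c !_) A) x) (cong₂ _xor_ (av x Dx) (comb-avoids (c !_) x Dx)))
            (λ i → trans (!-⊕ z (comb (c !_) A) (edge i)) (trans (cong₂ _xor_ (trans (sym (pre-! edge z i)) (e i)) (comb-edge (c !_) i)) (𝔹.xor-same (⨁ (λ a → c ! a ∧ △ a ! i))))))

        copies : ∀ t → (∀ a → values t ! a ≡ false) ⊎ (∃ λ i → ∀ a → values t ! a ≡ △ a ! i) →
          (∀ z → mem (evenSpace E) z → Avoids D z → z ! t ≡ false) ⊎ (∃ λ f → kernel ! f ≡ true × (∀ z → mem (evenSpace E) z → Avoids D z → z ! t ≡ z ! f))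
        copies t (inj₁ h) = inj₁ λ z mz av → let c , e = as-comb z mz av in trans (cong (_! t) e) (trans (comb-! c A t)
          (⨁-false _ (λ a → trans (cong (c a ∧_) (trans (sym (!-tab (λ a → A a ! t) a)) (h a))) (𝔹.∧-zeroʳ _))))
        copies t (inj₂ (i , h)) = inj₂ (edge i , edge-∈ i , λ z mz av → let c , e = as-comb z mz av in
          trans (cong (_! t) e) (trans (comb-! c A t) (trans (⨁.sum-cong-≗ (λ a → cong (c a ∧_) (trans (sym (!-tab (λ a → A a ! t) a)) (h a))))
            (sym (trans (cong (_! edge i) e) (comb-edge c i))))))

      liftT : ∀ a → Lifted (triangle a)
      liftT a = lift (triangle a) (triangle-even a)

      -- The values of a tree edge on the four lifts have sum zero, as the lifts cancel, and vanish
      -- for the triangle that misses the branch set of the edge. By `functional` only zero and the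
      -- six coordinate functionals remain, that is, a coloop or a copy of a connecting edge.
      determined : ∀ t → T ! t ≡ true →
        (∀ z → mem (evenSpace E) z → Avoids D z → z ! t ≡ false) ⊎ (∃ λ f → kernel ! f ≡ true × (∀ z → mem (evenSpace E) z → Avoids D z → z ! t ≡ z ! f))
      determined t tT = copies triangle liftT triangles-cancel triangle-combination t
        (functional (values triangle liftT triangles-cancel triangle-combination t) j
          (trans (!-tab (λ a → proj₁ (liftT a) ! t) j) (misses-branch j (proj₁ (liftT j)) (proj₁ (proj₂ (liftT j))) (proj₁ (proj₂ (proj₂ (liftT j)))) (proj₂ (proj₂ (proj₂ (liftT j)))) t tT refl))
          (values-even triangle liftT triangles-cancel triangle-combination t))
        where
        j = proj₁ (βE t)

      graphic-minor : {M : Mat m} → Rep M (evenSpace E) → (∀ x → ground M ! x ≡ true) → ∃ λ N → SeriesMinor M N × Iso N MK4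
      graphic-minor {M} R full = N , steps , spaceIso⇒iso rep MK4-rep (subst (λ S → SpaceIso S space (evenSpace (ends K4))) (sym ground≡) iso)
        where
        minor : SeriesMinorOn M (evenSpace E) kernel D
        minor = series-minor kernel R (incl λ x _ → full x) D
          (λ x Dx → ≢true⇒false λ k → t≢f Dx (trans (VecP.lookup-map x not (kernel ∪ T)) (cong not (trans (!-∪ kernel T x) (cong (_∨ T ! x) k)))))
          (λ x _ nk nD → determined x ([ (λ k → ⊥-elim (t≢f k nk)) , id ]′ (∨-true (trans (sym (!-∪ kernel T x))
            (≢false⇒true λ h → t≢f (trans (VecP.lookup-map x not (kernel ∪ T)) (cong not h)) nD)))))
        open SeriesMinorOn minor
        iso : SpaceIso kernel space (evenSpace (ends K4))
        iso = kernel-iso {space} {evenSpace (ends K4)} id (λ _ → refl)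
          (λ X mX → let z , mz , av , vals = lift X mX in subst (mem space) (trace-img z X id (λ _ → refl) vals) (trace z mz av))
          (λ w mw → let z , mz , av , e = extend w mw in subst (mem (evenSpace (ends K4))) (sym (trans (cong (pre edge) e) (pre-∩-kernel z id))) (even-kernel z mz av))

    module Cographic where

      section : ∀ i → Fin n
      section i = proj₁ (onto i)

      -- A cut without edges of the spanning trees is constant on branch sets, by `factors`, so it
      -- comes from a cut of the quotient.
      descend : ∀ f → (∀ t → T ! t ≡ true → cut E f ! t ≡ false) → ∀ x → cut E f ! x ≡ f ! section (proj₁ (βE x)) xor f ! section (proj₂ (βE x))
      descend f h x = trans (cut-! E f x) (cong₂ _xor_ (agrees (proj₁ (E x))) (agrees (proj₂ (E x))))
        where
        agrees : ∀ p → f ! p ≡ f ! section (β p)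
        agrees p = factors f (λ t tT → xor≡f⇒≡ (trans (sym (cut-! E f t)) (h t tT))) p (section (β p)) (sym (proj₂ (onto (β p))))

      below : Subset n → Subset 4
      below f = tabulate (λ i → f ! section i)

      at-edge : ∀ f → (∀ t → T ! t ≡ true → cut E f ! t ≡ false) → ∀ i → cut E f ! edge i ≡ cut (ends K4) (below f) ! i
      at-edge f h i = trans (descend f h (edge i)) (trans ([ (λ e → cong (λ (s , t) → f ! section s xor f ! section t) e)
          , (λ e → trans (cong (λ (s , t) → f ! section s xor f ! section t) e) (𝔹.xor-comm (f ! section (proj₂ (ends K4 i))) (f ! section (proj₁ (ends K4 i))))) ]′ (ends-edge i))
        (sym (trans (cut-! (ends K4) (below f) i) (cong₂ _xor_ (!-tab (λ i → f ! section i) (proj₁ (ends K4 i))) (!-tab (λ i → f ! section i) (proj₂ (ends K4 i)))))))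

      -- Such cuts vanish on edges inside a branch set and cannot tell apart two edges between the
      -- same branch sets: coloops and series classes in the dual.
      determined : ∀ x → (∀ z → mem (cutSpace E) z → Avoids T z → z ! x ≡ false) ⊎ (∃ λ f → kernel ! f ≡ true × (∀ z → mem (cutSpace E) z → Avoids T z → z ! x ≡ z ! f))
      determined x = [ (λ e → inj₁ λ { _ (f , refl) av → trans (descend f av x) (trans (cong (λ s → f ! section s xor f ! section (proj₂ (βE x))) e) (𝔹.xor-same (f ! section (proj₂ (βE x))))) })
        , (λ (i , e) → inj₂ (edge i , edge-∈ i , λ { _ (f , refl) av → trans (descend f av x) (sym (trans (descend f av (edge i)) (parallel f i e (ends-edge i)))) })) ]′ (K4-complete (proj₁ (βE x)) (proj₂ (βE x)))
        where
        parallel : ∀ f i → ends K4 i ≡ βE x ⊎ ends K4 i ≡ (proj₂ (βE x) , proj₁ (βE x)) → βE (edge i) ≡ ends K4 i ⊎ βE (edge i) ≡ (proj₂ (ends K4 i) , proj₁ (ends K4 i)) →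
          f ! section (proj₁ (βE (edge i))) xor f ! section (proj₂ (βE (edge i))) ≡ f ! section (proj₁ (βE x)) xor f ! section (proj₂ (βE x))
        parallel f i e e' = trans (value e') (value' e)
          where
          val : Fin 4 × Fin 4 → Bool
          val (s , t) = f ! section s xor f ! section t
          value : βE (edge i) ≡ ends K4 i ⊎ βE (edge i) ≡ (proj₂ (ends K4 i) , proj₁ (ends K4 i)) → val (βE (edge i)) ≡ val (ends K4 i)
          value (inj₁ e) = cong val e
          value (inj₂ e) = trans (cong val e) (𝔹.xor-comm (f ! section (proj₂ (ends K4 i))) (f ! section (proj₁ (ends K4 i))))
          value' : ends K4 i ≡ βE x ⊎ ends K4 i ≡ (proj₂ (βE x) , proj₁ (βE x)) → val (ends K4 i) ≡ val (βE x)
          value' (inj₁ e) = cong val e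
          value' (inj₂ e) = trans (cong val e) (𝔹.xor-comm (f ! section (proj₂ (βE x))) (f ! section (proj₁ (βE x))))

      opposite-invol : ∀ (i : Fin 6) → Fin.opposite (Fin.opposite i) ≡ i
      opposite-invol = FinP.opposite-involutive

      cographic-minor : {M : Mat m} → Rep M (cutSpace E) → (∀ x → ground M ! x ≡ true) → ∃ λ N → SeriesMinor M N × Iso N MK4
      cographic-minor {M} R full = N , steps , spaceIso⇒iso rep MK4-rep (subst (λ S → SpaceIso S space (evenSpace (ends K4))) (sym ground≡) iso)
        where
        minor : SeriesMinorOn M (cutSpace E) kernel T
        minor = series-minor kernel R (incl λ x _ → full x) T T∩kernel (λ x _ _ _ → determined x)
        open SeriesMinorOn minor
        -- Cuts of K4 lift by pulling vertex sets back along `β`; being constant on branch sets, the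
        -- lifts avoid the trees.
        pullback : Subset 4 → Subset n
        pullback h = tabulate (λ p → h ! β p)
        pullback-avoids : ∀ h → Avoids T (cut E (pullback h))
        pullback-avoids h t tT = trans (cut-! E (pullback h) t) (trans (cong₂ _xor_ (!-tab (λ p → h ! β p) _) (!-tab (λ p → h ! β p) _))
          (trans (cong (λ s → h ! s xor h ! proj₂ (βE t)) (within t tT)) (𝔹.xor-same (h ! proj₂ (βE t)))))
        below-pullback : ∀ h → below (pullback h) ≡ h
        below-pullback h = ext λ i → trans (!-tab (λ i → pullback h ! section i) i) (trans (!-tab (λ p → h ! β p) (section i)) (cong (h !_) (proj₂ (onto i))))
        to : ∀ X → mem (evenSpace (ends K4)) X → mem space (img (edge ∘ Fin.opposite) X)
        to X mX = let h , e = even⇒cut X mX in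
          subst (mem space) (trace-img (cut E (pullback h)) X Fin.opposite opposite-invol
            (λ i → trans (at-edge (pullback h) (pullback-avoids h) (Fin.opposite i)) (trans (cong (λ g → cut (ends K4) g ! Fin.opposite i) (below-pullback h)) (sym (e i)))))
            (trace (cut E (pullback h)) (pullback h , refl) (pullback-avoids h))
        from : ∀ w → mem space w → mem (evenSpace (ends K4)) (pre (edge ∘ Fin.opposite) w)
        from w mw = let z , (f , fe) , av , e = extend w mw
                        av' = λ t tT → trans (cong (_! t) (sym fe)) (av t tT)
          in subst (mem (evenSpace (ends K4))) (ext {X = tabulate (λ i → cut (ends K4) (below f) ! Fin.opposite i)} {Y = pre (edge ∘ Fin.opposite) w}
              (λ i → trans (!-tab (λ i → cut (ends K4) (below f) ! Fin.opposite i) i) (trans (sym (at-edge f av' (Fin.opposite i)))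
                (sym (trans (cong (λ y → pre (edge ∘ Fin.opposite) y ! i) e) (trans (cong (_! i) (pre-∩-kernel z Fin.opposite)) (trans (pre-! (edge ∘ Fin.opposite) z i) (cong (_! edge (Fin.opposite i)) fe))))))))
            (cut⇒even (below f))
        iso : SpaceIso kernel space (evenSpace (ends K4))
        iso = kernel-iso {space} {evenSpace (ends K4)} Fin.opposite opposite-invol to from

open K4Minors

-- Assembling the equivalences.

open import Relation.Binary.Construct.Closure.ReflexiveTransitive using (Star; ε; _◅_)

private variable
  n m k : ℕ

series⇒gseries : {M N : Mat m} → SeriesMinor M N → GSeriesMinor M N
series⇒gseries ε = ε
series⇒gseries (del x p ◅ s) = del x p ◅ series⇒gseries s
series⇒gseries (series x p q ◅ s) = series x p q ◅ series⇒gseries s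
series⇒gseries (coloop x p ◅ s) = coloop x p ◅ series⇒gseries s

series⇒minor : {M N : Mat m} → SeriesMinor M N → Minor M N
series⇒minor ε = ε
series⇒minor (del x p ◅ s) = del x p ◅ series⇒minor s
series⇒minor (series x p q ◅ s) = con x p ◅ series⇒minor s
series⇒minor (coloop x p ◅ s) = con x (proj₁ p) ◅ series⇒minor s

-- A walk from a vertex of `W` to one outside has a step at which it leaves `W`.
connected⇒linked : ∀ {v m} (G : Graph v m) → Connected G → Linked (ends G)
connected⇒linked G conn W (a , Wa) (b , Wb) = crossing (conn a b) Wa
  where
  joins : ∀ {a c i} → Incident G a i → Incident G c i → W ! a ≡ true → W ! c ≡ false → Adj (ends G) a c
  joins {i = i} (inj₁ refl) (inj₁ refl) Wa Wc = ⊥-elim (t≢f Wa Wc)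
  joins {i = i} (inj₁ refl) (inj₂ refl) Wa Wc = i , inj₁ refl
  joins {i = i} (inj₂ refl) (inj₁ refl) Wa Wc = i , inj₂ refl
  joins {i = i} (inj₂ refl) (inj₂ refl) Wa Wc = ⊥-elim (t≢f Wa Wc)
  crossing : ∀ {a} → Reach G fullˢ a b → W ! a ≡ true → ∃ λ p → ∃ λ q → Adj (ends G) p q × W ! p ≡ true × W ! q ≡ false
  crossing here Wa = ⊥-elim (t≢f Wa Wb)
  crossing {a} (step {c = c} i _ ai ci r) Wa = next (W ! c) refl
    where
    next : ∀ w → W ! c ≡ w → ∃ λ p → ∃ λ q → Adj (ends G) p q × W ! p ≡ true × W ! q ≡ false
    next true Wc = crossing r Wc
    next false Wc = a , c , joins ai ci Wa Wc , Wa , Wc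

module _ {v m : ℕ} (G : Graph v m) (loopless : ∀ i → proj₁ (ends G i) ≢ proj₂ (ends G i)) where

  private
    F T : Subset m → Set
    F = mem (evenSpace (ends G))
    T = mem (cutSpace (ends G))

  graphic-seriesParallel : Root F T → SeriesParallel (cycM G)
  graphic-seriesParallel ρ = record
    { space = evenSpace (ends G) ; rep = cycM-rep G loopless ; term = root ; linear = linear
    ; leaves≼ = incl λ x _ → !-full x
    ; sound = λ z h → incl (λ x _ → allLeaves x) , flow⇒ z h
    ; complete = λ z _ h → flow⇐ z h }
    where open Root ρ

  -- Putting `free#` in parallel with the dual network lets its root value be arbitrary, which is
  -- the contraction of the root.
  cographic-seriesParallel : Root F T → SeriesParallel (dual (cycM G))
  cographic-seriesParallel ρ = record
    { space = cutSpace (ends G) ; rep = cocycM-rep G loopless ; term = par (dualT root) free#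
    ; linear = linear-dual root linear , tt , disj (λ x _ → !-∅ x)
    ; leaves≼ = incl λ x _ → !-full x
    ; sound = λ z h → let t , s = tension⇒ z h in
        incl (λ x _ → at (∪-l (leaves (dualT root)) ∅ˢ) x (trans (cong (_! x) (leaves-dual root)) (allLeaves x))) , t , s , tt
    ; complete = λ { z _ (t , s , _) → tension⇐ z t s } }
    where open Root ρ

Outcome : Mat m → Set₁
Outcome M = SeriesParallel M ⊎ (∃[ N ] (SeriesMinor M N × Iso N MK4))

-- The element of `Fin m` is an edge; as the graph has no loops there are at least two vertices,
-- where `dichotomy` starts.
outcome : ∀ {v m} (G : Graph v m) → Simple G → Connected G → (M : Mat m) → (M ≡ cycM G ⊎ M ≡ dual (cycM G)) →
  Fin m → Outcome M
outcome {zero} G _ _ M _ e with proj₁ (ends G e)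
... | ()
outcome {suc zero} G (loopless , _) _ M _ e = ⊥-elim (loopless e (all-equal (proj₁ (ends G e)) (proj₂ (ends G e))))
  where
  all-equal : ∀ (x y : Fin 1) → x ≡ y
  all-equal zero zero = refl
outcome {suc (suc v)} G (loopless , _) conn M kind _ = [ (λ r → inj₁ (sp kind (reduces⇒root r (initial-net (ends G) loopless)))) , (λ k → inj₂ (minor kind (branches k))) ]′
  (dichotomy v (ends G) (connected⇒linked G conn))
  where
  sp : M ≡ cycM G ⊎ M ≡ dual (cycM G) → Root (mem (evenSpace (ends G))) (mem (cutSpace (ends G))) → SeriesParallel M
  sp (inj₁ refl) ρ = graphic-seriesParallel G loopless ρ
  sp (inj₂ refl) ρ = cographic-seriesParallel G loopless ρ
  minor : M ≡ cycM G ⊎ M ≡ dual (cycM G) → Branches (ends G) → ∃[ N ] (SeriesMinor M N × Iso N MK4)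
  minor (inj₁ refl) B = Graphic.graphic-minor B (cycM-rep G loopless) !-full
  minor (inj₂ refl) B = Cographic.cographic-minor B (cocycM-rep G loopless) !-full

graph-rep : ∀ {v m} (G : Graph v m) → Simple G → (M : Mat m) → (M ≡ cycM G ⊎ M ≡ dual (cycM G)) → ∃ (Rep M)
graph-rep G (loopless , _) _ (inj₁ refl) = _ , cycM-rep G loopless
graph-rep G (loopless , _) _ (inj₂ refl) = _ , cocycM-rep G loopless

theorem7p4 : ∀ {c ℓ : Level} (K : Field c ℓ) {v m : ℕ} (G : Graph v m) → Simple G → Connected G
    → (M : Mat m) → (M ≡ cycM G ⊎ M ≡ dual (cycM G)) → (∃[ C ] circ M C)
    → (Polys.Cyc.μ≤2 K M ⇔ (¬ (∃[ N ] (GSeriesMinor M N × Iso N MK4))))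
    × ((¬ (∃[ N ] (GSeriesMinor M N × Iso N MK4))) ⇔ (¬ (∃[ N ] (SeriesMinor M N × Iso N MK4))))
    × ((¬ (∃[ N ] (SeriesMinor M N × Iso N MK4))) ⇔ (¬ (∃[ N ] (Minor M N × Iso N MK4))))
theorem7p4 K {m = m} G simple conn M kind (C , circC) =
  ( (λ μ (N , gs , iso) → [ (λ SP → seriesParallel⇒¬K4 (seriesParallel-gseries SP gs) iso)
                         , (λ (N' , ms , iso') → K4-series-minor⇒¬μ≤2 K R ms iso' μ) ]′ result)
  , (λ none → [ (λ SP → Toric.Generators.connected⇒μ≤2 K M (SeriesParallel.rep SP) (seriesParallel⇒rowsConnected SP))
             , (λ (N , ms , iso) → ⊥-elim (none (N , series⇒gseries ms , iso))) ]′ result))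
  , ( (λ none (N , ms , iso) → none (N , series⇒gseries ms , iso))
    , (λ none (N , gs , iso) → [ (λ SP → seriesParallel⇒¬K4 (seriesParallel-gseries SP gs) iso) , none ]′ result))
  , ( (λ none (N , ms , iso) → [ (λ SP → seriesParallel⇒¬K4 (seriesParallel-minor SP ms) iso) , none ]′ result)
    , (λ none (N , ms , iso) → none (N , series⇒minor ms , iso)))
  where
  R : Rep M (proj₁ (graph-rep G simple M kind))
  R = proj₂ (graph-rep G simple M kind)
  result : Outcome M
  result = outcome G simple conn M kind (proj₁ (proj₁ (proj₂ (circ⇒ R circC))))
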